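{- Let $X$ be a finite nonempty set and let $\mathcal F$ and $\mathcal F'$ be forests on $X$. Then $$h(\mathcal F,\mathcal F') = \min\{ w(\sigma) \,:\, \sigma \text{ is a cherry picking sequence for } \mathcal F \text{ and } \mathcal F'\}.$$
   Context: All graphs are finite multigraphs without loops. A leaf of a graph is a vertex of degree at most one. Suppressing a degree-two vertex $v$ with incident edges $\{u,v\},\{v,w\}$, $u\neq w$, means deleting $v$ and these two edges and adding the edge $\{u,w\}$. A phylogenetic network on a finite nonempty set $X$ is a simple connected graph $\mathcal N=(V,E)$ whose set of leaves is exactly $X$ and in which every non-leaf vertex has degree three; if $X=\{x\}$ the single vertex $x$ is regarded as a phylogenetic network. Its reticulation number is $r(\mathcal N)=|E|-(|V|-1)$. A phylogenetic tree on $X$ is a phylogenetic network on $X$ with no cycles. A forest on $X$ is a set of phylogenetic trees whose leaf sets are pairwise disjoint with union $X$. A phylogenetic tree $\mathcal T$ on $Y\subseteq X$ is displayed by $\mathcal N$ if $\mathcal T$ can be obtained from some subtree $\mathcal N[\mathcal T]$ of $\mathcal N$ by suppressing all its degree-two vertices; $\mathcal N$ displays a forest $\mathcal F$ on $X$ if every tree of $\mathcal F$ is displayed by $\mathcal N$ and the subtrees $\mathcal N[\mathcal T]$, $\mathcal T\in\mathcal F$, can be chosen pairwise vertex-disjoint. The hybrid number is $h(\mathcal F,\mathcal F')=\min\{r(\mathcal N): \mathcal N \text{ a phylogenetic network on } X \text{ displaying } \mathcal F \text{ and } \mathcal F'\}$. Forest notions: a cherry of a phylogenetic tree $\mathcal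 T$ is a pair $(x,y)$ of distinct leaves such that either $\mathcal T$ is the single edge $\{x,y\}$ or $x,y$ are adjacent to a common vertex; a cherry of a forest is a cherry of one of its trees. For a leaf $x$, $e_x$ denotes the edge containing $x$ (pendant edge). A phylogenetic tree $\mathcal S$ is a proper pendant subtree of a tree $\mathcal T$ if there is a cut-edge $e$ of $\mathcal T$ such that $\mathcal S$ equals one of the two components obtained by deleting $e$ and suppressing resulting degree-two vertices; this edge is denoted $e_{\mathcal S}$ (for $\mathcal S$ a single leaf $p$, $e_{\mathcal S}=e_p$). $((x,y),p)$ denotes a proper pendant subtree with leaf set $\{x,y,p\}$ in which $(x,y)$ is a cherry, and $((x,y),(p,q))$ a proper pendant subtree with leaf set $\{x,y,p,q\}$ in which $(x,y)$ and $(p,q)$ are cherries; $(p,q)$ also denotes the two-leaf pendant subtree on $\{p,q\}$. For an edge $e$ of a tree $\mathcal T_e$ in a forest $\mathcal F$, $\mathcal F-e$ is obtained by replacing $\mathcal T_e$ by the trees obtained from $\mathcal T_e$ by deleting $e$ and suppressing degree-two vertices. For $x\in X$, $|X|\ge 2$, with $\mathcal T_x$ the tree of $\mathcal F$ containing $x$, $\mathcal F-x$ is obtained by removing $\mathcal T_x$ if it is the single vertex $x$, and otherwise replacing $\mathcal T_x$ by the tree obtained by deleting $x$ and $e_x$ and suppressing the resulting degree-two vertex. Cherry picking sequence: for forests $\mathcal F,\mathcal F'$ on $X$, a sequence $\sigma=(x_1,\dots,x_m)$ of elements of $X$, $m\ge |X|\ge 1$, is a cherry picking sequence for $\mathcal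 F$ and $\mathcal F'$ if there are forests $\mathcal F[i],\mathcal F'[i]$, $1\le i\le m$, with $\mathcal F[1]=\mathcal F$, $\mathcal F'[1]=\mathcal F'$, $\mathcal F[m]=\mathcal F'[m]=\{x_m\}$, and for each $1\le i\le m-1$ precisely one of the following holds: (C1) $(x_i,y)$ is a cherry in both $\mathcal F[i]$ and $\mathcal F'[i]$ for some $y$, and $\mathcal F[i+1]=\mathcal F[i]-x_i$, $\mathcal F'[i+1]=\mathcal F'[i]-x_i$; (C2) $(x_i,y)$ is a cherry in $\mathcal F[i]$ for some $y$ and one of: (a) $(x_i,z)$ is a cherry in $\mathcal F'[i]$ with $z\ne y$, $\mathcal F'[i+1]=\mathcal F'[i]$, and either (i) $\mathcal F[i+1]$ is $\mathcal F[i]-e_{x_i}$ or $\mathcal F[i]-e_y$, or (ii) $((x_i,y),p)$ is a proper pendant subtree of a tree in $\mathcal F[i]$, $p\in X$, and $\mathcal F[i+1]=\mathcal F[i]-e_{\mathcal S}$ for some $\mathcal S\in\{p,((x_i,y),p)\}$, or (iii) $((x_i,y),(p,q))$ is a proper pendant subtree of a tree in $\mathcal F[i]$, $p\ne q\in X$, and $\mathcal F[i+1]=\mathcal F[i]-e_{\mathcal S}$ for some $\mathcal S\in\{p,q,(p,q)\}$; (b) $x_i,y$ are leaves of one tree $\mathcal T'\in\mathcal F'[i]$, neither in a cherry of $\mathcal T'$, and either (i) $\mathcal F'[i+1]=\mathcal F'[i]$ and $\mathcal F[i+1]$ is $\mathcal F[i]-e_{x_i}$ or $\mathcal F[i]-e_y$,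 or (ii) for $e$ the edge of $\mathcal T'$ containing the vertex adjacent to $x_i$ and not on the path between $x_i$ and $y$, $\mathcal F'[i+1]=\mathcal F'[i]-e$ and $\mathcal F[i+1]=\mathcal F[i]$; (c) $x_i$ and $y$ lie in different trees of $\mathcal F'[i]$, neither is an isolated vertex or in a cherry of $\mathcal F'[i]$, $\mathcal F'[i+1]=\mathcal F'[i]$, and $\mathcal F[i+1]$ is $\mathcal F[i]-e_{x_i}$ or $\mathcal F[i]-e_y$; or the same holds with the roles of $\mathcal F$ and $\mathcal F'$ reversed; (C3) $x_i$ is a single-vertex component of $\mathcal F[i]$, $\mathcal F[i+1]=\mathcal F[i]-x_i$ and $\mathcal F'[i+1]=\mathcal F'[i]-x_i$, or the same with the roles of $\mathcal F$ and $\mathcal F'$ reversed. Weight: if $m\ge2$, set $c(x_i)=0$ if (C1) or (C3) applies at step $i$ and $c(x_i)=1$ otherwise, and $w(\sigma)=\sum_{i=1}^{m-1}c(x_i)$; if $m=1$, $w(\sigma)=0$. -}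

module Defs where

open import Data.Nat using (ℕ; zero; suc; _+_; _∸_; _≤_; _<_)
open import Data.Nat.Properties using (_≟_)
open import Data.List using (List; []; _∷_; _++_; length; filter)
open import Data.List.Membership.Propositional using (_∈_)
open import Data.List.Relation.Unary.All using (All)
open import Data.List.Relation.Unary.Linked using (Linked)
open import Data.List.Relation.Unary.Unique.Propositional using (Unique)
open import Data.Product using (Σ; _×_; _,_; proj₁; proj₂)
open import Data.Sum using (_⊎_)
open import Relation.Nullary using (¬_; Dec; yes; no)
open import Relation.Nullary.Decidable using (_×-dec_; _⊎-dec_; ¬?)
open import Relation.Binary.PropositionalEquality using (_≡_; _≢_)
open import Relation.Binary.Construct.Closure.ReflexiveTransitive using (Star)

-- Finite multigraphs.  Vertices are natural numbers (the labels in X are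
-- natural numbers too); V is the vertex list, E the edge list, where an
-- entry (a , b) stands for the unordered edge {a,b}; repeated entries are
-- parallel edges.

record Graph : Set where
  constructor mkGraph
  field
    V : List ℕ
    E : List (ℕ × ℕ)
open Graph public

Inc : ℕ → ℕ × ℕ → Set
Inc v e = proj₁ e ≡ v ⊎ proj₂ e ≡ v

inc? : (v : ℕ) → (e : ℕ × ℕ) → Dec (Inc v e)
inc? v e = (proj₁ e ≟ v) ⊎-dec (proj₂ e ≟ v)

Joins : ℕ → ℕ → ℕ × ℕ → Set
Joins a b e = (proj₁ e ≡ a × proj₂ e ≡ b) ⊎ (proj₁ e ≡ b × proj₂ e ≡ a)

joins? : (a b : ℕ) → (e : ℕ × ℕ) → Dec (Joins a b e)
joins? a b e = ((proj₁ e ≟ a) ×-dec (proj₂ e ≟ b)) ⊎-dec ((proj₁ e ≟ b) ×-dec (proj₂ e ≟ a))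

mult : Graph → ℕ → ℕ → ℕ
mult G a b = length (filter (joins? a b) (E G))

deg : Graph → ℕ → ℕ
deg G v = length (filter (inc? v) (E G))

Adj : Graph → ℕ → ℕ → Set
Adj G a b = 0 < mult G a b

WF : Graph → Set
WF G = Unique (V G) × All (λ e → proj₁ e ∈ V G × proj₂ e ∈ V G × proj₁ e ≢ proj₂ e) (E G)

Simple : Graph → Set
Simple G = WF G × (∀ a b → mult G a b ≤ 1)

Reach : Graph → ℕ → ℕ → Set
Reach G = Star (Adj G)

Connected : Graph → Set
Connected G = ∀ a b → a ∈ V G → b ∈ V G → Reach G a b

-- a cycle (of a simple graph): distinct vertices v, v2, ..., vk, k ≥ 3,
-- consecutive ones adjacent and vk adjacent to v
Cycle : Graph → Set
Cycle G = Σ ℕ λ v → Σ (List ℕ) λ rest →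
  2 ≤ length rest × Unique (v ∷ rest) × Linked (Adj G) (v ∷ rest ++ v ∷ [])

Acyclic : Graph → Set
Acyclic G = ¬ Cycle G

SimplePath : Graph → ℕ → ℕ → List ℕ → Set
SimplePath G x y mid = Unique (x ∷ mid ++ y ∷ []) × Linked (Adj G) (x ∷ mid ++ y ∷ [])

EdgeOnPath : Graph → ℕ → ℕ → ℕ → ℕ → Set
EdgeOnPath G x y u v = Σ (List ℕ) λ mid → SimplePath G x y mid ×
  Σ (List ℕ) λ pre → Σ (List ℕ) λ suf →
    (x ∷ mid ++ y ∷ [] ≡ pre ++ u ∷ v ∷ suf) ⊎ (x ∷ mid ++ y ∷ [] ≡ pre ++ v ∷ u ∷ suf)

Leaf : Graph → ℕ → Set
Leaf G v = v ∈ V G × deg G v ≤ 1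

LeafSetIs : Graph → List ℕ → Set
LeafSetIs G X = (∀ v → Leaf G v → v ∈ X) × (∀ v → v ∈ X → Leaf G v)

NonLeafDeg3 : Graph → Set
NonLeafDeg3 G = ∀ v → v ∈ V G → deg G v ≤ 1 ⊎ deg G v ≡ 3

PhyloNetwork : List ℕ → Graph → Set
PhyloNetwork X N = Simple N × Connected N × LeafSetIs N X × NonLeafDeg3 N

-- reticulation number |E| - (|V| - 1)
ret : Graph → ℕ
ret N = length (E N) + 1 ∸ length (V N)

-- A forest on X is represented as the disjoint union of its trees, i.e.
-- a single graph whose connected components are the trees: simple,
-- acyclic, leaves exactly X, every non-leaf of degree 3.
ForestOn : List ℕ → Graph → Set
ForestOn X F = Simple F × Acyclic F × LeafSetIs F X × NonLeafDeg3 F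

delV : ℕ → List ℕ → List ℕ
delV v = filter (λ u → ¬? (u ≟ v))

delIncident : ℕ → List (ℕ × ℕ) → List (ℕ × ℕ)
delIncident v = filter (λ e → ¬? (inc? v e))

removeEdge : ℕ → ℕ → List (ℕ × ℕ) → List (ℕ × ℕ)
removeEdge a b [] = []
removeEdge a b (e ∷ es) with joins? a b e
... | yes _ = es
... | no _ = e ∷ removeEdge a b es

Suppress1 : Graph → Graph → Set
Suppress1 G H = Σ ℕ λ v → Σ ℕ λ u → Σ ℕ λ w →
  v ∈ V G × deg G v ≡ 2 × u ≢ w × Adj G u v × Adj G v w ×
  H ≡ mkGraph (delV v (V G)) ((u , w) ∷ delIncident v (E G))

SuppressAll : Graph → Graph → Set
SuppressAll G H = Star Suppress1 G H × (∀ v → v ∈ V H → deg H v ≢ 2)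

IsoFix : List ℕ → Graph → Graph → Set
IsoFix X G H = Σ (ℕ → ℕ) λ f → Σ (ℕ → ℕ) λ g →
  (∀ v → v ∈ V G → f v ∈ V H) × (∀ v → v ∈ V H → g v ∈ V G) ×
  (∀ v → v ∈ V G → g (f v) ≡ v) × (∀ v → v ∈ V H → f (g v) ≡ v) ×
  (∀ a b → a ∈ V G → b ∈ V G → mult H (f a) (f b) ≡ mult G a b) ×
  (∀ x → x ∈ X → x ∈ V G × f x ≡ x)

SubgraphOf : Graph → Graph → Set
SubgraphOf S N = WF S × (∀ v → v ∈ V S → v ∈ V N) × (∀ a b → mult S a b ≤ mult N a b)

-- N displays the forest F on X: a subgraph S of N whose components are
-- (vertex-disjoint) subtrees N[T], such that suppressing all degree-two
-- vertices of S yields F (up to isomorphism fixing the labels).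
Displays : List ℕ → Graph → Graph → Set
Displays X N F = Σ Graph λ S → Σ Graph λ S' →
  SubgraphOf S N × Acyclic S × SuppressAll S S' × IsoFix X S' F

DelEdge : Graph → ℕ → ℕ → Graph → Set
DelEdge F a b G = Adj F a b × SuppressAll (mkGraph (V F) (removeEdge a b (E F))) G

DelPendant : Graph → ℕ → Graph → Set
DelPendant F x G = Σ ℕ λ z → DelEdge F x z G

DelLeaf : Graph → ℕ → Graph → Set
DelLeaf F x G =
  (x ∈ V F × deg F x ≡ 0 × G ≡ mkGraph (delV x (V F)) (E F)) ⊎
  (x ∈ V F × deg F x ≡ 1 × SuppressAll (mkGraph (delV x (V F)) (delIncident x (E F))) G)

Cherry : Graph → ℕ → ℕ → Set
Cherry F x y = x ≢ y × Leaf F x × Leaf F y × (Adj F x y ⊎ Σ ℕ λ v → Adj F x v × Adj F y v)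

InCherry : Graph → ℕ → Set
InCherry F x = Σ ℕ λ z → Cherry F x z

ComponentOf : Graph → ℕ → Graph → Set
ComponentOf H a C = WF C ×
  (∀ v → v ∈ V C → v ∈ V H × Reach H a v) × (∀ v → v ∈ V H → Reach H a v → v ∈ V C) ×
  (∀ u v → Reach H a u → mult C u v ≡ mult H u v) ×
  (∀ u v → ¬ Reach H a u → mult C u v ≡ 0)

-- {a,b} is a cut-edge of F and S is the tree obtained from the component
-- containing a after deleting {a,b} and suppressing degree-two vertices
-- (so S is a proper pendant subtree with e_S = {a,b})
PendantSide : Graph → ℕ → ℕ → Graph → Set
PendantSide F a b S = Adj F a b ×
  ¬ Reach (mkGraph (V F) (removeEdge a b (E F))) a b ×
  Σ Graph λ C → ComponentOf (mkGraph (V F) (removeEdge a b (E F))) a C × SuppressAll C S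

-- Cherry picking steps.  F,F' are the current forests, G,G' the next ones.

C1 : ℕ → Graph → Graph → Graph → Graph → Set
C1 x F F' G G' = Σ ℕ λ y → Cherry F x y × Cherry F' x y × DelLeaf F x G × DelLeaf F' x G'

C3 : ℕ → Graph → Graph → Graph → Graph → Set
C3 x F F' G G' = ((x ∈ V F × deg F x ≡ 0) ⊎ (x ∈ V F' × deg F' x ≡ 0)) ×
  DelLeaf F x G × DelLeaf F' x G'

DelPendXY : Graph → ℕ → ℕ → Graph → Set
DelPendXY F x y G = DelPendant F x G ⊎ DelPendant F y G

C2aii : ℕ → ℕ → Graph → Graph → Set
C2aii x y F G = Σ ℕ λ p → Σ ℕ λ a → Σ ℕ λ b → Σ Graph λ S →
  PendantSide F a b S × LeafSetIs S (x ∷ y ∷ p ∷ []) × Cherry S x y × p ≢ x × p ≢ y ×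
  (DelPendant F p G ⊎ DelEdge F a b G)

C2aiii : ℕ → ℕ → Graph → Graph → Set
C2aiii x y F G = Σ ℕ λ p → Σ ℕ λ q → Σ ℕ λ a → Σ ℕ λ b → Σ Graph λ S →
  PendantSide F a b S × LeafSetIs S (x ∷ y ∷ p ∷ q ∷ []) × Cherry S x y × Cherry S p q ×
  p ≢ q × p ≢ x × p ≢ y × q ≢ x × q ≢ y ×
  (DelPendant F p G ⊎ DelPendant F q G ⊎
   (Σ ℕ λ c → Σ ℕ λ d → Σ Graph λ S' →
      PendantSide F c d S' × LeafSetIs S' (p ∷ q ∷ []) × DelEdge F c d G))

C2a : ℕ → ℕ → Graph → Graph → Graph → Graph → Set
C2a x y F F' G G' = Σ ℕ λ z → Cherry F' x z × z ≢ y × G' ≡ F' ×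
  (DelPendXY F x y G ⊎ C2aii x y F G ⊎ C2aiii x y F G)

C2b : ℕ → ℕ → Graph → Graph → Graph → Graph → Set
C2b x y F F' G G' = Reach F' x y × Leaf F' x × Leaf F' y × ¬ InCherry F' x × ¬ InCherry F' y ×
  ((G' ≡ F' × DelPendXY F x y G) ⊎
   (Σ ℕ λ v → Σ ℕ λ z → Adj F' x v × Adj F' v z × z ≢ x × ¬ EdgeOnPath F' x y v z ×
      DelEdge F' v z G' × G ≡ F))

C2c : ℕ → ℕ → Graph → Graph → Graph → Graph → Set
C2c x y F F' G G' = ¬ Reach F' x y × deg F' x ≢ 0 × deg F' y ≢ 0 ×
  ¬ InCherry F' x × ¬ InCherry F' y × G' ≡ F' × DelPendXY F x y G

-- (C2) with (x,y) a cherry of F (the reversed roles are handled in CPS)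
C2 : ℕ → Graph → Graph → Graph → Graph → Set
C2 x F F' G G' = Σ ℕ λ y → Cherry F x y × (C2a x y F F' G G' ⊎ C2b x y F F' G G' ⊎ C2c x y F F' G G')

IsSingleton : ℕ → Graph → Set
IsSingleton x G = V G ≡ x ∷ [] × E G ≡ []

-- CPS F F' σ w : σ is a cherry picking sequence for F and F' (witnessed by
-- the chosen intermediate forests) whose weight is w.  Steps of type
-- (C1)/(C3) cost 0, steps of type (C2) cost 1.
data CPS : Graph → Graph → List ℕ → ℕ → Set where
  final : ∀ {F F' x} → IsSingleton x F → IsSingleton x F' → CPS F F' (x ∷ []) 0
  free  : ∀ {F F' G G' x σ w} → (C1 x F F' G G' ⊎ C3 x F F' G G') →
          CPS G G' σ w → CPS F F' (x ∷ σ) w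
  paid  : ∀ {F F' G G' x σ w} → (C2 x F F' G G' ⊎ C2 x F' F G' G) →
          CPS G G' σ w → CPS F F' (x ∷ σ) (suc w)

CherryPickingSeq : List ℕ → Graph → Graph → List ℕ → ℕ → Set
CherryPickingSeq X F F' σ w = length X ≤ length σ × CPS F F' σ w

IsMin : (ℕ → Set) → ℕ → Set
IsMin P k = P k × (∀ n → P n → k ≤ n)

HybridNumberIs : List ℕ → Graph → Graph → ℕ → Set
HybridNumberIs X F F' = IsMin (λ n → Σ Graph λ N →
  PhyloNetwork X N × Displays X N F × Displays X N F' × ret N ≡ n)

MinCPSWeightIs : List ℕ → Graph → Graph → ℕ → Set
MinCPSWeightIs X F F' = IsMin (λ n → Σ (List ℕ) λ σ → CherryPickingSeq X F F' σ n)

{-# OPTIONS --safe #-}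
module Submission where

-- A forest is only seen through its label splits: for each edge, which labels stay connected when it is deleted.
-- Two forests on X with the same splits are isomorphic, since every vertex is the median of three labels and the
-- median can be read off the splits. So a network displays F as soon as it contains a subforest with the splits of F.
--
-- From a sequence to a network: undo the steps from the last one. A removed leaf is put back on a subdivided edge,
-- which does not change |E| - |V|; a cut edge is put back as an edge between two subdivided edges, which raises it by one.
--
-- From a network N to a sequence: let S and S' be the copies of F and F' in N and let I be their common part.
-- Free steps leave N alone. If none is possible, an edge of S (or S') outside the other copy which separates labels
-- can be deleted from N unless it is a bridge of N, and this lowers |E| - |V| by one. Bridges are avoided by working on the
-- smallest side of such a bridge. There a deepest cherry (x,y) of F is taken: if x and y are not connected in I, a pendant
-- edge is cut; otherwise x or y lies in a cherry (x,z) of F', or neither does, and since I cannot carry two conflicting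
-- quartets one of the cuts allowed by (C2) is an edge outside I.
--
-- The minimum exists constructively because both sides are governed by a game with finitely many moves.

open import Defs
open import Data.Nat using (ℕ; zero; suc; _+_; _≤_; _<_; z≤n; s≤s; s≤s⁻¹; _⊔_)
open import Data.Nat.Properties
open import Data.List using (List; []; _∷_; _++_; length; filter; map; foldr)
open import Data.List.Properties using (filter-accept; filter-reject; filter-all; filter-none; filter-some; filter-notAll; length-map; ∷-injectiveˡ)
open import Data.List.Membership.Propositional using (_∈_; _∉_; find; lose)
open import Data.List.Membership.Propositional.Properties using (∈-filter⁺; ∈-filter⁻; ∈-++⁺ʳ; ∈-++⁺ˡ; ∈-map⁺; ∈-map⁻)
open import Data.List.Membership.DecPropositional _≟_ using (_∈?_)
open import Data.List.Relation.Unary.Any as Any using (Any; here; there; any?)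
open import Data.List.Relation.Unary.All as All using (All; []; _∷_)
import Data.List.Relation.Unary.All.Properties as Allₚ
open import Data.List.Relation.Unary.AllPairs using ([]; _∷_)
open import Data.List.Relation.Unary.Linked using (Linked; []; [-]; _∷_)
open import Data.List.Relation.Unary.Unique.Propositional using (Unique)
import Data.List.Relation.Unary.Unique.Propositional.Properties as Uₚ
open import Data.Product using (Σ; _×_; _,_; proj₁; proj₂)
open import Data.Product.Properties using (≡-dec)
open import Data.List.Membership.DecPropositional (≡-dec _≟_ _≟_) using () renaming (_∈?_ to _∈ₑ?_)
open import Data.Sum using (_⊎_; inj₁; inj₂; [_,_]; swap)
open import Data.Unit using (⊤; tt)
open import Data.Empty using (⊥; ⊥-elim)
open import Function using (case_of_)
open import Relation.Nullary using (¬_; Dec; yes; no)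
open import Relation.Nullary.Decidable using (¬?; _×-dec_; _⊎-dec_; map′; decidable-stable)
open import Relation.Binary.PropositionalEquality using (_≡_; _≢_; refl; sym; trans; cong; cong₂; subst)
open import Relation.Binary.Construct.Closure.ReflexiveTransitive as Star using (Star; ε; _◅_; _◅◅_)

module EdgeDeletion where

  Gr : Set₁
  Gr = ℕ → ℕ → Set

  infix 4 _⊑_
  _⊑_ : Gr → Gr → Set
  R ⊑ T = ∀ {a b} → R a b → T a b

  Symm : Gr → Set
  Symm R = ∀ {a b} → R a b → R b a

  record del (R : Gr) (a b u v : ℕ) : Set where
    constructor _,_
    field
      kept : R u v
      distinct : ¬ Joins a b (u , v)
  open del public

  infixr 6 _∩_
  record _∩_ (R K : Gr) (u v : ℕ) : Set where
    constructor _,_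
    field
      inl : R u v
      inr : K u v
  open _∩_ public

  Forest : Gr → Set
  Forest R = ∀ {a b} → R a b → ¬ Star (del R a b) a b

  joins-flip : ∀ {a b u v} → Joins a b (u , v) → Joins a b (v , u)
  joins-flip (inj₁ (p , q)) = inj₂ (q , p)
  joins-flip (inj₂ (p , q)) = inj₁ (q , p)

  joins-comm : ∀ {a b u v} → Joins a b (u , v) → Joins b a (u , v)
  joins-comm = swap

  joins-swap : ∀ {c d a b} → Joins c d (a , b) → Joins a b (c , d)
  joins-swap (inj₁ (refl , refl)) = inj₁ (refl , refl)
  joins-swap (inj₂ (refl , refl)) = inj₂ (refl , refl)

  joins-self : ∀ {a b} → Joins a b (a , b)
  joins-self = inj₁ (refl , refl)

  del-sym : ∀ {R} c d → Symm R → Symm (del R c d)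
  del-sym c d s (r , n) = s r , λ j → n (joins-flip j)

  del-comm : ∀ {R c d} → del R c d ⊑ del R d c
  del-comm (r , n) = r , λ j → n (joins-comm j)

  del-mono : ∀ {R T c d} → R ⊑ T → del R c d ⊑ del T c d
  del-mono f (r , n) = f r , n

  del-cong : ∀ {R c d c' d'} → Joins c d (c' , d') → del R c d ⊑ del R c' d'
  del-cong (inj₁ (refl , refl)) r = r
  del-cong (inj₂ (refl , refl)) r = del-comm r

  del⊑ : ∀ {R c d} → del R c d ⊑ R
  del⊑ = kept

  star-sym : ∀ {R} → Symm R → ∀ {x y} → Star R x y → Star R y x
  star-sym s = Star.reverse s

  mono : ∀ {R T} → R ⊑ T → ∀ {x y} → Star R x y → Star T x y
  mono f = Star.map f

  forest-⊑ : ∀ {R T} → R ⊑ T → Forest T → Forest R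
  forest-⊑ f fo r s = fo (f r) (mono (del-mono f) s)

  forest-≢ : ∀ {R a b} → Forest R → R a b → a ≢ b
  forest-≢ fo r refl = fo r ε

  one : ∀ {R : Gr} {a b} → R a b → Star R a b
  one r = r ◅ ε

  -- How a walk of R looks when the steps along {c,d} are taken out.
  Across : Gr → ℕ → ℕ → ℕ → ℕ → Set
  Across T c d x y = (Star T x c × Star T d y) ⊎ (Star T x d × Star T c y)

  across : ∀ {R T : Gr} {W : Set} c d → (∀ {u v} → R u v → T u v ⊎ (W × Joins c d (u , v))) →
    ∀ {x y} → Star R x y → Star T x y ⊎ (W × Across T c d x y)
  across c d f ε = inj₁ ε
  across c d f (r ◅ s) with f r | across c d f s
  ... | inj₁ t | inj₁ s' = inj₁ (t ◅ s')
  ... | inj₁ t | inj₂ (w , inj₁ (p , q)) = inj₂ (w , inj₁ (t ◅ p , q))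
  ... | inj₁ t | inj₂ (w , inj₂ (p , q)) = inj₂ (w , inj₂ (t ◅ p , q))
  ... | inj₂ (w , inj₁ (refl , refl)) | inj₁ s' = inj₂ (w , inj₁ (ε , s'))
  ... | inj₂ (w , inj₁ (refl , refl)) | inj₂ (_ , inj₁ (p , q)) = inj₂ (w , inj₁ (ε , q))
  ... | inj₂ (w , inj₁ (refl , refl)) | inj₂ (_ , inj₂ (p , q)) = inj₁ q
  ... | inj₂ (w , inj₂ (refl , refl)) | inj₁ s' = inj₂ (w , inj₂ (ε , s'))
  ... | inj₂ (w , inj₂ (refl , refl)) | inj₂ (_ , inj₁ (p , q)) = inj₁ q
  ... | inj₂ (w , inj₂ (refl , refl)) | inj₂ (_ , inj₂ (p , q)) = inj₂ (w , inj₂ (ε , q))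

  cross : ∀ {R} → Symm R → ∀ c d {x y} → Star R x y → Star (del R c d) x y ⊎ (R c d × Across (del R c d) c d x y)
  cross {R} s c d = across c d f
    where
    f : ∀ {u v} → R u v → del R c d u v ⊎ (R c d × Joins c d (u , v))
    f {u} {v} r with joins? c d (u , v)
    ... | no n = inj₁ (r , n)
    ... | yes (inj₁ (refl , refl)) = inj₂ (r , inj₁ (refl , refl))
    ... | yes (inj₂ (refl , refl)) = inj₂ (s r , inj₂ (refl , refl))

  cross! : ∀ {R} → Symm R → ∀ c d {x y} → Star R x y → ¬ Star (del R c d) x y → R c d × Across (del R c d) c d x y
  cross! s c d p n with cross s c d p
  ... | inj₁ q = ⊥-elim (n q)
  ... | inj₂ q = q

  helly : ∀ {A S} → Symm S → Symm A → A ⊑ S → Forest S → ∀ {c d x y} → Star A x y → Star (del S c d) x y → Star (del A c d) x y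
  helly {A} {S} ss sa i fo {c} {d} p q with cross sa c d p
  ... | inj₁ r = r
  ... | inj₂ (e , inj₁ (u , v)) = ⊥-elim (fo (i e) (star-sym (del-sym c d ss) (mono (del-mono i) u) ◅◅ q ◅◅ star-sym (del-sym c d ss) (mono (del-mono i) v)))
  ... | inj₂ (e , inj₂ (u , v)) = ⊥-elim (fo (i e) (mono (del-mono i) v ◅◅ star-sym (del-sym c d ss) q ◅◅ mono (del-mono i) u))

  share : ∀ {A} → Symm A → ∀ {c d x y z p} → Star A x y → Star A z p →
    ¬ Star (del A c d) x y → ¬ Star (del A c d) z p → Star A x z
  share {A} s {c} {d} xy zp nxy nzp with cross! s c d xy nxy | cross! s c d zp nzp
  ... | e , inj₁ (u , _) | _ , inj₁ (u' , _) = mono del⊑ u ◅◅ star-sym s (mono del⊑ u')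
  ... | e , inj₁ (u , _) | _ , inj₂ (u' , _) = mono del⊑ u ◅◅ (e ◅ star-sym s (mono del⊑ u'))
  ... | e , inj₂ (u , _) | _ , inj₁ (u' , _) = mono del⊑ u ◅◅ (s e ◅ star-sym s (mono del⊑ u'))
  ... | e , inj₂ (u , _) | _ , inj₂ (u' , _) = mono del⊑ u ◅◅ star-sym s (mono del⊑ u')

  passes : ∀ {A} → Symm A → ∀ {c d x y} → Star A x y → ¬ Star (del A c d) x y → Star A x c
  passes s {c} {d} xy n with cross! s c d xy n
  ... | e , inj₁ (u , _) = mono del⊑ u
  ... | e , inj₂ (u , _) = mono del⊑ u ◅◅ one (s e)

  toward : ∀ {R r v} → Star R r v → r ≢ v → Σ ℕ λ n → R n v × Star (del R v n) r n
  toward ε ne = ⊥-elim (ne refl)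
  toward {R} {r} {v} (_◅_ {j = r'} e s) ne with r' ≟ v
  ... | yes refl = r , e , ε
  ... | no ne' with toward s ne'
  ... | n , e' , s' = n , e' , (e , λ { (inj₁ (p , _)) → ne p ; (inj₂ (_ , q)) → ne' q }) ◅ s'

  avoid : ∀ {T : Gr} {x} → Symm T → (∀ {n m} → T x n → T x m → n ≡ m) → ∀ {y z} → y ≢ x → z ≢ x →
    Star T y z → Star (λ a b → T a b × a ≢ x × b ≢ x) y z
  avoid s u ny nz ε = ε
  avoid {x = x} s u ny nz (_◅_ {j = k} r p) with k ≟ x
  ... | no nk = (r , ny , nk) ◅ avoid s u nk nz p
  avoid s u ny nz (r ◅ ε) | yes refl = ⊥-elim (nz refl)
  avoid s u ny nz (r ◅ (r' ◅ p)) | yes refl with u (s r) r'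
  ... | refl = avoid s u ny nz p

  side-mono : ∀ {R} → Symm R → Forest R → ∀ {a b c u} → R a c → c ≢ b → Star (del R c a) c u → Star (del R a b) c u
  side-mono {R} s fo {a} {b} {c} ac ne p with cross (del-sym c a s) a b p
  ... | inj₁ q = mono (λ { ((r , _) , n) → r , n }) q
  ... | inj₂ (_ , inj₁ (q , _)) = ⊥-elim (fo (s ac) (mono del⊑ q))
  ... | inj₂ ((ab , _) , inj₂ (q , _)) = ⊥-elim (fo (s ac) (mono del⊑ q ◅◅ one (s ab , λ { (inj₁ (h , _)) → ne (sym h) ; (inj₂ (h , k)) → ne (trans (sym k) (sym h)) })))

  side-extend : ∀ {R} → Symm R → Forest R → ∀ {a b c u} → R a c → c ≢ b → Star (del R c a) c u → Star (del R a b) a u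
  side-extend s fo {a} {b} {c} ac ne p = (ac , λ { (inj₁ (_ , h)) → ne h ; (inj₂ (_ , k)) → forest-≢ fo ac (sym k) }) ◅ side-mono s fo ac ne p

  -- An edge separates v from the labels beyond at most one of its neighbours.
  two-ways : ∀ {R : Gr} → Symm R → Forest R → ∀ {v m n x y} → R v m → R v n → m ≢ n → Star (del R m v) m x → Star (del R n v) n y →
    ∀ c d → Star (del R c d) v x ⊎ Star (del R c d) v y
  two-ways {R} s fo {v} {m} {n} vm vn ne mx ny c d with joins? c d (v , m) | joins? c d (v , n)
  ... | yes j | _ = inj₂ (mono (del-cong (joins-swap j)) (side-extend s fo vn (λ e → ne (sym e)) ny))
  ... | no _ | yes j = inj₁ (mono (del-cong (joins-swap j)) (side-extend s fo vm ne mx))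
  ... | no k | no k' with cross (del-sym m v s) c d mx
  ...   | inj₁ t = inj₁ ((vm , k) ◅ mono (del-mono kept) t)
  ...   | inj₂ (e , p) with cross (del-sym n v s) c d ny
  ...     | inj₁ t = inj₂ ((vn , k') ◅ mono (del-mono kept) t)
  ...     | inj₂ (e' , q) = ⊥-elim (fo vm (side-extend s fo vn (λ h → ne (sym h)) (reach e' (del-sym n v s) q) ◅◅ star-sym (del-sym v m s) (mono del-comm (reach e (del-sym m v s) p))))
    where
    reach : ∀ {T : Gr} {p q} → T c d → Symm T → Across (del T c d) c d p q → Star T p c
    reach e s (inj₁ (p , _)) = mono del⊑ p
    reach e s (inj₂ (p , _)) = mono del⊑ p ◅◅ one (s e)

  Ad : List (ℕ × ℕ) → Gr
  Ad es a b = (a , b) ∈ es ⊎ (b , a) ∈ es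

  ad? : ∀ es a b → Dec (Ad es a b)
  ad? es a b = ((a , b) ∈ₑ? es) ⊎-dec ((b , a) ∈ₑ? es)

  record Listed (R : Gr) : Set where
    constructor listed
    field
      es : List (ℕ × ℕ)
      to : ∀ {a b} → R a b → Ad es a b
      from : ∀ {a b} → Ad es a b → R a b
  open Listed

  symm : ∀ {R} → Listed R → Symm R
  symm l r = from l (swap (to l r))

  edge? : ∀ {R} → Listed R → ∀ a b → Dec (R a b)
  edge? l a b = map′ (from l) (to l) (ad? (es l) a b)

  listed-Ad : ∀ es → Listed (Ad es)
  listed-Ad es = listed es (λ x → x) (λ x → x)

  listed-filter : ∀ {R K} → Listed R → (∀ a b → Dec (K a b)) → Symm K → Listed (R ∩ K)
  listed-filter {R} {K} l k? ks = record
    { es = filter (λ e → k? (proj₁ e) (proj₂ e)) (es l)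
    ; to = λ { (r , k) → [ (λ m → inj₁ (∈-filter⁺ _ m k)) , (λ m → inj₂ (∈-filter⁺ _ m (ks k))) ] (to l r) }
    ; from = [ (λ m → let (p , q) = ∈-filter⁻ _ m in from l (inj₁ p) , q) , (λ m → let (p , q) = ∈-filter⁻ _ m in from l (inj₂ p) , ks q) ] }

  listed-cong : ∀ {R T} → R ⊑ T → T ⊑ R → Listed R → Listed T
  listed-cong f g l = listed (es l) (λ r → to l (g r)) (λ r → f (from l r))

  listed-del : ∀ {R} → Listed R → ∀ a b → Listed (del R a b)
  listed-del {R} l a b = listed-cong (λ { (r , n) → r , n }) (λ { (r , n) → r , n })
    (listed-filter {R} {λ u v → ¬ Joins a b (u , v)} l (λ u v → ¬? (joins? a b (u , v))) (λ n j → n (joins-flip j)))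

  star[]-≡ : ∀ {a b} → Star (Ad []) a b → a ≡ b
  star[]-≡ ε = refl
  star[]-≡ (inj₁ () ◅ _)
  star[]-≡ (inj₂ () ◅ _)

  abstract
    conn-list? : ∀ es a b → Dec (Star (Ad es) a b)
    conn-list? [] a b = map′ (λ { refl → ε }) star[]-≡ (a ≟ b)
    conn-list? ((c , d) ∷ es) a b =
      map′ [ mono up , [ (λ { (p , q) → mono up p ◅◅ (inj₁ (here refl) ◅ mono up q) }) , (λ { (p , q) → mono up p ◅◅ (inj₂ (here refl) ◅ mono up q) }) ] ]
           down
           (conn-list? es a b ⊎-dec ((conn-list? es a c ×-dec conn-list? es d b) ⊎-dec (conn-list? es a d ×-dec conn-list? es c b)))
      where
      up : Ad es ⊑ Ad ((c , d) ∷ es)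
      up = [ (λ x → inj₁ (there x)) , (λ x → inj₂ (there x)) ]
      f : ∀ {u v} → Ad ((c , d) ∷ es) u v → Ad es u v ⊎ (⊤ × Joins c d (u , v))
      f (inj₁ (here refl)) = inj₂ (tt , inj₁ (refl , refl))
      f (inj₁ (there x)) = inj₁ (inj₁ x)
      f (inj₂ (here refl)) = inj₂ (tt , inj₂ (refl , refl))
      f (inj₂ (there x)) = inj₁ (inj₂ x)
      down : ∀ {x y} → Star (Ad ((c , d) ∷ es)) x y → Star (Ad es) x y ⊎ Across (Ad es) c d x y
      down s with across c d f s
      ... | inj₁ p = inj₁ p
      ... | inj₂ (_ , p) = inj₂ p

    conn? : ∀ {R} → Listed R → ∀ a b → Dec (Star R a b)
    conn? l a b = map′ (mono (from l)) (mono (to l)) (conn-list? (es l) a b)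

  -- Deleting the edges outside K one at a time, connectivity of x and y in a forest survives (helly)
  -- until an edge separating them is met.
  separating : ∀ {S K} → Listed S → Forest S → (∀ a b → Dec (K a b)) → Symm K → ∀ {x y} → Star S x y →
    ¬ Star (S ∩ K) x y → Σ ℕ λ c → Σ ℕ λ d → S c d × ¬ K c d × ¬ Star (del S c d) x y
  separating {S} {K} l fo k? ks {x} {y} p n with go (es l) (mono (λ r → r , inj₂ (to l r)) p)
    where
    Res : Set
    Res = Σ ℕ λ c → Σ ℕ λ d → S c d × ¬ K c d × ¬ Star (del S c d) x y
    T : List (ℕ × ℕ) → Gr
    T es a b = S a b × (K a b ⊎ Ad es a b)
    T-sym : ∀ {es} → Symm (T es)
    T-sym (r , inj₁ k) = symm l r , inj₁ (ks k)
    T-sym (r , inj₂ k) = symm l r , inj₂ (swap k)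
    go : ∀ es → Star (T es) x y → Res ⊎ Star (S ∩ K) x y
    go [] q = inj₂ (mono (λ { (r , inj₁ k) → r , k ; (r , inj₂ (inj₁ ())) ; (r , inj₂ (inj₂ ())) }) q)
    go ((c , d) ∷ es) q with k? c d
    ... | yes k = go es (mono f q)
      where
      f : T ((c , d) ∷ es) ⊑ T es
      f (r , inj₁ k) = r , inj₁ k
      f (r , inj₂ (inj₁ (here refl))) = r , inj₁ k
      f (r , inj₂ (inj₁ (there m))) = r , inj₂ (inj₁ m)
      f (r , inj₂ (inj₂ (here refl))) = r , inj₁ (ks k)
      f (r , inj₂ (inj₂ (there m))) = r , inj₂ (inj₂ m)
    ... | no nk with conn? (listed-del l c d) x y
    ...   | no ns = inj₁ (c , d , proj₁ (cross! (symm l) c d p ns) , nk , ns)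
    ...   | yes ys = go es (mono f (helly (symm l) (T-sym {(c , d) ∷ es}) proj₁ fo q ys))
      where
      f : del (T ((c , d) ∷ es)) c d ⊑ T es
      f ((r , inj₁ k) , _) = r , inj₁ k
      f ((r , inj₂ (inj₁ (here refl))) , j) = ⊥-elim (j (inj₁ (refl , refl)))
      f ((r , inj₂ (inj₁ (there m))) , j) = r , inj₂ (inj₁ m)
      f ((r , inj₂ (inj₂ (here refl))) , j) = ⊥-elim (j (inj₂ (refl , refl)))
      f ((r , inj₂ (inj₂ (there m))) , j) = r , inj₂ (inj₂ m)
  ... | inj₁ r = r
  ... | inj₂ s = ⊥-elim (n s)

  separated : ∀ {S} → Listed S → Forest S → ∀ {x y} → Star S x y → x ≢ y → Σ ℕ λ c → Σ ℕ λ d → S c d × ¬ Star (del S c d) x y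
  separated {S} l fo p ne with separating {S} {λ _ _ → ⊥} l fo (λ _ _ → no λ ()) (λ ()) p (λ { ε → ne refl ; ((_ , ()) ◅ _) })
  ... | c , d , r , _ , n = c , d , r , n

  -- Recursion along the directed edges (a , b), from the far ends of the side of a towards b.
  side-induction : ∀ {R} → Listed R → Forest R → (P : ℕ → ℕ → Set) →
    (∀ a b → R a b → (∀ c → R a c → c ≢ b → P c a) → P a b) → ∀ a b → R a b → P a b
  side-induction {R} l fo P step a b r = go (length (es l)) (es l) ≤-refl a b r (λ u w r' _ _ → to l r')
    where
    go : ∀ n Q → length Q ≤ n → ∀ a b → R a b → (∀ u w → R u w → Star (del R a b) a u → ¬ Joins a b (u , w) → Ad Q u w) → P a b
    empty : ∀ Q {u w} → length Q ≤ 0 → ¬ Ad Q u w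
    empty [] le (inj₁ ())
    empty [] le (inj₂ ())
    go n Q le a b ab inv = step a b ab (rec n le)
      where
      nj : ∀ {c} → R a c → c ≢ b → ¬ Joins a b (a , c)
      nj ac ne (inj₁ (_ , h)) = ne h
      nj ac ne (inj₂ (_ , h)) = forest-≢ fo ac (sym h)
      rec : ∀ n → length Q ≤ n → ∀ c → R a c → c ≢ b → P c a
      rec zero le c ac ne = ⊥-elim (empty Q le (inv a c ac ε (nj ac ne)))
      rec (suc n) le c ac ne = go n (filter nj? Q) (s≤s⁻¹ (≤-trans (filter-notAll nj? Q dec) le)) c a (symm l ac) inv'
        where
        nj? : (e : ℕ × ℕ) → Dec (¬ Joins c a e)
        nj? e = ¬? (joins? c a e)
        dec : Any (λ e → ¬ (¬ Joins c a e)) Q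
        dec with inv a c ac ε (nj ac ne)
        ... | inj₁ m = Any.map (λ { refl k → k (inj₂ (refl , refl)) }) m
        ... | inj₂ m = Any.map (λ { refl k → k (inj₁ (refl , refl)) }) m
        inv' : ∀ u w → R u w → Star (del R c a) c u → ¬ Joins c a (u , w) → Ad (filter nj? Q) u w
        inv' u w uw cu j with inv u w uw (side-extend (symm l) fo ac ne cu) jab
          where
          jab : ¬ Joins a b (u , w)
          jab (inj₁ (refl , _)) = fo (symm l ac) cu
          jab (inj₂ (refl , refl)) = fo (symm l ac) (cu ◅◅ one (uw , j))
        ... | inj₁ m = inj₁ (∈-filter⁺ nj? m j)
        ... | inj₂ m = inj₂ (∈-filter⁺ nj? m (λ j' → j (joins-flip j')))

  label-beyond : ∀ {R} {L : ℕ → Set} → Listed R → Forest R → (∀ a b → R a b → L a ⊎ Σ ℕ λ c → R a c × c ≢ b) →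
    ∀ a b → R a b → Σ ℕ λ v → L v × Star (del R a b) a v
  label-beyond {R} {L} l fo next = side-induction l fo (λ a b → Σ ℕ λ v → L v × Star (del R a b) a v) step
    where
    step : ∀ a b → R a b → (∀ c → R a c → c ≢ b → Σ ℕ λ v → L v × Star (del R c a) c v) → Σ ℕ λ v → L v × Star (del R a b) a v
    step a b ab rec with next a b ab
    ... | inj₁ la = a , la , ε
    ... | inj₂ (c , ac , ne) with rec c ac ne
    ... | v , lv , s = v , lv , side-extend (symm l) fo ac ne s

  decide : ∀ {A B : Set} → Dec A → (A → B) → (¬ A → B) → B
  decide (yes a) p q = p a
  decide (no n) p q = q n

open EdgeDeletion

module LabelSplits where

  infix 8 _˘
  _˘ : Gr → Gr
  (P ˘) x y = P y x

  SameSplit : Gr → Gr → ℕ → ℕ → Gr → ℕ → ℕ → Set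
  SameSplit P F c d S c' d' = ∀ {x x' y y'} → P x x' → P y y' →
    (Star (del F c d) x y → Star (del S c' d') x' y') × (Star (del S c' d') x' y' → Star (del F c d) x y)

  NoSplit : Gr → Gr → ℕ → ℕ → Set
  NoSplit P F c d = ∀ {x x' y y'} → P x x' → P y y' → Star F x y → Star (del F c d) x y

  -- P relates the labels of F to those of S.
  record Half (P F S : Gr) : Set where
    field
      conn : ∀ {x x' y y'} → P x x' → P y y' → Star F x y → Star S x' y'
      match : ∀ {c d} → F c d → NoSplit P F c d ⊎ (Σ ℕ λ c' → Σ ℕ λ d' → S c' d' × SameSplit P F c d S c' d')
  open Half public

  record Eqv (P F S : Gr) : Set where
    constructor eqv
    field
      fwd : Half P F S
      bwd : Half (P ˘) S F
  open Eqv public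

  eqv-sym : ∀ {P F S} → Eqv P F S → Eqv (P ˘) S F
  eqv-sym (eqv f b) = eqv b f

  half-trans : ∀ {P Q R F G H : Gr} → (∀ {x z} → R x z → Σ ℕ λ y → P x y × Q y z) → Half P F G → Half Q G H → Half R F H
  half-trans {P} {Q} {R} {F} {G} {H} h f g = record { conn = cn ; match = mt }
    where
    cn : ∀ {x x' y y'} → R x x' → R y y' → Star F x y → Star H x' y'
    cn r r' s with h r | h r'
    ... | _ , p , q | _ , p' , q' = conn g q q' (conn f p p' s)
    mt : ∀ {c d} → F c d → NoSplit R F c d ⊎ (Σ ℕ λ c' → Σ ℕ λ d' → H c' d' × SameSplit R F c d H c' d')
    mt e with match f e
    ... | inj₁ t = inj₁ λ r r' s → t (proj₁ (proj₂ (h r))) (proj₁ (proj₂ (h r'))) s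
    ... | inj₂ (c' , d' , e' , i) with match g e'
    ...   | inj₁ t = inj₁ λ { r r' s → let (_ , p , q) = h r ; (_ , p' , q') = h r' in proj₂ (i p p') (t q q' (conn f p p' s)) }
    ...   | inj₂ (c'' , d'' , e'' , j) = inj₂ (c'' , d'' , e'' , λ r r' → let (_ , p , q) = h r ; (_ , p' , q') = h r' in
              (λ s → proj₁ (j q q') (proj₁ (i p p') s)) , (λ s → proj₂ (i p p') (proj₂ (j q q') s)))

  eqv-trans : ∀ {P Q R F G H : Gr} → (∀ {x z} → R x z → Σ ℕ λ y → P x y × Q y z) → Eqv P F G → Eqv Q G H → Eqv R F H
  eqv-trans h (eqv f b) (eqv f' b') = eqv (half-trans h f f') (half-trans (λ r → let (y , p , q) = h r in y , q , p) b' b)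

  half-restrict : ∀ {P Q F S} → Q ⊑ P → Half P F S → Half Q F S
  half-restrict {P} {Q} {F} {S} h f = record { conn = λ p q → conn f (h p) (h q) ; match = λ e → mt (match f e) }
    where
    mt : ∀ {c d} → NoSplit P F c d ⊎ (Σ ℕ λ c' → Σ ℕ λ d' → S c' d' × SameSplit P F c d S c' d') →
      NoSplit Q F c d ⊎ (Σ ℕ λ c' → Σ ℕ λ d' → S c' d' × SameSplit Q F c d S c' d')
    mt (inj₁ t) = inj₁ λ p q → t (h p) (h q)
    mt (inj₂ (c' , d' , e , i)) = inj₂ (c' , d' , e , λ p q → i (h p) (h q))

  eqv-restrict : ∀ {P Q F S} → Q ⊑ P → Eqv P F S → Eqv Q F S
  eqv-restrict h (eqv f b) = eqv (half-restrict h f) (half-restrict h b)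

  half-≡ : ∀ {S T} → S ⊑ T → T ⊑ S → Half _≡_ S T
  half-≡ f g = record
    { conn = λ { refl refl → mono f }
    ; match = λ {c} {d} e → inj₂ (c , d , f e , λ { refl refl → mono (del-mono f) , mono (del-mono g) }) }

  eqv-≡ : ∀ {S T} → S ⊑ T → T ⊑ S → Eqv _≡_ S T
  eqv-≡ f g = eqv (half-≡ f g) (half-restrict sym (half-≡ g f))

  eqv-cong : ∀ {P F S F' S'} → F ⊑ F' → F' ⊑ F → S ⊑ S' → S' ⊑ S → Eqv P F S → Eqv P F' S'
  eqv-cong a b c d e = eqv-trans (λ p → _ , refl , p) (eqv-≡ b a) (eqv-trans (λ p → _ , p , refl) e (eqv-≡ c d))

  data add (R : Gr) (a b u v : ℕ) : Set where
    old : R u v → add R a b u v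
    new : Joins a b (u , v) → add R a b u v

  add-sym : ∀ {R a b} → Symm R → Symm (add R a b)
  add-sym s (old r) = old (s r)
  add-sym s (new j) = new (joins-flip j)

  add-across : ∀ {R a b x y} → Star (add R a b) x y → Star R x y ⊎ Across R a b x y
  add-across {R} {a} {b} s with across {W = ⊤} a b (λ { (old r) → inj₁ r ; (new j) → inj₂ (tt , j) }) s
  ... | inj₁ p = inj₁ p
  ... | inj₂ (_ , p) = inj₂ p

  across-add : ∀ {R a b x y} → Across R a b x y → Star (add R a b) x y
  across-add (inj₁ (p , q)) = mono old p ◅◅ (new (inj₁ (refl , refl)) ◅ mono old q)
  across-add (inj₂ (p , q)) = mono old p ◅◅ (new (inj₂ (refl , refl)) ◅ mono old q)

  add-conn : ∀ {P F S : Gr} {a a' b b'} → P a a' → P b b' → (∀ {x x' y y'} → P x x' → P y y' → Star F x y → Star S x' y') →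
    ∀ {x x' y y'} → P x x' → P y y' → Star (add F a b) x y → Star (add S a' b') x' y'
  add-conn pa pb h px py s with add-across s
  ... | inj₁ q = mono old (h px py q)
  ... | inj₂ (inj₁ (q , r)) = across-add (inj₁ (h px pa q , h pb py r))
  ... | inj₂ (inj₂ (q , r)) = across-add (inj₂ (h px pb q , h pa py r))

  add-del : ∀ {R a b c d} → Symm R → ¬ R a b → R c d → add (del R c d) a b ⊑ del (add R a b) c d
  add-del s n e (old (r , m)) = old r , m
  add-del {R} s n e (new j) = new j , λ j' → n (f j j' e)
    where
    f : ∀ {a b c d u v} → Joins a b (u , v) → Joins c d (u , v) → R c d → R a b
    f (inj₁ (refl , refl)) (inj₁ (refl , refl)) e = e
    f (inj₁ (refl , refl)) (inj₂ (refl , refl)) e = s e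
    f (inj₂ (refl , refl)) (inj₁ (refl , refl)) e = s e
    f (inj₂ (refl , refl)) (inj₂ (refl , refl)) e = e

  del-add : ∀ {R a b c d} → del (add R a b) c d ⊑ add (del R c d) a b
  del-add (old r , n) = old (r , n)
  del-add (new j , n) = new j

  ⊑-del-add : ∀ {R a b c d} → Symm R → ¬ R a b → Joins a b (c , d) → R ⊑ del (add R a b) c d
  ⊑-del-add s n (inj₁ (refl , refl)) r = old r , λ { (inj₁ (refl , refl)) → n r ; (inj₂ (refl , refl)) → n (s r) }
  ⊑-del-add s n (inj₂ (refl , refl)) r = old r , λ { (inj₁ (refl , refl)) → n (s r) ; (inj₂ (refl , refl)) → n r }

  del-add-⊑ : ∀ {R a b c d} → Joins a b (c , d) → del (add R a b) c d ⊑ R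
  del-add-⊑ _ (old r , _) = r
  del-add-⊑ (inj₁ (refl , refl)) (new j , n) = ⊥-elim (n j)
  del-add-⊑ (inj₂ (refl , refl)) (new j , n) = ⊥-elim (n (swap j))

  half-add : ∀ {P F S a a' b b'} → Symm F → Symm S → ¬ F a b → ¬ S a' b' → P a a' → P b b' → Eqv P F S → Half P (add F a b) (add S a' b')
  half-add {P} {F} {S} {a} {a'} {b} {b'} sf ss nf ns pa pb E = record { conn = add-conn pa pb (conn (fwd E)) ; match = mt }
    where
    mt : ∀ {c d} → add F a b c d → NoSplit P (add F a b) c d ⊎ (Σ ℕ λ c' → Σ ℕ λ d' → add S a' b' c' d' × SameSplit P (add F a b) c d (add S a' b') c' d')
    mt (new j) = inj₂ (a' , b' , new joins-self , λ p q →
      (λ s → mono (⊑-del-add ss ns joins-self) (conn (fwd E) p q (mono (del-add-⊑ j) s))) ,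
      (λ s → mono (⊑-del-add sf nf j) (conn (bwd E) p q (mono (del-add-⊑ joins-self) s))))
    mt (old e) with match (fwd E) e
    ... | inj₁ t = inj₁ λ p q s → mono (add-del sf nf e)
            (add-conn {λ x y → x ≡ y × Σ ℕ λ x' → P x x'} (refl , _ , pa) (refl , _ , pb) (λ { (refl , _ , p) (refl , _ , q) → t p q }) (refl , _ , p) (refl , _ , q) s)
    ... | inj₂ (c' , d' , e' , i) = inj₂ (c' , d' , old e' , λ p q →
            (λ s → mono (add-del ss ns e') (add-conn pa pb (λ p q → proj₁ (i p q)) p q (mono del-add s))) ,
            (λ s → mono (add-del sf nf e) (add-conn {P ˘} pa pb (λ p q → proj₂ (i p q)) p q (mono del-add s))))

  eqv-add : ∀ {P F S a a' b b'} → Symm F → Symm S → ¬ F a b → ¬ S a' b' → P a a' → P b b' → Eqv P F S → Eqv P (add F a b) (add S a' b')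
  eqv-add sf ss nf ns pa pb E = eqv (half-add sf ss nf ns pa pb E) (half-add ss sf ns nf pa pb (eqv-sym E))

  forest-add : ∀ {R a b} → Symm R → Forest R → ¬ Star R a b → Forest (add R a b)
  forest-add s fo n (new j) t with j | mono (del-add-⊑ j) t
  ... | inj₁ (refl , refl) | t' = n t'
  ... | inj₂ (refl , refl) | t' = n (star-sym s t')
  forest-add s fo n (old r) t with add-across (mono del-add t)
  ... | inj₁ q = fo r q
  ... | inj₂ (inj₁ (p , q)) = n (star-sym s (mono del⊑ p) ◅◅ (r ◅ star-sym s (mono del⊑ q)))
  ... | inj₂ (inj₂ (p , q)) = n (mono del⊑ q ◅◅ (s r ◅ mono del⊑ p))

  data ext (P : Gr) (a a' x y : ℕ) : Set where
    old : P x y → ext P a a' x y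
    new : x ≡ a → y ≡ a' → ext P a a' x y

  isolated-≡ : ∀ {R : Gr} {a y} → (∀ n → ¬ R a n) → Star R a y → a ≡ y
  isolated-≡ n ε = refl
  isolated-≡ n (r ◅ _) = ⊥-elim (n _ r)

  ext-flip : ∀ {P a a'} → (ext P a a') ˘ ⊑ ext (P ˘) a' a
  ext-flip (old p) = old p
  ext-flip (new p q) = new q p

  isolated-conn : ∀ {P T U : Gr} {a a'} → Symm T → (∀ n → ¬ T a n) → (∀ {x} → ¬ P a x) →
    (∀ {x x' y y'} → P x x' → P y y' → Star T x y → Star U x' y') →
    ∀ {x x' y y'} → ext P a a' x x' → ext P a a' y y' → Star T x y → Star U x' y'
  isolated-conn s n np h (old p) (old q) t = h p q t
  isolated-conn s n np h (old p) (new refl refl) t with isolated-≡ n (star-sym s t)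
  ... | refl = ⊥-elim (np p)
  isolated-conn s n np h (new refl refl) (old q) t with isolated-≡ n t
  ... | refl = ⊥-elim (np q)
  isolated-conn s n np h (new refl refl) (new refl refl) t = ε

  half-isolated : ∀ {P F S a a'} → Symm F → Symm S → (∀ n → ¬ F a n) → (∀ n → ¬ S a' n) → (∀ {x} → ¬ P a x) → (∀ {x} → ¬ P x a') →
    Half P F S → Half (ext P a a') F S
  half-isolated {P} {F} {S} {a} {a'} sf ss nf ns pa pa' h = record { conn = isolated-conn sf nf pa (conn h) ; match = mt }
    where
    mt : ∀ {c d} → F c d → NoSplit (ext P a a') F c d ⊎ (Σ ℕ λ c' → Σ ℕ λ d' → S c' d' × SameSplit (ext P a a') F c d S c' d')
    mt {c} {d} e with match h e
    ... | inj₁ t = inj₁ λ p q s → isolated-conn {λ x y → x ≡ y × Σ ℕ λ x' → P x x'} {a' = a} sf nf (λ r → pa (proj₂ (proj₂ r))) (λ { (refl , _ , p) (refl , _ , q) → t p q }) (g p) (g q) s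
      where
      g : ∀ {x x'} → ext P a a' x x' → ext (λ x y → x ≡ y × Σ ℕ λ x' → P x x') a a x x
      g (old p) = old (refl , _ , p)
      g (new p q) = new p p
    ... | inj₂ (c' , d' , e' , i) = inj₂ (c' , d' , e' , λ p q →
        isolated-conn (del-sym c d sf) (λ n r → nf n (kept r)) pa (λ p q → proj₁ (i p q)) p q ,
        isolated-conn {P ˘} (del-sym c' d' ss) (λ n r → ns n (kept r)) pa' (λ p q → proj₂ (i p q)) (ext-flip p) (ext-flip q))

  eqv-isolated : ∀ {P F S a a'} → Symm F → Symm S → (∀ n → ¬ F a n) → (∀ n → ¬ S a' n) → (∀ {x} → ¬ P a x) → (∀ {x} → ¬ P x a') →
    Eqv P F S → Eqv (ext P a a') F S
  eqv-isolated sf ss nf ns pa pa' (eqv f b) = eqv (half-isolated sf ss nf ns pa pa' f) (half-restrict ext-flip (half-isolated ss sf ns nf pa' pa b))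

  data subdiv (H : Gr) (u w v a b : ℕ) : Set where
    rest : H a b → ¬ Joins u w (a , b) → subdiv H u w v a b
    left : Joins u v (a , b) → subdiv H u w v a b
    right : Joins v w (a , b) → subdiv H u w v a b

  collapse : ℕ → ℕ → ℕ → ℕ
  collapse v t a with a ≟ v
  ... | yes _ = t
  ... | no _ = a

  collapse-v : ∀ v t → collapse v t v ≡ t
  collapse-v v t with v ≟ v
  ... | yes _ = refl
  ... | no n = ⊥-elim (n refl)

  collapse-≢ : ∀ {v t a} → a ≢ v → collapse v t a ≡ a
  collapse-≢ {v} {t} {a} ne with a ≟ v
  ... | yes e = ⊥-elim (ne e)
  ... | no _ = refl

  Fresh : Gr → ℕ → Set
  Fresh H v = ∀ {a b} → H a b → a ≢ v × b ≢ v

  collapse-walk : ∀ {G T : Gr} v t → (∀ {a b} → G a b → Star T (collapse v t a) (collapse v t b)) →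
    ∀ {x y} → x ≢ v → y ≢ v → Star G x y → Star T x y
  collapse-walk {G} {T} v t f {x} {y} nx ny s with Star.kleisliStar {T = G} {U = T} (collapse v t) f s
  ... | r rewrite collapse-≢ {v} {t} nx | collapse-≢ {v} {t} ny = r

  module _ {H : Gr} {u w v : ℕ} (sh : Symm H) (uw : H u w) (fr : Fresh H v) where

    private
      G : Gr
      G = subdiv H u w v
      nu : u ≢ v
      nu = proj₁ (fr uw)
      nw : w ≢ v
      nw = proj₂ (fr uw)

    subdiv-sym : Symm G
    subdiv-sym (rest r n) = rest (sh r) λ j → n (joins-flip j)
    subdiv-sym (left j) = left (joins-flip j)
    subdiv-sym (right j) = right (joins-flip j)

    private
      pull : ∀ {T : Gr} t → Symm T → (∀ {a b} → G a b → H a b → T a b) → Star T u t → Star T w t → ∀ {a b} → G a b → Star T (collapse v t a) (collapse v t b)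
      pull {T} t s f pu pw g@(rest h _) rewrite collapse-≢ {v} {t} (proj₁ (fr h)) | collapse-≢ {v} {t} (proj₂ (fr h)) = one (f g h)
      pull t s f pu pw (left (inj₁ (refl , refl))) rewrite collapse-≢ {v} {t} nu | collapse-v v t = pu
      pull t s f pu pw (left (inj₂ (refl , refl))) rewrite collapse-≢ {v} {t} nu | collapse-v v t = star-sym s pu
      pull t s f pu pw (right (inj₁ (refl , refl))) rewrite collapse-≢ {v} {t} nw | collapse-v v t = star-sym s pw
      pull t s f pu pw (right (inj₂ (refl , refl))) rewrite collapse-≢ {v} {t} nw | collapse-v v t = pw

      Old : Gr
      Old x y = x ≡ y × x ≢ v

    subdiv-down : ∀ {x y} → x ≢ v → y ≢ v → Star G x y → Star H x y
    subdiv-down = collapse-walk v u (pull u sh (λ _ h → h) ε (one (sh uw)))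

    subdiv-up : ∀ {x y} → Star H x y → Star G x y
    subdiv-up = Star.kleisliStar (λ x → x) f
      where
      f : ∀ {a b} → H a b → Star G a b
      f {a} {b} h with joins? u w (a , b)
      ... | no n = one (rest h n)
      ... | yes (inj₁ (refl , refl)) = left (inj₁ (refl , refl)) ◅ one (right (inj₁ (refl , refl)))
      ... | yes (inj₂ (refl , refl)) = right (inj₂ (refl , refl)) ◅ one (left (inj₂ (refl , refl)))

    private
      nj : ∀ {c d a} → c ≢ v → d ≢ v → ¬ Joins c d (v , a)
      nj nc nd (inj₁ (p , _)) = nc (sym p)
      nj nc nd (inj₂ (p , _)) = nd (sym p)

    subdiv-other : ∀ {c d} → H c d → ¬ Joins u w (c , d) → SameSplit Old H c d G c d
    subdiv-other {c} {d} h n (refl , nx) (refl , ny) = Star.kleisliStar (λ x → x) up , collapse-walk v u dn nx ny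
      where
      nc : c ≢ v
      nc = proj₁ (fr h)
      nd : d ≢ v
      nd = proj₂ (fr h)
      up : ∀ {a b} → del H c d a b → Star (del G c d) a b
      up {a} {b} (r , m) with joins? u w (a , b)
      ... | no k = one (rest r k , m)
      ... | yes (inj₁ (refl , refl)) = (left (inj₁ (refl , refl)) , λ j → nj nc nd (joins-flip j)) ◅ one (right (inj₁ (refl , refl)) , nj nc nd)
      ... | yes (inj₂ (refl , refl)) = (right (inj₂ (refl , refl)) , λ j → nj nc nd (joins-flip j)) ◅ one (left (inj₂ (refl , refl)) , nj nc nd)
      uw' : del H c d u w
      uw' = uw , λ { (inj₁ (refl , refl)) → n (inj₁ (refl , refl)) ; (inj₂ (refl , refl)) → n (inj₂ (refl , refl)) }
      dn : ∀ {a b} → del G c d a b → Star (del H c d) (collapse v u a) (collapse v u b)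
      dn (rest h _ , m) rewrite collapse-≢ {v} {u} (proj₁ (fr h)) | collapse-≢ {v} {u} (proj₂ (fr h)) = one (h , m)
      dn (left (inj₁ (refl , refl)) , m) rewrite collapse-≢ {v} {u} nu | collapse-v v u = ε
      dn (left (inj₂ (refl , refl)) , m) rewrite collapse-≢ {v} {u} nu | collapse-v v u = ε
      dn (right (inj₁ (refl , refl)) , m) rewrite collapse-≢ {v} {u} nw | collapse-v v u = one uw'
      dn (right (inj₂ (refl , refl)) , m) rewrite collapse-≢ {v} {u} nw | collapse-v v u = one (del-sym c d sh uw')

    subdiv-left : SameSplit Old H u w G u v
    subdiv-left (refl , nx) (refl , ny) =
      mono (λ { (r , m) → rest r m , λ { (inj₁ (_ , q)) → proj₂ (fr r) q ; (inj₂ (q , _)) → proj₁ (fr r) q } }) ,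
      collapse-walk v w dn nx ny
      where
      dn : ∀ {a b} → del G u v a b → Star (del H u w) (collapse v w a) (collapse v w b)
      dn (rest h k , m) rewrite collapse-≢ {v} {w} (proj₁ (fr h)) | collapse-≢ {v} {w} (proj₂ (fr h)) = one (h , k)
      dn (left j , m) = ⊥-elim (m j)
      dn (right (inj₁ (refl , refl)) , m) rewrite collapse-≢ {v} {w} nw | collapse-v v w = ε
      dn (right (inj₂ (refl , refl)) , m) rewrite collapse-≢ {v} {w} nw | collapse-v v w = ε

    subdiv-right : SameSplit Old H u w G v w
    subdiv-right (refl , nx) (refl , ny) =
      mono (λ { (r , m) → rest r m , λ { (inj₁ (q , _)) → proj₁ (fr r) q ; (inj₂ (_ , q)) → proj₂ (fr r) q } }) ,
      collapse-walk v u dn nx ny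
      where
      dn : ∀ {a b} → del G v w a b → Star (del H u w) (collapse v u a) (collapse v u b)
      dn (rest h k , m) rewrite collapse-≢ {v} {u} (proj₁ (fr h)) | collapse-≢ {v} {u} (proj₂ (fr h)) = one (h , k)
      dn (right j , m) = ⊥-elim (m j)
      dn (left (inj₁ (refl , refl)) , m) rewrite collapse-≢ {v} {u} nu | collapse-v v u = ε
      dn (left (inj₂ (refl , refl)) , m) rewrite collapse-≢ {v} {u} nu | collapse-v v u = ε

    subdiv-eqv : Eqv Old H G
    subdiv-eqv = eqv
      (record { conn = λ { (refl , _) (refl , _) → subdiv-up } ; match = λ e → inj₂ (m e) })
      (record { conn = λ { (refl , nx) (refl , ny) → subdiv-down nx ny } ; match = λ e → inj₂ (m' e) })
      where
      m : ∀ {c d} → H c d → Σ ℕ λ c' → Σ ℕ λ d' → G c' d' × SameSplit Old H c d G c' d'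
      m {c} {d} h with joins? u w (c , d)
      ... | no n = c , d , rest h n , subdiv-other h n
      ... | yes (inj₁ (refl , refl)) = u , v , left joins-self , subdiv-left
      ... | yes (inj₂ (refl , refl)) = u , v , left joins-self , λ p q →
             (λ s → proj₁ (subdiv-left p q) (mono del-comm s)) , (λ s → mono del-comm (proj₂ (subdiv-left p q) s))
      m' : ∀ {c d} → G c d → Σ ℕ λ c' → Σ ℕ λ d' → H c' d' × SameSplit (Old ˘) G c d H c' d'
      m' {c} {d} (rest h n) = c , d , h , λ { (refl , p) (refl , q) → let i = subdiv-other h n (refl , p) (refl , q) in proj₂ i , proj₁ i }
      m' (left (inj₁ (refl , refl))) = u , w , uw , λ { (refl , p) (refl , q) → let i = subdiv-left (refl , p) (refl , q) in proj₂ i , proj₁ i }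
      m' (left (inj₂ (refl , refl))) = u , w , uw , λ { (refl , p) (refl , q) → let i = subdiv-left (refl , p) (refl , q) in (λ s → proj₂ i (mono del-comm s)) , λ s → mono del-comm (proj₁ i s) }
      m' (right (inj₁ (refl , refl))) = u , w , uw , λ { (refl , p) (refl , q) → let i = subdiv-right (refl , p) (refl , q) in proj₂ i , proj₁ i }
      m' (right (inj₂ (refl , refl))) = u , w , uw , λ { (refl , p) (refl , q) → let i = subdiv-right (refl , p) (refl , q) in (λ s → proj₂ i (mono del-comm s)) , λ s → mono del-comm (proj₁ i s) }

    subdiv-forest : Forest H → Forest G
    subdiv-forest fo {c} {d} (rest h n) s = fo h (proj₂ (subdiv-other h n (refl , proj₁ (fr h)) (refl , proj₂ (fr h))) s)
    subdiv-forest fo (left j) s = fo uw (proj₂ (subdiv-left (refl , nu) (refl , nw)) (f j s ◅◅ one (right joins-self , λ { (inj₁ (p , _)) → nu (sym p) ; (inj₂ (_ , q)) → forest-≢ fo uw (sym q) })))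
      where
      f : ∀ {c d} → Joins u v (c , d) → Star (del G c d) c d → Star (del G u v) u v
      f (inj₁ (refl , refl)) s = s
      f (inj₂ (refl , refl)) s = star-sym (del-sym u v subdiv-sym) (mono del-comm s)
    subdiv-forest fo (right j) s = fo uw (proj₂ (subdiv-right (refl , nu) (refl , nw)) ((left joins-self , λ { (inj₁ (p , _)) → nu p ; (inj₂ (p , _)) → forest-≢ fo uw p }) ◅ f j s))
      where
      f : ∀ {c d} → Joins v w (c , d) → Star (del G c d) c d → Star (del G v w) v w
      f (inj₁ (refl , refl)) s = s
      f (inj₂ (refl , refl)) s = star-sym (del-sym v w subdiv-sym) (mono del-comm s)

    subdiv-forest⁻ : u ≢ w → Forest G → Forest H
    subdiv-forest⁻ ne fo {c} {d} h s with joins? u w (c , d)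
    ... | no n = fo (rest h n) (proj₁ (subdiv-other h n (refl , proj₁ (fr h)) (refl , proj₂ (fr h))) s)
    ... | yes j = fo (left joins-self) (proj₁ (subdiv-left (refl , nu) (refl , nw)) (f j s) ◅◅ one (right (inj₂ (refl , refl)) , λ { (inj₁ (p , _)) → ne (sym p) ; (inj₂ (p , _)) → nw p }))
      where
      f : ∀ {c d} → Joins u w (c , d) → Star (del H c d) c d → Star (del H u w) u w
      f (inj₁ (refl , refl)) s = s
      f (inj₂ (refl , refl)) s = star-sym (del-sym u w sh) (mono del-comm s)

  record Mid (R : Gr) (a u w u0 w0 : ℕ) : Set where
    field
      m-listed : Listed R
      m-forest : Forest R
      au : R a u
      aw : R a w
      u≢w : u ≢ w
      only : ∀ {n} → R a n → n ≡ u ⊎ n ≡ w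
      u-side : Star (del R u a) u u0
      w-side : Star (del R w a) w w0

    m-sym : Symm R
    m-sym = symm m-listed

    mid-flip : Mid R a w u w0 u0
    mid-flip = record { m-listed = m-listed ; m-forest = m-forest ; au = aw ; aw = au ; u≢w = λ e → u≢w (sym e)
                      ; only = λ r → swap (only r) ; u-side = w-side ; w-side = u-side }

    a~w0 : Star (del R a u) a w0
    a~w0 = side-extend m-sym m-forest aw (λ e → u≢w (sym e)) w-side

    u0≁w0 : ¬ Star (del R a u) u0 w0
    u0≁w0 s = m-forest au (a~w0 ◅◅ star-sym (del-sym a u m-sym) (mono del-comm u-side ◅◅ s))

    fork : ∀ {c d} → Star (del R c d) a u0 ⊎ Star (del R c d) a w0
    fork {c} {d} = two-ways m-sym m-forest au aw u≢w u-side w-side c d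

    sides-agree : ∀ {x y} → x ≢ a → y ≢ a → Star (del R a u) x y → Star (del R a w) x y
    sides-agree {x} {y} nx ny s with cross (del-sym a u m-sym) a w s
    ... | inj₁ t = mono (del-mono del⊑) t
    ... | inj₂ (_ , inj₁ (p , _)) = ⊥-elim (nx (sym (isolated-≡ none (star-sym (del-sym a w (del-sym a u m-sym)) p))))
      where
      none : ∀ n → ¬ del (del R a u) a w a n
      none n ((r , i) , j) = [ (λ { refl → i joins-self }) , (λ { refl → j joins-self }) ] (only r)
    ... | inj₂ (_ , inj₂ (_ , q)) = ⊥-elim (ny (sym (isolated-≡ none q)))
      where
      none : ∀ n → ¬ del (del R a u) a w a n
      none n ((r , i) , j) = [ (λ { refl → i joins-self }) , (λ { refl → j joins-self }) ] (only r)
  open Mid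

  split-finish : ∀ {P F S a a' c d c' d' l l'} → Symm F → Symm S → SameSplit P F c d S c' d' → P l l' →
    Star (del F c d) a l → Star (del S c' d') a' l' → SameSplit (ext P a a') F c d S c' d'
  split-finish sf ss i pl s s' (old p) (old q) = i p q
  split-finish {c = c} {d} {c'} {d'} sf ss i pl s s' (old p) (new refl refl) =
    (λ t → proj₁ (i p pl) (t ◅◅ s) ◅◅ star-sym (del-sym c' d' ss) s') , (λ t → proj₂ (i p pl) (t ◅◅ s') ◅◅ star-sym (del-sym c d sf) s)
  split-finish {c = c} {d} {c'} {d'} sf ss i pl s s' (new refl refl) (old q) =
    (λ t → s' ◅◅ proj₁ (i pl q) (star-sym (del-sym c d sf) s ◅◅ t)) , (λ t → s ◅◅ proj₂ (i pl q) (star-sym (del-sym c' d' ss) s' ◅◅ t))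
  split-finish sf ss i pl s s' (new refl refl) (new refl refl) = (λ _ → ε) , (λ _ → ε)

  -- In the mixed case an edge {c,d} of F below u (a stays with w0) matches an edge {c',d'} of S below w'
  -- (a' stays with u0'). If it separates u0 from w0 this forces its label split to be that of {a,u}.
  module Mixed {P F S : Gr} {a u w u0 w0 a' u' w' u0' w0' : ℕ} (M : Mid F a u w u0 w0) (M' : Mid S a' u' w' u0' w0')
    (pu : P u0 u0') (pw : P w0 w0') (iu : SameSplit P F a u S a' u')
    {c d c' d' : ℕ} (i : SameSplit P F c d S c' d') (aw0 : Star (del F c d) a w0) (au0' : Star (del S c' d') a' u0')
    (n : ¬ Star (del F c d) u0 w0) where

    private
      sf : Symm F
      sf = m-sym M
      ss : Symm S
      ss = m-sym M'
      dsf : Symm (del F c d)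
      dsf = del-sym c d sf
      dau : Symm (del F a u)
      dau = del-sym a u sf

      below-u : ∀ {y y'} → P y y' → Star (del F a u) y u0 → ¬ Star (del F c d) y w0
      below-u p yu yw = n (proj₂ (i pu pw) (star-sym (del-sym c' d' ss) au0' ◅◅ star-sym (del-sym c' d' ss) (passes (del-sym c' d' ss) y'w' λ t → u0≁w0 M' (star-sym (del-sym a' u' ss) (proj₁ (iu p pu) yu) ◅◅ mono (del-mono del⊑) t)) ◅◅ y'w'))
        where
        y'w' = proj₁ (i p pw) yw

      u~u0 : Star (del F a u) u u0
      u~u0 = mono del-comm (u-side M)

      there-split : ∀ {x x' y y'} → P x x' → P y y' → Star (del F c d) x y → Star (del F a u) x y
      there-split px py s with cross dsf a u s
      ... | inj₁ t = mono (del-mono del⊑) t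
      ... | inj₂ (e , inj₁ (p , q)) = ⊥-elim (below-u py (star-sym dau (mono (del-mono del⊑) q) ◅◅ u~u0) (star-sym dsf (mono del⊑ q) ◅◅ (dsf e ◅ aw0)))
      ... | inj₂ (e , inj₂ (p , q)) = ⊥-elim (below-u px (mono (del-mono del⊑) p ◅◅ u~u0) (mono del⊑ p ◅◅ (dsf e ◅ aw0)))

      contra : ∀ {x x' y y'} → P x x' → P y y' → Star (del F a u) x y → Star (del F c d) x u0 → Star (del F c d) y w0 → ⊥
      contra px py xy xu yw with cross sf a u (mono del⊑ yw ◅◅ star-sym sf (mono del⊑ aw0))
      ... | inj₁ ya = n (star-sym dsf (star-sym dsf xa ◅◅ xu) ◅◅ aw0)
        where
        xa = passes dsf {a} {u} xu λ t → m-forest M (au M) (star-sym dau (xy ◅◅ ya) ◅◅ mono (del-mono del⊑) t ◅◅ star-sym dau u~u0)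
      ... | inj₂ (_ , inj₁ (ya , _)) = n (star-sym dsf (star-sym dsf xa ◅◅ xu) ◅◅ aw0)
        where
        xa = passes dsf {a} {u} xu λ t → m-forest M (au M) (star-sym dau (xy ◅◅ ya) ◅◅ mono (del-mono del⊑) t ◅◅ star-sym dau u~u0)
      ... | inj₂ (_ , inj₂ (yu , _)) = below-u py (yu ◅◅ u~u0) yw

      back-split : ∀ {x x' y y'} → P x x' → P y y' → Star (del F a u) x y → Star (del F c d) x y
      back-split {x} {_} {y} px py s with conn? (listed-del (m-listed M) c d) x y
      ... | yes t = t
      ... | no nt with cross! sf c d (mono del⊑ s) nt | cross! sf c d (star-sym sf (au M ◅ mono del⊑ (u-side M)) ◅◅ (aw M ◅ mono del⊑ (w-side M))) n
      ...   | _ , inj₁ (p , q) | _ , inj₁ (p' , q') = ⊥-elim (contra px py s (p ◅◅ star-sym dsf p') (star-sym dsf q ◅◅ q'))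
      ...   | _ , inj₂ (p , q) | _ , inj₂ (p' , q') = ⊥-elim (contra px py s (p ◅◅ star-sym dsf p') (star-sym dsf q ◅◅ q'))
      ...   | _ , inj₁ (p , q) | _ , inj₂ (p' , q') = ⊥-elim (contra py px (star-sym dau s) (star-sym dsf q ◅◅ star-sym dsf p') (p ◅◅ q'))
      ...   | _ , inj₂ (p , q) | _ , inj₁ (p' , q') = ⊥-elim (contra py px (star-sym dau s) (star-sym dsf q ◅◅ star-sym dsf p') (p ◅◅ q'))

    mixed-split : SameSplit P F c d S a' u'
    mixed-split p q = (λ s → proj₁ (iu p q) (there-split p q s)) , (λ s → back-split p q (proj₂ (iu p q) s))

  half-extend : ∀ {P F S a u w u0 w0 a' u' w' u0' w0'} → Mid F a u w u0 w0 → Mid S a' u' w' u0' w0' → P u0 u0' → P w0 w0' →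
    SameSplit P F a u S a' u' → SameSplit P F a w S a' w' → (∀ {x x'} → P x x' → x ≢ a × x' ≢ a') →
    Eqv P F S → Half (ext P a a') F S
  half-extend {P} {F} {S} {a} {u} {w} {u0} {w0} {a'} {u'} {w'} {u0'} {w0'} M M' pu pw iu iw ne E = record { conn = cn ; match = mt }
    where
    sf : Symm F
    sf = m-sym M
    ss : Symm S
    ss = m-sym M'
    fu : Star F a u0
    fu = au M ◅ mono del⊑ (u-side M)
    fu' : Star S a' u0'
    fu' = au M' ◅ mono del⊑ (u-side M')
    cn : ∀ {x x' y y'} → ext P a a' x x' → ext P a a' y y' → Star F x y → Star S x' y'
    cn (old p) (old q) s = conn (fwd E) p q s
    cn (old p) (new refl refl) s = conn (fwd E) p pu (s ◅◅ fu) ◅◅ star-sym ss fu'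
    cn (new refl refl) (old q) s = fu' ◅◅ conn (fwd E) pu q (star-sym sf fu ◅◅ s)
    cn (new refl refl) (new refl refl) s = ε
    Res : ℕ → ℕ → Set
    Res c d = NoSplit (ext P a a') F c d ⊎ (Σ ℕ λ c' → Σ ℕ λ d' → S c' d' × SameSplit (ext P a a') F c d S c' d')
    as-u : ∀ {c d} → SameSplit P F c d S a' u' → Star (del F c d) a w0 → Res c d
    as-u i s = inj₂ (a' , u' , au M' , split-finish sf ss i pw s (a~w0 M'))
    as-w : ∀ {c d} → SameSplit P F c d S a' w' → Star (del F c d) a u0 → Res c d
    as-w i s = inj₂ (a' , w' , aw M' , split-finish sf ss i pu s (a~w0 (mid-flip M')))
    u→w : ∀ {c d} → SameSplit P F c d S a' u' → SameSplit P F c d S a' w'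
    u→w i p q = (λ s → sides-agree M' (proj₂ (ne p)) (proj₂ (ne q)) (proj₁ (i p q) s)) ,
                (λ s → proj₂ (i p q) (sides-agree (mid-flip M') (proj₂ (ne p)) (proj₂ (ne q)) s))
    w→u : ∀ {c d} → SameSplit P F c d S a' w' → SameSplit P F c d S a' u'
    w→u i p q = (λ s → sides-agree (mid-flip M') (proj₂ (ne p)) (proj₂ (ne q)) (proj₁ (i p q) s)) ,
                (λ s → proj₂ (i p q) (sides-agree M' (proj₂ (ne p)) (proj₂ (ne q)) s))
    by-fork : ∀ {c d} → SameSplit P F c d S a' u' → SameSplit P F c d S a' w' → Star (del F c d) a u0 ⊎ Star (del F c d) a w0 → Res c d
    by-fork i j (inj₁ s) = as-w j s
    by-fork i j (inj₂ s) = as-u i s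
    recast : ∀ {c d c' d' e f} → Joins e f (c' , d') → SameSplit P F c d S c' d' → SameSplit P F c d S e f
    recast j i p q = (λ s → mono (del-cong (joins-swap j)) (proj₁ (i p q) s)) , (λ s → proj₂ (i p q) (mono (del-cong j) s))
    two-forks : ∀ {c d c' d'} → S c' d' → SameSplit P F c d S c' d' → Star (del F c d) a u0 ⊎ Star (del F c d) a w0 →
      Star (del S c' d') a' u0' ⊎ Star (del S c' d') a' w0' → Res c d
    two-forks e i (inj₁ s) (inj₁ s') = inj₂ (_ , _ , e , split-finish sf ss i pu s s')
    two-forks e i (inj₂ s) (inj₂ s') = inj₂ (_ , _ , e , split-finish sf ss i pw s s')
    two-forks {c} {d} e i (inj₂ s) (inj₁ s') with conn? (listed-del (m-listed M) c d) u0 w0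
    ... | yes t = inj₂ (_ , _ , e , split-finish sf ss i pu (s ◅◅ star-sym (del-sym c d sf) t) s')
    ... | no n = as-u (Mixed.mixed-split M M' pu pw iu i s s' n) s
    two-forks {c} {d} e i (inj₁ s) (inj₂ s') with conn? (listed-del (m-listed M) c d) w0 u0
    ... | yes t = inj₂ (_ , _ , e , split-finish sf ss i pw (s ◅◅ star-sym (del-sym c d sf) t) s')
    ... | no n = as-w (Mixed.mixed-split (mid-flip M) (mid-flip M') pw pu iw i s s' n) s
    mt : ∀ {c d} → F c d → Res c d
    mt {c} {d} e with joins? a u (c , d) | joins? a w (c , d)
    ... | yes (inj₁ (refl , refl)) | _ = as-u iu (a~w0 M)
    ... | yes (inj₂ (refl , refl)) | _ = as-u (λ p q → (λ s → proj₁ (iu p q) (mono del-comm s)) , (λ s → mono del-comm (proj₂ (iu p q) s))) (mono del-comm (a~w0 M))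
    ... | no _ | yes (inj₁ (refl , refl)) = as-w iw (a~w0 (mid-flip M))
    ... | no _ | yes (inj₂ (refl , refl)) = as-w (λ p q → (λ s → proj₁ (iw p q) (mono del-comm s)) , (λ s → mono del-comm (proj₂ (iw p q) s))) (mono del-comm (a~w0 (mid-flip M)))
    ... | no nu | no nw with match (fwd E) e
    ...   | inj₁ t = inj₁ tr
      where
      au0 : Star (del F c d) a u0
      au0 with fork M
      ... | inj₁ s = s
      ... | inj₂ s = s ◅◅ t pw pu (star-sym sf (aw M ◅ mono del⊑ (w-side M)) ◅◅ fu)
      tr : NoSplit (ext P a a') F c d
      tr (old p) (old q) s = t p q s
      tr (old p) (new refl refl) s = t p pu (s ◅◅ fu) ◅◅ star-sym (del-sym c d sf) au0
      tr (new refl refl) (old q) s = au0 ◅◅ t pu q (star-sym sf fu ◅◅ s)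
      tr (new refl refl) (new refl refl) s = ε
    ...   | inj₂ (c' , d' , e' , i) with joins? a' u' (c' , d') | joins? a' w' (c' , d')
    ...     | yes j | _ = by-fork (recast j i) (u→w (recast j i)) (fork M)
    ...     | no _ | yes j = by-fork (w→u (recast j i)) (recast j i) (fork M)
    ...     | no nu' | no nw' = two-forks e' i (fork M) (fork M')

  eqv-extend : ∀ {P F S a u w u0 w0 a' u' w' u0' w0'} → Mid F a u w u0 w0 → Mid S a' u' w' u0' w0' → P u0 u0' → P w0 w0' →
    SameSplit P F a u S a' u' → SameSplit P F a w S a' w' → (∀ {x x'} → P x x' → x ≢ a × x' ≢ a') →
    Eqv P F S → Eqv (ext P a a') F S
  eqv-extend M M' pu pw iu iw ne E = eqv (half-extend M M' pu pw iu iw ne E)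
    (half-restrict ext-flip (half-extend M' M pu pw (λ p q → proj₂ (iu p q) , proj₁ (iu p q)) (λ p q → proj₂ (iw p q) , proj₁ (iw p q)) (λ p → proj₂ (ne p) , proj₁ (ne p)) (eqv-sym E)))

open LabelSplits

module GraphBasics where

  Edges : Set
  Edges = List (ℕ × ℕ)

  multE : Edges → ℕ → ℕ → ℕ
  multE es a b = length (filter (joins? a b) es)

  degE : Edges → ℕ → ℕ
  degE es v = length (filter (inc? v) es)

  0<filter : ∀ {A : Set} {P : A → Set} (P? : ∀ x → Dec (P x)) xs → 0 < length (filter P? xs) → Σ A λ x → x ∈ xs × P x
  0<filter P? (x ∷ xs) lt with P? x
  ... | yes p = x , here refl , p
  ... | no _ with 0<filter P? xs lt
  ... | y , m , p = y , there m , p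

  filter-0< : ∀ {A : Set} {P : A → Set} (P? : ∀ x → Dec (P x)) {x xs} → x ∈ xs → P x → 0 < length (filter P? xs)
  filter-0< P? m p = filter-some P? (Any.map (λ { refl → p }) m)

  adj→ad : ∀ {es a b} → 0 < multE es a b → Ad es a b
  adj→ad {es} {a} {b} lt with 0<filter (joins? a b) es lt
  ... | _ , m , inj₁ (refl , refl) = inj₁ m
  ... | _ , m , inj₂ (refl , refl) = inj₂ m

  ad→adj : ∀ {es a b} → Ad es a b → 0 < multE es a b
  ad→adj {es} {a} {b} (inj₁ m) = filter-0< (joins? a b) m (inj₁ (refl , refl))
  ad→adj {es} {a} {b} (inj₂ m) = filter-0< (joins? a b) m (inj₂ (refl , refl))

  toAd : ∀ G {a b} → Adj G a b → Ad (E G) a b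
  toAd G {a} {b} = adj→ad {E G} {a} {b}

  fromAd : ∀ G {a b} → Ad (E G) a b → Adj G a b
  fromAd G {a} {b} = ad→adj {E G} {a} {b}

  adj-listed : ∀ G → Listed (Adj G)
  adj-listed G = listed (E G) adj→ad ad→adj

  ≤1-≢0 : ∀ {k} → k ≢ 0 → k ≤ 1 → k ≡ 1
  ≤1-≢0 {zero} n _ = ⊥-elim (n refl)
  ≤1-≢0 {suc zero} _ _ = refl
  ≤1-≢0 {suc (suc k)} _ (s≤s ())

  adj-sym : ∀ G → Symm (Adj G)
  adj-sym G = symm (adj-listed G)

  adj? : ∀ G a b → Dec (Adj G a b)
  adj? G = edge? (adj-listed G)

  adj-∈ : ∀ {G a b} → WF G → Adj G a b → a ∈ V G × b ∈ V G × a ≢ b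
  adj-∈ {G} wf ab with adj→ad ab
  ... | inj₁ m = All.lookup (proj₂ wf) m
  ... | inj₂ m = let (p , q , r) = All.lookup (proj₂ wf) m in q , p , λ e → r (sym e)

  ¬adj-mult : ∀ {es a b} → ¬ Ad es a b → multE es a b ≡ 0
  ¬adj-mult {es} {a} {b} n with multE es a b in eq
  ... | zero = refl
  ... | suc k = ⊥-elim (n (adj→ad {es} (subst (0 <_) (sym eq) (s≤s z≤n))))

  adj-mult : ∀ {es a b} → multE es a b ≤ 1 → Ad es a b → multE es a b ≡ 1
  adj-mult {es} {a} {b} le ab with multE es a b | ad→adj {es} ab | le
  ... | suc zero | _ | _ = refl
  ... | suc (suc k) | _ | s≤s ()

  count-split : ∀ {A : Set} {P Q : A → Set} (P? : ∀ x → Dec (P x)) (Q? : ∀ x → Dec (Q x)) xs →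
    length (filter P? xs) ≡ length (filter P? (filter Q? xs)) + length (filter P? (filter (λ x → ¬? (Q? x)) xs))
  count-split P? Q? [] = refl
  count-split P? Q? (x ∷ xs) with Q? x
  ... | yes q with P? x
  ...   | yes p = cong suc (count-split P? Q? xs)
  ...   | no np = count-split P? Q? xs
  count-split P? Q? (x ∷ xs) | no nq with P? x
  ...   | yes p = trans (cong suc (count-split P? Q? xs)) (sym (+-suc _ _))
  ...   | no np = count-split P? Q? xs

  count-filter-≤ : ∀ {A : Set} {P Q : A → Set} (P? : ∀ x → Dec (P x)) (Q? : ∀ x → Dec (Q x)) xs →
    length (filter P? (filter Q? xs)) ≤ length (filter P? xs)
  count-filter-≤ P? Q? xs rewrite count-split P? Q? xs = m≤m+n _ _

  count-∩ : ∀ {A : Set} {P Q J : A → Set} (P? : ∀ x → Dec (P x)) (Q? : ∀ x → Dec (Q x)) (J? : ∀ x → Dec (J x)) →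
    (∀ {x} → P x → Q x → J x) → (∀ {x} → J x → P x × Q x) → ∀ xs → length (filter P? (filter Q? xs)) ≡ length (filter J? xs)
  count-∩ P? Q? J? f g [] = refl
  count-∩ P? Q? J? f g (x ∷ xs) with Q? x | J? x
  ... | no nq | yes j = ⊥-elim (nq (proj₂ (g j)))
  ... | no nq | no _ = count-∩ P? Q? J? f g xs
  ... | yes q | yes j with P? x
  ...   | yes p = cong suc (count-∩ P? Q? J? f g xs)
  ...   | no np = ⊥-elim (np (proj₁ (g j)))
  count-∩ P? Q? J? f g (x ∷ xs) | yes q | no nj with P? x
  ...   | yes p = ⊥-elim (nj (f p q))
  ...   | no np = count-∩ P? Q? J? f g xs

  count-tail : ∀ {A : Set} {P : A → Set} (P? : ∀ x → Dec (P x)) x xs → length (filter P? xs) ≤ length (filter P? (x ∷ xs))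
  count-tail P? x xs with P? x
  ... | yes _ = n≤1+n _
  ... | no _ = ≤-refl

  inc-inc-joins : ∀ {a v e} → a ≢ v → Inc a e → Inc v e → Joins a v e
  inc-inc-joins ne (inj₁ p) (inj₁ q) = ⊥-elim (ne (trans (sym p) q))
  inc-inc-joins ne (inj₁ p) (inj₂ q) = inj₁ (p , q)
  inc-inc-joins ne (inj₂ p) (inj₁ q) = inj₂ (q , p)
  inc-inc-joins ne (inj₂ p) (inj₂ q) = ⊥-elim (ne (trans (sym p) q))

  joins-inc : ∀ {a v e} → Joins a v e → Inc a e × Inc v e
  joins-inc (inj₁ (p , q)) = inj₁ p , inj₂ q
  joins-inc (inj₂ (p , q)) = inj₂ q , inj₁ p

  deg-delIncident : ∀ es {a v} → a ≢ v → degE es a ≡ multE es a v + degE (delIncident v es) a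
  deg-delIncident es {a} {v} ne = trans (count-split (inc? a) (inc? v) es)
    (cong (_+ degE (delIncident v es) a) (count-∩ (inc? a) (inc? v) (joins? a v) (inc-inc-joins ne) joins-inc es))

  ad-delIncident⁻ : ∀ {es v a b} → Ad (delIncident v es) a b → Ad es a b × a ≢ v × b ≢ v
  ad-delIncident⁻ (inj₁ m) = let (p , q) = ∈-filter⁻ _ m in inj₁ p , (λ e → q (inj₁ e)) , (λ e → q (inj₂ e))
  ad-delIncident⁻ (inj₂ m) = let (p , q) = ∈-filter⁻ _ m in inj₂ p , (λ e → q (inj₂ e)) , (λ e → q (inj₁ e))

  ad-delIncident⁺ : ∀ {es v a b} → Ad es a b → a ≢ v → b ≢ v → Ad (delIncident v es) a b
  ad-delIncident⁺ (inj₁ m) na nb = inj₁ (∈-filter⁺ _ m [ na , nb ])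
  ad-delIncident⁺ (inj₂ m) na nb = inj₂ (∈-filter⁺ _ m [ nb , na ])

  ∈-delV⁺ : ∀ {x v V} → x ∈ V → x ≢ v → x ∈ delV v V
  ∈-delV⁺ m n = ∈-filter⁺ _ m n

  ∈-delV⁻ : ∀ {x v V} → x ∈ delV v V → x ∈ V × x ≢ v
  ∈-delV⁻ {V = V} m = ∈-filter⁻ _ {xs = V} m

  other : ℕ → ℕ × ℕ → ℕ
  other v (a , b) with a ≟ v
  ... | yes _ = b
  ... | no _ = a

  nbrs : ℕ → Edges → List ℕ
  nbrs v [] = []
  nbrs v (e ∷ es) with inc? v e
  ... | yes _ = other v e ∷ nbrs v es
  ... | no _ = nbrs v es

  nbrs-length : ∀ v es → length (nbrs v es) ≡ degE es v
  nbrs-length v [] = refl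
  nbrs-length v (e ∷ es) with inc? v e
  ... | yes i rewrite filter-accept (inc? v) {xs = es} i = cong suc (nbrs-length v es)
  ... | no n rewrite filter-reject (inc? v) {xs = es} n = nbrs-length v es

  other-joins : ∀ v e → Inc v e → Joins v (other v e) e
  other-joins v (a , b) i with a ≟ v | i
  ... | yes p | _ = inj₁ (p , refl)
  ... | no n | inj₁ p = ⊥-elim (n p)
  ... | no n | inj₂ q = inj₂ (refl , q)

  joins-other : ∀ {v n e} → proj₁ e ≢ proj₂ e → Joins v n e → n ≡ other v e
  joins-other {v} {n} {a , b} ne j with a ≟ v | j
  ... | yes p | inj₁ (_ , q) = sym q
  ... | yes p | inj₂ (_ , q) = ⊥-elim (ne (trans p (sym q)))
  ... | no m | inj₁ (p , _) = ⊥-elim (m p)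
  ... | no m | inj₂ (p , _) = sym p

  joins-ad : ∀ {a b e es} → Joins a b e → e ∈ es → Ad es a b
  joins-ad (inj₁ (refl , refl)) m = inj₁ m
  joins-ad (inj₂ (refl , refl)) m = inj₂ m

  nbrs-∈ : ∀ {v es n} → n ∈ nbrs v es → Ad es v n
  nbrs-∈ {v} {e ∷ es} m with inc? v e | m
  ... | yes i | here refl = joins-ad (other-joins v e i) (here refl)
  ... | yes i | there m' = [ (λ x → inj₁ (there x)) , (λ x → inj₂ (there x)) ] (nbrs-∈ {v} {es} m')
  ... | no _ | m' = [ (λ x → inj₁ (there x)) , (λ x → inj₂ (there x)) ] (nbrs-∈ {v} {es} m')

  ∈-nbrs′ : ∀ {v es n e} → All (λ e → proj₁ e ≢ proj₂ e) es → e ∈ es → Joins v n e → n ∈ nbrs v es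
  ∈-nbrs′ {v} {e ∷ es} (ne ∷ _) (here refl) j with inc? v e
  ... | yes i = here (joins-other ne j)
  ... | no n = ⊥-elim (n (proj₁ (joins-inc j)))
  ∈-nbrs′ {v} {e ∷ es} (_ ∷ nl) (there m) j with inc? v e
  ... | yes i = there (∈-nbrs′ nl m j)
  ... | no n = ∈-nbrs′ nl m j

  ∈-nbrs : ∀ {v es n} → All (λ e → proj₁ e ≢ proj₂ e) es → Ad es v n → n ∈ nbrs v es
  ∈-nbrs nl (inj₁ m) = ∈-nbrs′ nl m (inj₁ (refl , refl))
  ∈-nbrs nl (inj₂ m) = ∈-nbrs′ nl m (inj₂ (refl , refl))

  nbrs-unique : ∀ {v es} → All (λ e → proj₁ e ≢ proj₂ e) es → (∀ b → multE es v b ≤ 1) → Unique (nbrs v es)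
  nbrs-unique {v} {[]} _ _ = []
  nbrs-unique {v} {e ∷ es} (ne ∷ nl) le with inc? v e
  ... | no n = nbrs-unique nl (λ b → ≤-trans (count-tail (joins? v b) e es) (le b))
  ... | yes i = All.tabulate (λ { {n} m refl → absurd (nbrs-∈ {v} {es} m) }) ∷ nbrs-unique nl (λ b → ≤-trans (count-tail (joins? v b) e es) (le b))
    where
    absurd : Ad es v (other v e) → ⊥
    absurd ad with le (other v e)
    ... | q rewrite filter-accept (joins? v (other v e)) {xs = es} (other-joins v e i) = case ≤-trans (s≤s (ad→adj {es} ad)) q of λ { (s≤s ()) }

  no-loops : ∀ {G} → WF G → All (λ e → proj₁ e ≢ proj₂ e) (E G)
  no-loops wf = All.map (λ p → proj₂ (proj₂ p)) (proj₂ wf)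

  module _ {G : Graph} (si : Simple G) where

    private
      un : ∀ v → Unique (nbrs v (E G))
      un v = nbrs-unique (no-loops {G} (proj₁ si)) (λ b → proj₂ si v b)

      mem : ∀ {v n} → Adj G v n → n ∈ nbrs v (E G)
      mem a = ∈-nbrs (no-loops {G} (proj₁ si)) (adj→ad a)

    deg-0 : ∀ {v} → deg G v ≡ 0 → ∀ n → ¬ Adj G v n
    deg-0 {v} d n a with nbrs v (E G) | mem a | nbrs-length v (E G)
    ... | _ ∷ _ | _ | q = case trans q d of λ ()

    deg-≤1 : ∀ {v} → deg G v ≤ 1 → ∀ {n m} → Adj G v n → Adj G v m → n ≡ m
    deg-≤1 {v} d a b with nbrs v (E G) | mem a | mem b | nbrs-length v (E G)
    ... | _ ∷ [] | here refl | here refl | _ = refl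
    ... | _ ∷ _ ∷ _ | _ | _ | q = case subst (_≤ 1) (sym q) d of λ { (s≤s ()) }

    deg-1 : ∀ {v} → deg G v ≡ 1 → Σ ℕ λ n → Adj G v n
    deg-1 {v} d with nbrs v (E G) in eq | nbrs-length v (E G)
    ... | [] | q = case trans q d of λ ()
    ... | n ∷ _ | q = n , ad→adj {E G} (nbrs-∈ {v} {E G} (subst (n ∈_) (sym eq) (here refl)))

    deg-2 : ∀ {v} → deg G v ≡ 2 → Σ ℕ λ u → Σ ℕ λ w → nbrs v (E G) ≡ u ∷ w ∷ [] × u ≢ w × Adj G v u × Adj G v w × (∀ {n} → Adj G v n → n ≡ u ⊎ n ≡ w)
    deg-2 {v} d with nbrs v (E G) in eq | nbrs-length v (E G) | un v
    ... | [] | q | _ = case trans q d of λ ()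
    ... | _ ∷ [] | q | _ = case trans q d of λ ()
    ... | _ ∷ _ ∷ _ ∷ _ | q | _ = case trans q d of λ ()
    ... | u ∷ w ∷ [] | q | (ne ∷ _) ∷ _ = u , w , refl , ne , is u (here refl) , is w (there (here refl)) , only
      where
      is : ∀ n → n ∈ u ∷ w ∷ [] → Adj G v n
      is n m = ad→adj {E G} (nbrs-∈ {v} {E G} (subst (n ∈_) (sym eq) m))
      only : ∀ {n} → Adj G v n → n ≡ u ⊎ n ≡ w
      only {n} a with subst (n ∈_) eq (mem a)
      ... | here p = inj₁ p
      ... | there (here p) = inj₂ p

    deg-3 : ∀ {v} → deg G v ≡ 3 → Σ ℕ λ p → Σ ℕ λ q → Σ ℕ λ r → Adj G v p × Adj G v q × Adj G v r × p ≢ q × p ≢ r × q ≢ r ×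
      (∀ {n} → Adj G v n → n ≡ p ⊎ n ≡ q ⊎ n ≡ r)
    deg-3 {v} d with nbrs v (E G) in eq | nbrs-length v (E G) | un v
    ... | [] | q | _ = case trans q d of λ ()
    ... | _ ∷ [] | q | _ = case trans q d of λ ()
    ... | _ ∷ _ ∷ [] | q | _ = case trans q d of λ ()
    ... | _ ∷ _ ∷ _ ∷ _ ∷ _ | q | _ = case trans q d of λ ()
    ... | a ∷ b ∷ c ∷ [] | q | (n1 ∷ n2 ∷ _) ∷ (n3 ∷ _) ∷ _ = a , b , c , is a (here refl) , is b (there (here refl)) , is c (there (there (here refl))) , n1 , n2 , n3 , only
      where
      is : ∀ n → n ∈ a ∷ b ∷ c ∷ [] → Adj G v n
      is n m = ad→adj {E G} (nbrs-∈ {v} {E G} (subst (n ∈_) (sym eq) m))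
      only : ∀ {n} → Adj G v n → n ≡ a ⊎ n ≡ b ⊎ n ≡ c
      only {n} x with subst (n ∈_) eq (mem x)
      ... | here p = inj₁ p
      ... | there (here p) = inj₂ (inj₁ p)
      ... | there (there (here p)) = inj₂ (inj₂ p)

  data UPath (R : Gr) : ℕ → ℕ → List ℕ → Set where
    end : ∀ {y} → UPath R y y (y ∷ [])
    step : ∀ {x z y L} → R x z → UPath R z y L → x ∉ L → UPath R x y (x ∷ L)

  upath-suffix : ∀ {R z y L x} → UPath R z y L → x ∈ L → Σ (List ℕ) λ L' → UPath R x y L'
  upath-suffix {L = L} end (here refl) = _ , end
  upath-suffix (step r p n) (here refl) = _ , step r p n
  upath-suffix (step r p n) (there m) = upath-suffix p m

  erase : ∀ {R x y} → Star R x y → Σ (List ℕ) λ L → UPath R x y L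
  erase ε = _ , end
  erase {x = x} (r ◅ s) with erase s
  ... | L , p with x ∈? L
  ...   | yes m = upath-suffix p m
  ...   | no n = x ∷ L , step r p n

  upath-list : ∀ {R x y L} → UPath R x y L → x ≢ y → Σ (List ℕ) λ mid → L ≡ x ∷ mid ++ y ∷ [] × Unique L × Linked R L
  upath-list end ne = ⊥-elim (ne refl)
  upath-list {y = y} (step {z = z} r p n) ne with z ≟ y
  upath-list {x = x} {y} (step {z = z} r end n) ne | yes refl = [] , refl , (Allₚ.¬Any⇒All¬ _ n ∷ ([] ∷ [])) , r ∷ [-]
  upath-list {x = x} {y} (step {z = z} r (step r' p' n') n) ne | yes refl = ⊥-elim (n' (last∈ p'))
    where
    last∈ : ∀ {R x y L} → UPath R x y L → y ∈ L
    last∈ end = here refl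
    last∈ (step _ p _) = there (last∈ p)
  upath-list {x = x} {y} (step {z = z} r p n) ne | no ne' with upath-list p ne'
  ... | mid , refl , u , l = z ∷ mid , refl , (Allₚ.¬Any⇒All¬ _ n ∷ u) , r ∷ l

  linked-snoc : ∀ {R : Gr} xs {y z} → Linked R (xs ++ y ∷ []) → R y z → Linked R (xs ++ y ∷ z ∷ [])
  linked-snoc [] [-] r = r ∷ [-]
  linked-snoc (x ∷ []) (r' ∷ l) r = r' ∷ linked-snoc [] l r
  linked-snoc (x ∷ x' ∷ xs) (r' ∷ l) r = r' ∷ linked-snoc (x' ∷ xs) l r

  linked-map : ∀ {R T : Gr} → R ⊑ T → ∀ {xs} → Linked R xs → Linked T xs
  linked-map f [] = []
  linked-map f [-] = [-]
  linked-map f (r ∷ l) = f r ∷ linked-map f l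

  acyclic→forest : ∀ {G} → WF G → Acyclic G → Forest (Adj G)
  acyclic→forest {G} wf ac {a} {b} ab s with erase s
  ... | L , p with upath-list p (proj₂ (proj₂ (adj-∈ {G} wf ab)))
  ... | [] , refl , u , ((_ , n) ∷ _) = n joins-self
  ... | m ∷ mid , refl , u , l = ac (a , m ∷ mid ++ b ∷ [] , s≤s (len mid) , u ,
          subst (Linked (Adj G)) (cong (λ z → a ∷ m ∷ z) (assoc mid)) (linked-snoc (a ∷ m ∷ mid) (linked-map kept l) (adj-sym G ab)))
    where
    len : ∀ xs → 1 ≤ length (xs ++ b ∷ [])
    len [] = s≤s z≤n
    len (x ∷ xs) = s≤s z≤n
    assoc : ∀ xs → xs ++ b ∷ a ∷ [] ≡ (xs ++ b ∷ []) ++ a ∷ []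
    assoc [] = refl
    assoc (x ∷ xs) = cong (x ∷_) (assoc xs)

  forest→acyclic : ∀ {G} → Forest (Adj G) → Acyclic G
  forest→acyclic {G} fo (v , r1 ∷ r2 ∷ rs , _ , (nv1 ∷ nv2 ∷ nv) ∷ (n12 ∷ n1) ∷ _ , e1 ∷ e2 ∷ l) =
    fo e1 (star-sym (del-sym v r1 (adj-sym G)) ((e2 , λ { (inj₁ (p , _)) → nv1 (sym p) ; (inj₂ (_ , q)) → nv2 (sym q) }) ◅ walk r2 rs nv2 nv n12 n1 l))
    where
    walk : ∀ c cs → v ≢ c → All (v ≢_) cs → r1 ≢ c → All (r1 ≢_) cs → Linked (Adj G) (c ∷ cs ++ v ∷ []) → Star (del (Adj G) v r1) c v
    walk c [] nc _ mc _ (e ∷ _) = one (e , λ { (inj₁ (p , _)) → nc (sym p) ; (inj₂ (p , _)) → mc (sym p) })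
    walk c (c' ∷ cs) nc (nc' ∷ ncs) mc (mc' ∷ mcs) (e ∷ l) =
      (e , λ { (inj₁ (p , _)) → nc (sym p) ; (inj₂ (_ , q)) → nc' (sym q) }) ◅ walk c' cs nc' ncs mc' mcs l
  forest→acyclic fo (v , [] , () , _)
  forest→acyclic fo (v , _ ∷ [] , s≤s () , _)

open GraphBasics

module Suppression where

  data On (X : List ℕ) (x : ℕ) : ℕ → Set where
    on : x ∈ X → On X x x

  on-sym : ∀ {X} → On X ⊑ (On X ˘)
  on-sym (on m) = on m

  on-flip : ∀ {X F S} → Eqv (On X) F S → Eqv (On X) S F
  on-flip e = eqv-restrict on-sym (eqv-sym e)

  on-trans : ∀ {X F G H} → Eqv (On X) F G → Eqv (On X) G H → Eqv (On X) F H
  on-trans = eqv-trans (λ { (on m) → _ , on m , on m })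

  on-refl : ∀ {X F} → Eqv (On X) F F
  on-refl {F = F} = eqv-restrict (λ { (on m) → refl }) (eqv-≡ {F} {F} (λ r → r) (λ r → r))

  module Suppress {G : Graph} {v u w : ℕ} (si : Simple G) (fo : Forest (Adj G)) (d2 : deg G v ≡ 2) (u≢w : u ≢ w)
    (uv : Adj G u v) (vw : Adj G v w) where

    H : Graph
    H = mkGraph (delV v (V G)) ((u , w) ∷ delIncident v (E G))

    private
      sg : Symm (Adj G)
      sg = adj-sym G
      u≢v : u ≢ v
      u≢v = forest-≢ fo uv
      w≢v : w ≢ v
      w≢v e = forest-≢ fo vw (sym e)

    nbr-v : ∀ {n} → Adj G v n → n ≡ u ⊎ n ≡ w
    nbr-v a with deg-2 si d2
    ... | p , q , _ , ne , _ , _ , only with only (sg uv) | only vw | only a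
    ... | inj₁ refl | inj₁ refl | _ = ⊥-elim (u≢w refl)
    ... | inj₂ refl | inj₂ refl | _ = ⊥-elim (u≢w refl)
    ... | inj₁ refl | inj₂ refl | r = r
    ... | inj₂ refl | inj₁ refl | r = swap r

    no-uw : ¬ Adj G u w
    no-uw a = fo a ((uv , λ { (inj₁ (_ , p)) → w≢v (sym p) ; (inj₂ (p , _)) → u≢w p }) ◅ one (vw , λ { (inj₁ (p , _)) → u≢v (sym p) ; (inj₂ (p , _)) → w≢v (sym p) }))

    adj⁻ : ∀ {a b} → Adj H a b → Joins u w (a , b) ⊎ (Adj G a b × a ≢ v × b ≢ v)
    adj⁻ {a} {b} h with adj→ad {E H} {a} {b} h
    ... | inj₁ (here refl) = inj₁ joins-self
    ... | inj₂ (here refl) = inj₁ (inj₂ (refl , refl))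
    ... | inj₁ (there m) = let (p , q) = ad-delIncident⁻ (inj₁ m) in inj₂ (ad→adj {E G} p , q)
    ... | inj₂ (there m) = let (p , q) = ad-delIncident⁻ (inj₂ m) in inj₂ (ad→adj {E G} p , q)

    adj⁺ : ∀ {a b} → Adj G a b → a ≢ v → b ≢ v → Adj H a b
    adj⁺ {a} {b} r na nb = ad→adj {E H} {a} {b} ([ (λ m → inj₁ (there m)) , (λ m → inj₂ (there m)) ] (ad-delIncident⁺ (toAd G r) na nb))

    uw : Adj H u w
    uw = ad→adj {E H} {u} {w} (inj₁ (here refl))

    private
      fresh : Fresh (Adj H) v
      fresh {a} {b} h with adj⁻ {a} {b} h
      ... | inj₁ (inj₁ (refl , refl)) = u≢v , w≢v
      ... | inj₁ (inj₂ (refl , refl)) = w≢v , u≢v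
      ... | inj₂ (_ , p , q) = p , q

      to-sub : Adj G ⊑ subdiv (Adj H) u w v
      to-sub {a} {b} r with a ≟ v | b ≟ v
      to-sub {a} {b} r | yes refl | _ with nbr-v r
      ... | inj₁ refl = left (inj₂ (refl , refl))
      ... | inj₂ refl = right (inj₁ (refl , refl))
      to-sub {a} {b} r | no _ | yes refl with nbr-v (sg r)
      ... | inj₁ refl = left (inj₁ (refl , refl))
      ... | inj₂ refl = right (inj₂ (refl , refl))
      to-sub {a} {b} r | no na | no nb = rest (adj⁺ r na nb) (λ { (inj₁ (refl , refl)) → no-uw r ; (inj₂ (refl , refl)) → no-uw (sg r) })

      from-sub : subdiv (Adj H) u w v ⊑ Adj G
      from-sub {a} {b} (rest h n) with adj⁻ {a} {b} h
      ... | inj₁ j = ⊥-elim (n j)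
      ... | inj₂ (r , _) = r
      from-sub (left (inj₁ (refl , refl))) = uv
      from-sub (left (inj₂ (refl , refl))) = sg uv
      from-sub (right (inj₁ (refl , refl))) = vw
      from-sub (right (inj₂ (refl , refl))) = sg vw

    forestH : Forest (Adj H)
    forestH = subdiv-forest⁻ (adj-sym H) uw fresh u≢w (forest-⊑ from-sub fo)

    eqvH : ∀ {X} → v ∉ X → Eqv (On X) (Adj G) (Adj H)
    eqvH n = eqv-restrict (λ { (on m) → refl , λ { refl → n m } })
      (eqv-sym (eqv-cong (λ r → r) (λ r → r) from-sub to-sub (subdiv-eqv (adj-sym H) uw fresh)))

    degH : ∀ {a} → a ≢ v → deg H a ≡ deg G a
    degH {a} ne with inc? a (u , w)
    ... | yes i = trans (cong length (filter-accept (inc? a) {xs = delIncident v (E G)} i)) (sym (trans (deg-delIncident (E G) ne) (cong (_+ degE (delIncident v (E G)) a) (adj-mult {E G} (proj₂ si a v) (av i)))))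
      where
      av : Inc a (u , w) → Ad (E G) a v
      av (inj₁ refl) = toAd G uv
      av (inj₂ refl) = toAd G (sg vw)
    ... | no n = trans (cong length (filter-reject (inc? a) {xs = delIncident v (E G)} n)) (sym (trans (deg-delIncident (E G) ne) (cong (_+ degE (delIncident v (E G)) a) (¬adj-mult {E G} λ av → n ([ (λ e → inj₁ (sym e)) , (λ e → inj₂ (sym e)) ] (nbr-v (sg (ad→adj {E G} av))))))))

    simpleH : Simple H
    simpleH = (Uₚ.filter⁺ (λ x → ¬? (x ≟ v)) (proj₁ (proj₁ si)) , ((∈-delV⁺ (proj₁ (adj-∈ {G} (proj₁ si) uv)) u≢v , ∈-delV⁺ (proj₁ (proj₂ (adj-∈ {G} (proj₁ si) vw))) w≢v , u≢w) ∷ All.tabulate ends)) , multH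
      where
      ends : ∀ {e} → e ∈ delIncident v (E G) → proj₁ e ∈ delV v (V G) × proj₂ e ∈ delV v (V G) × proj₁ e ≢ proj₂ e
      ends m with ∈-filter⁻ (λ e → ¬? (inc? v e)) m
      ... | m' , n with All.lookup (proj₂ (proj₁ si)) m'
      ... | p , q , r = ∈-delV⁺ p (λ e → n (inj₁ e)) , ∈-delV⁺ q (λ e → n (inj₂ e)) , r
      multH : ∀ a b → mult H a b ≤ 1
      multH a b with joins? a b (u , w)
      ... | no n = subst (_≤ 1) (sym (cong length (filter-reject (joins? a b) {xs = delIncident v (E G)} n))) (≤-trans (count-filter-≤ (joins? a b) (λ e → ¬? (inc? v e)) (E G)) (proj₂ si a b))
      ... | yes j = subst (_≤ 1) (sym (trans (cong length (filter-accept (joins? a b) {xs = delIncident v (E G)} j)) (cong suc (¬adj-mult {delIncident v (E G)} λ ad → no-uw (f j (ad→adj {E G} (proj₁ (ad-delIncident⁻ ad)))))))) ≤-refl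
        where
        f : Joins a b (u , w) → Adj G a b → Adj G u w
        f (inj₁ (refl , refl)) r = r
        f (inj₂ (refl , refl)) r = sg r

  record PreF (X : List ℕ) (G : Graph) : Set where
    constructor pref
    field
      simple : Simple G
      forest : Forest (Adj G)
      lab : ∀ {x} → x ∈ X → x ∈ V G
      leaf : ∀ {x} → x ∈ X → deg G x ≤ 1
      inner : ∀ {v} → v ∈ V G → v ∈ X ⊎ deg G v ≡ 2 ⊎ deg G v ≡ 3

  record IsF (X : List ℕ) (G : Graph) : Set where
    constructor isf
    field
      simple : Simple G
      forest : Forest (Adj G)
      lab : ∀ {x} → x ∈ X → x ∈ V G
      leaf : ∀ {x} → x ∈ X → deg G x ≤ 1
      inner : ∀ {v} → v ∈ V G → v ∈ X ⊎ deg G v ≡ 3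

  deg2-∉ : ∀ {X G v} → PreF X G → deg G v ≡ 2 → v ∉ X
  deg2-∉ p d m = case subst (_≤ 1) d (PreF.leaf p m) of λ { (s≤s ()) }

  record Suppressed (X : List ℕ) (G H : Graph) : Set where
    field
      pre : PreF X H
      eqvX : Eqv (On X) (Adj G) (Adj H)
      adjs : ∀ {a b} → Adj G a b → deg G a ≢ 2 → deg G b ≢ 2 → Adj H a b
  open Suppressed

  suppress-star : ∀ {X G H} → PreF X G → Star Suppress1 G H → Suppressed X G H
  suppress-star p ε = record { pre = p ; eqvX = on-refl ; adjs = λ r _ _ → r }
  suppress-star {X} {G} p ((v , u , w , vV , d , ne , uv , vw , refl) ◅ s) = record
    { pre = pre r ; eqvX = on-trans (S.eqvH (deg2-∉ p d)) (eqvX r)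
    ; adjs = λ ab na nb → adjs r (S.adj⁺ ab (nv na) (nv nb)) (λ e → na (trans (sym (S.degH (nv na))) e)) (λ e → nb (trans (sym (S.degH (nv nb))) e)) }
    where
    open PreF p
    module S = Suppress {G} simple forest d ne uv vw
    nv : ∀ {a} → deg G a ≢ 2 → a ≢ v
    nv n refl = n d
    p' : PreF X S.H
    p' = pref S.simpleH S.forestH (λ m → ∈-delV⁺ (lab m) (λ { refl → deg2-∉ p d m }))
      (λ m → subst (_≤ 1) (sym (S.degH (λ { refl → deg2-∉ p d m }))) (leaf m))
      (λ m → let (m' , n) = ∈-delV⁻ m in subst (λ k → _ ∈ X ⊎ k ≡ 2 ⊎ k ≡ 3) (sym (S.degH n)) (inner m'))
    r : Suppressed X S.H _
    r = suppress-star p' s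

  suppress-isF : ∀ {X G H} → PreF X G → SuppressAll G H → IsF X H
  suppress-isF p (s , n) with suppress-star p s
  ... | r = isf (PreF.simple q) (PreF.forest q) (PreF.lab q) (PreF.leaf q) (λ {v} m → [ inj₁ , [ (λ d → ⊥-elim (n v m d)) , inj₂ ] ] (PreF.inner q m))
    where q = pre r

  abstract
    -- The suppression obtained by always treating the first degree-two vertex of the list.
    suppress′ : ℕ → Graph → Graph
    suppress′ zero G = G
    suppress′ (suc n) G with filter (λ v → deg G v ≟ 2) (V G)
    ... | [] = G
    ... | v ∷ _ with nbrs v (E G)
    ...   | u ∷ w ∷ [] = suppress′ n (mkGraph (delV v (V G)) ((u , w) ∷ delIncident v (E G)))
    ...   | _ = G

    suppress : Graph → Graph
    suppress G = suppress′ (length (V G)) G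

    suppress′-all : ∀ {X} n G → PreF X G → length (V G) ≤ n → SuppressAll G (suppress′ n G)
    suppress′-all zero (mkGraph [] _) p _ = ε , λ v ()
    suppress′-all (suc n) G p le with filter (λ v → deg G v ≟ 2) (V G) in eq
    ... | [] = ε , λ v m d → none (subst (v ∈_) eq (∈-filter⁺ (λ v → deg G v ≟ 2) m d))
      where
      none : ∀ {v : ℕ} → ¬ (v ∈ [])
      none ()
    ... | v ∷ vs with ∈-filter⁻ (λ v → deg G v ≟ 2) (subst (v ∈_) (sym eq) (here refl))
    ...   | vV , d with deg-2 (PreF.simple p) d
    ...     | u , w , nb , ne , vu , vw , _ rewrite nb = st ◅ proj₁ r , proj₂ r
      where
      H : Graph
      H = mkGraph (delV v (V G)) ((u , w) ∷ delIncident v (E G))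
      st : Suppress1 G H
      st = v , u , w , vV , d , ne , adj-sym G vu , vw , refl
      r : SuppressAll H (suppress′ n H)
      r = suppress′-all n H (pre (suppress-star p (st ◅ ε))) (s≤s⁻¹ (≤-trans (filter-notAll (λ x → ¬? (x ≟ v)) (V G) (Any.map (λ { refl k → k refl }) vV)) le))

    suppress-all : ∀ {X G} → PreF X G → SuppressAll G (suppress G)
    suppress-all {G = G} p = suppress′-all _ G p ≤-refl

  cutE : Graph → ℕ → ℕ → Graph
  cutE F a b = mkGraph (V F) (removeEdge a b (E F))

  delE : ℕ → ℕ → Edges → Edges
  delE a b = filter (λ e → ¬? (joins? a b e))

  removeEdge-delE : ∀ a b es → multE es a b ≤ 1 → removeEdge a b es ≡ delE a b es
  removeEdge-delE a b [] le = refl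
  removeEdge-delE a b (e ∷ es) le with joins? a b e
  ... | yes j = trans (sym (filter-all (λ e → ¬? (joins? a b e)) (All.tabulate λ m j' → case ≤-trans (s≤s (filter-0< (joins? a b) m j')) (subst (_≤ 1) (cong length (filter-accept (joins? a b) {xs = es} j)) le) of λ { (s≤s ()) }))) (sym (filter-reject (λ e → ¬? (joins? a b e)) {xs = es} (λ n → n j)))
  ... | no n = trans (cong (e ∷_) (removeEdge-delE a b es (≤-trans (count-tail (joins? a b) e es) le))) (sym (filter-accept (λ e → ¬? (joins? a b e)) {xs = es} n))

  ad-delE⁺ : ∀ {es a b u v} → Ad es u v → ¬ Joins a b (u , v) → Ad (delE a b es) u v
  ad-delE⁺ (inj₁ m) n = inj₁ (∈-filter⁺ _ m n)
  ad-delE⁺ (inj₂ m) n = inj₂ (∈-filter⁺ _ m (λ j → n (joins-flip j)))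

  ad-delE⁻ : ∀ {es a b u v} → Ad (delE a b es) u v → Ad es u v × ¬ Joins a b (u , v)
  ad-delE⁻ (inj₁ m) = let (p , n) = ∈-filter⁻ _ m in inj₁ p , n
  ad-delE⁻ (inj₂ m) = let (p , n) = ∈-filter⁻ _ m in inj₂ p , λ j → n (joins-flip j)

  deg-delE-≢ : ∀ es {a b v} → v ≢ a → v ≢ b → degE (delE a b es) v ≡ degE es v
  deg-delE-≢ es {a} {b} {v} na nb = sym (trans (count-split (inc? v) (joins? a b) es) (cong (λ z → length z + degE (delE a b es) v) (filter-none (inc? v) (All.map (f _) (Allₚ.all-filter (joins? a b) es)))))
    where
    f : ∀ e → Joins a b e → ¬ Inc v e
    f e (inj₁ (p , q)) (inj₁ r) = na (trans (sym r) p)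
    f e (inj₁ (p , q)) (inj₂ r) = nb (trans (sym r) q)
    f e (inj₂ (p , q)) (inj₁ r) = nb (trans (sym r) p)
    f e (inj₂ (p , q)) (inj₂ r) = na (trans (sym r) q)

  deg-delE-∈ : ∀ es {a b v} → v ≡ a ⊎ v ≡ b → degE es v ≡ multE es a b + degE (delE a b es) v
  deg-delE-∈ es {a} {b} {v} i = trans (count-split (inc? v) (joins? a b) es) (cong (λ z → length z + degE (delE a b es) v) (filter-all (inc? v) (All.map (f i) (Allₚ.all-filter (joins? a b) es))))
    where
    f : v ≡ a ⊎ v ≡ b → ∀ {e} → Joins a b e → Inc v e
    f (inj₁ refl) j = proj₁ (joins-inc j)
    f (inj₂ refl) j = proj₂ (joins-inc j)

  module CutEdge {F : Graph} {a b : ℕ} (si : Simple F) (ab : Adj F a b) where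

    private
      eq : removeEdge a b (E F) ≡ delE a b (E F)
      eq = removeEdge-delE a b (E F) (proj₂ si a b)

    cut⁻ : Adj (cutE F a b) ⊑ del (Adj F) a b
    cut⁻ r with ad-delE⁻ (subst (λ z → Ad z _ _) eq (adj→ad {removeEdge a b (E F)} r))
    ... | p , n = ad→adj {E F} p , n

    cut⁺ : del (Adj F) a b ⊑ Adj (cutE F a b)
    cut⁺ (r , n) = ad→adj {removeEdge a b (E F)} (subst (λ z → Ad z _ _) (sym eq) (ad-delE⁺ (toAd F r) n))

    cut-deg-≢ : ∀ {v} → v ≢ a → v ≢ b → deg (cutE F a b) v ≡ deg F v
    cut-deg-≢ na nb = trans (cong (λ z → degE z _) eq) (deg-delE-≢ (E F) na nb)

    cut-deg-∈ : ∀ {v} → v ≡ a ⊎ v ≡ b → deg F v ≡ suc (deg (cutE F a b) v)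
    cut-deg-∈ {v} i = trans (deg-delE-∈ (E F) i) (cong₂ _+_ (adj-mult {E F} (proj₂ si a b) (toAd F ab)) (cong (λ z → degE z v) (sym eq)))

    cut-simple : Simple (cutE F a b)
    cut-simple = (proj₁ (proj₁ si) , subst (All _) (sym eq) (Allₚ.filter⁺ (λ e → ¬? (joins? a b e)) (proj₂ (proj₁ si)))) ,
      λ c d → subst (λ z → multE z c d ≤ 1) (sym eq) (≤-trans (count-filter-≤ (joins? c d) (λ e → ¬? (joins? a b e)) (E F)) (proj₂ si c d))

  cut-pre : ∀ {X F a b} → IsF X F → Adj F a b → PreF X (cutE F a b)
  cut-pre {X} {F} {a} {b} f ab = pref C.cut-simple (forest-⊑ (λ r → kept (C.cut⁻ r)) forest) lab lf inn
    where
    open IsF f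
    module C = CutEdge {F} simple ab
    lf : ∀ {x} → x ∈ X → deg (cutE F a b) x ≤ 1
    lf {x} m with x ≟ a | x ≟ b
    ... | yes p | _ = ≤-trans (n≤1+n _) (subst (_≤ 1) (C.cut-deg-∈ (inj₁ p)) (leaf m))
    ... | no _ | yes q = ≤-trans (n≤1+n _) (subst (_≤ 1) (C.cut-deg-∈ (inj₂ q)) (leaf m))
    ... | no p | no q = subst (_≤ 1) (sym (C.cut-deg-≢ p q)) (leaf m)
    inn : ∀ {v} → v ∈ V F → v ∈ X ⊎ deg (cutE F a b) v ≡ 2 ⊎ deg (cutE F a b) v ≡ 3
    inn {v} m with inner m
    ... | inj₁ i = inj₁ i
    ... | inj₂ d with v ≟ a | v ≟ b
    ...   | yes p | _ = inj₂ (inj₁ (suc-injective (trans (sym (C.cut-deg-∈ (inj₁ p))) d)))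
    ...   | no _ | yes q = inj₂ (inj₁ (suc-injective (trans (sym (C.cut-deg-∈ (inj₂ q))) d)))
    ...   | no p | no q = inj₂ (inj₂ (trans (C.cut-deg-≢ p q) d))

  dropV : Graph → ℕ → Graph
  dropV F x = mkGraph (delV x (V F)) (delIncident x (E F))

  drop⁻ : ∀ {F x a b} → Adj (dropV F x) a b → Adj F a b × a ≢ x × b ≢ x
  drop⁻ {F} r = let (p , q) = ad-delIncident⁻ {E F} (toAd (dropV F _) r) in ad→adj {E F} p , q

  drop⁺ : ∀ {F x a b} → Adj F a b → a ≢ x → b ≢ x → Adj (dropV F x) a b
  drop⁺ {F} {x} r na nb = ad→adj {delIncident x (E F)} (ad-delIncident⁺ (toAd F r) na nb)

  drop-simple : ∀ {F x} → Simple F → Simple (dropV F x)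
  drop-simple {F} {x} si = (Uₚ.filter⁺ (λ u → ¬? (u ≟ x)) (proj₁ (proj₁ si)) , All.tabulate ends) ,
    λ a b → ≤-trans (count-filter-≤ (joins? a b) (λ e → ¬? (inc? x e)) (E F)) (proj₂ si a b)
    where
    ends : ∀ {e} → e ∈ delIncident x (E F) → proj₁ e ∈ delV x (V F) × proj₂ e ∈ delV x (V F) × proj₁ e ≢ proj₂ e
    ends m with ∈-filter⁻ (λ e → ¬? (inc? x e)) m
    ... | m' , n with All.lookup (proj₂ (proj₁ si)) m'
    ... | p , q , r = ∈-delV⁺ p (λ e → n (inj₁ e)) , ∈-delV⁺ q (λ e → n (inj₂ e)) , r

  drop-pre : ∀ {X F x} → IsF X F → x ∈ X → PreF (delV x X) (dropV F x)
  drop-pre {X} {F} {x} f xX = pref (drop-simple {F} simple) (forest-⊑ (λ r → proj₁ (drop⁻ {F} r)) forest)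
    (λ m → let (p , q) = ∈-delV⁻ m in ∈-delV⁺ (lab p) q)
    (λ m → let (p , q) = ∈-delV⁻ m in ≤-trans (subst (degE (delIncident x (E F)) _ ≤_) (sym (deg-delIncident (E F) q)) (m≤n+m _ _)) (leaf p)) inn
    where
    open IsF f
    inn : ∀ {v} → v ∈ delV x (V F) → v ∈ delV x X ⊎ deg (dropV F x) v ≡ 2 ⊎ deg (dropV F x) v ≡ 3
    inn {v} m with ∈-delV⁻ m
    ... | m' , ne with inner m'
    ...   | inj₁ i = inj₁ (∈-delV⁺ i ne)
    ...   | inj₂ d with ad? (E F) v x
    ...     | yes ad = inj₂ (inj₁ (suc-injective (trans (cong (_+ degE (delIncident x (E F)) v) (sym (adj-mult {E F} (proj₂ simple v x) ad))) (trans (sym (deg-delIncident (E F) ne)) d))))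
    ...     | no nad = inj₂ (inj₂ (trans (cong (_+ degE (delIncident x (E F)) v) (sym (¬adj-mult {E F} nad))) (trans (sym (deg-delIncident (E F) ne)) d)))

  -- A leaf x lies on no path between other vertices, so removing it changes no split of them.
  drop-eqv : ∀ {X F x} → Simple F → deg F x ≤ 1 → Eqv (On (delV x X)) (Adj F) (Adj (dropV F x))
  drop-eqv {X} {F} {x} si d = eqv
    (record { conn = λ { (on m) (on m') s → mono (λ { (r , p , q) → drop⁺ {F} r p q }) (off (nx m) (nx m') s) }
            ; match = λ {c} {e} r → mt r })
    (record { conn = λ { (on m) (on m') → mono (λ r → proj₁ (drop⁻ {F} r)) } ; match = λ {c} {e} r → inj₂ (c , e , proj₁ (drop⁻ {F} r) , λ { (on m) (on m') → let i = same c e m m' in proj₂ i , proj₁ i }) })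
    where
    nx : ∀ {y} → y ∈ delV x X → y ≢ x
    nx m = proj₂ (∈-delV⁻ {V = X} m)
    off : ∀ {y z} → y ≢ x → z ≢ x → Star (Adj F) y z → Star (λ a b → Adj F a b × a ≢ x × b ≢ x) y z
    off = avoid (adj-sym F) (deg-≤1 si d)
    same : ∀ c e {y z} → y ∈ delV x X → z ∈ delV x X → (Star (del (Adj F) c e) y z → Star (del (Adj (dropV F x)) c e) y z) × (Star (del (Adj (dropV F x)) c e) y z → Star (del (Adj F) c e) y z)
    same c e m m' = (λ s → mono (λ { ((r , n) , p , q) → drop⁺ {F} r p q , n }) (avoid (del-sym c e (adj-sym F)) (λ p q → deg-≤1 si d (kept p) (kept q)) (nx m) (nx m') s)) , mono (del-mono (λ r → proj₁ (drop⁻ {F} r)))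
    mt : ∀ {c e} → Adj F c e → NoSplit (On (delV x X)) (Adj F) c e ⊎ (Σ ℕ λ c' → Σ ℕ λ e' → Adj (dropV F x) c' e' × SameSplit (On (delV x X)) (Adj F) c e (Adj (dropV F x)) c' e')
    mt {c} {e} r with c ≟ x | e ≟ x
    ... | yes refl | _ = inj₁ λ { (on m) (on m') s → mono (λ { (r , p , q) → r , λ { (inj₁ (h , _)) → p h ; (inj₂ (_ , h)) → q h } }) (off (nx m) (nx m') s) }
    ... | no _ | yes refl = inj₁ λ { (on m) (on m') s → mono (λ { (r , p , q) → r , λ { (inj₁ (_ , h)) → q h ; (inj₂ (h , _)) → p h } }) (off (nx m) (nx m') s) }
    ... | no p | no q = inj₂ (c , e , drop⁺ {F} r p q , λ { (on m) (on m') → same c e m m' })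

  isofix-eqv : ∀ {X G H} → WF G → WF H → IsoFix X G H → Eqv (On X) (Adj G) (Adj H)
  isofix-eqv {X} {G} {H} wg wh (f , g , fV , gV , gf , fg , mu , fx) = eqv-restrict lb (eqv
    (record { conn = λ { (refl , m) (refl , m') → Star.gmap f fwdA } ; match = λ {c} {d} e → let (cV , dV , _) = adj-∈ {G} wg e in inj₂ (f c , f d , fwdA e , λ { (refl , m) (refl , m') → same cV dV m m' }) })
    (record { conn = λ { (refl , m) (refl , m') s → back m m' (Star.gmap g bwdA s) } ; match = λ {c} {d} e → let (cV , dV , _) = adj-∈ {H} wh e in inj₂ (g c , g d , bwdA e , λ { (refl , m) (refl , m') → sameB cV dV m m' }) }))
    where
    P : Gr
    P x y = y ≡ f x × x ∈ V G
    lb : On X ⊑ P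
    lb (on m) = sym (proj₂ (fx _ m)) , proj₁ (fx _ m)
    fwdA : ∀ {a b} → Adj G a b → Adj H (f a) (f b)
    fwdA {a} {b} r = let (p , q , _) = adj-∈ {G} wg r in subst (0 <_) (sym (mu a b p q)) r
    bwdA : ∀ {a b} → Adj H a b → Adj G (g a) (g b)
    bwdA {a} {b} r = let (p , q , _) = adj-∈ {H} wh r in subst (0 <_) (trans (cong₂ (mult H) (sym (fg a p)) (sym (fg b q))) (mu (g a) (g b) (gV a p) (gV b q))) r
    back : ∀ {T x y} → x ∈ V G → y ∈ V G → Star T (g (f x)) (g (f y)) → Star T x y
    back {T} {x} {y} m m' s = subst (λ z → Star T z y) (gf x m) (subst (Star T (g (f x))) (gf y m') s)
    injf : ∀ {a b} → a ∈ V G → b ∈ V G → f a ≡ f b → a ≡ b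
    injf m m' e = trans (sym (gf _ m)) (trans (cong g e) (gf _ m'))
    injg : ∀ {a b} → a ∈ V H → b ∈ V H → g a ≡ g b → a ≡ b
    injg m m' e = trans (sym (fg _ m)) (trans (cong f e) (fg _ m'))
    fd : ∀ {c d} → c ∈ V G → d ∈ V G → ∀ {a b} → del (Adj G) c d a b → del (Adj H) (f c) (f d) (f a) (f b)
    fd cV dV (r , n) = let (p , q , _) = adj-∈ {G} wg r in fwdA r , λ { (inj₁ (h , k)) → n (inj₁ (injf p cV h , injf q dV k)) ; (inj₂ (h , k)) → n (inj₂ (injf p dV h , injf q cV k)) }
    gd : ∀ {c d} → c ∈ V H → d ∈ V H → ∀ {a b} → del (Adj H) c d a b → del (Adj G) (g c) (g d) (g a) (g b)
    gd cV dV (r , n) = let (p , q , _) = adj-∈ {H} wh r in bwdA r , λ { (inj₁ (h , k)) → n (inj₁ (injg p cV h , injg q dV k)) ; (inj₂ (h , k)) → n (inj₂ (injg p dV h , injg q cV k)) }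
    same : ∀ {c d x y} → c ∈ V G → d ∈ V G → x ∈ V G → y ∈ V G → (Star (del (Adj G) c d) x y → Star (del (Adj H) (f c) (f d)) (f x) (f y)) × (Star (del (Adj H) (f c) (f d)) (f x) (f y) → Star (del (Adj G) c d) x y)
    same {c} {d} cV dV m m' = Star.gmap f (fd cV dV) , λ s → back m m' (mono (subst (λ z → del (Adj G) (g (f c)) z ⊑ del (Adj G) c d) (sym (gf d dV)) (subst (λ z → del (Adj G) z d ⊑ del (Adj G) c d) (sym (gf c cV)) (λ r → r))) (Star.gmap g (gd (fV c cV) (fV d dV)) s))
    sameB : ∀ {c d x y} → c ∈ V H → d ∈ V H → x ∈ V G → y ∈ V G → (Star (del (Adj H) c d) (f x) (f y) → Star (del (Adj G) (g c) (g d)) x y) × (Star (del (Adj G) (g c) (g d)) x y → Star (del (Adj H) c d) (f x) (f y))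
    sameB {c} {d} cV dV m m' = (λ s → back m m' (Star.gmap g (gd cV dV) s)) , λ s → mono (subst (λ z → del (Adj H) (f (g c)) z ⊑ del (Adj H) c d) (sym (fg d dV)) (subst (λ z → del (Adj H) z d ⊑ del (Adj H) c d) (sym (fg c cV)) (λ r → r))) (Star.gmap f (fd (gV c cV) (gV d dV)) s)

open Suppression

module TreeStructure where

  record Tri (F : Graph) (v a b c : ℕ) : Set where
    constructor tri
    field
      va : Adj F v a
      vb : Adj F v b
      vc : Adj F v c
      a≢b : a ≢ b
      a≢c : a ≢ c
      b≢c : b ≢ c
      only3 : ∀ {n} → Adj F v n → n ≡ a ⊎ n ≡ b ⊎ n ≡ c
  open Tri public

  tri-swap : ∀ {F v a b c} → Tri F v a b c → Tri F v a c b
  tri-swap (tri p q r x y z o) = tri p r q y x (λ e → z (sym e)) (λ a → f (o a))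
    where
    f : ∀ {A B C : Set} → A ⊎ B ⊎ C → A ⊎ C ⊎ B
    f (inj₁ x) = inj₁ x
    f (inj₂ (inj₁ x)) = inj₂ (inj₂ x)
    f (inj₂ (inj₂ x)) = inj₂ (inj₁ x)

  tri-rot : ∀ {F v a b c} → Tri F v a b c → Tri F v b a c
  tri-rot (tri p q r x y z o) = tri q p r (λ e → x (sym e)) z y (λ a → f (o a))
    where
    f : ∀ {A B C : Set} → A ⊎ B ⊎ C → B ⊎ A ⊎ C
    f (inj₁ x) = inj₂ (inj₁ x)
    f (inj₂ (inj₁ x)) = inj₁ x
    f (inj₂ (inj₂ x)) = inj₂ (inj₂ x)

  module OnF {X : List ℕ} {F : Graph} (f : IsF X F) where
    open IsF f public

    private
      R : Gr
      R = Adj F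

    lF : Listed R
    lF = adj-listed F

    sF : Symm R
    sF = adj-sym F

    wfF : WF F
    wfF = proj₁ simple

    nbr1 : ∀ {x n m} → x ∈ X → R x n → R x m → n ≡ m
    nbr1 {x} i = deg-≤1 simple {x} (leaf i)

    deg3-of : ∀ {v b} → v ∉ X → R v b → deg F v ≡ 3
    deg3-of n r = [ (λ i → ⊥-elim (n i)) , (λ d → d) ] (inner (proj₁ (adj-∈ {F} wfF r)))

    tri-at : ∀ {v b} → v ∉ X → R v b → Σ ℕ λ c → Σ ℕ λ d → Tri F v b c d
    tri-at {v} {b} n vb with deg-3 simple {v} (deg3-of n vb)
    ... | p , q , r , vp , vq , vr , pq , pr , qr , o with o vb
    ...   | inj₁ refl = q , r , tri vp vq vr pq pr qr o
    ...   | inj₂ (inj₁ refl) = p , r , tri-rot {F} (tri vp vq vr pq pr qr o)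
    ...   | inj₂ (inj₂ refl) = p , q , tri-rot {F} (tri-swap {F} (tri vp vq vr pq pr qr o))

    tri-∉ : ∀ {v a b c} → Tri F v a b c → v ∉ X
    tri-∉ t i = a≢b t (nbr1 i (va t) (vb t))

    beyond : ∀ a b → R a b → Σ ℕ λ v → v ∈ X × Star (del R a b) a v
    beyond = label-beyond {R} {λ v → v ∈ X} lF forest next
      where
      next : ∀ a b → R a b → a ∈ X ⊎ Σ ℕ λ c → R a c × c ≢ b
      next a b r with a ∈? X
      ... | yes i = inj₁ i
      ... | no n with tri-at n r
      ... | c , _ , t = inj₂ (c , vb t , λ e → a≢b t (sym e))

    tri-side : ∀ {v b c d n} → Tri F v b c d → Star (del R v b) v n → n ≢ v → Star (del R c v) c n ⊎ Star (del R d v) d n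
    tri-side {v} {b} {c} {d} t s ne with toward (star-sym (del-sym v b sF) s) ne
    ... | m , (mv , k) , s' with only3 t (sF mv)
    ...   | inj₁ refl = ⊥-elim (k (inj₂ (refl , refl)))
    ...   | inj₂ (inj₁ refl) = inj₁ (mono (λ r → del-comm (del-mono kept r)) (star-sym (del-sym v m (del-sym v b sF)) s'))
    ...   | inj₂ (inj₂ refl) = inj₂ (mono (λ r → del-comm (del-mono kept r)) (star-sym (del-sym v m (del-sym v b sF)) s'))

    leaf-side : ∀ {c v n} → c ∈ X → R c v → Star (del R c v) c n → c ≡ n
    leaf-side i cv = isolated-≡ λ { m (r , k) → k (inj₁ (refl , nbr1 i r cv)) }

    extend : ∀ {a b c u} → R a c → c ≢ b → Star (del R c a) c u → Star (del R a b) a u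
    extend = side-extend sF forest

    record Deep (a b : ℕ) : Set where
      field
        v v' u x y t : ℕ
        tv : Tri F v v' u t
        tu : Tri F u v x y
        xX : x ∈ X
        yX : y ∈ X
        tail : t ∈ X ⊎ (Σ ℕ λ p → Σ ℕ λ q → Tri F t v p q × p ∈ X × q ∈ X)
        within : ∀ {n} → Star (del R v v') v n → Star (del R a b) a n
        top : (v ≡ a × v' ≡ b) ⊎ (Σ ℕ λ w → w ∈ X × Star (del R a b) a w × ¬ Star (del R v v') v w)

    data Class (a b : ℕ) : Set where
      leafC : a ∈ X → Class a b
      cherryC : ∀ x y → Tri F a b x y → x ∈ X → y ∈ X → Class a b
      deepC : Deep a b → Class a b

    deep-up : ∀ {a b c d} → Tri F a b c d → Deep c a → Deep a b
    deep-up {a} {b} {c} {d} t D = record { Deep D ; within = λ s → extend (vb t) (λ e → a≢b t (sym e)) (Deep.within D s) ; top = inj₂ (tp (Deep.top D)) }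
      where
      tp : (Deep.v D ≡ c × Deep.v' D ≡ a) ⊎ (Σ ℕ λ w → w ∈ X × Star (del R c a) c w × ¬ Star (del R (Deep.v D) (Deep.v' D)) (Deep.v D) w) →
        Σ ℕ λ w → w ∈ X × Star (del R a b) a w × ¬ Star (del R (Deep.v D) (Deep.v' D)) (Deep.v D) w
      tp (inj₂ (w , wX , s , n)) = w , wX , extend (vb t) (λ e → a≢b t (sym e)) s , n
      tp (inj₁ (refl , refl)) with beyond d a (sF (vc t))
      ... | w , wX , s = w , wX , extend (vc t) (λ e → a≢c t (sym e)) s ,
            λ s' → forest (sF (vb t)) (s' ◅◅ star-sym (del-sym c a sF) (mono del-comm (extend (vc t) (λ e → b≢c t (sym e)) s)))

    classify : ∀ a b → R a b → Class a b
    classify = side-induction lF forest Class stp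
      where
      deep1 : ∀ {a b c d} → Tri F a b c d → Σ ℕ (λ x → Σ ℕ λ y → Tri F c a x y × x ∈ X × y ∈ X) →
        (d ∈ X ⊎ (Σ ℕ λ p → Σ ℕ λ q → Tri F d a p q × p ∈ X × q ∈ X)) → Deep a b
      deep1 t (x , y , tc , xX , yX) tl = record { tv = t ; tu = tc ; xX = xX ; yX = yX ; tail = tl ; within = λ s → s ; top = inj₁ (refl , refl) }
      combine : ∀ {a b c d} → Tri F a b c d → Class c a → Class d a → Class a b
      combine t (deepC D) _ = deepC (deep-up t D)
      combine {a} {b} t _ (deepC D) = deepC (deep-up (tri-swap {F} t) D)
      combine t (leafC i) (leafC j) = cherryC _ _ t i j
      combine t (cherryC x y tc i j) (leafC k) = deepC (deep1 t (x , y , tc , i , j) (inj₁ k))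
      combine t (leafC k) (cherryC x y tc i j) = deepC (deep1 (tri-swap {F} t) (x , y , tc , i , j) (inj₁ k))
      combine t (cherryC x y tc i j) (cherryC p q td k l) = deepC (deep1 t (x , y , tc , i , j) (inj₂ (p , q , td , k , l)))
      stp : ∀ a b → R a b → (∀ c → R a c → c ≢ b → Class c a) → Class a b
      stp a b r rec with a ∈? X
      ... | yes i = leafC i
      ... | no n with tri-at n r
      ... | c , d , t = combine t (rec c (vb t) (λ e → a≢b t (sym e))) (rec d (vc t) (λ e → a≢c t (sym e)))

  count-within : ∀ {A : Set} {P Q : A → Set} (P? : ∀ x → Dec (P x)) (Q? : ∀ x → Dec (Q x)) xs →
    (∀ {x} → x ∈ xs → P x → Q x) → length (filter P? (filter Q? xs)) ≡ length (filter P? xs)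
  count-within {P = P} {Q} P? Q? xs h = sym (trans (count-split P? Q? xs)
    (trans (cong (λ z → length (filter P? (filter Q? xs)) + length z) (filter-none P? (All.tabulate none))) (+-identityʳ _)))
    where
    none : ∀ {x} → x ∈ filter (λ x → ¬? (Q? x)) xs → ¬ P x
    none m p = let (m' , nq) = ∈-filter⁻ (λ x → ¬? (Q? x)) m in nq (h m' p)

  module Pendant {X : List ℕ} {F : Graph} (f : IsF X F) {a b : ℕ} (ab : Adj F a b) (L : List ℕ)
    (L⊆ : ∀ {n} → n ∈ L → n ∈ X × Star (del (Adj F) a b) a n) (⊆L : ∀ {n} → n ∈ X → Star (del (Adj F) a b) a n → n ∈ L) where

    open OnF f
    private
      module Cu = CutEdge {F} simple ab
      H : Graph
      H = cutE F a b
      r? : ∀ n → Dec (Reach H a n)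
      r? n = conn? (adj-listed H) a n
      q? : (e : ℕ × ℕ) → Dec (Reach H a (proj₁ e))
      q? e = r? (proj₁ e)
      C : Graph
      C = mkGraph (filter r? (V F)) (filter q? (E H))
      hp : PreF X H
      hp = cut-pre f ab

      adC⁻ : ∀ {u v} → Ad (E C) u v → Ad (E H) u v × Reach H a u × Reach H a v
      adC⁻ (inj₁ m) = let (p , q) = ∈-filter⁻ q? m in inj₁ p , q , q ◅◅ one (fromAd H (inj₁ p))
      adC⁻ (inj₂ m) = let (p , q) = ∈-filter⁻ q? m in inj₂ p , q ◅◅ one (fromAd H (inj₁ p)) , q

      adC⁺ : ∀ {u v} → Ad (E H) u v → Reach H a u → Ad (E C) u v
      adC⁺ (inj₁ m) s = inj₁ (∈-filter⁺ q? m s)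
      adC⁺ (inj₂ m) s = inj₂ (∈-filter⁺ q? m (s ◅◅ one (fromAd H (inj₂ m))))

      degC : ∀ {v} → Reach H a v → deg C v ≡ deg H v
      degC {v} s = count-within (inc? v) q? (E H) λ { m (inj₁ refl) → s ; m (inj₂ refl) → s ◅◅ one (fromAd H (inj₂ m)) }

      wfC : WF C
      wfC = Uₚ.filter⁺ r? (proj₁ wfF) , All.tabulate λ m → let (m' , s) = ∈-filter⁻ q? m ; (p , q , ne) = All.lookup (proj₂ (proj₁ (PreF.simple hp))) m' in
              ∈-filter⁺ r? p s , ∈-filter⁺ r? q (s ◅◅ one (fromAd H (inj₁ m'))) , ne

      compC : ComponentOf H a C
      compC = wfC , (λ v m → ∈-filter⁻ r? m) , (λ v m s → ∈-filter⁺ r? m s) ,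
        (λ u v s → count-within (joins? u v) q? (E H) λ { m (inj₁ (refl , refl)) → s ; m (inj₂ (refl , refl)) → s ◅◅ one (fromAd H (inj₂ m)) }) ,
        (λ u v n → ¬adj-mult {E C} λ ad → n (proj₁ (proj₂ (adC⁻ ad))))

      up : ∀ {n} → Star (del (Adj F) a b) a n → Reach H a n
      up = mono Cu.cut⁺

      preC : PreF L C
      preC = pref (wfC , λ u v → ≤-trans (count-filter-≤ (joins? u v) q? (E H)) (proj₂ (PreF.simple hp) u v))
        (forest-⊑ (λ {u} {v} r → fromAd H {u} {v} (proj₁ (adC⁻ (toAd C {u} {v} r)))) (PreF.forest hp))
        (λ m → let (i , s) = L⊆ m in ∈-filter⁺ r? (lab i) (up s))
        (λ m → let (i , s) = L⊆ m in subst (_≤ 1) (sym (degC (up s))) (PreF.leaf hp i))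
        (λ m → let (i , s) = ∈-filter⁻ r? m in [ (λ j → inj₁ (⊆L j (mono Cu.cut⁻ s))) , (λ d → inj₂ (subst (λ k → k ≡ 2 ⊎ k ≡ 3) (sym (degC s)) d)) ] (PreF.inner hp i))

      S-all : SuppressAll C (suppress C)
      S-all = suppress-all preC

    S : Graph
    S = suppress C

    pendant : PendantSide F a b S
    pendant = ab , (λ s → forest ab (mono Cu.cut⁻ s)) , C , compC , S-all

    S-isF : IsF L S
    S-isF = suppress-isF preC S-all

    leafset : LeafSetIs S L
    leafset = (λ { v (m , d) → [ (λ i → i) , (λ e → case subst (_≤ 1) e d of λ { (s≤s ()) }) ] (IsF.inner S-isF m) }) , (λ v i → IsF.lab S-isF i , IsF.leaf S-isF i)

    S-adj : ∀ {x u} → x ∈ L → u ≢ a → u ≢ b → deg F u ≡ 3 → Adj F x u → Star (del (Adj F) a b) a u → Adj S x u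
    S-adj {x} {u} i na nb d xu s = Suppressed.adjs (suppress-star preC (proj₁ S-all)) {x} {u}
      (fromAd C {x} {u} (adC⁺ (toAd H {x} {u} (Cu.cut⁺ (xu , k))) (up (proj₂ (L⊆ i)))))
      (λ e → case subst (_≤ 1) e (PreF.leaf preC i) of λ { (s≤s ()) })
      (λ e → case trans (sym (trans (degC (up s)) (trans (Cu.cut-deg-≢ na nb) d))) e of λ ())
      where
      k : ¬ Joins a b (x , u)
      k (inj₁ (_ , e)) = nb e
      k (inj₂ (_ , e)) = na e

    S-cherry : ∀ {x y u} → x ≢ y → x ∈ L → y ∈ L → u ≢ a → u ≢ b → deg F u ≡ 3 → Adj F x u → Adj F y u → Star (del (Adj F) a b) a u → Cherry S x y
    S-cherry {x} {y} {u} ne i j na nb d xu yu s = ne , proj₂ leafset x i , proj₂ leafset y j , inj₂ (u , S-adj i na nb d xu s , S-adj j na nb d yu s)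

  record PendantTree (F : Graph) (a b : ℕ) (L : List ℕ) : Set where
    field
      tree : Graph
      is-pendant : PendantSide F a b tree
      leaves : LeafSetIs tree L
      cherries : ∀ {x y u} → x ≢ y → x ∈ L → y ∈ L → u ≢ a → u ≢ b → deg F u ≡ 3 → Adj F x u → Adj F y u → Star (del (Adj F) a b) a u → Cherry tree x y

  abstract
    pendant-tree : ∀ {X F} → IsF X F → ∀ {a b} → Adj F a b → ∀ L →
      (∀ {n} → n ∈ L → n ∈ X × Star (del (Adj F) a b) a n) → (∀ {n} → n ∈ X → Star (del (Adj F) a b) a n → n ∈ L) → PendantTree F a b L
    pendant-tree f ab L p q = record { tree = P.S ; is-pendant = P.pendant ; leaves = P.leafset ; cherries = P.S-cherry }
      where module P = Pendant f ab L p q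

  private
    hd : List ℕ → ℕ → ℕ
    hd [] u = u
    hd (a ∷ _) u = a

    lst : ℕ → List ℕ → ℕ
    lst v [] = v
    lst v (a ∷ as) = lst a as

    pre-walk : ∀ {R : Gr} {u v} pre {rest} → Linked R (pre ++ u ∷ rest) → All (λ a → a ≢ u × a ≢ v) pre → Star (del R u v) (hd pre u) u
    pre-walk [] l _ = ε
    pre-walk (a ∷ []) (r ∷ l) ((p , q) ∷ _) = one (r , λ { (inj₁ (e , _)) → p e ; (inj₂ (e , _)) → q e })
    pre-walk (a ∷ b ∷ pre) (r ∷ l) ((p , q) ∷ al) = (r , λ { (inj₁ (e , _)) → p e ; (inj₂ (e , _)) → q e }) ◅ pre-walk (b ∷ pre) l al

    suf-walk : ∀ {R : Gr} {u v w} suf → Linked R (w ∷ suf) → All (λ a → a ≢ u × a ≢ v) suf → Star (del R u v) w (lst w suf)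
    suf-walk [] l _ = ε
    suf-walk (a ∷ suf) (r ∷ l) ((p , q) ∷ al) = (r , λ { (inj₁ (_ , e)) → q e ; (inj₂ (_ , e)) → p e }) ◅ suf-walk suf l al

    lst-snoc : ∀ w mid y → lst w (mid ++ y ∷ []) ≡ y
    lst-snoc w [] y = refl
    lst-snoc w (m ∷ mid) y = lst-snoc m mid y

    lst-mid : ∀ w pre u v suf → lst w (pre ++ u ∷ v ∷ suf) ≡ lst v suf
    lst-mid w [] u v suf = refl
    lst-mid w (p ∷ pre) u v suf = lst-mid p pre u v suf

    unique-pre : ∀ (pre : List ℕ) {u v : ℕ} {suf : List ℕ} → Unique (pre ++ u ∷ v ∷ suf) → All (λ a → a ≢ u × a ≢ v) pre × All (λ a → a ≢ u × a ≢ v) suf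
    unique-pre [] ((_ ∷ p) ∷ q ∷ _) = [] , All.zipWith (λ { (a , b) → (λ e → a (sym e)) , (λ e → b (sym e)) }) (p , q)
    unique-pre (a ∷ pre) {u} {v} {suf} (p ∷ ps) = let (h , k) = unique-pre pre ps in
      (All.lookup p (∈-++⁺ʳ pre (here refl)) , All.lookup p (∈-++⁺ʳ pre (there (here refl)))) ∷ h , k

    linked-drop : ∀ {R : Gr} pre {u v suf} → Linked R (pre ++ u ∷ v ∷ suf) → Linked R (v ∷ suf)
    linked-drop [] (_ ∷ l) = l
    linked-drop (a ∷ []) (_ ∷ l) = linked-drop [] l
    linked-drop (a ∷ b ∷ pre) (_ ∷ l) = linked-drop (b ∷ pre) l

    path-cross : ∀ {R : Gr} {x y u v : ℕ} {mid : List ℕ} (pre : List ℕ) {suf : List ℕ} → Unique (x ∷ mid ++ y ∷ []) → Linked R (x ∷ mid ++ y ∷ []) →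
      x ∷ mid ++ y ∷ [] ≡ pre ++ u ∷ v ∷ suf → Star (del R u v) x u × Star (del R u v) v y
    path-cross {R} {x} {y} {u} {v} {mid} pre {suf} un l eq with unique-pre pre {u} {v} {suf} (subst Unique eq un)
    ... | ap , as = subst (λ z → Star (del R u v) z u) (h pre eq) (pre-walk pre (subst (Linked R) eq l) ap) ,
                    subst (Star (del R u v) v) (last pre eq) (suf-walk suf (linked-drop pre (subst (Linked R) eq l)) as)
      where
      h : ∀ pre → x ∷ mid ++ y ∷ [] ≡ pre ++ u ∷ v ∷ suf → hd pre u ≡ x
      h [] e = sym (∷-injectiveˡ e)
      h (_ ∷ _) e = sym (∷-injectiveˡ e)
      last : ∀ pre → x ∷ mid ++ y ∷ [] ≡ pre ++ u ∷ v ∷ suf → lst v suf ≡ y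
      last pre e = trans (sym (lst-mid x pre u v suf)) (trans (cong (lst x) (sym e)) (lst-snoc x (x ∷ mid) y))

  not-on-path : ∀ {F x y u v} → Forest (Adj F) → Adj F u v → Star (del (Adj F) u v) x y → ¬ EdgeOnPath F x y u v
  not-on-path {F} {x} {y} {u} {v} fo uv s (mid , (un , l) , pre , suf , inj₁ eq) =
    let (p , q) = path-cross pre un l eq in fo uv (star-sym (del-sym u v (adj-sym F)) p ◅◅ s ◅◅ star-sym (del-sym u v (adj-sym F)) q)
  not-on-path {F} {x} {y} {u} {v} fo uv s (mid , (un , l) , pre , suf , inj₂ eq) =
    let (p , q) = path-cross pre un l eq in fo (adj-sym F uv) (star-sym (del-sym v u (adj-sym F)) p ◅◅ mono del-comm s ◅◅ star-sym (del-sym v u (adj-sym F)) q)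

open TreeStructure

module SharedNetworks where

  length-delV : ∀ {x} xs → Unique xs → x ∈ xs → length xs ≡ suc (length (delV x xs))
  length-delV {x} (y ∷ xs) (ny ∷ u) (here refl) = cong suc (sym (trans (cong length (filter-reject (λ z → ¬? (z ≟ x)) {xs = xs} (λ n → n refl))) (cong length (filter-all (λ z → ¬? (z ≟ x)) (All.map (λ n e → n (sym e)) ny)))))
  length-delV {x} (y ∷ xs) (ny ∷ u) (there m) = cong suc (trans (length-delV xs u m) (sym (cong length (filter-accept (λ z → ¬? (z ≟ x)) {xs = xs} (All.lookup ny m)))))

  independent : ∀ es vs → Unique vs → Σ (List ℕ) λ ws → Unique ws × (∀ {a} → a ∈ ws → a ∈ vs) ×
    (∀ {a b} → a ∈ ws → b ∈ ws → Star (Ad es) a b → a ≡ b) × length vs ≤ length ws + length es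
  independent [] vs u = vs , u , (λ m → m) , (λ _ _ → star[]-≡) , ≤-reflexive (sym (+-identityʳ _))
  independent ((c , d) ∷ es) vs u with independent es vs u
  ... | ws , uw , sub , ind , le = body
    where
    f : ∀ {u v} → Ad ((c , d) ∷ es) u v → Ad es u v ⊎ (ℕ × Joins c d (u , v))
    f (inj₁ (here refl)) = inj₂ (0 , inj₁ (refl , refl))
    f (inj₁ (there x)) = inj₁ (inj₁ x)
    f (inj₂ (here refl)) = inj₂ (0 , inj₂ (refl , refl))
    f (inj₂ (there x)) = inj₁ (inj₂ x)
    sy : Symm (Ad es)
    sy = swap
    body : Σ (List ℕ) λ ws → Unique ws × (∀ {a} → a ∈ ws → a ∈ vs) ×
      (∀ {a b} → a ∈ ws → b ∈ ws → Star (Ad ((c , d) ∷ es)) a b → a ≡ b) × length vs ≤ length ws + suc (length es)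
    body with any? (λ a → conn-list? es a c) ws
    ... | no n = ws , uw , sub , i , ≤-trans le (+-monoʳ-≤ (length ws) (n≤1+n _))
      where
      i : ∀ {a b} → a ∈ ws → b ∈ ws → Star (Ad ((c , d) ∷ es)) a b → a ≡ b
      i ma mb s with across c d f s
      ... | inj₁ t = ind ma mb t
      ... | inj₂ (_ , inj₁ (t , _)) = ⊥-elim (n (lose ma t))
      ... | inj₂ (_ , inj₂ (_ , t)) = ⊥-elim (n (lose mb (star-sym sy t)))
    ... | yes p with find p
    ...   | a₀ , m₀ , s₀ = delV a₀ ws , Uₚ.filter⁺ (λ z → ¬? (z ≟ a₀)) uw , (λ m → sub (proj₁ (∈-delV⁻ m))) , i ,
              subst (length vs ≤_) (trans (cong (_+ length es) (length-delV ws uw m₀)) (sym (+-suc _ _))) le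
      where
      i : ∀ {a b} → a ∈ delV a₀ ws → b ∈ delV a₀ ws → Star (Ad ((c , d) ∷ es)) a b → a ≡ b
      i ma mb s with ∈-delV⁻ {V = ws} ma | ∈-delV⁻ {V = ws} mb | across c d f s
      ... | ma' , na | mb' , nb | inj₁ t = ind ma' mb' t
      ... | ma' , na | mb' , nb | inj₂ (_ , inj₁ (t , _)) = ⊥-elim (na (ind ma' m₀ (t ◅◅ star-sym sy s₀)))
      ... | ma' , na | mb' , nb | inj₂ (_ , inj₂ (_ , t)) = ⊥-elim (nb (ind mb' m₀ (star-sym sy t ◅◅ star-sym sy s₀)))

  connected-size : ∀ es vs → Unique vs → (∀ {a b} → a ∈ vs → b ∈ vs → Star (Ad es) a b) → length vs ≤ 1 + length es
  connected-size es vs u con with independent es vs u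
  ... | [] , _ , _ , _ , le = m≤n⇒m≤1+n le
  ... | _ ∷ [] , _ , _ , _ , le = le
  ... | a ∷ b ∷ ws , (n ∷ _) ∷ _ , sub , ind , le = ⊥-elim (n (ind (here refl) (there (here refl)) (con (sub (here refl)) (sub (there (here refl))))))

  -- A connected graph N = (vs, EN) with |EN| + 1 - |vs| ≤ n containing copies S, S' of F, F'.
  record St (X : List ℕ) (F F' : Graph) (n : ℕ) : Set where
    field
      EN ES ES' : Edges
      vs : List ℕ
      vsU : Unique vs
      ends : ∀ {a b} → Ad EN a b → a ∈ vs
      con : ∀ {a b} → a ∈ vs → b ∈ vs → Star (Ad EN) a b
      cnt : length EN + 1 ≤ n + length vs
      S⊆ : Ad ES ⊑ Ad EN
      S'⊆ : Ad ES' ⊑ Ad EN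
      foS : Forest (Ad ES)
      foS' : Forest (Ad ES')
      X⊆ : ∀ {x} → x ∈ X → x ∈ vs
      eS : Eqv (On X) (Adj F) (Ad ES)
      eS' : Eqv (On X) (Adj F') (Ad ES')

    I : Gr
    I = Ad ES ∩ Ad ES'

    iL : Listed I
    iL = listed-filter (listed-Ad ES) (ad? ES') swap

    foI : Forest I
    foI = forest-⊑ inl foS

  st-swap : ∀ {X F F' n} → St X F F' n → St X F' F n
  st-swap s = record { EN = EN ; ES = ES' ; ES' = ES ; vs = vs ; vsU = vsU ; ends = ends ; con = con ; cnt = cnt ; S⊆ = S'⊆ ; S'⊆ = S⊆ ; foS = foS' ; foS' = foS ; X⊆ = X⊆ ; eS = eS' ; eS' = eS }
    where open St s

  Tight : ∀ {X F F' n} → St X F F' n → Set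
  Tight {X} s = ∀ {c d} → I c d → Σ ℕ λ p → Σ ℕ λ r → p ∈ X × r ∈ X × Star I p r × ¬ Star (del I c d) p r
    where open St s

  tight-swap : ∀ {X F F' n} {s : St X F F' n} → Tight s → Tight (st-swap s)
  tight-swap t (p , q) with t (q , p)
  ... | a , b , aX , bX , s , n = a , b , aX , bX , mono (λ { (x , y) → y , x }) s , λ s' → n (mono (del-mono (λ { (x , y) → y , x })) s')

  above : ∀ vs → Σ ℕ λ t → t ∉ vs
  above vs = suc (foldr _⊔_ 0 vs) , λ m → 1+n≰n (bound vs m)
    where
    bound : ∀ vs {x} → x ∈ vs → x ≤ foldr _⊔_ 0 vs
    bound (y ∷ vs) (here refl) = m≤m⊔n y _
    bound (y ∷ vs) (there m) = ≤-trans (bound vs m) (m≤n⊔m y _)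

  count-< : ∀ {A : Set} {P Q : A → Set} (P? : ∀ x → Dec (P x)) (Q? : ∀ x → Dec (Q x)) xs → (∀ {x} → x ∈ xs → P x → Q x) →
    ∀ {x} → x ∈ xs → Q x → ¬ P x → length (filter P? xs) < length (filter Q? xs)
  count-< P? Q? xs h m q np = subst (_< length (filter Q? xs)) (count-within P? Q? xs h)
    (filter-notAll P? (filter Q? xs) (Any.map (λ { refl → np }) (∈-filter⁺ Q? m q)))

  -- An edge {s,t} of I whose end t ∉ X meets no other edge of I need not be shared:
  -- S' is rerouted through a fresh copy t* of t, joined to s, which adds one vertex and one edge to N.
  module Reroute {X F F' n} (st : St X F F' n) {s t : ℕ} (sst : St.I st s t) (t∉ : t ∉ X) (only-s : ∀ {s'} → St.I st s' t → s' ≡ s) where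

    open St st

    private
      t* : ℕ
      t* = proj₁ (above vs)
      t*∉ : t* ∉ vs
      t*∉ = proj₂ (above vs)

      s∈ : s ∈ vs
      s∈ = ends (S⊆ (inl sst))
      t∈ : t ∈ vs
      t∈ = ends (S⊆ (swap (inl sst)))
      s≢t : s ≢ t
      s≢t = forest-≢ foS (inl sst)

      sw : ℕ → ℕ
      sw a with a ≟ t | a ≟ t*
      ... | yes _ | _ = t*
      ... | no _ | yes _ = t
      ... | no _ | no _ = a

      sw-t : sw t ≡ t*
      sw-t with t ≟ t | t ≟ t*
      ... | yes _ | _ = refl
      ... | no n | _ = ⊥-elim (n refl)

      sw-t* : sw t* ≡ t
      sw-t* with t* ≟ t | t* ≟ t*
      ... | yes e | _ = e
      ... | no _ | yes _ = refl
      ... | no _ | no n = ⊥-elim (n refl)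

      sw-id : ∀ {a} → a ≢ t → a ≢ t* → sw a ≡ a
      sw-id {a} n m with a ≟ t | a ≟ t*
      ... | yes e | _ = ⊥-elim (n e)
      ... | no _ | yes e = ⊥-elim (m e)
      ... | no _ | no _ = refl

      vs≢ : ∀ {a} → a ∈ vs → a ≢ t*
      vs≢ m refl = t*∉ m

      sw-sw : ∀ a → sw (sw a) ≡ a
      sw-sw a with a ≟ t | a ≟ t*
      ... | yes refl | _ = sw-t*
      ... | no _ | yes refl = sw-t
      ... | no n | no m = sw-id n m

      swe : ℕ × ℕ → ℕ × ℕ
      swe (a , b) = sw a , sw b

      Moved : ℕ × ℕ → Set
      Moved (a , b) = Ad ES' a b × ¬ Ad ES a b
      moved? : ∀ e → Dec (Moved e)
      moved? (a , b) = ad? ES' a b ×-dec ¬? (ad? ES a b)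

      ren : ℕ × ℕ → ℕ × ℕ
      ren e with moved? e
      ... | yes _ = swe e
      ... | no _ = e

      ren-yes : ∀ {e} → Moved e → ren e ≡ swe e
      ren-yes {e} m with moved? e
      ... | yes _ = refl
      ... | no n = ⊥-elim (n m)

      ren-no : ∀ {e} → ¬ Moved e → ren e ≡ e
      ren-no {e} m with moved? e
      ... | yes p = ⊥-elim (m p)
      ... | no n = refl

    ES'* : Edges
    ES'* = map swe ES'

    private
      EN* : Edges
      EN* = (s , t*) ∷ map ren EN

      ad*⁻ : ∀ {a b} → Ad ES'* a b → Ad ES' (sw a) (sw b)
      ad*⁻ {a} {b} (inj₁ m) with ∈-map⁻ swe m
      ... | (c , d) , m' , refl = inj₁ (subst (_∈ ES') (cong₂ _,_ (sym (sw-sw c)) (sym (sw-sw d))) m')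
      ad*⁻ {a} {b} (inj₂ m) with ∈-map⁻ swe m
      ... | (c , d) , m' , refl = inj₂ (subst (_∈ ES') (cong₂ _,_ (sym (sw-sw c)) (sym (sw-sw d))) m')

      ad*⁺ : ∀ {a b} → Ad ES' a b → Ad ES'* (sw a) (sw b)
      ad*⁺ (inj₁ m) = inj₁ (∈-map⁺ swe m)
      ad*⁺ (inj₂ m) = inj₂ (∈-map⁺ swe m)

      kept-edge : ∀ {a b} → Ad EN a b → ¬ Moved (a , b) → Ad EN* a b
      kept-edge (inj₁ m) n = inj₁ (there (subst (_∈ map ren EN) (ren-no n) (∈-map⁺ ren m)))
      kept-edge (inj₂ m) n = inj₂ (there (subst (_∈ map ren EN) (ren-no (λ { (p , q) → n (swap p , λ z → q (swap z)) })) (∈-map⁺ ren m)))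

      moved-edge : ∀ {a b} → Ad EN a b → Moved (a , b) → Ad EN* (sw a) (sw b)
      moved-edge (inj₁ m) n = inj₁ (there (subst (_∈ map ren EN) (ren-yes n) (∈-map⁺ ren m)))
      moved-edge (inj₂ m) (p , q) = inj₂ (there (subst (_∈ map ren EN) (ren-yes (swap p , λ z → q (swap z))) (∈-map⁺ ren m)))

      S-kept : ∀ {a b} → Ad ES a b → Ad EN* a b
      S-kept r = kept-edge (S⊆ r) (λ m → proj₂ m r)

      S'-kept : Ad ES'* ⊑ Ad EN*
      S'-kept {a} {b} r* with ad*⁻ r*
      ... | r with ad? ES (sw a) (sw b)
      ...   | no n = subst (λ z → Ad EN* z b) (sw-sw a) (subst (Ad EN* (sw (sw a))) (sw-sw b) (moved-edge (S'⊆ r) (r , n)))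
      ...   | yes q with sw a ≟ t | sw b ≟ t
      ...     | yes e | _ = subst (λ z → Ad EN* z b) (sym ea) (subst (Ad EN* t*) (sym eb) (inj₂ (here refl)))
        where
        ea : a ≡ t*
        ea = trans (sym (sw-sw a)) (trans (cong sw e) sw-t)
        eb : b ≡ s
        eb = trans (sym (sw-sw b)) (trans (cong sw (only-s (swap (subst (λ z → Ad ES z (sw b)) e q) , swap (subst (λ z → Ad ES' z (sw b)) e r)))) (sw-id s≢t (vs≢ s∈)))
      ...     | no _ | yes e = subst (λ z → Ad EN* z b) (sym ea) (subst (Ad EN* s) (sym eb) (inj₁ (here refl)))
        where
        eb : b ≡ t*
        eb = trans (sym (sw-sw b)) (trans (cong sw e) sw-t)
        ea : a ≡ s
        ea = trans (sym (sw-sw a)) (trans (cong sw (only-s (subst (Ad ES (sw a)) e q , subst (Ad ES' (sw a)) e r))) (sw-id s≢t (vs≢ s∈)))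
      ...     | no na | no nb = subst (λ z → Ad EN* z b) ea (subst (Ad EN* (sw a)) eb (S-kept q))
        where
        ea : sw a ≡ a
        ea = trans (sym (sw-id na (vs≢ (ends (S⊆ q))))) (sw-sw a)
        eb : sw b ≡ b
        eb = trans (sym (sw-id nb (vs≢ (ends (S⊆ (swap q)))))) (sw-sw b)

      sy* : Symm (Ad EN*)
      sy* = swap

      s~t* : Star (Ad EN*) s t*
      s~t* = one (inj₁ (here refl))

      to-copy : ∀ {a} → a ∈ vs → Star (Ad EN*) a (sw a)
      to-copy {a} m with a ≟ t | a ≟ t*
      ... | yes refl | _ = one (S-kept (swap (inl sst))) ◅◅ s~t*
      ... | no _ | yes refl = ⊥-elim (t*∉ m)
      ... | no _ | no _ = ε

      con-old : ∀ {a b} → Ad EN a b → Star (Ad EN*) a b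
      con-old {a} {b} r with moved? (a , b)
      ... | no n = one (kept-edge r n)
      ... | yes m = to-copy (ends r) ◅◅ (moved-edge r m ◅ star-sym sy* (to-copy (ends (swap r))))

      con* : ∀ {a b} → a ∈ t* ∷ vs → b ∈ t* ∷ vs → Star (Ad EN*) a b
      con* a b = star-sym sy* (from-s a) ◅◅ from-s b
        where
        from-s : ∀ {a} → a ∈ t* ∷ vs → Star (Ad EN*) s a
        from-s (here refl) = s~t*
        from-s (there m) = Star.kleisliStar (λ x → x) con-old (con s∈ m)

      sw∈ : ∀ {a} → a ∈ vs → sw a ∈ t* ∷ vs
      sw∈ {a} m with a ≟ t | a ≟ t*
      ... | yes _ | _ = here refl
      ... | no _ | yes _ = there t∈
      ... | no _ | no _ = there m

      ren∈ : ∀ {e} → e ∈ EN → proj₁ (ren e) ∈ t* ∷ vs × proj₂ (ren e) ∈ t* ∷ vs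
      ren∈ {e} m with moved? e
      ... | yes _ = sw∈ (ends (inj₁ m)) , sw∈ (ends (inj₂ m))
      ... | no _ = there (ends (inj₁ m)) , there (ends (inj₂ m))

      ends* : ∀ {a b} → Ad EN* a b → a ∈ t* ∷ vs
      ends* (inj₁ (here refl)) = there s∈
      ends* (inj₂ (here refl)) = here refl
      ends* (inj₁ (there m)) with ∈-map⁻ ren m
      ... | e , m' , refl = proj₁ (ren∈ m')
      ends* (inj₂ (there m)) with ∈-map⁻ ren m
      ... | e , m' , refl = proj₂ (ren∈ m')

      inj-sw : ∀ {a b} → sw a ≡ sw b → a ≡ b
      inj-sw {a} {b} e = trans (sym (sw-sw a)) (trans (cong sw e) (sw-sw b))

      del*⁻ : ∀ {c d a b} → del (Ad ES'*) c d a b → del (Ad ES') (sw c) (sw d) (sw a) (sw b)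
      del*⁻ (r , n) = ad*⁻ r , λ { (inj₁ (p , q)) → n (inj₁ (inj-sw p , inj-sw q)) ; (inj₂ (p , q)) → n (inj₂ (inj-sw p , inj-sw q)) }

      del*⁺ : ∀ {c d a b} → del (Ad ES') c d a b → del (Ad ES'*) (sw c) (sw d) (sw a) (sw b)
      del*⁺ (r , n) = ad*⁺ r , λ { (inj₁ (p , q)) → n (inj₁ (inj-sw p , inj-sw q)) ; (inj₂ (p , q)) → n (inj₂ (inj-sw p , inj-sw q)) }

      fix : ∀ {x} → x ∈ X → sw x ≡ x
      fix m = sw-id (λ { refl → t∉ m }) (vs≢ (X⊆ m))

      at : ∀ {T : Gr} {x y} → x ∈ X → y ∈ X → Star T (sw x) (sw y) → Star T x y
      at {T} {x} {y} m m' q = subst (λ z → Star T z y) (fix m) (subst (Star T (sw x)) (fix m') q)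

      eqv* : Eqv (On X) (Ad ES') (Ad ES'*)
      eqv* = eqv
        (record { conn = λ { (on m) (on m') q → at m m' (Star.gmap sw ad*⁺ q) }
                ; match = λ {c} {d} e → inj₂ (sw c , sw d , ad*⁺ e , λ { (on m) (on m') → same c d m m' }) })
        (record { conn = λ { (on m) (on m') q → at m m' (Star.gmap sw ad*⁻ q) }
                ; match = λ {c} {d} e → inj₂ (sw c , sw d , ad*⁻ e , λ { (on m) (on m') → same' c d m m' }) })
        where
        same : ∀ c d {x y} → x ∈ X → y ∈ X → (Star (del (Ad ES') c d) x y → Star (del (Ad ES'*) (sw c) (sw d)) x y) × (Star (del (Ad ES'*) (sw c) (sw d)) x y → Star (del (Ad ES') c d) x y)
        same c d m m' = (λ q → at m m' (Star.gmap sw del*⁺ q)) , (λ q → at m m' (Star.gmap sw (λ r → subst (λ z → del (Ad ES') z d _ _) (sw-sw c) (subst (λ z → del (Ad ES') _ z _ _) (sw-sw d) (del*⁻ r))) q))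
        same' : ∀ c d {x y} → x ∈ X → y ∈ X → (Star (del (Ad ES'*) c d) x y → Star (del (Ad ES') (sw c) (sw d)) x y) × (Star (del (Ad ES') (sw c) (sw d)) x y → Star (del (Ad ES'*) c d) x y)
        same' c d m m' = (λ q → at m m' (Star.gmap sw del*⁻ q)) , (λ q → at m m' (Star.gmap sw (λ r → subst (λ z → del (Ad ES'*) z d _ _) (sw-sw c) (subst (λ z → del (Ad ES'*) _ z _ _) (sw-sw d) (del*⁺ r))) q))

    st* : St X F F' n
    st* = record
      { EN = EN* ; ES = ES ; ES' = ES'* ; vs = t* ∷ vs
      ; vsU = Allₚ.¬Any⇒All¬ _ t*∉ ∷ vsU
      ; ends = ends* ; con = con*
      ; cnt = subst (suc (length (map ren EN)) + 1 ≤_) (sym (+-suc n (length vs))) (s≤s (subst (λ k → k + 1 ≤ n + length vs) (sym (length-map ren EN)) cnt))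
      ; S⊆ = S-kept ; S'⊆ = S'-kept ; foS = foS
      ; foS' = λ r q → foS' (ad*⁻ r) (Star.gmap sw del*⁻ q)
      ; X⊆ = λ m → there (X⊆ m) ; eS = eS ; eS' = on-trans eS' eqv* }

    fewer : length (filter (λ e → ad? ES'* (proj₁ e) (proj₂ e)) ES) < length (filter (λ e → ad? ES' (proj₁ e) (proj₂ e)) ES)
    fewer = go (inl sst)
      where
      imp : ∀ {e} → e ∈ ES → Ad ES'* (proj₁ e) (proj₂ e) → Ad ES' (proj₁ e) (proj₂ e)
      imp {a , b} m r* with ad*⁻ r* | a ≟ t | b ≟ t
      ... | r | yes refl | _ = ⊥-elim (t*∉ (ends (S'⊆ (subst (λ z → Ad ES' z (sw b)) sw-t r))))
      ... | r | no _ | yes refl = ⊥-elim (t*∉ (ends (S'⊆ (swap (subst (Ad ES' (sw a)) sw-t r)))))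
      ... | r | no na | no nb = subst (λ z → Ad ES' z b) (sw-id na (vs≢ (ends (S⊆ (inj₁ m))))) (subst (Ad ES' (sw a)) (sw-id nb (vs≢ (ends (S⊆ (inj₂ m))))) r)
      no-t : ∀ {a} → ¬ Ad ES'* a t
      no-t r* = t*∉ (ends (S'⊆ (swap (subst (Ad ES' _) sw-t (ad*⁻ r*)))))
      go : Ad ES s t → _
      go (inj₁ m) = count-< (λ e → ad? ES'* (proj₁ e) (proj₂ e)) (λ e → ad? ES' (proj₁ e) (proj₂ e)) ES imp m (inr sst) no-t
      go (inj₂ m) = count-< (λ e → ad? ES'* (proj₁ e) (proj₂ e)) (λ e → ad? ES' (proj₁ e) (proj₂ e)) ES imp m (swap (inr sst)) (λ r → no-t (swap r))

  module _ {R : Gr} (l : Listed R) where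

    private
      alt? : ∀ s t → Dec (Σ ℕ λ s' → R s' t × s' ≢ s)
      alt? s t = map′ f g (any? (λ e → ((proj₂ e ≟ t) ×-dec ¬? (proj₁ e ≟ s)) ⊎-dec ((proj₁ e ≟ t) ×-dec ¬? (proj₂ e ≟ s))) (Listed.es l))
        where
        f : Any (λ e → (proj₂ e ≡ t × proj₁ e ≢ s) ⊎ (proj₁ e ≡ t × proj₂ e ≢ s)) (Listed.es l) → Σ ℕ λ s' → R s' t × s' ≢ s
        f a with find a
        ... | (p , q) , m , inj₁ (refl , n) = p , Listed.from l (inj₁ m) , n
        ... | (p , q) , m , inj₂ (refl , n) = q , Listed.from l (inj₂ m) , n
        g : (Σ ℕ λ s' → R s' t × s' ≢ s) → Any (λ e → (proj₂ e ≡ t × proj₁ e ≢ s) ⊎ (proj₁ e ≡ t × proj₂ e ≢ s)) (Listed.es l)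
        g (s' , r , n) with Listed.to l r
        ... | inj₁ m = lose m (inj₁ (refl , n))
        ... | inj₂ m = lose m (inj₂ (refl , n))

    dangling : ∀ X → (Σ ℕ λ s → Σ ℕ λ t → R s t × t ∉ X × (∀ {s'} → R s' t → s' ≡ s)) ⊎ (∀ a b → R a b → a ∈ X ⊎ Σ ℕ λ c → R a c × c ≢ b)
    dangling X with any? (λ e → D? (proj₁ e) (proj₂ e) ⊎-dec D? (proj₂ e) (proj₁ e)) (Listed.es l)
      where
      D? : ∀ s t → Dec (t ∉ X × ¬ (Σ ℕ λ s' → R s' t × s' ≢ s))
      D? s t = ¬? (t ∈? X) ×-dec ¬? (alt? s t)
    ... | yes p with find p
    ...   | (s , t) , m , inj₁ (n , k) = inj₁ (s , t , Listed.from l (inj₁ m) , n , λ {s'} r → one-nbr s t k s' r)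
      where
      one-nbr : ∀ s t → ¬ (Σ ℕ λ s' → R s' t × s' ≢ s) → ∀ s' → R s' t → s' ≡ s
      one-nbr s t k s' r with s' ≟ s
      ... | yes e = e
      ... | no ne = ⊥-elim (k (s' , r , ne))
    ...   | (t , s) , m , inj₂ (n , k) = inj₁ (s , t , Listed.from l (inj₂ m) , n , λ {s'} r → one-nbr s t k s' r)
      where
      one-nbr : ∀ s t → ¬ (Σ ℕ λ s' → R s' t × s' ≢ s) → ∀ s' → R s' t → s' ≡ s
      one-nbr s t k s' r with s' ≟ s
      ... | yes e = e
      ... | no ne = ⊥-elim (k (s' , r , ne))
    dangling X | no np = inj₂ nx
      where
      nx : ∀ a b → R a b → a ∈ X ⊎ Σ ℕ λ c → R a c × c ≢ b
      nx a b r with a ∈? X | alt? b a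
      ... | yes i | _ = inj₁ i
      ... | no _ | yes (c , q , n) = inj₂ (c , symm l q , n)
      ... | no i | no k with Listed.to l r
      ...   | inj₁ m = ⊥-elim (np (lose m (inj₂ (i , k))))
      ...   | inj₂ m = ⊥-elim (np (lose m (inj₁ (i , k))))

  tighten : ∀ {X F F' n} → St X F F' n → Σ (St X F F' n) Tight
  tighten {X} {F} {F'} {n} s₀ = go _ s₀ ≤-refl
    where
    size : St X F F' n → ℕ
    size s = length (filter (λ e → ad? (St.ES' s) (proj₁ e) (proj₂ e)) (St.ES s))
    go : ∀ k (s : St X F F' n) → size s ≤ k → Σ (St X F F' n) Tight
    go k s le with dangling (St.iL s) X
    go k s le | inj₂ nx = s , λ {c} {d} cd → tg c d cd
      where
      open St s
      tg : ∀ c d → I c d → Σ ℕ λ p → Σ ℕ λ r → p ∈ X × r ∈ X × Star I p r × ¬ Star (del I c d) p r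
      tg c d cd with label-beyond {I} {λ v → v ∈ X} iL foI nx c d cd | label-beyond {I} {λ v → v ∈ X} iL foI nx d c (symm iL cd)
      ... | p , pX , sp | r , rX , sr = p , r , pX , rX , star-sym (symm iL) (mono del⊑ sp) ◅◅ (cd ◅ mono del⊑ sr) ,
            λ q → foI cd (sp ◅◅ q ◅◅ star-sym (del-sym c d (symm iL)) (mono del-comm sr))
    go zero s le | inj₁ (a , b , ab , n∉ , o) = ⊥-elim (case ≤-trans (Reroute.fewer s ab n∉ o) le of λ ())
    go (suc k) s le | inj₁ (a , b , ab , n∉ , o) = go k (Reroute.st* s ab n∉ o) (s≤s⁻¹ (≤-trans (Reroute.fewer s ab n∉ o) le))

open SharedNetworks

module RootChoice where

  -- B is a set of labels such that an edge of exactly one of S, S' separating two labels of B (in S, resp. S')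
  -- is no bridge of N, so that it can be deleted from N.
  record Root {X F F' n} (st : St X F F' n) : Set₁ where
    open St st
    field
      B : ℕ → Set
      safe : ∀ {x₁ x₂ c d} → B x₁ → B x₂ → Star (Ad ES) x₁ x₂ → Ad ES c d → ¬ Ad ES' c d → ¬ Star (del (Ad ES) c d) x₁ x₂ → Star (del (Ad EN) c d) c d
      safe' : ∀ {x₁ x₂ c d} → B x₁ → B x₂ → Star (Ad ES') x₁ x₂ → Ad ES' c d → ¬ Ad ES c d → ¬ Star (del (Ad ES') c d) x₁ x₂ → Star (del (Ad EN) c d) c d
      a b : ℕ
      ab : Adj F a b
      aside : ∀ {x} → x ∈ X → Star (del (Adj F) a b) a x → B x
      closed' : ∀ {x y} → x ∈ X → y ∈ X → B x → Star (Adj F') x y → B y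
      kind : (b ∈ X × (∀ {x} → x ∈ X → Star (Adj F) a x → B x)) ⊎ (∀ {x} → x ∈ X → B x → Star (del (Adj F) a b) a x)

  module Select {X F F' n} (st : St X F F' n) (f : IsF X F) (ni : ∀ {x} → x ∈ X → Σ ℕ λ m → Adj F x m) where

    open St st
    module OF = OnF f

    private
      N S S' : Gr
      N = Ad EN
      S = Ad ES
      S' = Ad ES'
      lN : Listed N
      lN = listed-Ad EN
      sN : Symm N
      sN = swap

      stable-conn : ∀ c d → ¬ ¬ Star (del N c d) c d → Star (del N c d) c d
      stable-conn c d = decidable-stable (conn? (listed-del lN c d) c d)

    Sepr : Edges → ℕ → ℕ → Set
    Sepr T c d = Any (λ x → Any (λ y → Star (Ad T) x y × ¬ Star (del (Ad T) c d) x y) X) X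

    Special : Edges → Edges → ℕ → ℕ → Set
    Special T T' c d = Ad T c d × ¬ Ad T' c d × ¬ Star (del N c d) c d × Sepr T c d

    special? : ∀ T T' c d → Dec (Special T T' c d)
    special? T T' c d = ad? T c d ×-dec ¬? (ad? T' c d) ×-dec ¬? (conn? (listed-del lN c d) c d) ×-dec
      any? (λ x → any? (λ y → conn-list? T x y ×-dec ¬? (conn? (listed-del (listed-Ad T) c d) x y)) X) X

    special-swap : ∀ {T T' c d} → Special T T' c d → Special T T' d c
    special-swap {T} {T'} {c} {d} (p , q , r , s) = swap p , (λ z → q (swap z)) , (λ z → r (star-sym (del-sym c d sN) (mono del-comm z))) ,
      Any.map (Any.map λ { (t , u) → t , λ z → u (mono del-comm z) }) s

    Sp : ℕ → ℕ → Set
    Sp c d = Special ES ES' c d ⊎ Special ES' ES c d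

    sp? : ∀ c d → Dec (Sp c d)
    sp? c d = special? ES ES' c d ⊎-dec special? ES' ES c d

    sp-swap : ∀ {c d} → Sp c d → Sp d c
    sp-swap = [ (λ s → inj₁ (special-swap s)) , (λ s → inj₂ (special-swap s)) ]

    sp-edge : ∀ {c d} → Sp c d → N c d
    sp-edge = [ (λ s → S⊆ (proj₁ s)) , (λ s → S'⊆ (proj₁ s)) ]

    br : ∀ {c d} → Sp c d → ¬ Star (del N c d) c d
    br = [ (λ s → proj₁ (proj₂ (proj₂ s))) , (λ s → proj₁ (proj₂ (proj₂ s))) ]

    μ : ℕ → ℕ → ℕ
    μ c d = length (filter (conn? (listed-del lN c d) c) vs)

    Minimal : ℕ → ℕ → Set
    Minimal α β = Sp α β × (∀ {c d} → Sp c d → ¬ μ c d < μ α β)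

    find-sp : (Q : ℕ → ℕ → Set) → (∀ c d → Dec (Q c d)) → (Σ ℕ λ c → Σ ℕ λ d → Sp c d × Q c d) ⊎ (∀ {c d} → Sp c d → ¬ Q c d)
    find-sp Q q? = go (any? (λ e → (sp? (proj₁ e) (proj₂ e) ×-dec q? (proj₁ e) (proj₂ e)) ⊎-dec (sp? (proj₂ e) (proj₁ e) ×-dec q? (proj₂ e) (proj₁ e))) EN)
      where
      Hit : ℕ × ℕ → Set
      Hit e = (Sp (proj₁ e) (proj₂ e) × Q (proj₁ e) (proj₂ e)) ⊎ (Sp (proj₂ e) (proj₁ e) × Q (proj₂ e) (proj₁ e))
      pick : ∀ e → Hit e → Σ ℕ λ c → Σ ℕ λ d → Sp c d × Q c d
      pick (c , d) (inj₁ (s , q)) = c , d , s , q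
      pick (d , c) (inj₂ (s , q)) = c , d , s , q
      go : Dec (Any Hit EN) → (Σ ℕ λ c → Σ ℕ λ d → Sp c d × Q c d) ⊎ (∀ {c d} → Sp c d → ¬ Q c d)
      go (yes p) = let (e , _ , h) = find p in inj₁ (pick e h)
      go (no np) = inj₂ λ s q → [ (λ m → np (lose m (inj₁ (s , q)))) , (λ m → np (lose m (inj₂ (s , q)))) ] (sp-edge s)

    minimal : (Σ ℕ λ α → Σ ℕ λ β → Minimal α β) ⊎ (∀ {c d} → ¬ Sp c d)
    minimal = start (find-sp (λ _ _ → ⊤) (λ _ _ → yes tt))
      where
      Smaller : ℕ → ℕ → Set
      Smaller c d = Σ ℕ λ c' → Σ ℕ λ d' → Sp c' d' × μ c' d' < μ c d
      smaller? : ∀ c d → Smaller c d ⊎ (∀ {c' d'} → Sp c' d' → ¬ μ c' d' < μ c d)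
      smaller? c d = find-sp (λ c' d' → μ c' d' < μ c d) (λ c' d' → μ c' d' <? μ c d)
      descend : ∀ k c d → Sp c d → μ c d ≤ k → Smaller c d ⊎ (∀ {c' d'} → Sp c' d' → ¬ μ c' d' < μ c d) → Σ ℕ λ α → Σ ℕ λ β → Minimal α β
      descend k c d s le (inj₂ none) = c , d , s , none
      descend zero c d s le (inj₁ (c' , d' , s' , lt)) = ⊥-elim (case ≤-trans lt le of λ ())
      descend (suc k) c d s le (inj₁ (c' , d' , s' , lt)) = descend k c' d' s' (s≤s⁻¹ (≤-trans lt le)) (smaller? c' d')
      start : (Σ ℕ λ c → Σ ℕ λ d → Sp c d × ⊤) ⊎ (∀ {c d} → Sp c d → ¬ ⊤) → (Σ ℕ λ α → Σ ℕ λ β → Minimal α β) ⊎ (∀ {c d} → ¬ Sp c d)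
      start (inj₁ (c , d , s , _)) = inj₁ (descend (μ c d) c d s ≤-refl (smaller? c d))
      start (inj₂ none) = inj₂ λ s → none s tt

    sepr : ∀ {T c d x y} → x ∈ X → y ∈ X → Star (Ad T) x y → ¬ Star (del (Ad T) c d) x y → Sepr T c d
    sepr mx my s n = lose mx (lose my (s , n))

    module Side {α β : ℕ} (mi : Minimal α β) where

      private
        dαβ : Symm (del N α β)
        dαβ = del-sym α β sN
        bridge : ¬ Star (del N α β) α β
        bridge = br (proj₁ mi)

      B : ℕ → Set
      B x = Star (del N α β) α x

      smaller : ∀ {c d} → N c d → ¬ Joins α β (c , d) → ¬ Star (del N c d) c d → B c → B d → Star (del N c d) α d → μ c d < μ α β
      smaller {c} {d} cd nj br bc bd αd = count-< (conn? (listed-del lN c d) c) (conn? (listed-del lN α β) α) vs imp (ends (sN cd)) bd br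
        where
        dcd : Symm (del N c d)
        dcd = del-sym c d sN
        imp : ∀ {v} → v ∈ vs → Star (del N c d) c v → Star (del N α β) α v
        imp _ s with cross dcd α β s
        ... | inj₁ t = bc ◅◅ mono (del-mono kept) t
        ... | inj₂ (_ , inj₁ (t , _)) = ⊥-elim (br (mono del⊑ t ◅◅ αd))
        ... | inj₂ (_ , inj₂ (t , _)) = ⊥-elim (bridge (bc ◅◅ mono (del-mono kept) t))

      inside : ∀ {T : Gr} {x₁ x₂ c d} → T ⊑ N → Symm T → Listed T → B x₁ → B x₂ → Star T x₁ x₂ → ¬ Star (del T c d) x₁ x₂ → ¬ Joins α β (c , d) × B c × B d
      inside {T} {x₁} {x₂} {c} {d} i sy l b₁ b₂ s n = decide (conn? (listed-del l α β) x₁ x₂)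
          (λ t → within (cross! (del-sym α β sy) c d t (λ q → n (mono (del-mono kept) q))))
          (λ nt → ⊥-elim (outside (proj₂ (cross! sy α β s nt))))
        where
        up : del (del T α β) c d ⊑ del N α β
        up ((r , m) , _) = i r , m
        within : del T α β c d × Across (del (del T α β) c d) c d x₁ x₂ → ¬ Joins α β (c , d) × B c × B d
        within ((_ , nj) , inj₁ (p , q)) = nj , b₁ ◅◅ mono up p , b₂ ◅◅ star-sym dαβ (mono up q)
        within ((_ , nj) , inj₂ (p , q)) = nj , b₂ ◅◅ star-sym dαβ (mono up q) , b₁ ◅◅ mono up p
        outside : ¬ Across (del T α β) α β x₁ x₂
        outside (inj₁ (p , q)) = bridge (b₂ ◅◅ star-sym dαβ (mono (del-mono i) q))
        outside (inj₂ (p , q)) = bridge (b₁ ◅◅ mono (del-mono i) p)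

      not-bridge : ∀ {c d} → Sp c d → ¬ Joins α β (c , d) → ¬ (B c × B d)
      not-bridge {c} {d} sp nj (bc , bd) with cross sN c d (con (ends (sp-edge (proj₁ mi))) (ends (sp-edge sp)))
      ... | inj₁ αc = proj₂ mi (sp-swap sp) (smaller (sN (sp-edge sp)) (λ j → nj (joins-flip j)) (br (sp-swap sp)) bd bc (mono del-comm αc))
      ... | inj₂ (_ , inj₁ (αc , _)) = proj₂ mi (sp-swap sp) (smaller (sN (sp-edge sp)) (λ j → nj (joins-flip j)) (br (sp-swap sp)) bd bc (mono del-comm αc))
      ... | inj₂ (_ , inj₂ (αd , _)) = proj₂ mi sp (smaller (sp-edge sp) nj (br sp) bc bd αd)

      safeS : ∀ {x₁ x₂ c d} → x₁ ∈ X → x₂ ∈ X → B x₁ → B x₂ → Star S x₁ x₂ → S c d → ¬ S' c d → ¬ Star (del S c d) x₁ x₂ → Star (del N c d) c d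
      safeS {c = c} {d} m₁ m₂ b₁ b₂ s e e' n = stable-conn c d λ nt → let (nj , bc , bd) = inside S⊆ swap (listed-Ad ES) b₁ b₂ s n in
        not-bridge (inj₁ (e , e' , nt , sepr m₁ m₂ s n)) nj (bc , bd)

      safeS' : ∀ {x₁ x₂ c d} → x₁ ∈ X → x₂ ∈ X → B x₁ → B x₂ → Star S' x₁ x₂ → S' c d → ¬ S c d → ¬ Star (del S' c d) x₁ x₂ → Star (del N c d) c d
      safeS' {c = c} {d} m₁ m₂ b₁ b₂ s e e' n = stable-conn c d λ nt → let (nj , bc , bd) = inside S'⊆ swap (listed-Ad ES') b₁ b₂ s n in
        not-bridge (inj₂ (e , e' , nt , sepr m₁ m₂ s n)) nj (bc , bd)

      module Cut (sp : Special ES ES' α β) where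

        private
          BX : ℕ → Set
          BX x = x ∈ X × B x

          S'B : S' ⊑ del N α β
          S'B r = S'⊆ r , λ { (inj₁ (refl , refl)) → proj₁ (proj₂ sp) r ; (inj₂ (refl , refl)) → proj₁ (proj₂ sp) (swap r) }

          closedB : ∀ {x y} → x ∈ X → y ∈ X → BX x → Star (Adj F') x y → BX y
          closedB mx my (_ , bx) s = my , bx ◅◅ mono S'B (conn (fwd eS') (on mx) (on my) s)

          record Cutting : Set where
            field
              a b x₀ y₀ : ℕ
              ab : Adj F a b
              x₀X : x₀ ∈ X
              y₀X : y₀ ∈ X
              αx₀ : Star (del S α β) α x₀
              βy₀ : Star (del S α β) β y₀
              ax₀ : Star (del (Adj F) a b) a x₀
              by₀ : Star (del (Adj F) a b) b y₀
              same : SameSplit (On X) (Adj F) a b S α β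

          mk : ∀ x y → x ∈ X → y ∈ X → Star (del S α β) α x → Star (del S α β) β y → Star S x y → ¬ Star (del S α β) x y → Cutting
          mk x y xX yX αx βy s n = matched (match (bwd eS) (proj₁ sp))
            where
            oriented : ∀ a b → Adj F a b → SameSplit (On X) (Adj F) a b S α β → Across (del (Adj F) a b) a b x y → Cutting
            oriented a b ab i (inj₁ (p , r)) = record { a = a ; b = b ; ab = ab ; x₀X = xX ; y₀X = yX ; αx₀ = αx ; βy₀ = βy
              ; ax₀ = star-sym (del-sym a b OF.sF) p ; by₀ = r ; same = i }
            oriented a b ab i (inj₂ (p , r)) = record { a = b ; b = a ; ab = OF.sF ab ; x₀X = xX ; y₀X = yX ; αx₀ = αx ; βy₀ = βy
              ; ax₀ = mono del-comm (star-sym (del-sym a b OF.sF) p) ; by₀ = mono del-comm r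
              ; same = λ m m' → (λ z → proj₁ (i m m') (mono del-comm z)) , (λ z → mono del-comm (proj₂ (i m m') z)) }
            matched : NoSplit (On X ˘) S α β ⊎ (Σ ℕ λ a → Σ ℕ λ b → Adj F a b × SameSplit (On X ˘) S α β (Adj F) a b) → Cutting
            matched (inj₁ t) = ⊥-elim (n (t (on xX) (on yX) s))
            matched (inj₂ (a , b , ab , i)) = oriented a b ab (λ { (on m) (on m') → let k = i (on m) (on m') in proj₂ k , proj₁ k })
              (proj₂ (cross! OF.sF a b (conn (bwd eS) (on xX) (on yX) s) (λ z → n (proj₂ (i (on xX) (on yX)) z))))

          cutting : Cutting
          cutting = let (x , xX , q) = find (proj₂ (proj₂ (proj₂ sp))) ; (y , yX , s , n) = find q in go x y xX yX s n (proj₂ (cross! swap α β s n))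
            where
            go : ∀ x y → x ∈ X → y ∈ X → Star S x y → ¬ Star (del S α β) x y → Across (del S α β) α β x y → Cutting
            go x y xX yX s n (inj₁ (p , r)) = mk x y xX yX (star-sym (del-sym α β swap) p) r s n
            go x y xX yX s n (inj₂ (p , r)) = mk y x yX xX r (star-sym (del-sym α β swap) p) (star-sym swap s) (λ z → n (star-sym (del-sym α β swap) z))

        private
          module FromCutting (cu : Cutting) where
            open Cutting cu

            root-only : (∀ {x} → x ∈ X → B x → Star (Adj F) a x) → Root st
            root-only h = record { B = BX ; safe = λ { (m , p) (m' , q) → safeS m m' p q } ; safe' = λ { (m , p) (m' , q) → safeS' m m' p q }
                ; a = a ; b = b ; ab = ab ; closed' = closedB
                ; aside = λ m s → m , mono (del-mono S⊆) αx₀ ◅◅ mono (del-mono S⊆) (proj₁ (same (on x₀X) (on m)) (star-sym (del-sym a b OF.sF) ax₀ ◅◅ s))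
                ; kind = inj₂ λ m bx → onl m (proj₂ bx) }
              where
              onl : ∀ {x} → x ∈ X → B x → Star (del (Adj F) a b) a x
              onl {x} m bx with cross OF.sF a b (h m bx)
              ... | inj₁ t = t
              ... | inj₂ (_ , inj₂ (_ , t)) = t
              ... | inj₂ (_ , inj₁ (_ , t)) = ⊥-elim (bridge (bx ◅◅ star-sym dαβ (mono (del-mono S⊆) βy₀ ◅◅ mono (del-mono S⊆) (proj₁ (same (on y₀X) (on m)) (star-sym (del-sym a b OF.sF) by₀ ◅◅ t)))))

            root-other : ∀ {x m} → x ∈ X → Adj F x m → B x → ¬ Star (Adj F) a x → Root st
            root-other {x} {m} xX xm bx nx = record { B = BX ; safe = λ { (m , p) (m' , q) → safeS m m' p q } ; safe' = λ { (m , p) (m' , q) → safeS' m m' p q }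
                ; a = m ; b = x ; ab = OF.sF xm ; closed' = closedB
                ; aside = λ m s → full m (mono del⊑ s)
                ; kind = inj₁ (xX , full) }
              where
              full : ∀ {y} → y ∈ X → Star (Adj F) m y → BX y
              full m s with cross OF.sF a b (xm ◅ s)
              ... | inj₁ t = m , bx ◅◅ mono (del-mono S⊆) (proj₁ (same (on xX) (on m)) t)
              ... | inj₂ (_ , inj₁ (t , _)) = ⊥-elim (nx (star-sym OF.sF (mono del⊑ t)))
              ... | inj₂ (_ , inj₂ (t , _)) = ⊥-elim (nx (star-sym OF.sF (mono del⊑ t ◅◅ one (OF.sF ab))))

            search : Dec (Any (λ x → B x × ¬ Star (Adj F) a x) X) → Root st
            search (yes p) = let (x , xX , bx , nx) = find p in root-other xX (proj₂ (ni xX)) bx nx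
            search (no np) = root-only λ {x} m bx → stable x m bx (conn? OF.lF a x)
              where
              stable : ∀ x → x ∈ X → B x → Dec (Star (Adj F) a x) → Star (Adj F) a x
              stable x m bx (yes s) = s
              stable x m bx (no ns) = ⊥-elim (np (lose m (bx , ns)))

        root : Root st
        root = FromCutting.search cutting (any? (λ x → conn? (listed-del lN α β) α x ×-dec ¬? (conn? OF.lF (Cutting.a cutting) x)) X)

    whole : (∀ {c d} → ¬ Sp c d) → ∀ {x} → x ∈ X → Root st
    whole none {x} xX = record { B = λ x → x ∈ X
      ; safe = λ {_} {_} {c} {d} m m' s e e' n → stable-conn c d λ nt → none (inj₁ (e , e' , nt , sepr m m' s n))
      ; safe' = λ {_} {_} {c} {d} m m' s e e' n → stable-conn c d λ nt → none (inj₂ (e , e' , nt , sepr m m' s n))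
      ; a = proj₁ (ni xX) ; b = x ; ab = OF.sF (proj₂ (ni xX)) ; aside = λ m _ → m ; closed' = λ _ m _ _ → m ; kind = inj₁ (xX , λ m _ → m) }

open RootChoice

module NetworkCuts where

  half-del : ∀ {P F S a b c d} → Listed F → Listed S → Forest F → Forest S → SameSplit P F a b S c d → Half P F S → Half P (del F a b) (del S c d)
  half-del {P} {F} {S} {a} {b} {c} {d} lf ls ff fs i h = record { conn = λ p q → proj₁ (i p q) ; match = mt }
    where
    both : ∀ {R a b e f x y} → Listed R → Forest R → Star (del R a b) x y → Star (del R e f) x y → Star (del (del R a b) e f) x y
    both {a = a} {b} l fo = helly (symm l) (del-sym a b (symm l)) del⊑ fo
    mt : ∀ {e f} → del F a b e f → NoSplit P (del F a b) e f ⊎ (Σ ℕ λ e' → Σ ℕ λ f' → del S c d e' f' × SameSplit P (del F a b) e f (del S c d) e' f')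
    mt {e} {f} (r , n) with match h r
    ... | inj₁ t = inj₁ λ p q s → both lf ff s (t p q (mono del⊑ s))
    ... | inj₂ (e' , f' , r' , j) with joins? c d (e' , f')
    ...   | no n' = inj₂ (e' , f' , (r' , n') , λ p q →
              (λ s → both ls fs (proj₁ (i p q) (mono del⊑ s)) (proj₁ (j p q) (mono (del-mono kept) s))) ,
              (λ s → both lf ff (proj₂ (i p q) (mono del⊑ s)) (proj₂ (j p q) (mono (del-mono kept) s))))
    ...   | yes k = inj₁ λ p q s → both lf ff s (proj₂ (j p q) (mono (del-cong k) (proj₁ (i p q) s)))

  eqv-del : ∀ {P F S a b c d} → Listed F → Listed S → Forest F → Forest S → SameSplit P F a b S c d → Eqv P F S → Eqv P (del F a b) (del S c d)
  eqv-del lf ls ff fs i e = eqv (half-del lf ls ff fs i (fwd e)) (half-del ls lf fs ff (λ p q → proj₂ (i p q) , proj₁ (i p q)) (bwd e))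

  cutC : Graph → ℕ → ℕ → Graph
  cutC F a b = suppress (cutE F a b)

  cutC-del : ∀ {X F a b} → IsF X F → Adj F a b → DelEdge F a b (cutC F a b)
  cutC-del f ab = ab , suppress-all (cut-pre f ab)

  del-isF : ∀ {X F a b G} → IsF X F → DelEdge F a b G → IsF X G
  del-isF f (ab , s) = suppress-isF (cut-pre f ab) s

  del-eqv : ∀ {X F a b G} → IsF X F → DelEdge F a b G → Eqv (On X) (del (Adj F) a b) (Adj G)
  del-eqv {X} {F} {a} {b} {G} f (ab , s) = eqv-cong C.cut⁻ C.cut⁺ (λ r → r) (λ r → r) (Suppressed.eqvX (suppress-star (cut-pre f ab) (proj₁ s)))
    where module C = CutEdge {F} {a} {b} (IsF.simple f) ab

  CutOK : ∀ {X F F' n} → St X F F' n → ℕ → ℕ → Set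
  CutOK {X} {F} st a b = Σ ℕ λ c → Σ ℕ λ d → Ad ES c d × ¬ Ad ES' c d × SameSplit (On X) (Adj F) a b (Ad ES) c d × Star (del (Ad EN) c d) c d
    where open St st

  cutOK-cong : ∀ {X F F' n a b e f} {st : St X F F' n} → Joins a b (e , f) → CutOK st a b → CutOK st e f
  cutOK-cong (inj₁ (refl , refl)) k = k
  cutOK-cong (inj₂ (refl , refl)) (c , d , p , q , i , r) = c , d , p , q , (λ x y → (λ s → proj₁ (i x y) (mono del-comm s)) , (λ s → mono del-comm (proj₂ (i x y) s))) , r

  -- Deleting the matching edge from N lowers |E| + 1 - |V| by one.
  st-cut : ∀ {X F F' n a b} (st : St X F F' n) → IsF X F → Adj F a b → CutOK st a b → Σ ℕ λ n' → n ≡ suc n' × St X (cutC F a b) F' n'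
  st-cut {X} {F} {F'} {n} {a} {b} st f ab (c , d , cd , ncd , i , nb) = go n cnt
    where
    open St st
    EN' : Edges
    EN' = delE c d EN
    dec : length EN' < length EN
    dec = filter-notAll (λ e → ¬? (joins? c d e)) EN ([ (λ m → lose m λ k → k (inj₁ (refl , refl))) , (λ m → lose m λ k → k (inj₂ (refl , refl))) ] (S⊆ cd))
    to' : ∀ {es} → del (Ad es) c d ⊑ Ad (delE c d es)
    to' (r , k) = ad-delE⁺ r k
    fr' : ∀ {es} → Ad (delE c d es) ⊑ del (Ad es) c d
    fr' r = let (p , k) = ad-delE⁻ r in p , k
    con' : ∀ {x y} → x ∈ vs → y ∈ vs → Star (Ad EN') x y
    con' mx my = Star.kleisliStar (λ x → x) f1 (con mx my)
      where
      f1 : ∀ {x y} → Ad EN x y → Star (Ad EN') x y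
      f1 {x} {y} r with joins? c d (x , y)
      ... | no k = one (to' (r , k))
      ... | yes (inj₁ (refl , refl)) = mono to' nb
      ... | yes (inj₂ (refl , refl)) = star-sym swap (mono to' nb)
    mk : ∀ n' → length EN' + 1 ≤ n' + length vs → St X (cutC F a b) F' n'
    mk n' le = record { EN = EN' ; ES = delE c d ES ; ES' = ES' ; vs = vs ; vsU = vsU
      ; ends = λ r → ends (kept (fr' {EN} r)) ; con = con' ; cnt = le
      ; S⊆ = λ r → let (p , k) = fr' {ES} r in to' (S⊆ p , k)
      ; S'⊆ = λ r → to' (S'⊆ r , λ { (inj₁ (refl , refl)) → ncd r ; (inj₂ (refl , refl)) → ncd (swap r) })
      ; foS = forest-⊑ (λ r → kept (fr' {ES} r)) foS ; foS' = foS' ; X⊆ = X⊆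
      ; eS = on-trans (on-flip (del-eqv f (cutC-del f ab))) (eqv-cong (λ r → r) (λ r → r) to' fr' (eqv-del (adj-listed F) (listed-Ad ES) (IsF.forest f) foS i eS))
      ; eS' = eS' }
    go : ∀ n → length EN + 1 ≤ n + length vs → Σ ℕ λ n' → n ≡ suc n' × St X (cutC F a b) F' n'
    go zero le = ⊥-elim (1+n≰n (≤-trans (≤-trans (≤-reflexive (sym (+-comm (length EN) 1))) (≤-trans le (connected-size EN' vs vsU con'))) dec))
    go (suc n') le = n' , refl , mk n' (≤-trans (≤-reflexive (+-comm (length EN') 1)) (≤-trans dec (s≤s⁻¹ (subst (_≤ suc (n' + length vs)) (+-comm (length EN) 1) le))))

  record CutCtx (X : List ℕ) (F F' : Graph) (n : ℕ) : Set₁ where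
    field
      st : St X F F' n
      f : IsF X F
      tight : Tight st
      B : ℕ → Set
      safe : ∀ {x₁ x₂ c d} → B x₁ → B x₂ → Star (Ad (St.ES st)) x₁ x₂ → Ad (St.ES st) c d → ¬ Ad (St.ES' st) c d →
        ¬ Star (del (Ad (St.ES st)) c d) x₁ x₂ → Star (del (Ad (St.EN st)) c d) c d

  module Cuts {X F F' n} (cc : CutCtx X F F' n) where

    open CutCtx cc
    open St st
    open OnF f using (lF; sF)

    agree→F : ∀ {x y} → x ∈ X → y ∈ X → Star I x y → Star (Adj F) x y
    agree→F mx my s = conn (bwd eS) (on mx) (on my) (mono inl s)

    matching : ∀ {a b x y} → Adj F a b → x ∈ X → y ∈ X → Star (Adj F) x y → ¬ Star (del (Adj F) a b) x y →
      Σ ℕ λ c → Σ ℕ λ d → Ad ES c d × SameSplit (On X) (Adj F) a b (Ad ES) c d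
    matching ab mx my s n with match (fwd eS) ab
    ... | inj₁ t = ⊥-elim (n (t (on mx) (on my) s))
    ... | inj₂ r = r

    sepOK : ∀ {x₁ x₂} → x₁ ∈ X → x₂ ∈ X → B x₁ → B x₂ → Star (Adj F) x₁ x₂ → ¬ Star I x₁ x₂ →
      Σ ℕ λ a → Σ ℕ λ b → Adj F a b × CutOK st a b × ¬ Star (del (Adj F) a b) x₁ x₂ ×
        (∀ {p q} → p ∈ X → q ∈ X → Star I p q → Star (del (Adj F) a b) p q)
    sepOK {x₁} {x₂} m₁ m₂ b₁ b₂ s n with separating (listed-Ad ES) foS (ad? ES') swap (conn (fwd eS) (on m₁) (on m₂) s) n
    ... | c , d , cd , ncd , k with match (bwd eS) cd
    ...   | inj₁ t = ⊥-elim (k (t (on m₁) (on m₂) (conn (fwd eS) (on m₁) (on m₂) s)))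
    ...   | inj₂ (a , b , ab , i) = a , b , ab , (c , d , cd , ncd , (λ { (on p) (on q) → let j = i (on p) (on q) in proj₂ j , proj₁ j }) , safe b₁ b₂ (conn (fwd eS) (on m₁) (on m₂) s) cd ncd k) ,
              (λ z → k (proj₂ (i (on m₁) (on m₂)) z)) ,
              (λ p q z → proj₁ (i (on p) (on q)) (mono (λ { (u , v) → u , λ { (inj₁ (refl , refl)) → ncd v ; (inj₂ (refl , refl)) → ncd (swap v) } }) z))

    tightOK : ∀ {a b x₁ x₂} → Adj F a b → x₁ ∈ X → x₂ ∈ X → B x₁ → B x₂ → Star (Adj F) x₁ x₂ → ¬ Star (del (Adj F) a b) x₁ x₂ →
      (∀ {p r} → p ∈ X → r ∈ X → Star I p r → Star (del (Adj F) a b) p r) → CutOK st a b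
    tightOK ab m₁ m₂ b₁ b₂ s n h with matching ab m₁ m₂ s n
    ... | c , d , cd , i = c , d , cd , ncd , i , safe b₁ b₂ (conn (fwd eS) (on m₁) (on m₂) s) cd ncd (λ z → n (proj₂ (i (on m₁) (on m₂)) z))
      where
      ncd : ¬ Ad ES' c d
      ncd cd' with tight (cd , cd')
      ... | p , r , pX , rX , t , k = k (helly swap (symm iL) inl foS t (proj₁ (i (on pX) (on rX)) (h pX rX t)))

  cherry-sym : ∀ {F x y} → Cherry F x y → Cherry F y x
  cherry-sym {F} (ne , lx , ly , inj₁ a) = (λ e → ne (sym e)) , ly , lx , inj₁ (adj-sym F a)
  cherry-sym (ne , lx , ly , inj₂ (v , p , q)) = (λ e → ne (sym e)) , ly , lx , inj₂ (v , q , p)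

  leaf? : ∀ F x → Dec (Leaf F x)
  leaf? F x = (x ∈? V F) ×-dec (deg F x ≤? 1)

  module CherryF {X F} (f : IsF X F) where
    open OnF f

    abstract
      cherry? : ∀ x y → Dec (Cherry F x y)
      cherry? x y = ¬? (x ≟ y) ×-dec leaf? F x ×-dec leaf? F y ×-dec (adj? F x y ⊎-dec
        map′ (λ p → let (v , _ , q) = find p in v , q) (λ { (v , q) → lose (proj₁ (proj₂ (adj-∈ {F} wfF (proj₁ q)))) q }) (any? (λ v → adj? F x v ×-dec adj? F y v) (V F)))

    leaf→X : ∀ {x} → Leaf F x → x ∈ X
    leaf→X (m , d) = [ (λ i → i) , (λ e → case subst (_≤ 1) e d of λ { (s≤s ()) }) ] (inner m)

    X→leaf : ∀ {x} → x ∈ X → Leaf F x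
    X→leaf m = lab m , leaf m

    abstract
      inCherry? : ∀ x → Dec (InCherry F x)
      inCherry? x = map′ (λ p → let (z , _ , c) = find p in z , c) (λ { (z , c) → lose (leaf→X (proj₁ (proj₂ (proj₂ c)))) c }) (any? (cherry? x) X)

    mk-cherry : ∀ {x y u} → x ≢ y → x ∈ X → y ∈ X → Adj F x u → Adj F y u → Cherry F x y
    mk-cherry {u = u} ne mx my p q = ne , X→leaf mx , X→leaf my , inj₂ (u , p , q)

    cherry-star : ∀ {x y} → Cherry F x y → Star (Adj F) x y
    cherry-star (_ , _ , _ , inj₁ a) = one a
    cherry-star (_ , _ , _ , inj₂ (v , p , q)) = p ◅ one (sF q)

    cherry-mid : ∀ {x y w} → Cherry F x y → w ∈ X → Star (Adj F) x w → w ≢ x → w ≢ y → Σ ℕ λ u → Σ ℕ λ k → Tri F u k x y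
    cherry-mid {x} {y} {w} (ne , lx , ly , inj₁ a) wX s nx ny = ⊥-elim (go {lx = lx} {ly} {a} s nx ny)
      where
      go : ∀ {x y w} → {lx : Leaf F x} → {ly : Leaf F y} → {a : Adj F x y} → Star (Adj F) x w → w ≢ x → w ≢ y → ⊥
      go ε nx ny = nx refl
      go {lx = lx} {ly} {a} (r ◅ s) nx ny with nbr1 (leaf→X lx) r a
      ... | refl = go {lx = ly} {lx} {sF a} s ny nx
    cherry-mid {x} {y} {w} (ne , lx , ly , inj₂ (u , xu , yu)) wX s nx ny with tri-at {u} {x} (λ i → ne (nbr1 i (sF xu) (sF yu))) (sF xu)
    ... | c , d , t with only3 t (sF yu)
    ...   | inj₁ e = ⊥-elim (ne (sym e))
    ...   | inj₂ (inj₁ refl) = u , d , tri-rot {F} (tri-swap {F} t)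
    ...   | inj₂ (inj₂ refl) = u , c , tri-rot {F} t

    off-cherry : ∀ {u k x y w} → Tri F u k x y → x ∈ X → y ∈ X → w ∈ X → w ≢ x → w ≢ y → ¬ Star (del (Adj F) u k) u w
    off-cherry {w = w} t mx my mw nx ny s with tri-side t s (λ { refl → tri-∉ t mw })
    ... | inj₁ z = nx (sym (leaf-side mx (sF (vb t)) z))
    ... | inj₂ z = ny (sym (leaf-side my (sF (vc t)) z))

    off-cherry′ : ∀ {u k x y w} → Tri F u k x y → x ∈ X → y ∈ X → w ∈ X → w ≢ x → w ≢ y → Star (Adj F) u w → Star (del (Adj F) u k) k w
    off-cherry′ {u} {k} t mx my mw nx ny s with cross sF u k s
    ... | inj₁ z = ⊥-elim (off-cherry t mx my mw nx ny z)
    ... | inj₂ (_ , inj₁ (_ , z)) = z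
    ... | inj₂ (_ , inj₂ (_ , z)) = ⊥-elim (off-cherry t mx my mw nx ny z)

    edge-in : ∀ {u a b m n} → Adj F m n → m ≡ u → (a ≡ u × n ≢ b × n ≢ u) → del (Adj F) a b m n
    edge-in r refl (refl , nb , nu) = r , λ { (inj₁ (_ , e)) → nb e ; (inj₂ (_ , e)) → nu e }

    tri-in : ∀ {u k x y} → Tri F u k x y → del (Adj F) u k u x × del (Adj F) u k u y
    tri-in t = edge-in (vb t) refl (refl , (λ e → a≢b t (sym e)) , (λ e → forest-≢ forest (vb t) (sym e))) ,
               edge-in (vc t) refl (refl , (λ e → a≢c t (sym e)) , (λ e → forest-≢ forest (vc t) (sym e)))

    sides-disjoint : ∀ {v a b c n} → Tri F v a b c → Star (del (Adj F) b v) b n → Star (del (Adj F) c v) c n → ⊥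
    sides-disjoint {v} {a} {b} {c} t p q = forest (vc t) (extend (vb t) (b≢c t) p ◅◅ star-sym (del-sym v c sF) (mono del-comm q))

    only-label : ∀ {k u y} → Adj F k u → (∀ {l} → l ∈ X → Star (del (Adj F) k u) k l → l ≡ y) → k ≡ y
    only-label {k} {u} {y} ku h = decide (k ∈? X) (λ kX → h kX ε) (λ n → ⊥-elim (go (tri-at n ku)))
      where
      go : (Σ ℕ λ c → Σ ℕ λ d → Tri F k u c d) → ⊥
      go (c , d , t) = let (l , lX , s) = beyond c k (sF (vb t)) ; (l' , lX' , s') = beyond d k (sF (vc t)) in
        sides-disjoint t s (subst (Star (del (Adj F) d k) d)
          (trans (h lX' (extend (vc t) (λ e → a≢c t (sym e)) s')) (sym (h lX (extend (vb t) (λ e → a≢b t (sym e)) s)))) s')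

open NetworkCuts

module PaidSteps where

  data Out {X F F' n} (st : St X F F' n) : Set where
    cutL : ∀ x {a b} → Adj F a b → CutOK st a b → C2 x F F' (cutC F a b) F' ⊎ C2 x F' F F' (cutC F a b) → Out st
    cutR : ∀ x {a b} → Adj F' a b → CutOK (st-swap st) a b → C2 x F F' F (cutC F' a b) ⊎ C2 x F' F (cutC F' a b) F → Out st

  out-swap : ∀ {X F F' n} {st : St X F F' n} → Out (st-swap st) → Out st
  out-swap (cutL x r k c) = cutR x r k (swap c)
  out-swap (cutR x r k c) = cutL x r k (swap c)

  pend-id : ∀ {X F F' n} {st : St X F F' n} (f : IsF X F) {x y a b} → Cherry F x y → CutOK st a b → ¬ Star (del (Adj F) a b) x y →
    Σ ℕ λ e → Σ ℕ λ g → Adj F e g × CutOK st e g × DelPendXY F x y (cutC F e g)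
  pend-id {F = F} {st = st} f {x} {y} {a} {b} (_ , _ , _ , inj₁ xy) ok n with joins? a b (x , y)
  ... | yes j = x , y , xy , cutOK-cong {st = st} j ok , inj₁ (y , cutC-del f xy)
  ... | no k = ⊥-elim (n (one (xy , k)))
  pend-id {F = F} {st = st} f {x} {y} {a} {b} (_ , _ , _ , inj₂ (u , xu , yu)) ok n with joins? a b (x , u) | joins? a b (y , u)
  ... | yes j | _ = x , u , xu , cutOK-cong {st = st} j ok , inj₁ (u , cutC-del f xu)
  ... | no _ | yes j = y , u , yu , cutOK-cong {st = st} j ok , inj₂ (u , cutC-del f yu)
  ... | no k | no k' = ⊥-elim (n ((xu , k) ◅ one (adj-sym F yu , λ j → k' (joins-flip j))))

  record PaidCtx (X : List ℕ) (F F' : Graph) (r : ℕ) : Set₁ where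
    field
      st : St X F F' r
      f : IsF X F
      f' : IsF X F'
      tight : Tight st
      ni : ∀ {x} → x ∈ X → Σ ℕ λ m → Adj F x m
      ni' : ∀ {x} → x ∈ X → Σ ℕ λ m → Adj F' x m
      nc : ∀ {x y} → Cherry F x y → ¬ Cherry F' x y
      R : Root st

  module Paid {X F F' r} (ctx : PaidCtx X F F' r) where

    open PaidCtx ctx
    open St st
    open Root R
    module O = OnF f
    module O' = OnF f'
    module K = CherryF f
    module K' = CherryF f'
    private
      cuts : CutCtx X F F' r
      cuts = record { st = st ; f = f ; tight = tight ; B = B ; safe = safe }
      cuts' : CutCtx X F' F r
      cuts' = record { st = st-swap st ; f = f' ; tight = tight-swap {s = st} tight ; B = B ; safe = safe' }
    module C = Cuts cuts
    module C' = Cuts cuts'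

    private
      flipI : ∀ {x y} → Star I x y → Star (St.I (st-swap st)) x y
      flipI = mono (λ { (p , q) → q , p })
      unflipI : ∀ {x y} → Star (St.I (st-swap st)) x y → Star I x y
      unflipI = mono (λ { (p , q) → q , p })
      sI : Symm I
      sI = symm iL
      RF RF' : Gr
      RF = Adj F
      RF' = Adj F'

      agree→F' : ∀ {x y} → x ∈ X → y ∈ X → Star I x y → Star RF' x y
      agree→F' mx my s = C'.agree→F mx my (flipI s)

    legalXY : ∀ {x y G} → Cherry F x y → DelPendXY F x y G → Σ ℕ λ z → C2 z F F' G F'
    legalXY {x} {y} {G} c d = go (K'.inCherry? x) (K'.inCherry? y) (conn? O'.lF x y)
      where
      mx : x ∈ X
      mx = K.leaf→X (proj₁ (proj₂ c))
      my : y ∈ X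
      my = K.leaf→X (proj₁ (proj₂ (proj₂ c)))
      nz : ∀ {w} → w ∈ X → deg F' w ≢ 0
      nz {w} m e = deg-0 O'.simple {w} e (proj₁ (ni' m)) (proj₂ (ni' m))
      go : Dec (InCherry F' x) → Dec (InCherry F' y) → Dec (Star RF' x y) → Σ ℕ λ z → C2 z F F' G F'
      go (yes (z , cz)) _ _ = x , y , c , inj₁ (z , cz , (λ { refl → nc c cz }) , refl , inj₁ d)
      go (no _) (yes (z , cz)) _ = y , x , cherry-sym {F} c , inj₁ (z , cz , (λ { refl → nc c (cherry-sym {F'} cz) }) , refl , inj₁ (swap d))
      go (no nx) (no ny) (yes r) = x , y , c , inj₂ (inj₁ (r , K'.X→leaf mx , K'.X→leaf my , nx , ny , inj₁ (refl , d)))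
      go (no nx) (no ny) (no nr) = x , y , c , inj₂ (inj₂ (nr , nz mx , nz my , nx , ny , refl , d))

    caseA : ∀ {x y z} → Cherry F x y → Cherry F' x z → B x → (Star I x z → Out st) → Out st
    caseA {x} {y} {z} c cz bx k with conn? iL x z
    ... | yes s = k s
    ... | no n = fin (C'.sepOK mx mz bx (closed' mx mz bx (K'.cherry-star cz)) (K'.cherry-star cz) (λ s → n (unflipI s)))
      where
      mx : x ∈ X
      mx = K.leaf→X (proj₁ (proj₂ c))
      mz : z ∈ X
      mz = K'.leaf→X (proj₁ (proj₂ (proj₂ cz)))
      fin : (Σ ℕ λ a → Σ ℕ λ b → RF' a b × CutOK (st-swap st) a b × ¬ Star (del RF' a b) x z × _) → Out st
      fin (a , b , ab , ok , ns , _) with pend-id {st = st-swap st} f' cz ok ns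
      ... | e , g , eg , ok' , d = cutR x {e} {g} eg ok' (inj₂ (z , cz , inj₁ (y , c , (λ { refl → nc c cz }) , refl , inj₁ d)))

    record Dir (x y : ℕ) : Set where
      field
        v n h : ℕ
        xv : RF' x v
        t : Tri F' v x n h
        ny : Star (del RF' n v) n y

    dir : ∀ {x y} → x ∈ X → y ∈ X → x ≢ y → Star RF' x y → ¬ InCherry F' x → Dir x y
    dir {x} {y} mx my ne s nx with ni' mx
    ... | v , xv with O'.tri-at {v} {x} (λ i → nx (v , forest-≢ O'.forest xv , K'.X→leaf mx , K'.X→leaf i , inj₁ xv)) (O'.sF xv)
    ... | n₁ , n₂ , t = go (O'.tri-side t vy (λ { refl → O'.tri-∉ t my }))
      where
      vy : Star (del RF' v x) v y
      vy with cross O'.sF v x (O'.sF xv ◅ s)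
      ... | inj₁ z = z
      ... | inj₂ (_ , inj₁ (_ , z)) = ⊥-elim (ne (O'.leaf-side mx xv (mono del-comm z)))
      ... | inj₂ (_ , inj₂ (_ , z)) = z
      go : Star (del RF' n₁ v) n₁ y ⊎ Star (del RF' n₂ v) n₂ y → Dir x y
      go (inj₁ z) = record { xv = xv ; t = t ; ny = z }
      go (inj₂ z) = record { xv = xv ; t = tri-swap {F'} t ; ny = z }

    module AtX {x y : ℕ} (mx : x ∈ X) (my : y ∈ X) (D : Dir x y) (xy : Star I x y) where
      open Dir D

      F'xy : Star RF' x y
      F'xy = agree→F' mx my xy

      nxy : ¬ Star (del RF' v n) x y
      nxy z = O'.forest (vb t) ((va t , λ { (inj₁ (_ , e)) → a≢b t e ; (inj₂ (_ , e)) → O'.tri-∉ t (subst (_∈ X) e mx) }) ◅ z ◅◅ star-sym (del-sym v n O'.sF) (mono del-comm ny))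

      vp : ∀ {p} → Star (del RF' h v) h p → Star (del RF' v n) v p
      vp hp = O'.extend (vc t) (λ e → b≢c t (sym e)) hp

      vx-in : del RF' v h v x
      vx-in = va t , λ { (inj₁ (_ , e)) → a≢c t e ; (inj₂ (_ , e)) → O'.tri-∉ t (subst (_∈ X) e mx) }

      h≢x : ∀ {p} → Star (del RF' h v) h p → p ≢ x
      h≢x hp refl = K'.sides-disjoint (tri-rot {F'} t) ε hp

      h≢y : ∀ {p} → Star (del RF' h v) h p → p ≢ y
      h≢y hp refl = K'.sides-disjoint t ny hp

      module _ (none : ∀ {p} → p ∈ X → Star (del RF' h v) h p → ¬ Star I x p) where

        private
          npr : ∀ {p r} → r ∈ X → r ≢ x → Star (del RF' h v) h p → Star (del RF' v h) v r → ¬ Star (del RF' v n) p r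
          npr {p} {r} mr ne hp vr z with toward (star-sym (del-sym v n (del-sym v h O'.sF)) (helly O'.sF (del-sym v h O'.sF) del⊑ O'.forest vr (vp hp ◅◅ z))) (λ { refl → O'.tri-∉ t mr })
          ... | m , ((mv , k₁) , k₂) , s with only3 t (O'.sF mv)
          ...   | inj₁ refl = ne (sym (O'.leaf-side mx xv (star-sym (del-sym x v O'.sF) (mono (λ { (((r , _) , _) , j) → r , λ j' → j (joins-comm j') }) s))))
          ...   | inj₂ (inj₁ refl) = k₂ (inj₂ (refl , refl))
          ...   | inj₂ (inj₂ refl) = k₁ (inj₂ (refl , refl))

          bad : ∀ {p r} → p ∈ X → r ∈ X → Star I p r → Star (del RF' v h) p h → Star (del RF' v h) v r → ⊥
          bad {p} {r} mp mr s ph vr with r ≟ x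
          ... | yes refl = none mp (mono del-comm (star-sym (del-sym v h O'.sF) ph)) (star-sym sI s)
          ... | no ne with C'.matching (vb t) mx my F'xy nxy
          ...   | c₁ , d₁ , _ , i = none mp hp (share sI {c₁} {d₁} xy s
                     (λ z → nxy (proj₂ (i (on mx) (on my)) (mono (del-mono inr) z)))
                     (λ z → npr mr ne hp vr (proj₂ (i (on mp) (on mr)) (mono (del-mono inr) z))))
            where
            hp : Star (del RF' h v) h p
            hp = mono del-comm (star-sym (del-sym v h O'.sF) ph)

          keep : ∀ {p r} → p ∈ X → r ∈ X → Star I p r → Star (del RF' v h) p r
          keep {p} {r} mp mr s with conn? (listed-del O'.lF v h) p r
          ... | yes z = z
          ... | no nz with cross! O'.sF v h (agree→F' mp mr s) nz
          ...   | _ , inj₁ (p₁ , p₂) = ⊥-elim (bad mr mp (star-sym sI s) (star-sym (del-sym v h O'.sF) p₂) (star-sym (del-sym v h O'.sF) p₁))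
          ...   | _ , inj₂ (p₁ , p₂) = ⊥-elim (bad mp mr s p₁ p₂)

        cutB : Cherry F x y → B x → ¬ InCherry F' x → ¬ InCherry F' y → Out st
        cutB c bx nx ny' with O'.beyond h v (O'.sF (vc t))
        ... | p₀ , m₀ , s₀ = cutR x {v} {h} (vc t) ok (inj₁ (y , c , inj₂ (inj₁ (F'xy , K'.X→leaf mx , K'.X→leaf my , nx , ny' , inj₂ (v , h , xv , vc t , (λ e → a≢c t (sym e)) ,
                not-on-path {F'} O'.forest (vc t) (del-sym v h O'.sF vx-in ◅ O'.extend (vb t) (b≢c t) ny) , cutC-del {a = v} {h} f' (vc t) , refl)))))
          where
          xp₀ : Star RF' x p₀
          xp₀ = xv ◅ (vc t ◅ mono del⊑ s₀)
          ok : CutOK (st-swap st) v h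
          ok = C'.tightOK (vc t) mx m₀ bx (closed' mx m₀ bx xp₀) xp₀ (λ z → O'.forest (vc t) (vx-in ◅ (z ◅◅ star-sym (del-sym v h O'.sF) (mono del-comm s₀)))) (λ mp mr s → keep mp mr (unflipI s))

    module Clash {x y : ℕ} (mx : x ∈ X) (my : y ∈ X) (c : Cherry F x y) (nx : ¬ InCherry F' x) (D : Dir x y) (D₂ : Dir y x) (xy : Star I x y)
      {p p' : ℕ} (mp : p ∈ X) (mp' : p' ∈ X) (hp : Star (del RF' (Dir.h D) (Dir.v D)) (Dir.h D) p) (hp' : Star (del RF' (Dir.h D₂) (Dir.v D₂)) (Dir.h D₂) p')
      (xp : Star I x p) (yp' : Star I y p') where
      private
        module A₁ = AtX mx my D xy
        module A₂ = AtX my mx D₂ (star-sym sI xy)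
        open Dir D
        open Dir D₂ renaming (v to v₂; n to m₂; h to h₂; xv to yv₂; t to t₂; ny to mx₂)

        v₂≢v : v₂ ≢ v
        v₂≢v refl = nx (y , K'.mk-cherry (proj₁ c) mx my xv yv₂)

        vx₂ : del RF' h₂ v₂ v x
        vx₂ = va t , λ { (inj₁ (_ , e)) → O'.tri-∉ t₂ (subst (_∈ X) e mx) ; (inj₂ (e , _)) → v₂≢v (sym e) }

        not-h₂x : ¬ Star (del RF' h₂ v₂) h₂ x
        not-h₂x s = K'.sides-disjoint t₂ mx₂ s

        e₁ : del RF' v n y v₂
        e₁ = yv₂ , λ { (inj₁ (e , _)) → O'.tri-∉ t (subst (_∈ X) e my) ; (inj₂ (_ , e)) → v₂≢v e }

        e₂ : del RF' v n v₂ h₂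
        e₂ = vc t₂ , λ { (inj₁ (e , _)) → v₂≢v e ; (inj₂ (_ , refl)) → not-h₂x (one vx₂) }

        e₃ : Star (del RF' v n) h₂ p'
        e₃ with cross (del-sym h₂ v₂ O'.sF) v n hp'
        ... | inj₁ z = mono (λ { ((r , _) , k) → r , k }) z
        ... | inj₂ (_ , inj₁ (z , _)) = ⊥-elim (not-h₂x (mono del⊑ z ◅◅ one vx₂))
        ... | inj₂ (e , inj₂ (z , _)) = ⊥-elim (not-h₂x (mono del⊑ z ◅◅ (del-sym h₂ v₂ O'.sF e ◅ one vx₂)))

        npp : ¬ Star (del RF' v n) p p'
        npp z = O'.forest (vb t) (A₁.vp hp ◅◅ z ◅◅ star-sym (del-sym v n O'.sF) (e₁ ◅ (e₂ ◅ e₃)) ◅◅ star-sym (del-sym v n O'.sF) (mono del-comm ny))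

      clash : ⊥
      clash with K.cherry-mid c mp (C.agree→F mx mp xp) (A₁.h≢x hp) (A₁.h≢y hp)
      ... | u , k , tu = body
        where
        off : ∀ {w} → w ∈ X → w ≢ x → w ≢ y → Star RF x w → Star (del RF u k) k w
        off mw a b s = K.off-cherry′ tu mx my mw a b (vb tu ◅ s)
        nxp : ¬ Star (del RF u k) x p
        nxp z = K.off-cherry tu mx my mp (A₁.h≢x hp) (A₁.h≢y hp) (proj₁ (K.tri-in tu) ◅ z)
        body : ⊥
        body with C.matching (va tu) mx mp (C.agree→F mx mp xp) nxp | C'.matching (vb t) mx my A₁.F'xy A₁.nxy
        ... | c₁ , d₁ , _ , i | c' , d' , _ , i' = nxp (proj₂ (i (on mx) (on mp)) (mono (del-mono inl) sh))
          where
          Axy : Star (del I c₁ d₁) x y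
          Axy = helly swap sI inl foS xy (proj₁ (i (on mx) (on my)) (del-sym u k O.sF (proj₁ (K.tri-in tu)) ◅ one (proj₂ (K.tri-in tu))))
          pp : Star I p p'
          pp = star-sym sI xp ◅◅ xy ◅◅ yp'
          App : Star (del I c₁ d₁) p p'
          App = helly swap sI inl foS pp (proj₁ (i (on mp) (on mp')) (star-sym (del-sym u k O.sF) (off mp (A₁.h≢x hp) (A₁.h≢y hp) (C.agree→F mx mp xp)) ◅◅
                  off mp' (A₂.h≢y hp') (A₂.h≢x hp') (C.agree→F mx mp' (xy ◅◅ yp'))))
          sh : Star (del I c₁ d₁) x p
          sh = share (del-sym c₁ d₁ sI) {c'} {d'} Axy App
            (λ z → A₁.nxy (proj₂ (i' (on mx) (on my)) (mono (λ { ((r , _) , q) → inr r , q }) z)))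
            (λ z → npp (proj₂ (i' (on mp) (on mp')) (mono (λ { ((r , _) , q) → inr r , q }) z)))

    module CaseB {x y : ℕ} (mx : x ∈ X) (my : y ∈ X) (c : Cherry F x y) (bx : B x) (by : B y) (xy : Star I x y)
      (nx : ¬ InCherry F' x) (ny : ¬ InCherry F' y) (D : Dir x y) (D₂ : Dir y x) where

      private
        Used : ∀ {u w} → Dir u w → ℕ → Set
        Used {u} E p = Star (del RF' (Dir.h E) (Dir.v E)) (Dir.h E) p × Star I u p

        used? : ∀ {u w} (E : Dir u w) → Dec (Any (Used E) X)
        used? {u} E = any? (λ p → conn? (listed-del O'.lF (Dir.h E) (Dir.v E)) (Dir.h E) p ×-dec conn? iL u p) X

        go : Dec (Any (Used D) X) → Dec (Any (Used D₂) X) → Out st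
        go (no np) _ = AtX.cutB mx my D xy (λ mp hp s → np (lose mp (hp , s))) c bx nx ny
        go (yes _) (no np) = AtX.cutB my mx D₂ (star-sym sI xy) (λ mp hp s → np (lose mp (hp , s))) (cherry-sym {F} c) by ny nx
        go (yes q) (yes q') with find q | find q'
        ... | p , mp , hp , xp | p' , mp' , hp' , yp' = ⊥-elim (Clash.clash mx my c nx D D₂ xy mp mp' hp hp' xp yp')

      out : Out st
      out = go (used? D) (used? D₂)

    caseB : ∀ {x y} → Cherry F x y → B x → B y → Star I x y → ¬ InCherry F' x → ¬ InCherry F' y → Out st
    caseB {x} {y} c bx by xy nx ny = CaseB.out mx my c bx by xy nx ny
        (dir mx my (proj₁ c) (agree→F' mx my xy) nx) (dir my mx (λ e → proj₁ c (sym e)) (agree→F' my mx (star-sym sI xy)) ny)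
      where
      mx : x ∈ X
      mx = K.leaf→X (proj₁ (proj₂ c))
      my : y ∈ X
      my = K.leaf→X (proj₁ (proj₂ (proj₂ c)))

    cherry-main : ∀ {x y} → Cherry F x y → B x → B y →
      (∀ {z} → Cherry F' x z → z ≢ y → Star I x y → Star I x z → Out st) →
      (∀ {z} → Cherry F' y z → z ≢ x → Star I y x → Star I y z → Out st) → Out st
    cherry-main {x} {y} c bx by A₁ A₂ = go (conn? iL x y)
      where
      mx : x ∈ X
      mx = K.leaf→X (proj₁ (proj₂ c))
      my : y ∈ X
      my = K.leaf→X (proj₁ (proj₂ (proj₂ c)))
      agree : Star I x y → Dec (InCherry F' x) → Dec (InCherry F' y) → Out st
      agree s (yes (z , cz)) _ = caseA c cz bx (A₁ cz (λ { refl → nc c cz }) s)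
      agree s (no _) (yes (z , cz)) = caseA (cherry-sym {F} c) cz by (A₂ cz (λ { refl → nc c (cherry-sym {F'} cz) }) (star-sym sI s))
      agree s (no nx) (no ny) = caseB c bx by s nx ny
      go : Dec (Star I x y) → Out st
      go (yes s) = agree s (K'.inCherry? x) (K'.inCherry? y)
      go (no ns) = let (a , b , ab , ok , k , _) = C.sepOK mx my bx by (K.cherry-star c) ns in out (pend-id {st = st} f {a = a} {b} c ok k)
        where
        out : (Σ ℕ λ e → Σ ℕ λ g → RF e g × CutOK st e g × DelPendXY F x y (cutC F e g)) → Out st
        out (e , g , eg , ok' , d) = let (z , l) = legalXY {G = cutC F e g} c d in cutL z {e} {g} eg ok' (inj₁ l)

    private
      sF : Symm RF
      sF = O.sF

    module DA (D : O.Deep a b) {z : ℕ} (cz : Cherry F' (O.Deep.x D) z) (zy : z ≢ O.Deep.y D)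
      (xy : Star I (O.Deep.x D) (O.Deep.y D)) (xz : Star I (O.Deep.x D) z) where

      open O.Deep D

      private
        zX : z ∈ X
        zX = K'.leaf→X (proj₁ (proj₂ (proj₂ cz)))
        zx : z ≢ x
        zx e = proj₁ cz (sym e)
        yx : y ≢ x
        yx e = b≢c tu (sym e)

        F'xy : Star RF' x y
        F'xy = C'.agree→F xX yX (mono (λ { (p , q) → q , p }) xy)

        agreeF : ∀ {p} → p ∈ X → Star I x p → Star RF x p
        agreeF = C.agree→F xX

        no-xz : ¬ Star (del RF u v) x z
        no-xz s = K.off-cherry tu xX yX zX zx zy (proj₁ (K.tri-in tu) ◅ s)

        cxy : Cherry F x y
        cxy = K.mk-cherry (b≢c tu) xX yX (sF (vb tu)) (sF (vc tu))

        above-F' : Σ ℕ λ u' → Σ ℕ λ k' → Tri F' u' k' x z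
        above-F' = K'.cherry-mid cz yX F'xy yx (λ e → zy (sym e))

        -- no fourth label agrees with x, y, z: the quartets xy|zp of F and xz|yp of F' conflict
        quartet : ∀ {p} → p ∈ X → p ≢ x → p ≢ y → p ≢ z → ¬ Star I x p
        quartet {p} pX px py pz xp with above-F'
        ... | u' , k' , t' with C.matching (va tu) xX zX (agreeF zX xz) no-xz | C'.matching (va t') xX yX F'xy nxy'
          where
          nxy' : ¬ Star (del RF' u' k') x y
          nxy' s = K'.off-cherry t' xX zX yX yx (λ e → zy (sym e)) (proj₁ (K'.tri-in t') ◅ s)
        ...   | c , d , _ , i | c' , d' , _ , i' = no-xz (proj₂ (i (on xX) (on zX)) (mono (del-mono inl) sh))
          where
          off : ∀ {w} → w ∈ X → w ≢ x → w ≢ y → Star I x w → Star (del RF u v) v w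
          off mw e e' s = K.off-cherry′ tu xX yX mw e e' (vb tu ◅ agreeF mw s)
          Axy : Star (del I c d) x y
          Axy = helly swap sI inl foS xy (proj₁ (i (on xX) (on yX)) (del-sym u v sF (proj₁ (K.tri-in tu)) ◅ one (proj₂ (K.tri-in tu))))
          Azp : Star (del I c d) z p
          Azp = helly swap sI inl foS (star-sym sI xz ◅◅ xp) (proj₁ (i (on zX) (on pX)) (star-sym (del-sym u v sF) (off zX zx zy xz) ◅◅ off pX px py xp))
          sh : Star (del I c d) x z
          sh = share (del-sym c d sI) {c'} {d'} Axy Azp
            (λ s → K'.off-cherry t' xX zX yX yx (λ e → zy (sym e)) (proj₁ (K'.tri-in t') ◅ proj₂ (i' (on xX) (on yX)) (mono (λ { ((q , _) , k) → inr q , k }) s)))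
            (λ s → K'.off-cherry t' xX zX pX px pz (proj₂ (K'.tri-in t') ◅ proj₂ (i' (on zX) (on pX)) (mono (λ { ((q , _) , k) → inr q , k }) s)))

        ux : Star (del RF u v) u x
        ux = one (proj₁ (K.tri-in tu))
        uy : Star (del RF u v) u y
        uy = one (proj₂ (K.tri-in tu))
        up-u : ∀ {w} → Star (del RF u v) u w → Star (del RF v v') v w
        up-u = O.extend (vb tv) (λ e → a≢b tv (sym e))
        up-t : ∀ {w} → Star (del RF t v) t w → Star (del RF v v') v w
        up-t = O.extend (vc tv) (λ e → a≢c tv (sym e))
        vu : Star (del RF v v') v u
        vu = one (proj₁ (K.tri-in tv))
        vt : Star (del RF v v') v t
        vt = one (proj₂ (K.tri-in tv))
        bv : ∀ {l} → l ∈ X → Star (del RF v v') v l → B l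
        bv m s = aside m (within s)
        bx : B x
        bx = bv xX (up-u ux)
        xv : Star RF x v
        xv = sF (vb tu) ◅ one (va tu)

        in-u : ∀ {l} → l ∈ X → Star (del RF u v) u l → l ≡ x ⊎ l ≡ y
        in-u {l} m s with l ≟ x | l ≟ y
        ... | yes e | _ = inj₁ e
        ... | no _ | yes e = inj₂ e
        ... | no n | no n' = ⊥-elim (K.off-cherry tu xX yX m n n' s)

        in-v : ∀ {l} → l ∈ X → Star (del RF v v') v l → (l ≡ x ⊎ l ≡ y) ⊎ Star (del RF t v) t l
        in-v m s with O.tri-side tv s (λ { refl → O.tri-∉ tv m })
        ... | inj₁ q = inj₁ (in-u m q)
        ... | inj₂ q = inj₂ q

        u-t : ∀ {l} → Star (del RF u v) u l → Star (del RF t v) t l → ⊥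
        u-t = K.sides-disjoint tv

        u≢v : u ≢ v
        u≢v = forest-≢ O.forest (va tu)
        u≢v' : u ≢ v'
        u≢v' e = a≢b tv (sym e)
        t≢v : t ≢ v
        t≢v e = forest-≢ O.forest (vc tv) (sym e)
        t≢v' : t ≢ v'
        t≢v' e = a≢c tv (sym e)
        du : deg F u ≡ 3
        du = O.deg3-of (O.tri-∉ tu) (va tu)

        c2a : ∀ {G} → (DelPendXY F x y G ⊎ C2aii x y F G ⊎ C2aiii x y F G) → C2 x F F' G F'
        c2a d = y , cxy , inj₁ (z , cz , zy , refl , d)

        beyond-v : ∀ {p} → p ∈ X → B p → Star RF x p → ¬ Star I x p →
          Σ ℕ λ a₁ → Σ ℕ λ b₁ → CutOK st a₁ b₁ × ¬ Star (del RF a₁ b₁) v p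
        beyond-v {p} pX bp s n =
          let (a₁ , b₁ , _ , ok , ns , keep) = C.sepOK xX pX bx bp s n
              xv' : ¬ Joins a₁ b₁ (x , u) → ¬ Joins a₁ b₁ (u , v) → Star (del RF a₁ b₁) x v
              xv' k₁ k₂ = (sF (vb tu) , k₁) ◅ one (va tu , k₂)
          in decide (joins? a₁ b₁ (x , u))
               (λ j → ⊥-elim (b≢c tu (O.leaf-side xX (sF (vb tu)) (mono (del-cong j) (keep xX yX xy)))))
               (λ k₁ → decide (joins? a₁ b₁ (u , v))
                 (λ j → ⊥-elim (no-xz (mono (del-cong j) (keep xX zX xz))))
                 (λ k₂ → a₁ , b₁ , ok , λ q → ns (xv' k₁ k₂ ◅◅ q)))

        module TailLeaf (tX : t ∈ X) where
          L : List ℕ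
          L = x ∷ y ∷ t ∷ []
          L⊆ : ∀ {l} → l ∈ L → l ∈ X × Star (del RF v v') v l
          L⊆ (here refl) = xX , up-u ux
          L⊆ (there (here refl)) = yX , up-u uy
          L⊆ (there (there (here refl))) = tX , vt
          ⊆L : ∀ {l} → l ∈ X → Star (del RF v v') v l → l ∈ L
          ⊆L m s with in-v m s
          ... | inj₁ (inj₁ e) = here e
          ... | inj₁ (inj₂ e) = there (here e)
          ... | inj₂ q = there (there (here (sym (O.leaf-side tX (sF (vc tv)) q))))
          pd : PendantTree F v v' L
          pd = pendant-tree f (va tv) L L⊆ ⊆L
          module Pd = PendantTree pd
          t≢x : t ≢ x
          t≢x e = u-t ux (subst (Star (del RF t v) t) e ε)
          t≢y : t ≢ y
          t≢y e = u-t uy (subst (Star (del RF t v) t) e ε)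
          aii : ∀ {G} → (DelPendant F t G ⊎ DelEdge F v v' G) → C2aii x y F G
          aii d = t , v , v' , Pd.tree , Pd.is-pendant , Pd.leaves ,
            Pd.cherries (b≢c tu) (here refl) (there (here refl)) u≢v u≢v' du (sF (vb tu)) (sF (vc tu)) vu , t≢x , t≢y , d

          del-t : DelPendant F t (cutC F t v)
          del-t = v , cutC-del {a = t} {v} f (sF (vc tv))
          c2-t : C2 x F F' (cutC F t v) F'
          c2-t = c2a {cutC F t v} (inj₂ (inj₁ (aii {cutC F t v} (inj₁ del-t))))
          del-top : DelEdge F v v' (cutC F v v')
          del-top = cutC-del {a = v} {v'} f (va tv)
          c2-top : C2 x F F' (cutC F v v') F'
          c2-top = c2a {cutC F v v'} (inj₂ (inj₁ (aii {cutC F v v'} (inj₂ del-top))))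

          ok-t : ∀ {a₁ b₁} → CutOK st a₁ b₁ → ¬ Star (del RF a₁ b₁) v t → Dec (Joins a₁ b₁ (t , v)) → CutOK st t v
          ok-t ok ns (yes j) = cutOK-cong {st = st} j ok
          ok-t ok ns (no k) = ⊥-elim (ns (one (vc tv , λ j → k (joins-flip j))))

          other-leaf : z ≢ t → Out st
          other-leaf zt = cutL x {t} {v} (sF (vc tv)) ok (inj₁ c2-t)
            where
            far : Σ ℕ λ a₁ → Σ ℕ λ b₁ → CutOK st a₁ b₁ × ¬ Star (del RF a₁ b₁) v t
            far = beyond-v tX (bv tX vt) (xv ◅◅ one (vc tv)) (quartet tX t≢x t≢y (λ e → zt (sym e)))
            ok : CutOK st t v
            ok = let (a₁ , b₁ , o , ns) = far in ok-t o ns (joins? a₁ b₁ (t , v))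

          cut-top : z ≡ t → ∀ {w} → w ∈ X → B w → Star RF x w → ¬ Star (del RF v v') v w → Out st
          cut-top zt {w} wX bw s n = cutL x {v} {v'} (va tv) ok (inj₁ c2-top)
            where
            bad : ∀ {p q} → p ∈ X → q ∈ X → Star I p q → Star (del RF v v') v p → Star (del RF v v') v' q → ⊥
            bad {p} {q} pX qX s vp v'q = quartet qX (nq (up-u ux)) (nq (up-u uy)) (λ e → nq vt (trans e zt)) (xp ◅◅ s)
              where
              nq : ∀ {l} → Star (del RF v v') v l → q ≢ l
              nq vl refl = O.forest (va tv) (vl ◅◅ star-sym (del-sym v v' sF) v'q)
              xp : Star I x p
              xp with in-v pX vp
              ... | inj₁ (inj₁ refl) = ε
              ... | inj₁ (inj₂ refl) = xy
              ... | inj₂ q' with O.leaf-side tX (sF (vc tv)) q'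
              ...   | refl = subst (Star I x) zt xz
            keep : ∀ {p q} → p ∈ X → q ∈ X → Star I p q → Star (del RF v v') p q
            keep {p} {q} pX qX s = decide (conn? (listed-del O.lF v v') p q) (λ k → k) λ nk →
              [ (λ { (k₁ , k₂) → ⊥-elim (bad pX qX s (star-sym (del-sym v v' sF) k₁) k₂) })
              , (λ { (k₁ , k₂) → ⊥-elim (bad qX pX (star-sym sI s) k₂ (star-sym (del-sym v v' sF) k₁)) })
              ] (proj₂ (cross! sF v v' (C.agree→F pX qX s) nk))
            ok : CutOK st v v'
            ok = C.tightOK {v} {v'} {x} {w} (va tv) xX wX bx bw s (λ q → n (up-u ux ◅◅ q)) keep

          -- if B consists of x, y, z only, the tree of F' containing them is a star
          star-contra : z ≡ t → (∀ {l} → l ∈ X → B l → Star (del RF v v') v l) → ⊥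
          star-contra zt h = go above-F'
            where
            is-y : ∀ {u' k'} → Tri F' u' k' x z → ∀ {l} → l ∈ X → Star (del RF' k' u') k' l → l ≡ y
            is-y {u'} {k'} t' {l} m s = pick (in-v m (h m (closed' xX m bx (O'.sF (vb t') ◅ (va t' ◅ mono del⊑ s)))))
              where
              not-x : l ≢ x
              not-x e = K'.sides-disjoint (tri-rot {F'} (tri-swap {F'} t')) (subst (Star (del RF' k' u') k') e s) ε
              not-z : l ≢ z
              not-z e = K'.sides-disjoint (tri-rot {F'} t') (subst (Star (del RF' k' u') k') e s) ε
              pick : (l ≡ x ⊎ l ≡ y) ⊎ Star (del RF t v) t l → l ≡ y
              pick (inj₁ (inj₁ e)) = ⊥-elim (not-x e)
              pick (inj₁ (inj₂ e)) = e
              pick (inj₂ q) = ⊥-elim (not-z (trans (sym (O.leaf-side tX (sF (vc tv)) q)) (sym zt)))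
            go : (Σ ℕ λ u' → Σ ℕ λ k' → Tri F' u' k' x z) → ⊥
            go (u' , k' , t') = nc cxy (K'.mk-cherry (b≢c tu) xX yX (O'.sF (vb t'))
              (subst (λ w → RF' w u') (K'.only-label (O'.sF (va t')) (is-y t')) (O'.sF (va t'))))

          same-leaf : z ≡ t → Out st
          same-leaf zt with top | kind
          ... | inj₂ (w , wX , s , n) | _ = cut-top zt wX (aside wX s) (star-sym sF (mono del⊑ (within (up-u ux))) ◅◅ mono del⊑ s) n
          ... | inj₁ (refl , refl) | inj₁ (bX , full) = cut-top zt bX (full bX (one ab)) (xv ◅◅ one (va tv)) (O.forest (va tv))
          ... | inj₁ (refl , refl) | inj₂ onl = ⊥-elim (star-contra zt onl)

          out : Out st
          out with z ≟ t
          ... | yes e = same-leaf e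
          ... | no n = other-leaf n

        module TailCherry {p q : ℕ} (tw : Tri F t v p q) (pX : p ∈ X) (qX : q ∈ X) where
          tp : Star (del RF t v) t p
          tp = one (proj₁ (K.tri-in tw))
          tq : Star (del RF t v) t q
          tq = one (proj₂ (K.tri-in tw))
          in-t : ∀ {l} → l ∈ X → Star (del RF t v) t l → l ≡ p ⊎ l ≡ q
          in-t {l} m s with l ≟ p | l ≟ q
          ... | yes e | _ = inj₁ e
          ... | no _ | yes e = inj₂ e
          ... | no n | no n' = ⊥-elim (K.off-cherry tw pX qX m n n' s)
          L : List ℕ
          L = x ∷ y ∷ p ∷ q ∷ []
          L⊆ : ∀ {l} → l ∈ L → l ∈ X × Star (del RF v v') v l
          L⊆ (here refl) = xX , up-u ux
          L⊆ (there (here refl)) = yX , up-u uy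
          L⊆ (there (there (here refl))) = pX , up-t tp
          L⊆ (there (there (there (here refl)))) = qX , up-t tq
          ⊆L : ∀ {l} → l ∈ X → Star (del RF v v') v l → l ∈ L
          ⊆L m s with in-v m s
          ... | inj₁ (inj₁ e) = here e
          ... | inj₁ (inj₂ e) = there (here e)
          ... | inj₂ k with in-t m k
          ...   | inj₁ e = there (there (here e))
          ...   | inj₂ e = there (there (there (here e)))
          pd : PendantTree F v v' L
          pd = pendant-tree f (va tv) L L⊆ ⊆L
          module Pd = PendantTree pd
          M⊆ : ∀ {l} → l ∈ p ∷ q ∷ [] → l ∈ X × Star (del RF t v) t l
          M⊆ (here refl) = pX , tp
          M⊆ (there (here refl)) = qX , tq
          ⊆M : ∀ {l} → l ∈ X → Star (del RF t v) t l → l ∈ p ∷ q ∷ []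
          ⊆M m s with in-t m s
          ... | inj₁ e = here e
          ... | inj₂ e = there (here e)
          pd' : PendantTree F t v (p ∷ q ∷ [])
          pd' = pendant-tree f (va tw) (p ∷ q ∷ []) M⊆ ⊆M
          module Pd' = PendantTree pd'

          apart : ∀ {k l} → Star (del RF u v) u k → Star (del RF t v) t l → l ≢ k
          apart s s' refl = u-t s s'

          aiii : ∀ {G} → (DelPendant F p G ⊎ DelPendant F q G ⊎ DelEdge F t v G) → C2aiii x y F G
          aiii {G} d = p , q , v , v' , Pd.tree , Pd.is-pendant , Pd.leaves ,
            Pd.cherries (b≢c tu) (here refl) (there (here refl)) u≢v u≢v' du (sF (vb tu)) (sF (vc tu)) vu ,
            Pd.cherries (b≢c tw) (there (there (here refl))) (there (there (there (here refl)))) t≢v t≢v' (O.deg3-of (O.tri-∉ tw) (va tw)) (sF (vb tw)) (sF (vc tw)) vt ,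
            b≢c tw , apart ux tp , apart uy tp , apart ux tq , apart uy tq , ch {G} d
            where
            ch : ∀ {G} → (DelPendant F p G ⊎ DelPendant F q G ⊎ DelEdge F t v G) →
              DelPendant F p G ⊎ DelPendant F q G ⊎ (Σ ℕ λ c → Σ ℕ λ d → Σ Graph λ S' → PendantSide F c d S' × LeafSetIs S' (p ∷ q ∷ []) × DelEdge F c d G)
            ch (inj₁ d) = inj₁ d
            ch (inj₂ (inj₁ d)) = inj₂ (inj₁ d)
            ch (inj₂ (inj₂ d)) = inj₂ (inj₂ (t , v , Pd'.tree , Pd'.is-pendant , Pd'.leaves , d))

          del-vt : DelEdge F t v (cutC F t v)
          del-vt = cutC-del {a = t} {v} f (va tw)
          c2-vt : C2 x F F' (cutC F t v) F'
          c2-vt = c2a {cutC F t v} (inj₂ (inj₂ (aiii {cutC F t v} (inj₂ (inj₂ del-vt)))))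

          module Pick {p' : ℕ} (mp' : p' ∈ X) (tp' : RF t p') (sp' : Star (del RF t v) t p') (zp' : z ≢ p')
            (mk : ∀ {G} → DelPendant F p' G → C2aiii x y F G) where
            del-p : DelPendant F p' (cutC F p' t)
            del-p = t , cutC-del {a = p'} {t} f (sF tp')
            c2-p : C2 x F F' (cutC F p' t) F'
            c2-p = c2a {cutC F p' t} (inj₂ (inj₂ (mk {cutC F p' t} del-p)))
            fin : ∀ {a₁ b₁} → CutOK st a₁ b₁ → ¬ Star (del RF a₁ b₁) v p' → Dec (Joins a₁ b₁ (t , v)) → Dec (Joins a₁ b₁ (p' , t)) → Out st
            fin ok ns (yes j) _ = cutL x {t} {v} (va tw) (cutOK-cong {st = st} j ok) (inj₁ c2-vt)
            fin ok ns (no _) (yes j) = cutL x {p'} {t} (sF tp') (cutOK-cong {st = st} j ok) (inj₁ c2-p)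
            fin ok ns (no k₁) (no k₂) = ⊥-elim (ns ((vc tv , λ j → k₁ (joins-flip j)) ◅ one (tp' , λ j → k₂ (joins-flip j))))
            far : Σ ℕ λ a₁ → Σ ℕ λ b₁ → CutOK st a₁ b₁ × ¬ Star (del RF a₁ b₁) v p'
            far = beyond-v mp' (bv mp' (up-t sp')) (xv ◅◅ (vc tv ◅ one tp')) (quartet mp' (apart ux sp') (apart uy sp') (λ e → zp' (sym e)))
            pick : Out st
            pick = let (a₁ , b₁ , o , ns) = far in fin o ns (joins? a₁ b₁ (t , v)) (joins? a₁ b₁ (p' , t))

          out : Out st
          out with z ≟ p
          ... | no n = Pick.pick pX (vb tw) tp n (λ {G} d → aiii {G} (inj₁ d))
          ... | yes e = Pick.pick qX (vc tw) tq (λ e' → b≢c tw (trans (sym e) e')) (λ {G} d → aiii {G} (inj₂ (inj₁ d)))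

      deepA : Out st
      deepA = go tail
        where
        go : (t ∈ X ⊎ (Σ ℕ λ p → Σ ℕ λ q → Tri F t v p q × p ∈ X × q ∈ X)) → Out st
        go (inj₁ tX) = TailLeaf.out tX
        go (inj₂ (p , q , tw , pX , qX)) = TailCherry.out tw pX qX

    flip-deep : O.Deep a b → O.Deep a b
    flip-deep D = record { v = v ; v' = v' ; u = u ; x = y ; y = x ; t = t ; tv = tv ; tu = tri-swap {F} tu ; xX = yX ; yX = xX ; tail = tail ; within = within ; top = top }
      where open O.Deep D

    private
      from-cherry : ∀ {x y} → Tri F a b x y → x ∈ X → y ∈ X → ∀ {z} → Cherry F' x z → z ≢ y → Star I x y → Star I x z → Out st
      from-cherry {x} {y} t xX yX {z} cz zy xy xz = ⊥-elim (go kind)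
        where
        zX : z ∈ X
        zX = K'.leaf→X (proj₁ (proj₂ (proj₂ cz)))
        zx : z ≢ x
        zx e = proj₁ cz (sym e)
        bx : B x
        bx = aside xX (one (proj₁ (K.tri-in t)))
        go : (b ∈ X × (∀ {x} → x ∈ X → Star RF a x → B x)) ⊎ (∀ {x} → x ∈ X → B x → Star (del RF a b) a x) → ⊥
        go (inj₂ onl) = K.off-cherry t xX yX zX zx zy (onl zX (closed' xX zX bx (K'.cherry-star cz)))
        go (inj₁ (bX , _)) with O.leaf-side bX (sF ab) (mono del-comm (K.off-cherry′ t xX yX zX zx zy (vb t ◅ C.agree→F xX zX xz)))
        ... | refl = nc (K.mk-cherry (proj₁ cz) xX zX (sF (vb t)) (sF ab)) cz

      from-leaf : a ∈ X → (b ∈ X × (∀ {x} → x ∈ X → Star RF a x → B x)) ⊎ (∀ {x} → x ∈ X → B x → Star (del RF a b) a x) → Out st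
      from-leaf aX (inj₂ onl) with ni' aX
      ... | m , am with O'.beyond m a (O'.sF am)
      ...   | l , lX , s with O.leaf-side aX ab (onl lX (closed' aX lX (aside aX ε) (am ◅ mono del⊑ s)))
      ...     | refl = ⊥-elim (O'.forest am (star-sym (del-sym a m O'.sF) (mono del-comm s)))
      from-leaf aX (inj₁ (bX , full)) = cherry-main {a} {b} c (full aX ε) (full bX (one ab)) (λ cz n _ s → ⊥-elim (no-third aX bX ab cz n s)) (λ cz n _ s → ⊥-elim (no-third bX aX (sF ab) cz n s))
        where
        c : Cherry F a b
        c = forest-≢ O.forest ab , K.X→leaf aX , K.X→leaf bX , inj₁ ab
        pair : ∀ {x y z} → x ∈ X → y ∈ X → RF x y → Star RF x z → z ≡ x ⊎ z ≡ y
        pair xX yX e ε = inj₁ refl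
        pair xX yX e (r ◅ s) with O.nbr1 xX r e
        ... | refl = swap (pair yX xX (sF e) s)
        no-third : ∀ {x y z} → x ∈ X → y ∈ X → RF x y → Cherry F' x z → z ≢ y → Star I x z → ⊥
        no-third xX yX e cz zy xz = [ (λ q → proj₁ cz (sym q)) , zy ] (pair xX yX e (C.agree→F xX (K'.leaf→X (proj₁ (proj₂ (proj₂ cz)))) xz))

    paid-step : Out st
    paid-step with O.classify a b ab
    ... | O.leafC aX = from-leaf aX kind
    ... | O.cherryC x y t xX yX = cherry-main {x} {y} (K.mk-cherry (b≢c t) xX yX (sF (vb t)) (sF (vc t))) (aside xX (one (proj₁ (K.tri-in t)))) (aside yX (one (proj₂ (K.tri-in t))))
            (from-cherry t xX yX) (from-cherry (tri-swap {F} t) yX xX)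
    ... | O.deepC D = cherry-main {x} {y} (K.mk-cherry (b≢c tu) xX yX (sF (vb tu)) (sF (vc tu))) (bd (proj₁ (K.tri-in tu)) xX) (bd (proj₂ (K.tri-in tu)) yX)
            (λ cz n s s' → DA.deepA D cz n s s') (λ cz n s s' → DA.deepA (flip-deep D) cz n s s')
      where
      open O.Deep D
      bd : ∀ {l} → del RF u v u l → l ∈ X → B l
      bd e m = aside m (within (O.extend (vb tv) (λ e → a≢b tv (sym e)) (one e)))

open PaidSteps

module NetworkToSequence where

  del0-isF : ∀ {X F x} → IsF X F → x ∈ X → deg F x ≡ 0 → IsF (delV x X) (mkGraph (delV x (V F)) (E F))
  del0-isF {X} {F} {x} f xX d = isf ((Uₚ.filter⁺ (λ u → ¬? (u ≟ x)) (proj₁ wfF) , All.tabulate ends) , proj₂ simple) forest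
    (λ m → let (p , q) = ∈-delV⁻ m in ∈-delV⁺ (lab p) q) (λ m → leaf (proj₁ (∈-delV⁻ m)))
    (λ m → let (p , q) = ∈-delV⁻ m in [ (λ i → inj₁ (∈-delV⁺ i q)) , inj₂ ] (inner p))
    where
    open OnF f
    ends : ∀ {e} → e ∈ E F → proj₁ e ∈ delV x (V F) × proj₂ e ∈ delV x (V F) × proj₁ e ≢ proj₂ e
    ends {a , b} m with All.lookup (proj₂ wfF) m
    ... | p , q , ne = ∈-delV⁺ p (λ { refl → deg-0 simple {a} d b (fromAd F (inj₁ m)) }) , ∈-delV⁺ q (λ { refl → deg-0 simple {b} d a (fromAd F (inj₂ m)) }) , ne

  delLeaf-isF : ∀ {X F x G} → IsF X F → x ∈ X → DelLeaf F x G → IsF (delV x X) G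
  delLeaf-isF f m (inj₁ (_ , d , refl)) = del0-isF f m d
  delLeaf-isF f m (inj₂ (_ , d , s)) = suppress-isF (drop-pre f m) s

  delLeaf-eqv : ∀ {X F x G} → IsF X F → x ∈ X → DelLeaf F x G → Eqv (On (delV x X)) (Adj F) (Adj G)
  delLeaf-eqv f m (inj₁ (_ , d , refl)) = on-refl
  delLeaf-eqv {X} {F} f m (inj₂ (_ , d , s)) = on-trans (drop-eqv {X} {F} (IsF.simple f) (IsF.leaf f m)) (Suppressed.eqvX (suppress-star (drop-pre f m) (proj₁ s)))

  abstract
    delC : Graph → ℕ → Graph
    delC F x with deg F x ≟ 0
    ... | yes _ = mkGraph (delV x (V F)) (E F)
    ... | no _ = suppress (dropV F x)

    delC-del : ∀ {X F x} → IsF X F → x ∈ X → DelLeaf F x (delC F x)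
    delC-del {X} {F} {x} f m with deg F x ≟ 0
    ... | yes d = inj₁ (IsF.lab f m , d , refl)
    ... | no n = inj₂ (IsF.lab f m , ≤1-≢0 n (IsF.leaf f m) , suppress-all (drop-pre f m))

  -- A liberal game, decidable by finite search: any edge may be cut (at cost one).
  -- In CG t w, t is the number of moves and w the number of cuts.
  CherryD : Graph → ℕ → ℕ → Set
  CherryD F x y = x ≢ y × Leaf F x × Leaf F y × (Adj F x y ⊎ Any (λ v → Adj F x v × Adj F y v) (V F))

  FreeOK : Graph → Graph → ℕ → Set
  FreeOK F F' x = deg F x ≡ 0 ⊎ (x ∈ V F' × deg F' x ≡ 0) ⊎ Any (λ y → CherryD F x y × CherryD F' x y) (V F)

  CG : ℕ → ℕ → Graph → Graph → Set
  CutG : ℕ → ℕ → Graph → Graph → Set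
  CG zero w F F' = w ≡ 0 × Any (λ x → IsSingleton x F × IsSingleton x F') (V F)
  CG (suc t) w F F' = Any (λ x → FreeOK F F' x × CG t w (delC F x) (delC F' x)) (V F) ⊎ CutG t w F F'
  CutG t zero F F' = ⊥
  CutG t (suc w) F F' = Any (λ a → Any (λ b → Adj F a b × CG t w (cutC F a b) F') (V F)) (V F) ⊎
                        Any (λ a → Any (λ b → Adj F' a b × CG t w F (cutC F' a b)) (V F')) (V F')

  singleton? : ∀ x G → Dec (IsSingleton x G)
  singleton? x (mkGraph (y ∷ []) []) = map′ (λ { refl → refl , refl }) (λ { (refl , _) → refl }) (y ≟ x)
  singleton? x (mkGraph [] _) = no λ { (() , _) }
  singleton? x (mkGraph (_ ∷ _ ∷ _) _) = no λ { (() , _) }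
  singleton? x (mkGraph (_ ∷ []) (_ ∷ _)) = no λ { (_ , ()) }

  cherryD? : ∀ F x y → Dec (CherryD F x y)
  cherryD? F x y = ¬? (x ≟ y) ×-dec leaf? F x ×-dec leaf? F y ×-dec (adj? F x y ⊎-dec any? (λ v → adj? F x v ×-dec adj? F y v) (V F))

  freeOK? : ∀ F F' x → Dec (FreeOK F F' x)
  freeOK? F F' x = (deg F x ≟ 0) ⊎-dec (((x ∈? V F') ×-dec (deg F' x ≟ 0)) ⊎-dec any? (λ y → cherryD? F x y ×-dec cherryD? F' x y) (V F))

  cg? : ∀ t w F F' → Dec (CG t w F F')
  cutG? : ∀ t w F F' → Dec (CutG t w F F')
  cg? zero w F F' = (w ≟ 0) ×-dec any? (λ x → singleton? x F ×-dec singleton? x F') (V F)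
  cg? (suc t) w F F' = any? (λ x → freeOK? F F' x ×-dec cg? t w (delC F x) (delC F' x)) (V F) ⊎-dec cutG? t w F F'
  cutG? t zero F F' = no λ ()
  cutG? t (suc w) F F' = any? (λ a → any? (λ b → adj? F a b ×-dec cg? t w (cutC F a b) F') (V F)) (V F) ⊎-dec
                         any? (λ a → any? (λ b → adj? F' a b ×-dec cg? t w F (cutC F' a b)) (V F')) (V F')

  cherry→D : ∀ {F x y} → WF F → Cherry F x y → CherryD F x y
  cherry→D wf (ne , lx , ly , inj₁ a) = ne , lx , ly , inj₁ a
  cherry→D {F} wf (ne , lx , ly , inj₂ (v , p , q)) = ne , lx , ly , inj₂ (lose (proj₁ (proj₂ (adj-∈ {F} wf p))) (p , q))

  D→cherry : ∀ {F x y} → CherryD F x y → Cherry F x y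
  D→cherry (ne , lx , ly , inj₁ a) = ne , lx , ly , inj₁ a
  D→cherry (ne , lx , ly , inj₂ p) = ne , lx , ly , inj₂ (let (v , _ , q) = find p in v , q)

  single : ∀ {x F} → IsF (x ∷ []) F → IsSingleton x F
  single {x} {F} f = vV (V F) (proj₁ wfF) (λ m → all-x m) (lab (here refl)) , eE
    where
    open OnF f
    no-edge : ∀ {a b} → ¬ Adj F a b
    no-edge {a} {b} ab with beyond a b ab | beyond b a (sF ab)
    ... | _ , here refl , s | _ , here refl , s' = forest ab (s ◅◅ star-sym (del-sym a b sF) (mono del-comm s'))
    eE : E F ≡ []
    eE = go (E F) refl
      where
      go : ∀ es → E F ≡ es → E F ≡ []
      go [] e = e
      go ((a , b) ∷ es) e = ⊥-elim (no-edge {a} {b} (fromAd F (inj₁ (subst ((a , b) ∈_) (sym e) (here refl)))))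
    all-x : ∀ {v} → v ∈ V F → v ≡ x
    all-x {v} m with inner m
    ... | inj₁ (here e) = e
    ... | inj₂ d = case trans (sym d) (cong (λ es → degE es v) eE) of λ ()
    vV : ∀ vs → Unique vs → (∀ {v} → v ∈ vs → v ≡ x) → x ∈ vs → vs ≡ x ∷ []
    vV (v ∷ []) _ h _ = cong (_∷ []) (h (here refl))
    vV (v ∷ w ∷ vs) ((ne ∷ _) ∷ _) h _ = ⊥-elim (ne (trans (h (here refl)) (sym (h (there (here refl))))))

  st-drop : ∀ {X F F' G G' n x} → IsF X F → IsF X F' → x ∈ X → DelLeaf F x G → DelLeaf F' x G' → St X F F' n → St (delV x X) G G' n
  st-drop {X} {x = x} f f' m d d' s = record { EN = EN ; ES = ES ; ES' = ES' ; vs = vs ; vsU = vsU ; ends = ends ; con = con ; cnt = cnt ; S⊆ = S⊆ ; S'⊆ = S'⊆ ; foS = foS ; foS' = foS'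
    ; X⊆ = λ i → X⊆ (proj₁ (∈-delV⁻ i)) ; eS = on-trans (on-flip (delLeaf-eqv f m d)) (eqv-restrict sub eS) ; eS' = on-trans (on-flip (delLeaf-eqv f' m d')) (eqv-restrict sub eS') }
    where
    open St s
    sub : On (delV x X) ⊑ On X
    sub (on i) = on (proj₁ (∈-delV⁻ i))

  select : ∀ {X F F' n} (st : St X F F' n) → IsF X F → IsF X F' → Tight st →
    (∀ {x} → x ∈ X → Σ ℕ λ m → Adj F x m) → (∀ {x} → x ∈ X → Σ ℕ λ m → Adj F' x m) →
    (∀ {x y} → Cherry F x y → ¬ Cherry F' x y) → ∀ {x} → x ∈ X → Out st
  select {X} {F} {F'} {n} st f f' tight ni ni' nc {x} xX = go (S.minimal)
    where
    module S = Select st f ni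
    module S' = Select (st-swap st) f' ni'
    here-root : Root st → Out st
    here-root R = Paid.paid-step (record { st = st ; f = f ; f' = f' ; tight = tight ; ni = ni ; ni' = ni' ; nc = nc ; R = R })
    there-root : Root (st-swap st) → Out (st-swap st)
    there-root R = Paid.paid-step (record { st = st-swap st ; f = f' ; f' = f ; tight = tight-swap {s = st} tight ; ni = ni' ; ni' = ni ; nc = λ c c' → nc c' c ; R = R })
    side : ∀ {α β} → S.Minimal α β → S.Sp α β → Out st
    side mi (inj₁ sp) = here-root (S.Side.Cut.root mi sp)
    side mi (inj₂ sp) = out-swap {st = st} (there-root (S'.Side.Cut.root (inj₁ sp , λ s → proj₂ mi (swap s)) sp))
    go : (Σ ℕ λ α → Σ ℕ λ β → S.Minimal α β) ⊎ (∀ {c d} → ¬ S.Sp c d) → Out st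
    go (inj₂ none) = here-root (S.whole none xX)
    go (inj₁ (α , β , mi)) = side mi (proj₁ mi)

  Goal : ℕ → ℕ → List ℕ → Graph → Graph → Set
  Goal n k X F F' = Σ ℕ λ w → w ≤ n × (Σ (List ℕ) λ σ → CPS F F' σ w × length X ≤ length σ) × CG (k + w) w F F'

  NoFree : List ℕ → Graph → Graph → Set
  NoFree X F F' = (∀ {x} → x ∈ X → deg F x ≢ 0) × (∀ {x} → x ∈ X → deg F' x ≢ 0) × (∀ {x y} → Cherry F x y → ¬ Cherry F' x y)

  FreeStep : List ℕ → Graph → Graph → Set
  FreeStep X F F' = Σ ℕ λ x → x ∈ X × FreeOK F F' x × (∀ {G G'} → DelLeaf F x G → DelLeaf F' x G' → C1 x F F' G G' ⊎ C3 x F F' G G')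

  free? : ∀ {X F F'} → IsF X F → IsF X F' → FreeStep X F F' ⊎ NoFree X F F'
  free? {X} {F} {F'} f f' = go (any? (λ x → (deg F x ≟ 0) ⊎-dec (deg F' x ≟ 0)) X) (any? (λ x → any? (λ y → K.cherry? x y ×-dec K'.cherry? x y) X) X)
    where
    module K = CherryF f
    module K' = CherryF f'
    go : Dec (Any (λ x → deg F x ≡ 0 ⊎ deg F' x ≡ 0) X) → Dec (Any (λ x → Any (λ y → Cherry F x y × Cherry F' x y) X) X) → FreeStep X F F' ⊎ NoFree X F F'
    go (yes p) _ = let (x , m , d) = find p in inj₁ (x , m , lone x m d)
      where
      lone : ∀ x → x ∈ X → deg F x ≡ 0 ⊎ deg F' x ≡ 0 → FreeOK F F' x × (∀ {G G'} → DelLeaf F x G → DelLeaf F' x G' → C1 x F F' G G' ⊎ C3 x F F' G G')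
      lone x m (inj₁ d) = inj₁ d , λ g g' → inj₂ (inj₁ (IsF.lab f m , d) , g , g')
      lone x m (inj₂ d) = inj₂ (inj₁ (IsF.lab f' m , d)) , λ g g' → inj₂ (inj₂ (IsF.lab f' m , d) , g , g')
    go (no _) (yes q) = let (x , m , q') = find q ; (y , m' , c , c') = find q' in
      inj₁ (x , m , inj₂ (inj₂ (lose (IsF.lab f m') (cherry→D {F} (proj₁ (IsF.simple f)) c , cherry→D {F'} (proj₁ (IsF.simple f')) c'))) , λ g g' → inj₁ (y , c , c' , g , g'))
    go (no n) (no n') = inj₂ ((λ m d → n (lose m (inj₁ d))) , (λ m d → n (lose m (inj₂ d))) ,
      λ c c' → n' (lose (K.leaf→X (proj₁ (proj₂ c))) (lose (K.leaf→X (proj₁ (proj₂ (proj₂ c)))) (c , c'))))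

  has-nbr : ∀ {X F} → IsF X F → (∀ {x} → x ∈ X → deg F x ≢ 0) → ∀ {x} → x ∈ X → Σ ℕ λ m → Adj F x m
  has-nbr {X} {F} f h {x} m = deg-1 (IsF.simple f) (≤1-≢0 (h m) (IsF.leaf f m))

  net→cps : ∀ n k X {F F'} → Unique X → length X ≡ suc k → IsF X F → IsF X F' → St X F F' n → Goal n k X F F'
  net→cps n zero (x ∷ []) u e f f' s = 0 , z≤n , (x ∷ [] , final (single f) (single f') , s≤s z≤n) , refl , lose (IsF.lab f (here refl)) (single f , single f')
  net→cps n (suc k) X {F} {F'} u e f f' s = go (free? f f')
    where
    free-step : ∀ {x} → x ∈ X → FreeOK F F' x → C1 x F F' (delC F x) (delC F' x) ⊎ C3 x F F' (delC F x) (delC F' x) →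
      Goal n k (delV x X) (delC F x) (delC F' x) → Goal n (suc k) X F F'
    free-step {x} m ok st (w , le , (σ , c , l) , g) = w , le , (x ∷ σ , free st c , subst (_≤ suc (length σ)) (sym (length-delV X u m)) (s≤s l)) , inj₁ (lose (IsF.lab f m) (ok , g))
    cut-l : ∀ {n a b x} → Adj F a b → C2 x F F' (cutC F a b) F' ⊎ C2 x F' F F' (cutC F a b) → Goal n (suc k) X (cutC F a b) F' → Goal (suc n) (suc k) X F F'
    cut-l {n} {a} {b} {x} ab c (w , le , (σ , d , l) , g) = suc w , s≤s le , (x ∷ σ , paid c d , m≤n⇒m≤1+n l) ,
      inj₂ (subst (λ t → CutG t (suc w) F F') (sym (+-suc k w)) (inj₁ (let (p , q , _) = adj-∈ {F} (proj₁ (IsF.simple f)) ab in lose p (lose q (ab , g)))))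
    cut-r : ∀ {n a b x} → Adj F' a b → C2 x F F' F (cutC F' a b) ⊎ C2 x F' F (cutC F' a b) F → Goal n (suc k) X F (cutC F' a b) → Goal (suc n) (suc k) X F F'
    cut-r {n} {a} {b} {x} ab c (w , le , (σ , d , l) , g) = suc w , s≤s le , (x ∷ σ , paid c d , m≤n⇒m≤1+n l) ,
      inj₂ (subst (λ t → CutG t (suc w) F F') (sym (+-suc k w)) (inj₂ (let (p , q , _) = adj-∈ {F'} (proj₁ (IsF.simple f')) ab in lose p (lose q (ab , g)))))
    paid-l : ∀ n {a b x} → Adj F a b → C2 x F F' (cutC F a b) F' ⊎ C2 x F' F F' (cutC F a b) → (Σ ℕ λ n' → n ≡ suc n' × St X (cutC F a b) F' n') → Goal n (suc k) X F F'
    paid-l zero ab c (_ , () , _)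
    paid-l (suc n) {a} {b} ab c (.n , refl , s') = cut-l ab c (net→cps n (suc k) X u e (del-isF {a = a} {b} f (cutC-del f ab)) f' s')
    paid-r : ∀ n {a b x} → Adj F' a b → C2 x F F' F (cutC F' a b) ⊎ C2 x F' F (cutC F' a b) F → (Σ ℕ λ n' → n ≡ suc n' × St X (cutC F' a b) F n') → Goal n (suc k) X F F'
    paid-r zero ab c (_ , () , _)
    paid-r (suc n) {a} {b} ab c (.n , refl , s') = cut-r ab c (net→cps n (suc k) X u e f (del-isF {a = a} {b} f' (cutC-del f' ab)) (st-swap s'))
    some : ∀ {k} xs → length xs ≡ suc k → Σ ℕ λ x → x ∈ xs
    some (x ∷ xs) _ = x , here refl
    by-out : (s' : St X F F' n) → Out s' → Goal n (suc k) X F F'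
    by-out s' (cutL x ab ok c) = paid-l n ab c (st-cut s' f ab ok)
    by-out s' (cutR x ab ok c) = paid-r n ab c (st-cut (st-swap s') f' ab ok)
    go : FreeStep X F F' ⊎ NoFree X F F' → Goal n (suc k) X F F'
    go (inj₁ (x , m , ok , st)) = free-step m ok (st (delC-del f m) (delC-del f' m))
      (net→cps n k (delV x X) (Uₚ.filter⁺ (λ z → ¬? (z ≟ x)) u) (suc-injective (trans (sym (length-delV X u m)) e)) (delLeaf-isF f m (delC-del f m)) (delLeaf-isF f' m (delC-del f' m))
        (st-drop f f' m (delC-del f m) (delC-del f' m) s))
    go (inj₂ (h , h' , nc)) = let (s' , t) = tighten s in
      by-out s' (select s' f f' t (has-nbr f h) (has-nbr f' h') nc (proj₂ (some X e)))

open NetworkToSequence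

module Uniqueness where

  -- m is the median of x, y, z: no edge separates it from two of them.
  record Median (R : Gr) (m x y z : ℕ) : Set where
    constructor median
    field
      mx : Star R m x
      my : Star R m y
      mz : Star R m z
      xy : ∀ c d → Star (del R c d) m x ⊎ Star (del R c d) m y
      xz : ∀ c d → Star (del R c d) m x ⊎ Star (del R c d) m z
      yz : ∀ c d → Star (del R c d) m y ⊎ Star (del R c d) m z
  open Median

  module MedianExists {R : Gr} (l : Listed R) (fo : Forest R) {x y z : ℕ} (x~y : Star R x y) (x~z : Star R x z) where

    private
      s : Symm R
      s = symm l

      P : ℕ → ℕ → Set
      P a b = Star (del R b a) b x → Star (del R a b) a y → Star (del R a b) a z → Σ ℕ λ m → Median R m x y z

      dirn : ∀ {a b w} → w ≢ a → Star (del R a b) a w → Σ ℕ λ n → R a n × n ≢ b × Star (del R n a) n w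
      dirn {a} {b} ne t with toward (star-sym (del-sym a b s) t) ne
      ... | n , (na , k) , q = n , s na , (λ e → k (inj₂ (e , refl))) , mono (λ r → del-comm (del-mono kept r)) (star-sym (del-sym a n (del-sym a b s)) q)

      dirn′ : ∀ {a w} → w ≢ a → Star R a w → Σ ℕ λ n → R a n × Star (del R n a) n w
      dirn′ {a} ne t with toward (star-sym s t) ne
      ... | n , na , q = n , s na , mono del-comm (star-sym (del-sym a n s) q)

      out : ∀ {a b w} → R a b → Star (del R b a) b w → Star R a w
      out r t = r ◅ mono del⊑ t

      here? : ∀ {m a b w} → R m b → Star (del R b m) b a → Star (del R m b) m w → ∀ c d → Star (del R c d) m a ⊎ Star (del R c d) m w
      here? {m} {a} {b} {w} mb ba mw c d with w ≟ m
      ... | yes refl = inj₂ ε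
      ... | no ne with dirn ne mw
      ...   | n , mn , nb , nw = two-ways s fo mb mn (λ e → nb (sym e)) ba nw c d

      stp : ∀ a b → R a b → (∀ c → R a c → c ≢ b → P c a) → P a b
      stp a b ab rec bx ay az with y ≟ a | z ≟ a
      ... | yes refl | _ = a , median (out ab bx) ε (mono del⊑ az) (λ _ _ → inj₂ ε) (here? ab bx az) (λ _ _ → inj₁ ε)
      ... | no _ | yes refl = a , median (out ab bx) (mono del⊑ ay) ε (here? ab bx ay) (λ _ _ → inj₂ ε) (λ _ _ → inj₂ ε)
      ... | no ny | no nz with dirn ny ay | dirn nz az
      ...   | n₁ , r₁ , k₁ , q₁ | n₂ , r₂ , k₂ , q₂ with n₁ ≟ n₂
      ...     | no ne = a , median (out ab bx) (mono del⊑ ay) (mono del⊑ az) (two-ways s fo ab r₁ (λ e → k₁ (sym e)) bx q₁) (two-ways s fo ab r₂ (λ e → k₂ (sym e)) bx q₂) (two-ways s fo r₁ r₂ ne q₁ q₂)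
      ...     | yes refl = rec n₁ r₁ k₁ (side-extend s fo ab (λ e → k₁ (sym e)) bx) q₁ q₂

    exists : Σ ℕ λ m → Median R m x y z
    exists with y ≟ x | z ≟ x
    ... | yes refl | _ = x , median ε ε x~z (λ _ _ → inj₁ ε) (λ _ _ → inj₁ ε) (λ _ _ → inj₁ ε)
    ... | no _ | yes refl = x , median ε x~y ε (λ _ _ → inj₁ ε) (λ _ _ → inj₁ ε) (λ _ _ → inj₂ ε)
    ... | no ny | no nz with dirn′ ny x~y | dirn′ nz x~z
    ...   | n₁ , r₁ , q₁ | n₂ , r₂ , q₂ with n₁ ≟ n₂
    ...     | no ne = x , median ε x~y x~z (λ _ _ → inj₁ ε) (λ _ _ → inj₁ ε) (two-ways s fo r₁ r₂ ne q₁ q₂)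
    ...     | yes refl = side-induction l fo P stp n₁ x (s r₁) ε q₁ q₂

  data Cor (X : List ℕ) (F H : Gr) (v m : ℕ) : Set where
    cor : ∀ {x y z} → x ∈ X → y ∈ X → z ∈ X → Median F v x y z → Median H m x y z → Cor X F H v m

  cor-flip : ∀ {X F H v m} → Cor X F H v m → Cor X H F m v
  cor-flip (cor x y z p q) = cor x y z q p

  module Correspond {X : List ℕ} {F H : Graph} (f : IsF X F) (h : IsF X H) (e : Eqv (On X) (Adj F) (Adj H)) where

    module O = OnF f
    module Q = OnF h

    private
      RF RH : Gr
      RF = Adj F
      RH = Adj H
      C : ℕ → ℕ → Set
      C = Cor X RF RH

    rep : ∀ {v} → v ∈ V F → Σ ℕ λ x → Σ ℕ λ y → Σ ℕ λ z → x ∈ X × y ∈ X × z ∈ X × Median RF v x y z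
    rep {v} m with O.inner m
    ... | inj₁ i = v , v , v , i , i , i , median ε ε ε (λ _ _ → inj₁ ε) (λ _ _ → inj₁ ε) (λ _ _ → inj₁ ε)
    ... | inj₂ d with deg-3 O.simple {v} d
    ...   | p , q , r , vp , vq , vr , pq , pr , qr , _ with O.beyond p v (O.sF vp) | O.beyond q v (O.sF vq) | O.beyond r v (O.sF vr)
    ...     | x , xX , sx | y , yX , sy | z , zX , sz = x , y , z , xX , yX , zX , median (vp ◅ mono del⊑ sx) (vq ◅ mono del⊑ sy) (vr ◅ mono del⊑ sz)
                (two-ways O.sF O.forest vp vq pq sx sy) (two-ways O.sF O.forest vp vr pr sx sz) (two-ways O.sF O.forest vq vr qr sy sz)

    img : ∀ {v} → v ∈ V F → Σ ℕ λ m → m ∈ V H × C v m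
    img {v} i with rep i
    ... | x , y , z , xX , yX , zX , md with MedianExists.exists {RH} Q.lF Q.forest (conn (fwd e) (on xX) (on yX) (star-sym O.sF (mx md) ◅◅ my md)) (conn (fwd e) (on xX) (on zX) (star-sym O.sF (mx md) ◅◅ mz md))
    ...   | m , md' = m , inV (mx md') , cor xX yX zX md md'
      where
      inV : ∀ {m} → Star RH m x → m ∈ V H
      inV ε = Q.lab xX
      inV (r ◅ _) = proj₁ (adj-∈ {H} Q.wfF r)

    img-total : ∀ v → Dec (v ∈ V F) → Σ ℕ λ m → v ∈ V F → m ∈ V H × C v m
    img-total v (yes i) = let (m , p) = img i in m , λ _ → p
    img-total v (no n) = 0 , λ i → ⊥-elim (n i)

    module _ {c d c' d' : ℕ} (i : SameSplit (On X) RF c d RH c' d') where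

      private
        pick : ∀ {A B C A' B' C' : Set} → A ⊎ B → A ⊎ C → B ⊎ C → A' ⊎ B' → A' ⊎ C' → B' ⊎ C' → (A × A') ⊎ (B × B') ⊎ (C × C')
        pick (inj₁ a) _ _ (inj₁ a') _ _ = inj₁ (a , a')
        pick (inj₁ a) _ _ (inj₂ b') (inj₁ a') _ = inj₁ (a , a')
        pick (inj₁ a) _ (inj₁ b) (inj₂ b') (inj₂ c') _ = inj₂ (inj₁ (b , b'))
        pick (inj₁ a) _ (inj₂ c) (inj₂ b') (inj₂ c') _ = inj₂ (inj₂ (c , c'))
        pick (inj₂ b) _ _ (inj₂ b') _ _ = inj₂ (inj₁ (b , b'))
        pick (inj₂ b) _ _ (inj₁ a') _ (inj₁ b') = inj₂ (inj₁ (b , b'))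
        pick (inj₂ b) (inj₁ a) _ (inj₁ a') _ (inj₂ c') = inj₁ (a , a')
        pick (inj₂ b) (inj₂ c) _ (inj₁ a') _ (inj₂ c') = inj₂ (inj₂ (c , c'))

        common : ∀ {v m} → C v m → Σ ℕ λ l → l ∈ X × Star (del RF c d) v l × Star (del RH c' d') m l
        common (cor xX yX zX p q) with pick (xy p c d) (xz p c d) (yz p c d) (xy q c' d') (xz q c' d') (yz q c' d')
        ... | inj₁ (s , t) = _ , xX , s , t
        ... | inj₂ (inj₁ (s , t)) = _ , yX , s , t
        ... | inj₂ (inj₂ (s , t)) = _ , zX , s , t

      cor-split : SameSplit C RF c d RH c' d'
      cor-split p q with common p | common q
      ... | l , lX , s , t | l' , lX' , s' , t' =
        (λ k → t ◅◅ proj₁ (i (on lX) (on lX')) (star-sym (del-sym c d O.sF) s ◅◅ k ◅◅ s') ◅◅ star-sym (del-sym c' d' Q.sF) t') ,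
        (λ k → s ◅◅ proj₂ (i (on lX) (on lX')) (star-sym (del-sym c' d' Q.sF) t ◅◅ k ◅◅ t') ◅◅ star-sym (del-sym c d O.sF) s')

    cor-conn : ∀ {v m v' m'} → C v m → C v' m' → Star RF v v' → Star RH m m'
    cor-conn (cor xX _ _ p q) (cor xX' _ _ p' q') s = mx q ◅◅ conn (fwd e) (on xX) (on xX') (star-sym O.sF (mx p) ◅◅ s ◅◅ mx p') ◅◅ star-sym Q.sF (mx q')

    edge-match : ∀ {c d} → RF c d → Σ ℕ λ c' → Σ ℕ λ d' → RH c' d' × SameSplit C RF c d RH c' d'
    edge-match {c} {d} cd with match (fwd e) cd
    ... | inj₂ (c' , d' , r , i) = c' , d' , r , cor-split i
    ... | inj₁ t with O.beyond c d cd | O.beyond d c (O.sF cd)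
    ...   | x , xX , s | y , yX , s' = ⊥-elim (O.forest cd (s ◅◅ t (on xX) (on yX) (star-sym O.sF (mono del⊑ s) ◅◅ (cd ◅ mono del⊑ s')) ◅◅ star-sym (del-sym c d O.sF) (mono del-comm s')))

  module Iso {X : List ℕ} {F H : Graph} (f : IsF X F) (h : IsF X H) (e : Eqv (On X) (Adj F) (Adj H)) where

    module U = Correspond f h e
    module W = Correspond h f (on-flip e)
    open U using (module O; module Q)

    private
      C : ℕ → ℕ → Set
      C = Cor X (Adj F) (Adj H)

    cor-unique : ∀ {v v' m} → C v m → C v' m → v ≡ v'
    cor-unique {v} {v'} p q with v ≟ v'
    ... | yes r = r
    ... | no ne with separated O.lF O.forest (W.cor-conn (cor-flip p) (cor-flip q) ε) ne
    ...   | c , d , cd , n with U.edge-match cd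
    ...     | _ , _ , _ , i = ⊥-elim (n (proj₂ (i p q) ε))

    -- No vertex c lies strictly between the ends of an edge ab of F.
    module Between {a b c : ℕ} (ab : Adj F a b) (c≢a : c ≢ a) (c≢b : c ≢ b)
      (between : ∀ p q → Adj F p q → Star (del (Adj F) p q) c a ⊎ Star (del (Adj F) p q) c b) where

      close : ∀ {a b} → Adj F a b → c ≢ a → Star (del (Adj F) a b) c a → (∀ p q → Adj F p q → Star (del (Adj F) p q) c a ⊎ Star (del (Adj F) p q) c b) → ⊥
      close {a} {b} ab na t bt = go (separated O.lF O.forest (mono del⊑ t) na)
        where
        go : (Σ ℕ λ p → Σ ℕ λ q → Adj F p q × ¬ Star (del (Adj F) p q) c a) → ⊥
        go (p , q , pq , n') = decide (joins? p q (a , b)) (λ j → n' (mono (del-cong (joins-swap j)) t))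
          (λ k → [ n' , (λ t' → n' (t' ◅◅ one (O.sF ab , λ j → k (joins-flip j)))) ] (bt p q pq))

      absurd : ⊥
      absurd = [ (λ t → close ab c≢a t between) , (λ t → close (O.sF ab) c≢b (mono del-comm t) (λ p q pq → swap (between p q pq))) ] (between a b ab)

    cor-adj : (∀ {v m m'} → C v m → C v m' → m ≡ m') → ∀ {a b a' b'} → C a a' → C b b' → Adj F a b → Adj H a' b'
    cor-adj uniq {a} {b} {a'} {b'} ca cb ab = go (toward (U.cor-conn ca cb (one ab)) (λ q → forest-≢ O.forest ab (cor-unique ca (subst (C b) (sym q) cb))))
      where
      betw : ∀ {n} → Adj H n b' → Star (del (Adj H) b' n) a' n → ∀ c' d' → Star (del (Adj H) c' d') n a' ⊎ Star (del (Adj H) c' d') n b'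
      betw {n} nb s c' d' = decide (joins? c' d' (b' , n))
        (λ j → inj₁ (star-sym (del-sym c' d' Q.sF) (mono (del-cong (joins-swap j)) s)))
        (λ k → inj₂ (one (nb , λ j → k (joins-flip j))))
      between : ∀ {n c} → Adj H n b' → Star (del (Adj H) b' n) a' n → C c n → ∀ p q → Adj F p q → Star (del (Adj F) p q) c a ⊎ Star (del (Adj F) p q) c b
      between nb s cn p q pq = let (c' , d' , _ , i) = U.edge-match pq in
        [ (λ t → inj₁ (proj₂ (i cn ca) t)) , (λ t → inj₂ (proj₂ (i cn cb) t)) ] (betw nb s c' d')
      absurd : ∀ {n} → Adj H n b' → Star (del (Adj H) b' n) a' n → n ≢ a' → (Σ ℕ λ c → c ∈ V F × Cor X (Adj H) (Adj F) n c) → ⊥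
      absurd {n} nb s ne (c , _ , nc) = Between.absurd {a} {b} {c} ab (λ q → ne (uniq (subst (λ z → C z n) q cn) ca)) (λ q → forest-≢ Q.forest nb (uniq (subst (λ z → C z n) q cn) cb)) (between nb s cn)
        where
        cn : C c n
        cn = cor-flip nc
      go : (Σ ℕ λ n → Adj H n b' × Star (del (Adj H) b' n) a' n) → Adj H a' b'
      go (n , nb , s) = decide (n ≟ a') (λ q → subst (λ z → Adj H z b') q nb)
        (λ ne → ⊥-elim (absurd nb s ne (W.img (proj₁ (adj-∈ {H} Q.wfF nb)))))

  eqv-isofix : ∀ {X F H} → IsF X F → IsF X H → Eqv (On X) (Adj F) (Adj H) → IsoFix X F H
  eqv-isofix {X} {F} {H} f h e = φ , ψ , (λ v m → proj₁ (φ-cor m)) , (λ v m → proj₁ (ψ-cor m)) ,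
    (λ v m → J.cor-unique (proj₂ (ψ-cor (proj₁ (φ-cor m)))) (proj₂ (φ-cor m))) ,
    (λ v m → J'.cor-unique (cor-flip (proj₂ (φ-cor (proj₁ (ψ-cor m))))) (cor-flip (proj₂ (ψ-cor m)))) ,
    mu , (λ x m → IsF.lab f m , J'.cor-unique (cor-flip (proj₂ (φ-cor (IsF.lab f m)))) (trivial m))
    where
    module J = Iso f h e
    module J' = Iso h f (on-flip e)
    φ : ℕ → ℕ
    φ v = proj₁ (J.U.img-total v (v ∈? V F))
    ψ : ℕ → ℕ
    ψ v = proj₁ (J.W.img-total v (v ∈? V H))
    φ-cor : ∀ {v} → v ∈ V F → φ v ∈ V H × Cor X (Adj F) (Adj H) v (φ v)
    φ-cor {v} m = proj₂ (J.U.img-total v (v ∈? V F)) m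
    ψ-cor : ∀ {v} → v ∈ V H → ψ v ∈ V F × Cor X (Adj F) (Adj H) (ψ v) v
    ψ-cor {v} m = let (p , q) = proj₂ (J.W.img-total v (v ∈? V H)) m in p , cor-flip q
    trivial : ∀ {x} → x ∈ X → Cor X (Adj H) (Adj F) x x
    trivial m = cor m m m (median ε ε ε (λ _ _ → inj₁ ε) (λ _ _ → inj₁ ε) (λ _ _ → inj₁ ε)) (median ε ε ε (λ _ _ → inj₁ ε) (λ _ _ → inj₁ ε) (λ _ _ → inj₁ ε))
    uF : ∀ {v m m'} → Cor X (Adj F) (Adj H) v m → Cor X (Adj F) (Adj H) v m' → m ≡ m'
    uF p q = J'.cor-unique (cor-flip p) (cor-flip q)
    mu : ∀ a b → a ∈ V F → b ∈ V F → mult H (φ a) (φ b) ≡ mult F a b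
    mu a b ma mb = decide (adj? F a b)
      (λ r → trans (adj-mult {E H} (proj₂ (IsF.simple h) (φ a) (φ b)) (toAd H (J.cor-adj uF (proj₂ (φ-cor ma)) (proj₂ (φ-cor mb)) r))) (sym (adj-mult {E F} (proj₂ (IsF.simple f) a b) (toAd F r))))
      (λ n → trans (¬adj-mult {E H} (λ r → n (J'.cor-adj (λ p q → J.cor-unique (cor-flip p) (cor-flip q)) (cor-flip (proj₂ (φ-cor ma))) (cor-flip (proj₂ (φ-cor mb))) (fromAd H r)))) (sym (¬adj-mult {E F} (λ r → n (fromAd F r)))))

open Uniqueness

module NetworkSurgery where

  deg-yes : ∀ v e es → Inc v e → degE (e ∷ es) v ≡ suc (degE es v)
  deg-yes v e es i = cong length (filter-accept (inc? v) {xs = es} i)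

  deg-no : ∀ v e es → ¬ Inc v e → degE (e ∷ es) v ≡ degE es v
  deg-no v e es n = cong length (filter-reject (inc? v) {xs = es} n)

  mult-yes : ∀ a b e es → Joins a b e → multE (e ∷ es) a b ≡ suc (multE es a b)
  mult-yes a b e es j = cong length (filter-accept (joins? a b) {xs = es} j)

  mult-no : ∀ a b e es → ¬ Joins a b e → multE (e ∷ es) a b ≡ multE es a b
  mult-no a b e es n = cong length (filter-reject (joins? a b) {xs = es} n)

  deg-∉ : ∀ {G v} → WF G → v ∉ V G → deg G v ≡ 0
  deg-∉ {G} {v} wf n = cong length (filter-none (inc? v) (All.map (λ { (p , q , _) (inj₁ refl) → n p ; (p , q , _) (inj₂ refl) → n q }) (proj₂ wf)))

  ≤1-of-0 : ∀ {k} → k ≡ 0 → k ≤ 1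
  ≤1-of-0 refl = z≤n

  addV : Graph → ℕ → Graph
  addV G x = mkGraph (x ∷ V G) (E G)

  addV-simple : ∀ {G x} → Simple G → x ∉ V G → Simple (addV G x)
  addV-simple si n = (Allₚ.¬Any⇒All¬ _ n ∷ proj₁ (proj₁ si) , All.map (λ { (p , q , r) → there p , there q , r }) (proj₂ (proj₁ si))) , proj₂ si

  addE : Graph → ℕ → ℕ → Graph
  addE G a b = mkGraph (V G) ((a , b) ∷ E G)

  module AddE {G : Graph} {a b : ℕ} (si : Simple G) (aV : a ∈ V G) (bV : b ∈ V G) (ne : a ≢ b) (nab : ¬ Adj G a b) where

    addE⁻ : Adj (addE G a b) ⊑ add (Adj G) a b
    addE⁻ {c} {d} r with toAd (addE G a b) {c} {d} r
    ... | inj₁ (here refl) = new joins-self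
    ... | inj₂ (here refl) = new (inj₂ (refl , refl))
    ... | inj₁ (there m) = old (fromAd G (inj₁ m))
    ... | inj₂ (there m) = old (fromAd G (inj₂ m))

    addE⁺ : add (Adj G) a b ⊑ Adj (addE G a b)
    addE⁺ {c} {d} (old r) = fromAd (addE G a b) {c} {d} ([ (λ m → inj₁ (there m)) , (λ m → inj₂ (there m)) ] (toAd G r))
    addE⁺ {c} {d} (new (inj₁ (refl , refl))) = fromAd (addE G a b) {c} {d} (inj₁ (here refl))
    addE⁺ {c} {d} (new (inj₂ (refl , refl))) = fromAd (addE G a b) {c} {d} (inj₂ (here refl))

    addE-simple : Simple (addE G a b)
    addE-simple = (proj₁ (proj₁ si) , (aV , bV , ne) ∷ proj₂ (proj₁ si)) , mu
      where
      mu : ∀ c d → mult (addE G a b) c d ≤ 1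
      mu c d with joins? c d (a , b)
      ... | no n = subst (_≤ 1) (sym (mult-no c d (a , b) (E G) n)) (proj₂ si c d)
      ... | yes j = subst (_≤ 1) (sym (trans (mult-yes c d (a , b) (E G) j) (cong suc (¬adj-mult {E G} λ r → nab (f j (fromAd G r)))))) ≤-refl
        where
        f : Joins c d (a , b) → Adj G c d → Adj G a b
        f (inj₁ (refl , refl)) r = r
        f (inj₂ (refl , refl)) r = adj-sym G r

    addE-deg-end : ∀ {v} → v ≡ a ⊎ v ≡ b → deg (addE G a b) v ≡ suc (deg G v)
    addE-deg-end (inj₁ refl) = deg-yes a (a , b) (E G) (inj₁ refl)
    addE-deg-end (inj₂ refl) = deg-yes b (a , b) (E G) (inj₂ refl)

    addE-deg-≢ : ∀ {v} → v ≢ a → v ≢ b → deg (addE G a b) v ≡ deg G v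
    addE-deg-≢ {v} na nb = deg-no v (a , b) (E G) [ (λ e → na (sym e)) , (λ e → nb (sym e)) ]

    addE-deg-≥ : ∀ v → deg G v ≤ deg (addE G a b) v
    addE-deg-≥ v = count-tail (inc? v) (a , b) (E G)

  subG : Graph → ℕ → ℕ → ℕ → Graph
  subG G α β a = mkGraph (a ∷ V G) ((α , a) ∷ (a , β) ∷ delE α β (E G))

  module SubG {G : Graph} {α β a : ℕ} (si : Simple G) (αβ : Adj G α β) (fr : a ∉ V G) where

    private
      wf : WF G
      wf = proj₁ si
      αV : α ∈ V G
      αV = proj₁ (adj-∈ {G} wf αβ)
      βV : β ∈ V G
      βV = proj₁ (proj₂ (adj-∈ {G} wf αβ))
      α≢β : α ≢ β
      α≢β = proj₂ (proj₂ (adj-∈ {G} wf αβ))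
      α≢a : α ≢ a
      α≢a refl = fr αV
      β≢a : β ≢ a
      β≢a refl = fr βV
      es : Edges
      es = delE α β (E G)
      H : Graph
      H = subG G α β a

    sub-fresh : Fresh (Adj G) a
    sub-fresh r = (λ { refl → fr (proj₁ (adj-∈ {G} wf r)) }) , (λ { refl → fr (proj₁ (proj₂ (adj-∈ {G} wf r))) })

    sub⁻ : Adj H ⊑ subdiv (Adj G) α β a
    sub⁻ {c} {d} r with toAd H {c} {d} r
    ... | inj₁ (here refl) = left joins-self
    ... | inj₂ (here refl) = left (inj₂ (refl , refl))
    ... | inj₁ (there (here refl)) = right joins-self
    ... | inj₂ (there (here refl)) = right (inj₂ (refl , refl))
    ... | inj₁ (there (there m)) = let (p , n) = ad-delE⁻ {E G} (inj₁ m) in rest (fromAd G p) n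
    ... | inj₂ (there (there m)) = let (p , n) = ad-delE⁻ {E G} (inj₂ m) in rest (fromAd G p) n

    sub⁺ : subdiv (Adj G) α β a ⊑ Adj H
    sub⁺ {c} {d} (rest r n) = fromAd H {c} {d} ([ (λ m → inj₁ (there (there m))) , (λ m → inj₂ (there (there m))) ] (ad-delE⁺ (toAd G r) n))
    sub⁺ {c} {d} (left (inj₁ (refl , refl))) = fromAd H {c} {d} (inj₁ (here refl))
    sub⁺ {c} {d} (left (inj₂ (refl , refl))) = fromAd H {c} {d} (inj₂ (here refl))
    sub⁺ {c} {d} (right (inj₁ (refl , refl))) = fromAd H {c} {d} (inj₁ (there (here refl)))
    sub⁺ {c} {d} (right (inj₂ (refl , refl))) = fromAd H {c} {d} (inj₂ (there (here refl)))

    private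
      no-a : ∀ {c d} → Ad es c d → c ≢ a × d ≢ a
      no-a r = sub-fresh (fromAd G (proj₁ (ad-delE⁻ {E G} r)))

      mult-a : ∀ {c d} → Joins c d (α , a) ⊎ Joins c d (a , β) → multE es c d ≡ 0
      mult-a j = ¬adj-mult {es} λ r → f j (no-a r)
        where
        f : ∀ {c d} → Joins c d (α , a) ⊎ Joins c d (a , β) → ¬ (c ≢ a × d ≢ a)
        f (inj₁ (inj₁ (refl , refl))) (p , q) = q refl
        f (inj₁ (inj₂ (refl , refl))) (p , q) = p refl
        f (inj₂ (inj₁ (refl , refl))) (p , q) = p refl
        f (inj₂ (inj₂ (refl , refl))) (p , q) = q refl

    sub-deg-new : deg H a ≡ 2
    sub-deg-new = trans (deg-yes a (α , a) ((a , β) ∷ es) (inj₂ refl)) (cong suc (trans (deg-yes a (a , β) es (inj₁ refl)) (cong suc z)))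
      where
      z : degE es a ≡ 0
      z = cong length (filter-none (inc? a) (All.tabulate λ { m (inj₁ refl) → proj₁ (no-a (inj₁ m)) refl ; m (inj₂ refl) → proj₂ (no-a (inj₁ m)) refl }))

    sub-deg-old : ∀ {v} → v ≢ a → deg H v ≡ deg G v
    sub-deg-old {v} nv with v ≟ α | v ≟ β
    ... | yes refl | _ = trans (deg-yes v (α , a) ((a , β) ∷ es) (inj₁ refl)) (trans (cong suc (deg-no v (a , β) es [ (λ e → α≢a (sym e)) , (λ e → α≢β (sym e)) ])) (sym (trans (deg-delE-∈ (E G) {α} {β} (inj₁ refl)) (cong (_+ degE es v) (adj-mult {E G} (proj₂ si α β) (toAd G αβ))))))
    ... | no n | yes refl = trans (deg-no v (α , a) ((a , β) ∷ es) [ α≢β , (λ e → β≢a (sym e)) ]) (trans (deg-yes v (a , β) es (inj₂ refl)) (sym (trans (deg-delE-∈ (E G) {α} {β} (inj₂ refl)) (cong (_+ degE es v) (adj-mult {E G} (proj₂ si α β) (toAd G αβ))))))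
    ... | no n | no n' = trans (deg-no v (α , a) ((a , β) ∷ es) [ (λ e → n (sym e)) , (λ e → nv (sym e)) ]) (trans (deg-no v (a , β) es [ (λ e → nv (sym e)) , (λ e → n' (sym e)) ]) (deg-delE-≢ (E G) n n'))

    sub-simple : Simple H
    sub-simple = (Allₚ.¬Any⇒All¬ _ fr ∷ proj₁ wf , (there αV , here refl , α≢a) ∷ (here refl , there βV , λ e → β≢a (sym e)) ∷
        All.map (λ { (p , q , r) → there p , there q , r }) (Allₚ.filter⁺ (λ e → ¬? (joins? α β e)) (proj₂ wf))) , mu
      where
      clash : ∀ {c d} → Joins c d (α , a) → ¬ Joins c d (a , β)
      clash (inj₁ (refl , refl)) (inj₁ (e , _)) = α≢a (sym e)
      clash (inj₁ (refl , refl)) (inj₂ (_ , e)) = α≢β (sym e)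
      clash (inj₂ (refl , refl)) (inj₁ (_ , e)) = α≢β (sym e)
      clash (inj₂ (refl , refl)) (inj₂ (e , _)) = α≢a (sym e)
      mu : ∀ c d → mult H c d ≤ 1
      mu c d with joins? c d (α , a) | joins? c d (a , β)
      ... | yes j | _ = subst (_≤ 1) (sym (trans (mult-yes c d (α , a) ((a , β) ∷ es) j) (cong suc (trans (mult-no c d (a , β) es (clash j)) (mult-a (inj₁ j)))))) ≤-refl
      ... | no n | yes j = subst (_≤ 1) (sym (trans (mult-no c d (α , a) ((a , β) ∷ es) n) (trans (mult-yes c d (a , β) es j) (cong suc (mult-a (inj₂ j)))))) ≤-refl
      ... | no n | no n' = subst (_≤ 1) (sym (trans (mult-no c d (α , a) ((a , β) ∷ es) n) (mult-no c d (a , β) es n'))) (≤-trans (count-filter-≤ (joins? c d) (λ e → ¬? (joins? α β e)) (E G)) (proj₂ si c d))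

    sub-connected : Connected G → Connected H
    sub-connected con c d mc md = star-sym (adj-sym H) (from-α c mc) ◅◅ from-α d md
      where
      from-α : ∀ v → v ∈ a ∷ V G → Star (Adj H) α v
      from-α v (here refl) = one (sub⁺ (left joins-self))
      from-α v (there m) = mono sub⁺ (subdiv-up (adj-sym G) αβ sub-fresh (con α v αV m))

    sub-edges : length (E H) ≤ suc (length (E G))
    sub-edges = s≤s (filter-notAll (λ e → ¬? (joins? α β e)) (E G) ([ (λ m → lose m λ k → k (inj₁ (refl , refl))) , (λ m → lose m λ k → k (inj₂ (refl , refl))) ] (toAd G αβ)))

  -- N is a network up to the vertices of D, which still have degree two
  record PreNet (X D : List ℕ) (N : Graph) (w : ℕ) : Set where
    field
      simple : Simple N
      connected : Connected N
      labV : ∀ {x} → x ∈ X → x ∈ V N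
      labD : ∀ {x} → x ∈ X → deg N x ≤ 1
      inner : ∀ {v} → v ∈ V N → v ∈ X ⊎ deg N v ≡ 3 ⊎ (v ∈ D × deg N v ≡ 2)
      count : length (E N) + 1 ≤ w + length (V N)

  preNet-sub : ∀ {X D N w α β a} → PreNet X D N w → Adj N α β → a ∉ V N → PreNet X (a ∷ D) (subG N α β a) w
  preNet-sub {X} {D} {N} {w} {α} {β} {a} p αβ fr = record
    { simple = M.sub-simple ; connected = M.sub-connected connected ; labV = λ m → there (labV m)
    ; labD = λ m → subst (_≤ 1) (sym (M.sub-deg-old (old≢ (labV m)))) (labD m)
    ; inner = inn
    ; count = ≤-trans (+-monoˡ-≤ 1 M.sub-edges) (subst (suc (length (E N) + 1) ≤_) (sym (+-suc w (length (V N)))) (s≤s count)) }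
    where
    open PreNet p
    module M = SubG {N} {α} {β} {a} simple αβ fr
    old≢ : ∀ {v} → v ∈ V N → v ≢ a
    old≢ m refl = fr m
    inn : ∀ {v} → v ∈ a ∷ V N → v ∈ X ⊎ deg (subG N α β a) v ≡ 3 ⊎ (v ∈ a ∷ D × deg (subG N α β a) v ≡ 2)
    inn (here refl) = inj₂ (inj₂ (here refl , M.sub-deg-new))
    inn {v} (there m) with inner m
    ... | inj₁ i = inj₁ i
    ... | inj₂ (inj₁ d) = inj₂ (inj₁ (trans (M.sub-deg-old (old≢ m)) d))
    ... | inj₂ (inj₂ (i , d)) = inj₂ (inj₂ (there i , trans (M.sub-deg-old (old≢ m)) d))

  preNet-edge : ∀ {X D N w a b} → PreNet X D N w → a ∈ V N → b ∈ V N → a ≢ b → ¬ Adj N a b → deg N a ≡ 2 → deg N b ≡ 2 →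
    (∀ {v} → v ∈ D → v ≡ a ⊎ v ≡ b) → PreNet X [] (addE N a b) (suc w)
  preNet-edge {X} {D} {N} {w} {a} {b} p aV bV ne nab da db h = record
    { simple = M.addE-simple ; connected = λ c d mc md → mono (λ r → M.addE⁺ (old r)) (connected c d mc md) ; labV = labV
    ; labD = λ m → subst (_≤ 1) (sym (M.addE-deg-≢ (λ { refl → two≢ da (labD m) }) (λ { refl → two≢ db (labD m) }))) (labD m)
    ; inner = inn ; count = s≤s count }
    where
    open PreNet p
    module M = AddE {N} {a} {b} simple aV bV ne nab
    two≢ : ∀ {k} → k ≡ 2 → ¬ k ≤ 1
    two≢ refl (s≤s ())
    inn : ∀ {v} → v ∈ V N → v ∈ X ⊎ deg (addE N a b) v ≡ 3 ⊎ (v ∈ [] × deg (addE N a b) v ≡ 2)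
    inn {v} m with inner m
    ... | inj₁ i = inj₁ i
    ... | inj₂ (inj₁ d) = inj₂ (inj₁ (trans (M.addE-deg-≢ (λ { refl → case trans (sym d) da of λ () }) (λ { refl → case trans (sym d) db of λ () })) d))
    ... | inj₂ (inj₂ (i , d)) = inj₂ (inj₁ (trans (M.addE-deg-end (h i)) (cong suc d)))

  leafG : Graph → ℕ → ℕ → Graph
  leafG N a x = addE (addV N x) a x

  module LeafG {N : Graph} {a x : ℕ} (si : Simple N) (aV : a ∈ V N) (fr : x ∉ V N) where

    a≢x : a ≢ x
    a≢x refl = fr aV

    nax : ¬ Adj (addV N x) a x
    nax r = fr (proj₁ (proj₂ (adj-∈ {N} (proj₁ si) r)))

    module A = AddE {addV N x} {a} {x} (addV-simple {N} si fr) (there aV) (here refl) a≢x nax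

    leaf-connected : Connected N → Connected (leafG N a x)
    leaf-connected con c d mc md = star-sym (adj-sym (leafG N a x)) (from-a c mc) ◅◅ from-a d md
      where
      from-a : ∀ v → v ∈ x ∷ V N → Star (Adj (leafG N a x)) a v
      from-a v (here refl) = one (A.addE⁺ (new joins-self))
      from-a v (there m) = mono (λ r → A.addE⁺ (old r)) (con a v aV m)

  preNet-leaf : ∀ {X₀ X D N w a x} → PreNet X₀ D N w → a ∈ V N → x ∉ V N → a ∉ X₀ → deg N a ≡ 2 → (∀ {v} → v ∈ D → v ≡ a) →
    (∀ {y} → y ∈ X → y ≡ x ⊎ y ∈ X₀) → (∀ {y} → y ∈ X₀ → y ∈ X) → x ∈ X → PreNet X [] (leafG N a x) w
  preNet-leaf {X₀} {X} {D} {N} {w} {a} {x} p aV fr aX da h s₁ s₂ xX = record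
    { simple = M.A.addE-simple ; connected = M.leaf-connected connected
    ; labV = λ m → [ (λ { refl → here refl }) , (λ i → there (labV i)) ] (s₁ m)
    ; labD = ld ; inner = inn
    ; count = subst (suc (length (E N) + 1) ≤_) (sym (+-suc w (length (V N)))) (s≤s count) }
    where
    open PreNet p
    module M = LeafG {N} {a} {x} simple aV fr
    dx : deg (leafG N a x) x ≡ 1
    dx = trans (M.A.addE-deg-end (inj₂ refl)) (cong suc (deg-∉ {N} (proj₁ simple) fr))
    old≢ : ∀ {v} → v ∈ V N → v ≢ x
    old≢ m refl = fr m
    ld : ∀ {y} → y ∈ X → deg (leafG N a x) y ≤ 1
    ld m with s₁ m
    ... | inj₁ refl = ≤-reflexive dx
    ... | inj₂ i = subst (_≤ 1) (sym (M.A.addE-deg-≢ (λ { refl → aX i }) (old≢ (labV i)))) (labD i)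
    inn : ∀ {v} → v ∈ x ∷ V N → v ∈ X ⊎ deg (leafG N a x) v ≡ 3 ⊎ (v ∈ [] × deg (leafG N a x) v ≡ 2)
    inn (here refl) = inj₁ xX
    inn {v} (there m) with inner m
    ... | inj₁ i = inj₁ (s₂ i)
    ... | inj₂ (inj₁ d) = inj₂ (inj₁ (trans (M.A.addE-deg-≢ (λ { refl → case trans (sym d) da of λ () }) (old≢ m)) d))
    ... | inj₂ (inj₂ (i , d)) = inj₂ (inj₁ (trans (M.A.addE-deg-end (inj₁ (h i))) (cong suc d)))

open NetworkSurgery

module Copies where

  -- S is a copy in N of a forest with adjacency R: their labels, related by P, are split in the same way.
  -- Vertices of D are unfinished ends of S.
  record Emb (L D : List ℕ) (P : Gr) (N : Graph) (R : Gr) : Set where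
    field
      S : Graph
      sS : Simple S
      foS : Forest (Adj S)
      V⊆ : ∀ {v} → v ∈ V S → v ∈ V N
      E⊆ : Adj S ⊑ Adj N
      labS : ∀ {x y} → P x y → y ∈ V S
      low : ∀ {v} → v ∈ V S → v ∈ L ⊎ (v ∈ D × 1 ≤ deg S v) ⊎ 2 ≤ deg S v
      eqS : Eqv P R (Adj S)

  emb-⊆ : ∀ {L D P N N' R} → (∀ {v} → v ∈ V N → v ∈ V N') → Adj N ⊑ Adj N' → Emb L D P N R → Emb L D P N' R
  emb-⊆ f g e = record { S = S ; sS = sS ; foS = foS ; V⊆ = λ m → f (V⊆ m) ; E⊆ = λ r → g (E⊆ r) ; labS = labS ; low = low ; eqS = eqS }
    where open Emb e

  emb-rel : ∀ {L L' D P Q N R R'} → (∀ {v} → v ∈ L → v ∈ L') → Q ⊑ P → Eqv Q R' R → (∀ {x y} → Q x y → Q x x) → Emb L D P N R → Emb L' D Q N R'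
  emb-rel l q t d e = record { S = S ; sS = sS ; foS = foS ; V⊆ = V⊆ ; E⊆ = E⊆ ; labS = λ p → labS (q p)
    ; low = λ m → [ (λ i → inj₁ (l i)) , inj₂ ] (low m) ; eqS = eqv-trans (λ p → _ , d p , p) t (eqv-restrict q eqS) }
    where open Emb e

  module EmbSub {L D P N R} (e : Emb L D P N R) {α β a : ℕ} (sN : Simple N) (nαβ : Adj N α β) (fr : a ∉ V N) where

    open Emb e

    private
      module M = SubG {N} {α} {β} {a} sN nαβ fr
      frS : a ∉ V S
      frS m = fr (V⊆ m)

    module Used (sαβ : Adj S α β) where

      module T = SubG {S} {α} {β} {a} sS sαβ frS

      S⁺ : Graph
      S⁺ = subG S α β a

      toS⁺ : Adj S⁺ ⊑ Adj (subG N α β a)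
      toS⁺ {c} {d} r with T.sub⁻ {c} {d} r
      ... | rest q n = M.sub⁺ {c} {d} (rest (E⊆ q) n)
      ... | left j = M.sub⁺ {c} {d} (left j)
      ... | right j = M.sub⁺ {c} {d} (right j)

      foS⁺ : Forest (Adj S⁺)
      foS⁺ = forest-⊑ T.sub⁻ (subdiv-forest (adj-sym S) sαβ T.sub-fresh foS)

      old≢ : ∀ {v} → v ∈ V S → v ≢ a
      old≢ m refl = frS m

      low⁺ : ∀ {v} → v ∈ a ∷ V S → v ∈ L ⊎ (v ∈ D × 1 ≤ deg S⁺ v) ⊎ 2 ≤ deg S⁺ v
      low⁺ (here refl) = inj₂ (inj₂ (≤-reflexive (sym T.sub-deg-new)))
      low⁺ {v} (there m) = subst (λ k → v ∈ L ⊎ (v ∈ D × 1 ≤ k) ⊎ 2 ≤ k) (sym (T.sub-deg-old (old≢ m))) (low m)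

      eq⁺ : Eqv P R (Adj S⁺)
      eq⁺ = eqv-cong (λ r → r) (λ r → r) T.sub⁺ T.sub⁻ (eqv-trans (λ p → _ , p , (refl , old≢ (labS p))) eqS (subdiv-eqv (adj-sym S) sαβ T.sub-fresh))

      used : Emb L D P (subG N α β a) R
      used = record { S = S⁺ ; sS = T.sub-simple ; foS = foS⁺ ; V⊆ = λ { (here e) → here e ; (there m) → there (V⊆ m) } ; E⊆ = toS⁺ ; labS = λ p → there (labS p) ; low = low⁺ ; eqS = eq⁺ }

      module Middle {t u w u0 w0 u0' w0' : ℕ} (md : Mid R t u w u0 w0) (pu : P u0 u0') (pw : P w0 w0')
        (i : SameSplit P R t u (Adj S) α β) (αu : Star (del (Adj S) α β) α u0') (βw : Star (del (Adj S) α β) β w0')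
        (ne : ∀ {x x'} → P x x' → x ≢ t) where

        private
          α≢β : α ≢ β
          α≢β = proj₂ (proj₂ (adj-∈ {S} (proj₁ sS) sαβ))
          toL : del (Adj S) α β ⊑ del (Adj S⁺) α a
          toL (r , n) = T.sub⁺ (rest r n) , λ { (inj₁ (_ , q)) → proj₂ (T.sub-fresh r) q ; (inj₂ (q , _)) → proj₁ (T.sub-fresh r) q }
          toR : del (Adj S) α β ⊑ del (Adj S⁺) β a
          toR (r , n) = T.sub⁺ (rest r n) , λ { (inj₁ (_ , q)) → proj₂ (T.sub-fresh r) q ; (inj₂ (q , _)) → proj₁ (T.sub-fresh r) q }

          onl : ∀ {n} → Adj S⁺ a n → n ≡ α ⊎ n ≡ β
          onl {n} r with T.sub⁻ {a} {n} r
          ... | rest q _ = ⊥-elim (proj₁ (T.sub-fresh q) refl)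
          ... | left (inj₁ (p , q)) = ⊥-elim (proj₁ (T.sub-fresh sαβ) (sym p))
          ... | left (inj₂ (_ , q)) = inj₁ q
          ... | right (inj₁ (_ , q)) = inj₂ q
          ... | right (inj₂ (p , q)) = ⊥-elim (proj₂ (T.sub-fresh sαβ) (sym p))

          md' : Mid (Adj S⁺) a α β u0' w0'
          md' = record { m-listed = adj-listed S⁺ ; m-forest = foS⁺ ; au = T.sub⁺ (left (inj₂ (refl , refl))) ; aw = T.sub⁺ (right joins-self)
                       ; u≢w = α≢β ; only = onl ; u-side = mono toL αu ; w-side = mono toR βw }

          sub-cong : ∀ {c d x y} → Star (del (subdiv (Adj S) α β a) c d) x y → Star (del (Adj S⁺) c d) x y
          sub-cong = mono (del-mono T.sub⁺)
          cong-sub : ∀ {c d x y} → Star (del (Adj S⁺) c d) x y → Star (del (subdiv (Adj S) α β a) c d) x y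
          cong-sub = mono (del-mono T.sub⁻)

          iu : SameSplit P R t u (Adj S⁺) a α
          iu p q = let lf = subdiv-left (adj-sym S) sαβ T.sub-fresh (refl , old≢ (labS p)) (refl , old≢ (labS q)) in
            (λ s → mono del-comm (sub-cong (proj₁ lf (proj₁ (i p q) s)))) , (λ s → proj₂ (i p q) (proj₂ lf (cong-sub (mono del-comm s))))
          iw : SameSplit P R t w (Adj S⁺) a β
          iw p q = let rt = subdiv-right (adj-sym S) sαβ T.sub-fresh (refl , old≢ (labS p)) (refl , old≢ (labS q)) in
            (λ s → sub-cong (proj₁ rt (proj₁ (i p q) (Mid.sides-agree (Mid.mid-flip md) (ne p) (ne q) s)))) ,
            (λ s → Mid.sides-agree md (ne p) (ne q) (proj₂ (i p q) (proj₂ rt (cong-sub s))))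

        middle : Emb L D (ext P t a) (subG N α β a) R
        middle = record { S = S⁺ ; sS = T.sub-simple ; foS = foS⁺ ; V⊆ = Emb.V⊆ used ; E⊆ = toS⁺
          ; labS = λ { (old p) → there (labS p) ; (new refl refl) → here refl } ; low = low⁺
          ; eqS = eqv-extend md md' pu pw iu iw (λ p → ne p , old≢ (labS p)) eq⁺ }

    unused : ¬ Adj S α β → Emb L D P (subG N α β a) R
    unused n = record { S = S ; sS = sS ; foS = foS ; V⊆ = λ m → there (V⊆ m) ; labS = labS ; low = low ; eqS = eqS
      ; E⊆ = λ {c} {d} r → M.sub⁺ {c} {d} (rest (E⊆ r) λ { (inj₁ (refl , refl)) → n r ; (inj₂ (refl , refl)) → n (adj-sym S r) }) }

    plain : Emb L D P (subG N α β a) R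
    plain with adj? S α β
    ... | yes r = Used.used r
    ... | no n = unused n

  emb-stub : ∀ {L D P N R} (e : Emb L D P N R) {x α β a t} → Simple N → Adj N α β → a ∉ V N → P x α → (∀ n → ¬ Adj (Emb.S e) α n) →
    Symm R → (∀ n → ¬ R t n) → (∀ {z} → ¬ P t z) → Emb L (a ∷ D) (ext P t a) (subG N α β a) (add R x t)
  emb-stub {L} {D} {P} {N} {R} e {x} {α} {β} {a} {t} sN nαβ fr px iso sR nt pt = record
    { S = leafG S α a ; sS = K.A.addE-simple ; foS = forest-⊑ K.A.addE⁻ (forest-add (adj-sym S) foS nstar)
    ; V⊆ = λ { (here e) → here e ; (there m) → there (V⊆ m) } ; E⊆ = toN
    ; labS = λ { (old p) → there (labS p) ; (new refl refl) → here refl } ; low = low⁺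
    ; eqS = eqv-cong (λ r → r) (λ r → r) K.A.addE⁺ K.A.addE⁻
        (eqv-add sR (adj-sym S) (λ r → nt x (sR r)) (λ r → nA _ (adj-sym S r)) (old px) (new refl refl) (eqv-isolated sR (adj-sym S) nt nA pt (λ p → frS (labS p)) eqS)) }
    where
    open Emb e
    frS : a ∉ V S
    frS m = fr (V⊆ m)
    module M = SubG {N} {α} {β} {a} sN nαβ fr
    module K = LeafG {S} {α} {a} sS (labS px) frS
    nA : ∀ n → ¬ Adj S a n
    nA n r = frS (proj₁ (adj-∈ {S} (proj₁ sS) r))
    nstar : ¬ Star (Adj S) α a
    nstar s with isolated-≡ iso s
    ... | refl = frS (labS px)
    toN : Adj (leafG S α a) ⊑ Adj (subG N α β a)
    toN {c} {d} r with K.A.addE⁻ {c} {d} r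
    ... | new j = M.sub⁺ {c} {d} (left j)
    ... | old q = M.sub⁺ {c} {d} (rest (E⊆ q) λ { (inj₁ (refl , refl)) → iso _ q ; (inj₂ (refl , refl)) → iso _ (adj-sym S q) })
    da : deg (leafG S α a) a ≡ 1
    da = trans (K.A.addE-deg-end (inj₂ refl)) (cong suc (deg-∉ {S} (proj₁ sS) frS))
    low⁺ : ∀ {v} → v ∈ a ∷ V S → v ∈ L ⊎ (v ∈ a ∷ D × 1 ≤ deg (leafG S α a) v) ⊎ 2 ≤ deg (leafG S α a) v
    low⁺ (here refl) = inj₂ (inj₁ (here refl , ≤-reflexive (sym da)))
    low⁺ {v} (there m) with low m
    ... | inj₁ i = inj₁ i
    ... | inj₂ (inj₁ (i , d)) = inj₂ (inj₁ (there i , ≤-trans d (K.A.addE-deg-≥ v)))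
    ... | inj₂ (inj₂ d) = inj₂ (inj₂ (≤-trans d (K.A.addE-deg-≥ v)))

  emb-vertex : ∀ {L D P N R} (e : Emb L D P N R) {x} → x ∉ V N → Symm R → (∀ n → ¬ R x n) → (∀ {z} → ¬ P x z) → Emb (x ∷ L) D (ext P x x) (addV N x) R
  emb-vertex {L} {D} {P} {N} {R} e {x} fr sR nx px = record
    { S = addV S x ; sS = addV-simple {S} sS frS ; foS = foS ; V⊆ = λ { (here e) → here e ; (there m) → there (V⊆ m) } ; E⊆ = E⊆
    ; labS = λ { (old p) → there (labS p) ; (new refl refl) → here refl }
    ; low = λ { (here e) → inj₁ (here e) ; (there m) → [ (λ i → inj₁ (there i)) , inj₂ ] (low m) }
    ; eqS = eqv-isolated sR (adj-sym S) nx (λ n r → frS (proj₁ (adj-∈ {S} (proj₁ sS) r))) px (λ p → frS (labS p)) eqS }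
    where
    open Emb e
    frS : x ∉ V S
    frS m = fr (V⊆ m)

  emb-edge : ∀ {L D P N R} (e : Emb L D P N R) {a a' b b'} → P a a' → P b b' → Symm R → ¬ Star R a b → Adj N a' b' → a' ≢ b' →
    (∀ {v} → v ∈ D → v ≡ a' ⊎ v ≡ b') → Emb L [] P N (add R a b)
  emb-edge {L} {D} {P} {N} {R} e {a} {a'} {b} {b'} pa pb sR nab nN ne h = record
    { S = addE S a' b' ; sS = M.addE-simple ; foS = forest-⊑ M.addE⁻ (forest-add (adj-sym S) foS nS) ; V⊆ = V⊆
    ; E⊆ = toN ; labS = labS ; low = low⁺
    ; eqS = eqv-cong (λ r → r) (λ r → r) M.addE⁺ M.addE⁻ (eqv-add sR (adj-sym S) (λ r → nab (one r)) (λ r → nS (one r)) pa pb eqS) }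
    where
    open Emb e
    nS : ¬ Star (Adj S) a' b'
    nS s = nab (conn (bwd eqS) pa pb s)
    module M = AddE {S} {a'} {b'} sS (labS pa) (labS pb) ne (λ r → nS (one r))
    toN : Adj (addE S a' b') ⊑ Adj N
    toN {c} {d} r with M.addE⁻ {c} {d} r
    ... | old q = E⊆ q
    ... | new (inj₁ (refl , refl)) = nN
    ... | new (inj₂ (refl , refl)) = adj-sym N nN
    low⁺ : ∀ {v} → v ∈ V S → v ∈ L ⊎ (v ∈ [] × 1 ≤ deg (addE S a' b') v) ⊎ 2 ≤ deg (addE S a' b') v
    low⁺ {v} m with low m
    ... | inj₁ i = inj₁ i
    ... | inj₂ (inj₁ (i , d)) = inj₂ (inj₂ (subst (2 ≤_) (sym (M.addE-deg-end (h i))) (s≤s d)))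
    ... | inj₂ (inj₂ d) = inj₂ (inj₂ (≤-trans d (M.addE-deg-≥ v)))

open Copies

module EdgeReinsertion where

  -- Inner vertices avoid Z, the list of all labels, so that deleted labels can be put back under their names.
  record Net (Z X : List ℕ) (F F' : Graph) (w : ℕ) : Set where
    field
      N : Graph
      pn : PreNet X [] N w
      e : Emb X [] (On X) N (Adj F)
      e' : Emb X [] (On X) N (Adj F')
      some : Σ ℕ λ y → y ∈ X
      clean : ∀ {v} → v ∈ V N → v ∈ X ⊎ v ∉ Z

  net-swap : ∀ {Z X F F' w} → Net Z X F F' w → Net Z X F' F w
  net-swap n = record { N = N ; pn = pn ; e = e' ; e' = e ; some = some ; clean = clean }
    where open Net n

  second-nbr : ∀ {G v} → Simple G → 2 ≤ deg G v → ∀ b → Σ ℕ λ c → Adj G v c × c ≢ b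
  second-nbr {G} {v} si d b with nbrs v (E G) in eq | nbrs-length v (E G) | nbrs-unique {v} {E G} (no-loops {G} (proj₁ si)) (λ b → proj₂ si v b)
  ... | [] | q | _ = case subst (2 ≤_) (sym q) d of λ ()
  ... | _ ∷ [] | q | _ = case subst (2 ≤_) (sym q) d of λ { (s≤s ()) }
  ... | p ∷ q ∷ r | _ | (ne ∷ _) ∷ _ with p ≟ b
  ...   | no n = p , fromAd G (nbrs-∈ {v} {E G} (subst (p ∈_) (sym eq) (here refl))) , n
  ...   | yes refl = q , fromAd G (nbrs-∈ {v} {E G} (subst (q ∈_) (sym eq) (there (here refl)))) , λ e → ne (sym e)

  emb-isolated : ∀ {X N R} (e : Emb X [] (On X) N R) {l} → l ∈ X → (∀ n → ¬ R l n) → ∀ n → ¬ Adj (Emb.S e) l n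
  emb-isolated {X} e {l} lX iso n r with label-beyond {Adj S} {λ v → v ∈ X} (adj-listed S) foS next n l (adj-sym S r)
    where
    open Emb e
    next : ∀ a b → Adj S a b → a ∈ X ⊎ Σ ℕ λ c → Adj S a c × c ≢ b
    next a b ab with low (proj₁ (adj-∈ {S} (proj₁ sS) ab))
    ... | inj₁ i = inj₁ i
    ... | inj₂ (inj₁ (() , _))
    ... | inj₂ (inj₂ d) = inj₂ (second-nbr {S} sS d b)
  ... | l' , lX' , s with isolated-≡ iso (conn (bwd (Emb.eqS e)) (on lX) (on lX') (r ◅ mono del⊑ s))
  ...   | refl = Emb.foS e (adj-sym (Emb.S e) r) s

  net-nbr : ∀ N {b c} → Connected N → b ∈ V N → c ∈ V N → c ≢ b → Σ ℕ λ β → Adj N b β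
  net-nbr N {b} {c} con bV cV ne with con b c bV cV
  ... | ε = ⊥-elim (ne refl)
  ... | r ◅ _ = _ , r

  stub-restore : ∀ {X R a t s} → Symm R → (∀ n → ¬ R a n) → (∀ n → ¬ R t n) → a ≢ t → s ≢ t → t ∉ X → Eqv (On X) (add R a s) (add (add R a t) t s)
  stub-restore {X} {R} {a} {t} {s} sy ia it na ns tX = eqv-restrict (λ { (on m) → refl , λ { refl → tX m } })
    (eqv-cong (λ r → r) (λ r → r) f g (subdiv-eqv {add R a s} {a} {s} {t} (add-sym sy) (new joins-self) fresh))
    where
    fresh : Fresh (add R a s) t
    fresh (old r) = (λ { refl → it _ r }) , (λ { refl → it _ (sy r) })
    fresh (new (inj₁ (refl , refl))) = na , ns
    fresh (new (inj₂ (refl , refl))) = ns , na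
    f : subdiv (add R a s) a s t ⊑ add (add R a t) t s
    f (rest (old r) n) = old (old r)
    f (rest (new j) n) = ⊥-elim (n j)
    f (left j) = old (new j)
    f (right j) = new j
    g : add (add R a t) t s ⊑ subdiv (add R a s) a s t
    g (old (old r)) = rest (old r) λ { (inj₁ (refl , _)) → ia _ r ; (inj₂ (_ , refl)) → ia _ (sy r) }
    g (old (new j)) = left j
    g (new j) = right j

  listed-add : ∀ {R} → Listed R → ∀ a b → Listed (add R a b)
  listed-add {R} l a b = record { es = (a , b) ∷ Listed.es l ; to = t ; from = f }
    where
    t : ∀ {u v} → add R a b u v → Ad ((a , b) ∷ Listed.es l) u v
    t (old r) = [ (λ m → inj₁ (there m)) , (λ m → inj₂ (there m)) ] (Listed.to l r)
    t (new (inj₁ (refl , refl))) = inj₁ (here refl)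
    t (new (inj₂ (refl , refl))) = inj₂ (here refl)
    f : ∀ {u v} → Ad ((a , b) ∷ Listed.es l) u v → add R a b u v
    f (inj₁ (here refl)) = new joins-self
    f (inj₂ (here refl)) = new (inj₂ (refl , refl))
    f (inj₁ (there m)) = old (Listed.from l (inj₁ m))
    f (inj₂ (there m)) = old (Listed.from l (inj₂ m))

  add-isolated : ∀ {R a t x y} → (∀ n → ¬ R t n) → Symm R → x ≢ t → y ≢ t → Star (add R a t) x y → Star R x y
  add-isolated it sy nx ny s with add-across s
  ... | inj₁ q = q
  ... | inj₂ (inj₁ (_ , q)) = ⊥-elim (ny (sym (isolated-≡ it q)))
  ... | inj₂ (inj₂ (q , _)) = ⊥-elim (nx (sym (isolated-≡ it (star-sym sy q))))

  record FR (R : Gr) (VR : List ℕ) : Set where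
    field
      lR : Listed R
      fR : Forest R
      inVR : ∀ {u v} → R u v → u ∈ VR
    sR : Symm R
    sR = symm lR

  data End (X : List ℕ) (P R : Gr) (N S : Graph) (a : ℕ) : Set where
    mid-end : ∀ {u w u0 w0} → Mid R a u w u0 w0 → u0 ∈ X → w0 ∈ X → (∀ {x x'} → P x x' → x ≢ a) → End X P R N S a
    stub-end : a ∈ X → (∀ n → ¬ R a n) → (∀ n → ¬ Adj S a n) → ∀ {β} → Adj N a β → End X P R N S a

  -- A place for the end a of a deleted edge: the edge {α,β} of N is subdivided by a', which represents
  -- a itself, or (if a is a label) a vertex t subdividing the pendant edge of a.
  record Stage (X D VR : List ℕ) (P : Gr) (N : Graph) (R : Gr) (S : Graph) (a a' : ℕ) : Set₁ where
    field
      α β t : ℕ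
      nαβ : Adj N α β
      R⁺ : Gr
      fr⁺ : FR R⁺ (t ∷ VR)
      D⁺ : List ℕ
      D⊆ : ∀ {v} → v ∈ D⁺ → v ≡ a' ⊎ v ∈ D
      emb⁺ : Emb X D⁺ (ext P t a') (subG N α β a') R⁺
      t-ok : t ≡ a ⊎ t ∉ VR
      up : R ⊑ R⁺
      same-nbrs : ∀ {c n} → c ≢ a → c ≢ t → R⁺ c n → R c n
      back : ∀ {y} → y ≢ t → Star R⁺ t y → Star R a y
      restore : ∀ {Y s} → s ≢ t → (∀ {y} → y ∈ Y → y ∈ VR) → Eqv (On Y) (add R a s) (add R⁺ t s)
      near : ∀ {n} → Adj (subG N α β a') a' n → (Σ ℕ λ l → l ∈ X × Star R a l × Star (Adj S) n l) ⊎ (a ∈ X × Adj N a n) ⊎ (a ∈ X × n ≡ a)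
      iso⁺ : ∀ {l} → l ∈ V S → l ≢ a → (∀ n → ¬ Adj S l n) → ∀ n → ¬ Adj (Emb.S emb⁺) l n

  new-nbrs : ∀ {N α β a n} → Simple N → Adj N α β → a ∉ V N → Adj (subG N α β a) a n → n ≡ α ⊎ n ≡ β
  new-nbrs {N} {α} {β} {a} {n} si αβ fr r with SubG.sub⁻ {N} si αβ fr {a} {n} r
  ... | rest q _ = ⊥-elim (proj₁ (SubG.sub-fresh {N} si αβ fr q) refl)
  ... | left (inj₁ (p , q)) = ⊥-elim (proj₁ (SubG.sub-fresh {N} si αβ fr αβ) (sym p))
  ... | left (inj₂ (_ , q)) = inj₁ q
  ... | right (inj₁ (_ , q)) = inj₂ q
  ... | right (inj₂ (p , q)) = ⊥-elim (proj₂ (SubG.sub-fresh {N} si αβ fr αβ) (sym p))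

  module MakeStage {X D VR P N R} (e : Emb X D P N R) (sN : Simple N) (fr : FR R VR) (X⊆P : On X ⊑ P) (P⊆ : ∀ {x y} → P x y → x ∈ VR)
    {a a' : ℕ} (aVR : a ∈ VR) (fa : a' ∉ V N) where

    open Emb e
    open FR fr

    module FromMid {u w u0 w0 α β} (md : Mid R a u w u0 w0) (uX : u0 ∈ X) (wX : w0 ∈ X) (ne : ∀ {x x'} → P x x' → x ≢ a)
      (sαβ : Adj S α β) (i : SameSplit P R a u (Adj S) α β) (αu : Star (del (Adj S) α β) α u0) (βw : Star (del (Adj S) α β) β w0) where

      private
        module U = EmbSub.Used e {α} {β} {a'} sN (E⊆ sαβ) fa sαβ
        ua : Star R a u0
        ua = Mid.au md ◅ mono del⊑ (Mid.u-side md)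
        wa : Star R a w0
        wa = Mid.aw md ◅ mono del⊑ (Mid.w-side md)

      from-mid : Stage X D VR P N R S a a'
      from-mid = record
        { α = α ; β = β ; t = a ; nαβ = E⊆ sαβ ; R⁺ = R ; fr⁺ = record { lR = lR ; fR = fR ; inVR = λ r → there (inVR r) }
        ; D⁺ = D ; D⊆ = inj₂ ; emb⁺ = U.Middle.middle md (X⊆P (on uX)) (X⊆P (on wX)) i αu βw ne
        ; t-ok = inj₁ refl ; up = λ r → r ; same-nbrs = λ _ _ r → r ; back = λ _ s → s
        ; restore = λ _ _ → on-refl
        ; near = λ r → inj₁ ([ (λ { refl → u0 , uX , ua , mono del⊑ αu }) , (λ { refl → w0 , wX , wa , mono del⊑ βw }) ] (new-nbrs {N} sN (E⊆ sαβ) fa r))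
        ; iso⁺ = λ m _ iso n r → isoS m iso n (U.T.sub⁻ r) }
        where
        isoS : ∀ {l} → l ∈ V S → (∀ n → ¬ Adj S l n) → ∀ n → ¬ subdiv (Adj S) α β a' l n
        isoS m iso n (rest r _) = iso n r
        isoS m iso n (left (inj₁ (refl , _))) = iso _ sαβ
        isoS m iso n (left (inj₂ (refl , _))) = fa (V⊆ m)
        isoS m iso n (right (inj₁ (refl , _))) = fa (V⊆ m)
        isoS m iso n (right (inj₂ (refl , _))) = iso _ (adj-sym S sαβ)

    mid-stage : ∀ {u w u0 w0} → Mid R a u w u0 w0 → u0 ∈ X → w0 ∈ X → (∀ {x x'} → P x x' → x ≢ a) → Stage X D VR P N R S a a'
    mid-stage {u} {w} {u0} {w0} md uX wX ne = go (match (fwd eqS) (Mid.au md))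
      where
      uw : Star R u0 w0
      uw = star-sym sR (Mid.au md ◅ mono del⊑ (Mid.u-side md)) ◅◅ (Mid.aw md ◅ mono del⊑ (Mid.w-side md))
      go : NoSplit P R a u ⊎ (Σ ℕ λ α → Σ ℕ λ β → Adj S α β × SameSplit P R a u (Adj S) α β) → Stage X D VR P N R S a a'
      go (inj₁ t) = ⊥-elim (Mid.u0≁w0 md (t (X⊆P (on uX)) (X⊆P (on wX)) uw))
      go (inj₂ (α , β , r , i)) = [ (λ { (p , q) → FromMid.from-mid md uX wX ne r i (star-sym (del-sym α β (adj-sym S)) p) q })
          , (λ { (p , q) → FromMid.from-mid md uX wX ne (adj-sym S r) (λ x y → (λ s → mono del-comm (proj₁ (i x y) s)) , (λ s → proj₂ (i x y) (mono del-comm s)))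
               (mono del-comm (star-sym (del-sym α β (adj-sym S)) p)) (mono del-comm q) }) ]
        (proj₂ (cross! (adj-sym S) α β (conn (fwd eqS) (X⊆P (on uX)) (X⊆P (on wX)) uw) (λ s → Mid.u0≁w0 md (proj₂ (i (X⊆P (on uX)) (X⊆P (on wX))) s))))

    stub-stage : a ∈ X → (∀ n → ¬ R a n) → (∀ n → ¬ Adj S a n) → ∀ {β} → Adj N a β → Stage X D VR P N R S a a'
    stub-stage aX ia iS {β} aβ = record
      { α = a ; β = β ; t = t ; nαβ = aβ ; R⁺ = add R a t
      ; fr⁺ = record { lR = listed-add lR a t ; fR = forest-add sR fR (λ s → a≢t (isolated-≡ ia s)) ; inVR = inV }
      ; D⁺ = a' ∷ D ; D⊆ = λ { (here e) → inj₁ e ; (there m) → inj₂ m }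
      ; emb⁺ = emb-stub e sN aβ fa (X⊆P (on aX)) iS sR it (λ p → tV (P⊆ p))
      ; t-ok = inj₂ tV ; up = old ; same-nbrs = sn
      ; back = λ ny s → bk ny s
      ; restore = λ ns Y⊆ → stub-restore sR ia it a≢t ns (λ m → tV (Y⊆ m))
      ; near = λ r → [ (λ n → inj₂ (inj₂ (aX , n))) , (λ { refl → inj₂ (inj₁ (aX , aβ)) }) ] (new-nbrs {N} sN aβ fa r)
      ; iso⁺ = λ m nl iso n r → isoS m nl iso n (LeafG.A.addE⁻ {S} sS (labS (X⊆P (on aX))) (λ q → fa (V⊆ q)) r) }
      where
      t : ℕ
      t = proj₁ (above VR)
      tV : t ∉ VR
      tV = proj₂ (above VR)
      a≢t : a ≢ t
      a≢t q = tV (subst (_∈ VR) q aVR)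
      it : ∀ n → ¬ R t n
      it n r = tV (inVR r)
      inV : ∀ {u v} → add R a t u v → u ∈ t ∷ VR
      inV (old r) = there (inVR r)
      inV (new (inj₁ (refl , _))) = there aVR
      inV (new (inj₂ (refl , _))) = here refl
      sn : ∀ {c n} → c ≢ a → c ≢ t → add R a t c n → R c n
      sn na nt (old r) = r
      sn na nt (new (inj₁ (q , _))) = ⊥-elim (na q)
      sn na nt (new (inj₂ (q , _))) = ⊥-elim (nt q)
      bk : ∀ {y} → y ≢ t → Star (add R a t) t y → Star R a y
      bk ny s = add-isolated it sR a≢t ny (new joins-self ◅ s)
      isoS : ∀ {l} → l ∈ V S → l ≢ a → (∀ n → ¬ Adj S l n) → ∀ n → ¬ add (Adj S) a a' l n
      isoS m nl iso n (old r) = iso n r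
      isoS m nl iso n (new (inj₁ (q , _))) = nl q
      isoS m nl iso n (new (inj₂ (refl , _))) = fa (V⊆ m)

    stage : End X P R N S a → Stage X D VR P N R S a a'
    stage (mid-end md uX wX ne) = mid-stage md uX wX ne
    stage (stub-end aX ia iS aβ) = stub-stage aX ia iS aβ

  add-comm : ∀ {R a b} → add R a b ⊑ add R b a
  add-comm (old r) = old r
  add-comm (new j) = new (joins-comm j)

  module NetCut {Z X F F' G a b w} (f : IsF X F) (d : DelEdge F a b G) (net : Net Z X G F' w) where

    open OnF f
    open Net net

    private
      ab : Adj F a b
      ab = proj₁ d
      R₀ : Gr
      R₀ = del (Adj F) a b
      VR : List ℕ
      VR = a ∷ b ∷ V F
      module PN = PreNet pn

      fr₀ : FR R₀ VR
      fr₀ = record { lR = listed-del lF a b ; fR = forest-⊑ kept forest ; inVR = λ r → there (there (proj₁ (adj-∈ {F} wfF (kept r)))) }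

      e₀ : Emb X [] (On X) N R₀
      e₀ = emb-rel (λ m → m) (λ p → p) (del-eqv {a = a} {b} f d) (λ { (on m) → on m }) e

      S₀ : Graph
      S₀ = Emb.S e₀

      split-ab : ¬ Star R₀ a b
      split-ab = forest ab

      F≈ : Eqv (On X) (Adj F) (add R₀ a b)
      F≈ = eqv-cong to-F from-F (λ r → r) (λ r → r) on-refl
        where
        to-F : add R₀ a b ⊑ Adj F
        to-F (old r) = kept r
        to-F (new (inj₁ (refl , refl))) = ab
        to-F (new (inj₂ (refl , refl))) = sF ab
        from-F : Adj F ⊑ add R₀ a b
        from-F {u} {v} r with joins? a b (u , v)
        ... | yes j = new j
        ... | no n = old (r , n)

      isolated : ∀ {a b} → Adj F a b → a ∈ X → ∀ n → ¬ del (Adj F) a b a n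
      isolated ab aX n (r , k) with nbr1 aX r ab
      ... | refl = k joins-self

      mid-of : ∀ {a b} → Adj F a b → a ∉ X → Σ ℕ λ u → Σ ℕ λ w → Σ ℕ λ u0 → Σ ℕ λ w0 → Mid (del (Adj F) a b) a u w u0 w0 × u0 ∈ X × w0 ∈ X
      mid-of {a} {b} ab na with tri-at na ab
      ... | u , w , t with beyond u a (sF (vb t)) | beyond w a (sF (vc t))
      ...   | u0 , uX , su | w0 , wX , sw = u , w , u0 , w0 , record
              { m-listed = listed-del lF a b ; m-forest = forest-⊑ kept forest
              ; au = vb t , (λ { (inj₁ (_ , q)) → a≢b t (sym q) ; (inj₂ (q , _)) → forest-≢ forest ab q })
              ; aw = vc t , (λ { (inj₁ (_ , q)) → a≢c t (sym q) ; (inj₂ (q , _)) → forest-≢ forest ab q })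
              ; u≢w = b≢c t ; only = onl
              ; u-side = helly sF (del-sym a b sF) kept forest (side-mono sF forest (vb t) (λ q → a≢b t (sym q)) su) su
              ; w-side = helly sF (del-sym a b sF) kept forest (side-mono sF forest (vc t) (λ q → a≢c t (sym q)) sw) sw } , uX , wX
        where
        onl : ∀ {n} → del (Adj F) a b a n → n ≡ u ⊎ n ≡ w
        onl (r , k) with only3 t r
        ... | inj₁ refl = ⊥-elim (k joins-self)
        ... | inj₂ q = q

      flip₀ : del (Adj F) b a ⊑ R₀
      flip₀ = del-comm

      aV : a ∈ V F
      aV = proj₁ (adj-∈ {F} wfF ab)
      bV : b ∈ V F
      bV = proj₁ (proj₂ (adj-∈ {F} wfF ab))
      a≢b₀ : a ≢ b
      a≢b₀ = forest-≢ forest ab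

      far : ∀ {a b} → Adj F a b → a ∈ X → Σ ℕ λ l → l ∈ X × l ≢ a
      far {a} {b} ab aX with beyond b a (sF ab)
      ... | l , lX , s = l , lX , λ { refl → forest (sF ab) s }

      nbr-in : ∀ N' → Connected N' → (∀ {v} → v ∈ V N → v ∈ V N') → ∀ {a b} → Adj F a b → a ∈ X → Σ ℕ λ β → Adj N' a β
      nbr-in N' con up ab aX = let (l , lX , ne) = far ab aX in net-nbr N' con (up (PN.labV aX)) (up (PN.labV lX)) ne

      end-a : End X (On X) R₀ N S₀ a
      end-a with a ∈? X
      ... | yes aX = stub-end aX (isolated ab aX) (emb-isolated e₀ aX (isolated ab aX)) (proj₂ (nbr-in N PN.connected (λ m → m) ab aX))
      ... | no na = let (_ , _ , _ , _ , md , uX , wX) = mid-of ab na in mid-end md uX wX (λ { (on m) refl → na m })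

      a' : ℕ
      a' = proj₁ (above (V N ++ Z))
      a'∉ : a' ∉ V N
      a'∉ m = proj₂ (above (V N ++ Z)) (∈-++⁺ˡ m)

      st₁ : Stage X [] VR (On X) N R₀ S₀ a a'
      st₁ = MakeStage.stage e₀ PN.simple fr₀ (λ p → p) (λ { (on m) → there (there (lab m)) }) (here refl) a'∉ end-a

      module Second (st : Stage X [] VR (On X) N R₀ S₀ a a') (excl : ¬ (a ∈ X × b ∈ X × Adj N a b)) where

        open Stage st
        private
          N₁ : Graph
          N₁ = subG N α β a'
          pn₁ : PreNet X (a' ∷ []) N₁ w
          pn₁ = preNet-sub pn nαβ a'∉
          P₁ : Gr
          P₁ = ext (On X) t a'
          S₁ : Graph
          S₁ = Emb.S emb⁺
          b≢t : b ≢ t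
          b≢t refl = [ (λ q → a≢b₀ (sym q)) , (λ n → n (there (here refl))) ] t-ok

          P₁≢b : b ∉ X → ∀ {x x'} → P₁ x x' → x ≢ b
          P₁≢b nb (old (on m)) refl = nb m
          P₁≢b nb (new q _) refl = b≢t q

          iso-b : b ∈ X → ∀ n → ¬ R₀ b n
          iso-b bX n r = isolated (sF ab) bX n (del-comm r)

          b∈N : b ∈ X → b ∈ V S₀
          b∈N bX = Emb.labS e₀ (on bX)

          end-b : Dec (b ∈ X) → End X P₁ R⁺ N₁ S₁ b
          end-b (yes bX) = stub-end bX (λ n r → iso-b bX n (same-nbrs (λ q → a≢b₀ (sym q)) b≢t r)) (iso⁺ (b∈N bX) (λ q → a≢b₀ (sym q)) (emb-isolated e₀ bX (iso-b bX)))
            (proj₂ (nbr-in N₁ (PreNet.connected pn₁) there (sF ab) bX))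
          end-b (no nb) = let (u , w , u0 , w0 , md , uX , wX) = mid-of (sF ab) nb in mid-end {u = u} {w} {u0} {w0} (record
            { m-listed = FR.lR fr⁺ ; m-forest = FR.fR fr⁺ ; au = up (flip₀ (Mid.au md)) ; aw = up (flip₀ (Mid.aw md)) ; u≢w = Mid.u≢w md
            ; only = λ r → Mid.only md (del-comm (same-nbrs (λ q → a≢b₀ (sym q)) b≢t r))
            ; u-side = mono (del-mono (λ r → up (flip₀ r))) (Mid.u-side md) ; w-side = mono (del-mono (λ r → up (flip₀ r))) (Mid.w-side md) }) uX wX (P₁≢b nb)

          b' : ℕ
          b' = proj₁ (above (V N₁ ++ Z))
          b'∉ : b' ∉ V N₁
          b'∉ m = proj₂ (above (V N₁ ++ Z)) (∈-++⁺ˡ m)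

          st₂ : Stage X D⁺ (t ∷ VR) P₁ N₁ R⁺ S₁ b b'
          st₂ = MakeStage.stage emb⁺ (PreNet.simple pn₁) fr⁺ old (λ { (old (on m)) → there (there (there (lab m))) ; (new refl _) → here refl }) (there (there (here refl))) b'∉ (end-b (b ∈? X))

          module Last (st' : Stage X D⁺ (t ∷ VR) P₁ N₁ R⁺ S₁ b b') where

            module T = Stage st'
            N₂ : Graph
            N₂ = subG N₁ T.α T.β b'
            pn₂ : PreNet X (b' ∷ a' ∷ []) N₂ w
            pn₂ = preNet-sub pn₁ T.nαβ b'∉
            module M₁ = SubG {N} {α} {β} {a'} PN.simple nαβ a'∉
            module M₂ = SubG {N₁} {T.α} {T.β} {b'} (PreNet.simple pn₁) T.nαβ b'∉
            a'≢b' : a' ≢ b'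
            a'≢b' q = b'∉ (subst (_∈ V N₁) q (here refl))
            t≢T : t ≢ T.t
            t≢T q = [ (λ r → b≢t (trans (sym r) (sym q))) , (λ n → n (here (sym q))) ] T.t-ok

            no-conn : ¬ Star R⁺ t b
            no-conn s = split-ab (back b≢t s)

            not-adj₁ : ¬ (b ∈ X × Adj N₁ b a')
            not-adj₁ (bX , r) = go (near (adj-sym N₁ r))
              where
              go : (Σ ℕ λ l → l ∈ X × Star R₀ a l × Star (Adj S₀) b l) ⊎ (a ∈ X × Adj N a b) ⊎ (a ∈ X × b ≡ a) → ⊥
              go (inj₁ (l , lX , sa , sl)) = split-ab (subst (Star R₀ a) (sym (isolated-≡ (emb-isolated e₀ bX (iso-b bX)) sl)) sa)
              go (inj₂ (inj₁ (aX , q))) = excl (aX , bX , q)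
              go (inj₂ (inj₂ (_ , q))) = a≢b₀ (sym q)

            not-adj : ¬ Adj N₂ a' b'
            not-adj r with T.near (adj-sym N₂ r)
            ... | inj₁ (l , lX , sb , sl) = no-conn (conn (bwd (Emb.eqS emb⁺)) (new refl refl) (old (on lX)) sl ◅◅ star-sym (FR.sR fr⁺) sb)
            ... | inj₂ (inj₁ p) = not-adj₁ p
            ... | inj₂ (inj₂ (bX , q)) = a'∉ (subst (_∈ V N) (sym q) (PN.labV bX))

            N₃ : Graph
            N₃ = addE N₂ a' b'
            pn₃ : PreNet X [] N₃ (suc w)
            pn₃ = preNet-edge pn₂ (there (here refl)) (here refl) a'≢b' not-adj (trans (M₂.sub-deg-old a'≢b') M₁.sub-deg-new) M₂.sub-deg-new
              (λ { (here q) → inj₂ q ; (there (here q)) → inj₁ q })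

            module A₃ = AddE {N₂} {a'} {b'} (PreNet.simple pn₂) (there (here refl)) (here refl) a'≢b' not-adj

            no-conn₂ : ¬ Star T.R⁺ t T.t
            no-conn₂ s = no-conn (star-sym (FR.sR fr⁺) (T.back t≢T (star-sym (FR.sR T.fr⁺) s)))

            D-done : ∀ {v} → v ∈ T.D⁺ → v ≡ a' ⊎ v ≡ b'
            D-done m with T.D⊆ m
            ... | inj₁ q = inj₂ q
            ... | inj₂ i with D⊆ i
            ...   | inj₁ q = inj₁ q

            e₃ : Emb X [] (On X) N₃ (Adj F)
            e₃ = emb-rel (λ m → m) (λ p → old (old p)) rel (λ { (on m) → on m })
              (emb-edge (emb-⊆ (λ m → m) (λ r → A₃.addE⁺ (old r)) T.emb⁺) {t} {a'} {T.t} {b'} (old (new refl refl)) (new refl refl) (FR.sR T.fr⁺) no-conn₂ (A₃.addE⁺ (new joins-self)) a'≢b'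
                D-done)
              where
              rel : Eqv (On X) (Adj F) (add T.R⁺ t T.t)
              rel = on-trans F≈ (on-trans (restore b≢t (λ m → there (there (lab m)))) (eqv-cong add-comm add-comm add-comm add-comm (T.restore t≢T (λ m → there (there (there (lab m)))))))

            e₃' : Emb X [] (On X) N₃ (Adj F')
            e₃' = emb-⊆ (λ m → m) (λ r → A₃.addE⁺ (old r)) (EmbSub.plain (EmbSub.plain e' PN.simple nαβ a'∉) (PreNet.simple pn₁) T.nαβ b'∉)

            result : Net Z X F F' (suc w)
            result = record { N = N₃ ; pn = pn₃ ; e = e₃ ; e' = e₃' ; some = some ; clean = cl }
              where
              cl : ∀ {v} → v ∈ b' ∷ a' ∷ V N → v ∈ X ⊎ v ∉ Z
              cl (here refl) = inj₂ λ m → proj₂ (above (V N₁ ++ Z)) (∈-++⁺ʳ (V N₁) m)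
              cl (there (here refl)) = inj₂ λ m → proj₂ (above (V N ++ Z)) (∈-++⁺ʳ (V N) m)
              cl (there (there m)) = clean m

        result : Net Z X F F' (suc w)
        result = Last.result st₂

      direct : a ∈ X → b ∈ X → Adj N a b → Net Z X F F' (suc w)
      direct aX bX r = record { N = N ; pn = record { PreNet pn ; count = m≤n⇒m≤1+n PN.count } ; e' = e' ; some = some ; clean = clean
        ; e = emb-rel (λ m → m) (λ p → p) F≈ (λ { (on m) → on m }) (emb-edge e₀ (on aX) (on bX) (FR.sR fr₀) split-ab r a≢b₀ (λ ())) }

    net-cut : Net Z X F F' (suc w)
    net-cut = decide (a ∈? X) (λ aX → decide (b ∈? X) (λ bX → decide (adj? N a b) (direct aX bX) (λ n → Second.result st₁ (λ { (_ , _ , r) → n r })))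
        (λ nb → Second.result st₁ (λ { (_ , q , _) → nb q }))) (λ na → Second.result st₁ (λ { (q , _) → na q }))

open EdgeReinsertion

module LeafReinsertion where

  module Reattach {X F G x} (f : IsF X F) (xX : x ∈ X) (dl : DelLeaf F x G) {N : Graph} {w : ℕ}
    (pn : PreNet (delV x X) [] N w) (e : Emb (delV x X) [] (On (delV x X)) N (Adj G)) (x∉N : x ∉ V N) where

    open OnF f
    module PN = PreNet pn

    X₀ : List ℕ
    X₀ = delV x X

    R₀ : Gr
    R₀ = Adj (dropV F x)

    drop-adj⁺ : ∀ {a b} → Adj F a b → a ≢ x → b ≢ x → R₀ a b
    drop-adj⁺ = drop⁺ {F} {x}

    drop-adj⁻ : ∀ {a b} → R₀ a b → Adj F a b × a ≢ x × b ≢ x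
    drop-adj⁻ = drop⁻ {F} {x}

    fr₀ : FR R₀ (x ∷ V F)
    fr₀ = record { lR = adj-listed (dropV F x) ; fR = forest-⊑ (λ r → proj₁ (drop-adj⁻ r)) forest ; inVR = λ r → there (proj₁ (adj-∈ {F} wfF (proj₁ (drop-adj⁻ r)))) }

    e₀ : Emb X₀ [] (On X₀) N R₀
    e₀ = emb-rel (λ m → m) (λ p → p) (on-trans (on-flip (drop-eqv {X} {F} {x} simple (leaf xX))) (delLeaf-eqv f xX dl)) (λ { (on m) → on m }) e

    S₀ : Graph
    S₀ = Emb.S e₀

    sR₀ : Symm R₀
    sR₀ = FR.sR fr₀

    x-iso : ∀ n → ¬ R₀ x n
    x-iso n r = proj₁ (proj₂ (drop-adj⁻ r)) refl

    X₀⊆X : ∀ {y} → y ∈ X₀ → y ∈ X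
    X₀⊆X m = proj₁ (∈-delV⁻ m)

    x∉X₀ : x ∉ X₀
    x∉X₀ m = proj₂ (∈-delV⁻ {V = X} m) refl

    split-X : ∀ {y} → y ∈ X → y ≡ x ⊎ y ∈ X₀
    split-X {y} m with y ≟ x
    ... | yes q = inj₁ q
    ... | no n = inj₂ (∈-delV⁺ m n)

    x∷X₀ : ∀ {v} → v ∈ x ∷ X₀ → v ∈ X
    x∷X₀ (here refl) = xX
    x∷X₀ (there m) = X₀⊆X m

    with-x : ∀ {Q : Gr} → Q x x → On X₀ ⊑ Q → On X ⊑ Q
    with-x q h (on m) with split-X m
    ... | inj₁ refl = q
    ... | inj₂ i = h (on i)

    F≈ : ∀ {v} → Adj F x v → Eqv (On X) (Adj F) (add R₀ v x)
    F≈ {v} xv = eqv-cong to-F from-F (λ r → r) (λ r → r) on-refl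
      where
      to-F : add R₀ v x ⊑ Adj F
      to-F (old r) = proj₁ (drop-adj⁻ r)
      to-F (new (inj₁ (refl , refl))) = sF xv
      to-F (new (inj₂ (refl , refl))) = xv
      from-F : Adj F ⊑ add R₀ v x
      from-F {c} {d} r with c ≟ x | d ≟ x
      ... | yes refl | _ = new (inj₂ (refl , nbr1 xX r xv))
      ... | no _ | yes refl = new (inj₁ (nbr1 xX (sF r) xv , refl))
      ... | no p | no q = old (drop-adj⁺ r p q)

    F≈₀ : deg F x ≡ 0 → Eqv (On X) (Adj F) R₀
    F≈₀ d = eqv-cong (λ r → proj₁ (drop-adj⁻ r)) (λ {a} {b} r → drop-adj⁺ r (λ { refl → deg-0 simple {x} d b r }) (λ { refl → deg-0 simple {x} d a (sF r) })) (λ r → r) (λ r → r) on-refl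

    no-x : ∀ {T : Gr} → Symm T → (∀ n → ¬ T x n) → ∀ {t} → t ≢ x → ¬ Star T t x
    no-x sT iso ne s = ne (sym (isolated-≡ iso (star-sym sT s)))

    module At {α β : ℕ} (αβ : Adj N α β) (a' : ℕ) (a'∉ : a' ∉ V N) (a'≢x : a' ≢ x) where

      N₁ N₂ : Graph
      N₁ = subG N α β a'
      N₂ = leafG N₁ a' x

      x∉N₁ : x ∉ V N₁
      x∉N₁ (here q) = a'≢x (sym q)
      x∉N₁ (there m) = x∉N m

      pn₁ : PreNet X₀ (a' ∷ []) N₁ w
      pn₁ = preNet-sub pn αβ a'∉

      pn₂ : PreNet X [] N₂ w
      pn₂ = preNet-leaf pn₁ (here refl) x∉N₁ (λ m → a'∉ (PN.labV m)) (SubG.sub-deg-new {N} PN.simple αβ a'∉) (λ { (here q) → q }) split-X X₀⊆X xX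

      module K = LeafG {N₁} {a'} {x} (PreNet.simple pn₁) (here refl) x∉N₁

      isolated-leaf : deg F x ≡ 0 → Emb X [] (On X) N₂ (Adj F)
      isolated-leaf d = emb-rel x∷X₀ (with-x {ext (On X₀) x x} (new refl refl) old) (F≈₀ d) (λ { (on m) → on m })
        (emb-⊆ (λ m → m) (λ r → K.A.addE⁺ (old r)) (emb-vertex (EmbSub.plain e₀ PN.simple αβ a'∉) x∉N₁ sR₀ x-iso (λ { (on m) → x∉X₀ m })))

      finish : ∀ {D t v R} → Adj F x v → Emb X₀ D (ext (On X₀) t a') N₁ R → Symm R → (∀ n → ¬ R x n) → t ≢ x →
        (∀ {u} → u ∈ D → u ≡ a') → Eqv (On X) (add R₀ v x) (add R t x) → Emb X [] (On X) N₂ (Adj F)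
      finish {D} {t} {v} {R} xv e₁ sR iso ne h q = emb-rel x∷X₀ (with-x {ext (ext (On X₀) t a') x x} (new refl refl) (λ p → old (old p))) (on-trans (F≈ xv) q) (λ { (on m) → on m })
        (emb-edge (emb-⊆ (λ m → m) (λ r → K.A.addE⁺ (old r)) (emb-vertex e₁ x∉N₁ sR iso nP)) {t} {a'} {x} {x} (old (new refl refl)) (new refl refl) sR (no-x sR iso ne)
          (K.A.addE⁺ (new joins-self)) a'≢x (λ m → inj₁ (h m)))
        where
        nP : ∀ {z} → ¬ ext (On X₀) t a' x z
        nP (old (on m)) = x∉X₀ m
        nP (new r _) = ne (sym r)

      from-stage : ∀ {v} → Adj F x v → (st : Stage X₀ [] (x ∷ V F) (On X₀) N R₀ S₀ v a') → Stage.α st ≡ α → Stage.β st ≡ β → Emb X [] (On X) N₂ (Adj F)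
      from-stage {v} xv st qα qβ = finish xv e₁ (FR.sR fr⁺) iso t≢x D-ok rel
        where
        open Stage st using (t; R⁺; fr⁺; D⁺; D⊆; emb⁺; t-ok; same-nbrs; restore)
        ne : v ≢ x
        ne q = forest-≢ forest xv (sym q)
        e₁ : Emb X₀ D⁺ (ext (On X₀) t a') N₁ R⁺
        e₁ = subst (λ z → Emb X₀ D⁺ (ext (On X₀) t a') (subG N z β a') R⁺) qα (subst (λ z → Emb X₀ D⁺ (ext (On X₀) t a') (subG N (Stage.α st) z a') R⁺) qβ emb⁺)
        t≢x : t ≢ x
        t≢x q = [ (λ r → ne (trans (sym r) q)) , (λ n → n (here q)) ] t-ok
        iso : ∀ n → ¬ R⁺ x n
        iso n r = x-iso n (same-nbrs (λ q → ne (sym q)) (λ q → t≢x (sym q)) r)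
        D-ok : ∀ {u} → u ∈ D⁺ → u ≡ a'
        D-ok m with D⊆ m
        ... | inj₁ q = q
        rel : Eqv (On X) (add R₀ v x) (add R⁺ t x)
        rel = restore (λ q → t≢x (sym q)) (λ m → there (lab m))
    private
      on-VF : ∀ {u u'} → On X₀ u u' → u ∈ x ∷ V F
      on-VF (on m) = there (lab (X₀⊆X m))
    module MS {v a' : ℕ} (vV : v ∈ x ∷ V F) (a'∉ : a' ∉ V N) = MakeStage e₀ PN.simple fr₀ (λ p → p) on-VF {v} {a'} vV a'∉

    y-iso : ∀ {y} → y ∈ X₀ → Adj F x y → ∀ n → ¬ R₀ y n
    y-iso m xy n r = proj₂ (proj₂ (drop-adj⁻ r)) (nbr1 (X₀⊆X m) (proj₁ (drop-adj⁻ r)) (sF xy))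

    pair-stage : ∀ {y β a'} → y ∈ X₀ → Adj F x y → Adj N y β → (a'∉ : a' ∉ V N) → Stage X₀ [] (x ∷ V F) (On X₀) N R₀ S₀ y a'
    pair-stage {y} {β} m xy yβ a'∉ = MS.stub-stage (there (lab (X₀⊆X m))) a'∉ m (y-iso m xy) (emb-isolated e₀ m (y-iso m xy)) {β} yβ

    module MidInfo {v u k : ℕ} (t : Tri F v x u k) where

      private
        to-drop : ∀ {u w} → Adj F v u → u ≢ x → w ≢ x → Star (del (Adj F) u v) u w → Star (del R₀ u v) u w
        to-drop {u} vu nu nw s = mono (λ { ((r , n) , p , q) → drop-adj⁺ r p q , n }) (avoid (del-sym u v sF) (λ p q → nbr1 xX (kept p) (kept q)) nu nw s)
        not-x : ∀ {u w} → Adj F v u → u ≢ x → Star (del (Adj F) u v) u w → w ≢ x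
        not-x vu nu s refl = forest (sF vu) (s ◅◅ one (sF (va t) , λ { (inj₁ (q , _)) → nu (sym q) ; (inj₂ (q , _)) → forest-≢ forest (va t) (sym q) }))
        u≢x : u ≢ x
        u≢x q = a≢b t (sym q)
        k≢x : k ≢ x
        k≢x q = a≢c t (sym q)
        v≢x : v ≢ x
        v≢x = forest-≢ forest (va t)
        bu : Σ ℕ λ l → l ∈ X × Star (del (Adj F) u v) u l
        bu = beyond u v (sF (vb t))
        bk : Σ ℕ λ l → l ∈ X × Star (del (Adj F) k v) k l
        bk = beyond k v (sF (vc t))

      u0 w0 : ℕ
      u0 = proj₁ bu
      w0 = proj₁ bk

      su : Star (del (Adj F) u v) u u0
      su = proj₂ (proj₂ bu)

      uX : u0 ∈ X₀
      uX = ∈-delV⁺ (proj₁ (proj₂ bu)) (not-x (vb t) u≢x su)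
      wX : w0 ∈ X₀
      wX = ∈-delV⁺ (proj₁ (proj₂ bk)) (not-x (vc t) k≢x (proj₂ (proj₂ bk)))

      md : Mid R₀ v u k u0 w0
      md = record { m-listed = FR.lR fr₀ ; m-forest = FR.fR fr₀ ; au = drop-adj⁺ (vb t) v≢x u≢x ; aw = drop-adj⁺ (vc t) v≢x k≢x ; u≢w = b≢c t
        ; only = λ r → [ (λ q → ⊥-elim (proj₂ (proj₂ (drop-adj⁻ r)) q)) , (λ q → q) ] (only3 t (proj₁ (drop-adj⁻ r)))
        ; u-side = to-drop (vb t) u≢x (not-x (vb t) u≢x su) su ; w-side = to-drop (vc t) k≢x (not-x (vc t) k≢x (proj₂ (proj₂ bk))) (proj₂ (proj₂ bk)) }

      ne : ∀ {y y'} → On X₀ y y' → y ≢ v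
      ne (on m) refl = tri-∉ t (X₀⊆X m)

      vV : v ∈ x ∷ V F
      vV = there (proj₁ (adj-∈ {F} wfF (va t)))

      mid-st : ∀ {a'} → a' ∉ V N → Stage X₀ [] (x ∷ V F) (On X₀) N R₀ S₀ v a'
      mid-st a'∉ = MS.mid-stage vV a'∉ md uX wX ne

    module AtCherry {v y k β a' : ℕ} (t : Tri F v x y k) (yX : y ∈ X) (yβ : Adj N y β) (a'∉ : a' ∉ V N) where

      open MidInfo t

      private
        y₀ : y ∈ X₀
        y₀ = ∈-delV⁺ yX (λ q → a≢b t (sym q))
        y≡u0 : y ≡ u0
        y≡u0 = leaf-side yX (sF (vb t)) su
        sS : Symm (Adj S₀)
        sS = adj-sym S₀
        N1 : ∀ {n m} → Adj N y n → Adj N y m → n ≡ m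
        N1 = deg-≤1 PN.simple {y} (PN.labD y₀)
        S1 : ∀ {n m} → Adj S₀ y n → Adj S₀ y m → n ≡ m
        S1 p q = N1 (Emb.E⊆ e₀ p) (Emb.E⊆ e₀ q)
        w≢y : w0 ≢ y
        w≢y q = Mid.u0≁w0 md (subst (Star (del R₀ v y) u0) (trans (sym y≡u0) (sym q)) ε)
        Syw : Star (Adj S₀) y w0
        Syw = conn (fwd (Emb.eqS e₀)) (on y₀) (on wX) (star-sym sR₀ (one (Mid.au md)) ◅◅ (Mid.aw md ◅ mono del⊑ (Mid.w-side md)))
        off : ∀ {T : Gr} {b p q} → Symm T → (∀ {n m} → T y n → T y m → n ≡ m) → p ≢ y → q ≢ y → Star T p q → Star (del T y b) p q
        off sT u np nq s = mono (λ { (r , p , q) → r , λ { (inj₁ (h , _)) → p h ; (inj₂ (_ , h)) → q h } }) (avoid sT u np nq s)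
        first-step : ∀ {q} → q ≢ y → Star (Adj S₀) y q → Adj S₀ y β × Star (del (Adj S₀) y β) β q
        first-step ne ε = ⊥-elim (ne refl)
        first-step ne (r ◅ s) with N1 (Emb.E⊆ e₀ r) yβ
        ... | refl = r , off sS S1 (λ q → forest-≢ (Emb.foS e₀) r (sym q)) ne s
        first : Adj S₀ y β × Star (del (Adj S₀) y β) β w0
        first = first-step w≢y Syw
        R1 : ∀ {n m} → R₀ y n → R₀ y m → n ≡ m
        R1 p q = nbr1 yX (proj₁ (drop-adj⁻ p)) (proj₁ (drop-adj⁻ q))
        alone : ∀ {T : Gr} {b q} → (∀ {n m} → T y n → T y m → n ≡ m) → T y b → Star (del T y b) y q → y ≡ q
        alone u yb = isolated-≡ λ { n (r , j) → j (inj₁ (refl , u r yb)) }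
        yv : R₀ y v
        yv = sR₀ (Mid.au md)
        same : SameSplit (On X₀) R₀ v y (Adj S₀) y β
        same {p} {_} {q} (on mp) (on mq) with p ≟ y | q ≟ y
        ... | yes refl | _ = (λ s → subst (Star _ y) (alone R1 yv (mono del-comm s)) ε) , (λ s → subst (Star _ y) (alone S1 (proj₁ first) s) ε)
        ... | no _ | yes refl = (λ s → subst (λ z → Star _ z y) (alone R1 yv (star-sym (del-sym y v sR₀) (mono del-comm s))) ε) , (λ s → subst (λ z → Star _ z y) (alone S1 (proj₁ first) (star-sym (del-sym y β sS) s)) ε)
        ... | no np | no nq = (λ s → off sS S1 np nq (conn (fwd (Emb.eqS e₀)) (on mp) (on mq) (mono del⊑ s))) ,
                (λ s → mono del-comm (off sR₀ R1 np nq (conn (bwd (Emb.eqS e₀)) (on mp) (on mq) (mono del⊑ s))))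

      cherry-st : Stage X₀ [] (x ∷ V F) (On X₀) N R₀ S₀ v a'
      cherry-st = MS.FromMid.from-mid vV a'∉ md uX wX ne (proj₁ first) same (subst (Star (del (Adj S₀) y β) y) y≡u0 ε) (proj₂ first)

    data Kind : Set where
      iso : deg F x ≡ 0 → Kind
      pair : ∀ {y} → y ∈ X₀ → Adj F x y → Kind
      mid : ∀ {v u k} → Adj F x v → Tri F v x u k → Kind

    kind : Kind
    kind with deg F x ≟ 0
    ... | yes d = iso d
    ... | no n with deg-1 simple {x} (≤1-≢0 n (leaf xX))
    ...   | v , xv with v ∈? X
    ...     | yes m = pair (∈-delV⁺ m (λ q → forest-≢ forest xv (sym q))) xv
    ...     | no nv with tri-at nv (sF xv)
    ...       | u , k , t = mid xv t

    module Lone {y : ℕ} (y₀ : y ∈ X₀) (all-y : ∀ {v} → v ∈ V N → v ≡ y) where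

      N₂ : Graph
      N₂ = leafG N y x

      module K = LeafG {N} {y} {x} PN.simple (PN.labV y₀) x∉N

      lone-emb : Kind → Emb X [] (On X) N₂ (Adj F)
      lone-emb (iso d) = emb-rel x∷X₀ (with-x {ext (On X₀) x x} (new refl refl) old) (F≈₀ d) (λ { (on m) → on m })
        (emb-⊆ (λ m → m) (λ r → K.A.addE⁺ (old r)) (emb-vertex e₀ x∉N sR₀ x-iso (λ { (on m) → x∉X₀ m })))
      lone-emb (mid xv t) = ⊥-elim (Mid.u0≁w0 (MidInfo.md t) (subst (Star _ (MidInfo.u0 t)) (trans (all-y (PN.labV (MidInfo.uX t))) (sym (all-y (PN.labV (MidInfo.wX t))))) ε))
      lone-emb (pair {z} m xz) with all-y (PN.labV m)
      ... | refl = emb-rel x∷X₀ (with-x {ext (On X₀) x x} (new refl refl) old) (F≈ xz) (λ { (on m) → on m })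
        (emb-edge (emb-⊆ (λ m → m) (λ r → K.A.addE⁺ (old r)) (emb-vertex e₀ x∉N sR₀ x-iso (λ { (on m) → x∉X₀ m }))) {z} {z} {x} {x} (old (on m)) (new refl refl) sR₀
          (no-x sR₀ x-iso (λ q → forest-≢ forest xz (sym q))) (K.A.addE⁺ (new joins-self)) K.a≢x (λ ()))

      lone-net : deg N y ≡ 0 → PreNet X [] N₂ w
      lone-net d = record { simple = K.A.addE-simple ; connected = K.leaf-connected PN.connected
        ; labV = λ m → [ (λ { refl → here refl }) , (λ i → there (PN.labV i)) ] (split-X m)
        ; labD = λ m → [ (λ { refl → ≤-reflexive dx }) , (λ i → ≤-reflexive (dy (all-y (PN.labV i)))) ] (split-X m)
        ; inner = λ { (here refl) → inj₁ xX ; (there m) → inj₁ (subst (_∈ X) (sym (all-y m)) (X₀⊆X y₀)) }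
        ; count = subst (suc (length (E N) + 1) ≤_) (sym (+-suc w (length (V N)))) (s≤s PN.count) }
        where
        dx : deg N₂ x ≡ 1
        dx = trans (K.A.addE-deg-end (inj₂ refl)) (cong suc (deg-∉ {N} (proj₁ PN.simple) x∉N))
        dy : ∀ {v} → v ≡ y → deg N₂ v ≡ 1
        dy refl = trans (K.A.addE-deg-end (inj₁ refl)) (cong suc d)

  module CherryEmb {X F G x} (f : IsF X F) (xX : x ∈ X) (dl : DelLeaf F x G) {N : Graph} {w : ℕ}
    (pn : PreNet (delV x X) [] N w) (e : Emb (delV x X) [] (On (delV x X)) N (Adj G)) (x∉N : x ∉ V N) where

    open OnF f
    module A = Reattach f xX dl pn e x∉N
    module K = CherryF f

    cherry-emb : ∀ {y β a'} → Cherry F x y → y ∈ delV x X → (yβ : Adj N y β) (a'∉ : a' ∉ V N) → a' ≢ x → Emb X [] (On X) (leafG (subG N y β a') a' x) (Adj F)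
    cherry-emb {y} {β} {a'} (_ , _ , _ , inj₁ xy) m yβ a'∉ ne = A.At.from-stage yβ a' a'∉ ne xy (A.pair-stage m xy yβ a'∉) refl refl
    cherry-emb {y} {β} {a'} (x≢y , lx , ly , inj₂ (v , xv , yv)) m yβ a'∉ ne = go (tri-at {v} {x} (λ i → x≢y (nbr1 i (sF xv) (sF yv))) (sF xv))
      where
      yX : y ∈ X
      yX = K.leaf→X ly
      fin : ∀ {k} → Tri F v x y k → Emb X [] (On X) (leafG (subG N y β a') a' x) (Adj F)
      fin t = A.At.from-stage yβ a' a'∉ ne xv (A.AtCherry.cherry-st t yX yβ a'∉) refl refl
      go : (Σ ℕ λ c → Σ ℕ λ d → Tri F v x c d) → Emb X [] (On X) (leafG (subG N y β a') a' x) (Adj F)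
      go (c , d , t) with only3 t (sF yv)
      ... | inj₁ q = ⊥-elim (x≢y (sym q))
      ... | inj₂ (inj₁ refl) = fin t
      ... | inj₂ (inj₂ refl) = fin (tri-swap {F} t)

  data FreeCond (F F' : Graph) (x : ℕ) : Set where
    isolatedL : deg F x ≡ 0 → FreeCond F F' x
    isolatedR : deg F' x ≡ 0 → FreeCond F F' x
    common : ∀ y → Cherry F x y → Cherry F' x y → FreeCond F F' x

  module NetFree {Z X F F' G G' x w} (f : IsF X F) (f' : IsF X F') (xX : x ∈ X) (xZ : x ∈ Z) (dl : DelLeaf F x G) (dl' : DelLeaf F' x G')
    (net : Net Z (delV x X) G G' w) where

    open Net net

    private
      X₀ : List ℕ
      X₀ = delV x X
      module PN = PreNet pn

      x∉N : x ∉ V N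
      x∉N m = [ (λ i → proj₂ (∈-delV⁻ {V = X} i) refl) , (λ n → n xZ) ] (clean m)

      module A = Reattach f xX dl pn e x∉N
      module A' = Reattach f' xX dl' pn e' x∉N

      some' : Σ ℕ λ y → y ∈ X
      some' = x , xX

      up-clean : ∀ {v} → v ∈ V N → v ∈ X ⊎ v ∉ Z
      up-clean m = [ (λ i → inj₁ (A.X₀⊆X i)) , inj₂ ] (clean m)

      a' : ℕ
      a' = proj₁ (above (V N ++ Z))
      a'∉ : a' ∉ V N
      a'∉ m = proj₂ (above (V N ++ Z)) (∈-++⁺ˡ m)
      a'Z : a' ∉ Z
      a'Z m = proj₂ (above (V N ++ Z)) (∈-++⁺ʳ (V N) m)
      a'≢x : a' ≢ x
      a'≢x q = a'Z (subst (_∈ Z) (sym q) xZ)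

      build : ∀ {α β} (αβ : Adj N α β) → Emb X [] (On X) (leafG (subG N α β a') a' x) (Adj F) → Emb X [] (On X) (leafG (subG N α β a') a' x) (Adj F') → Net Z X F F' w
      build αβ g g' = record { N = leafG (subG N _ _ a') a' x ; pn = A.At.pn₂ αβ a' a'∉ a'≢x ; e = g ; e' = g' ; some = some' ; clean = cl }
        where
        cl : ∀ {v} → v ∈ x ∷ a' ∷ V N → v ∈ X ⊎ v ∉ Z
        cl (here refl) = inj₁ xX
        cl (there (here refl)) = inj₂ a'Z
        cl (there (there m)) = up-clean m

      lone : ∀ {y} → y ∈ X₀ → deg N y ≡ 0 → Net Z X F F' w
      lone {y} y₀ d = record { N = leafG N y x ; pn = A.Lone.lone-net y₀ all-y d ; e = A.Lone.lone-emb y₀ all-y A.kind ; e' = A'.Lone.lone-emb y₀ all-y A'.kind ; some = some' ; clean = cl }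
        where
        all-y : ∀ {v} → v ∈ V N → v ≡ y
        all-y {v} m = sym (isolated-≡ (deg-0 PN.simple {y} d) (PN.connected y v (PN.labV y₀) m))
        cl : ∀ {v} → v ∈ x ∷ V N → v ∈ X ⊎ v ∉ Z
        cl (here refl) = inj₁ xX
        cl (there m) = up-clean m

      nbr : ∀ {y} → y ∈ X₀ → deg N y ≢ 0 → Σ ℕ λ β → Adj N y β
      nbr {y} m n = deg-1 PN.simple {y} (≤1-≢0 n (PN.labD m))

      at-label : ∀ {y} → y ∈ X₀ → (∀ {β} (yβ : Adj N y β) → Emb X [] (On X) (leafG (subG N y β a') a' x) (Adj F) × Emb X [] (On X) (leafG (subG N y β a') a' x) (Adj F')) → Net Z X F F' w
      at-label {y} m h = decide (deg N y ≟ 0) (lone m) (λ n → let (β , yβ) = nbr m n in build yβ (proj₁ (h yβ)) (proj₂ (h yβ)))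

    common-cherry : ∀ {y} → Cherry F x y → Cherry F' x y → Net Z X F F' w
    common-cherry {y} c c' = at-label y₀ λ yβ → CherryEmb.cherry-emb f xX dl pn e x∉N c y₀ yβ a'∉ a'≢x , CherryEmb.cherry-emb f' xX dl' pn e' x∉N c' y₀ yβ a'∉ a'≢x
      where
      y₀ : y ∈ X₀
      y₀ = ∈-delV⁺ (CherryF.leaf→X f (proj₁ (proj₂ (proj₂ c)))) (λ q → proj₁ c (sym q))

    left-isolated : deg F x ≡ 0 → Net Z X F F' w
    left-isolated d = go A'.kind
      where
      go : A'.Kind → Net Z X F F' w
      go (A'.iso d') = at-label (proj₂ some) λ yβ → A.At.isolated-leaf yβ a' a'∉ a'≢x d , A'.At.isolated-leaf yβ a' a'∉ a'≢x d'
      go (A'.pair m xy) = at-label m λ yβ → A.At.isolated-leaf yβ a' a'∉ a'≢x d , A'.At.from-stage yβ a' a'∉ a'≢x xy (A'.pair-stage m xy yβ a'∉) refl refl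
      go (A'.mid xv t) = build αβ (A.At.isolated-leaf αβ a' a'∉ a'≢x d) (A'.At.from-stage αβ a' a'∉ a'≢x xv st refl refl)
        where
        st = A'.MidInfo.mid-st t a'∉
        αβ = Stage.nαβ st

  net-free : ∀ {Z X F F' G G' x w} → IsF X F → IsF X F' → x ∈ X → x ∈ Z → DelLeaf F x G → DelLeaf F' x G' → FreeCond F F' x → Net Z (delV x X) G G' w → Net Z X F F' w
  net-free f f' xX xZ dl dl' (isolatedL d) n = NetFree.left-isolated f f' xX xZ dl dl' n d
  net-free f f' xX xZ dl dl' (isolatedR d) n = net-swap (NetFree.left-isolated f' f xX xZ dl' dl (net-swap n) d)
  net-free f f' xX xZ dl dl' (common y c c') n = NetFree.common-cherry f f' xX xZ dl dl' n c c'

open LeafReinsertion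

forest→isF : ∀ {X F} → ForestOn X F → IsF X F
forest→isF {X} {F} (si , ac , (lf , lx) , n3) = isf si (acyclic→forest {F} (proj₁ si) ac) (λ m → proj₁ (lx _ m)) (λ m → proj₂ (lx _ m))
  (λ {v} m → [ (λ d → inj₁ (lf v (m , d))) , inj₂ ] (n3 v m))

Realizes : List ℕ → Graph → Graph → ℕ → Set
Realizes X F F' n = Σ Graph λ N → PhyloNetwork X N × Displays X N F × Displays X N F' × ret N ≡ n

unique-≤ : ∀ xs {ys : List ℕ} → Unique xs → Unique ys → (∀ {x} → x ∈ xs → x ∈ ys) → length xs ≤ length ys
unique-≤ [] _ _ _ = z≤n
unique-≤ (x ∷ xs) {ys} (nx ∷ u) u' sub = subst (suc (length xs) ≤_) (sym (length-delV ys u' (sub (here refl))))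
  (s≤s (unique-≤ xs u (Uₚ.filter⁺ (λ z → ¬? (z ≟ x)) u') (λ m → ∈-delV⁺ (sub (there m)) (λ { refl → All.lookup nx m refl }))))

deg-⊑ : ∀ {S N} → Simple S → Simple N → Adj S ⊑ Adj N → ∀ v → deg S v ≤ deg N v
deg-⊑ {S} {N} s s' h v = subst (_≤ deg N v) (nbrs-length v (E S)) (subst (length (nbrs v (E S)) ≤_) (nbrs-length v (E N))
  (unique-≤ (nbrs v (E S)) (nbrs-unique {v} {E S} (no-loops {S} (proj₁ s)) (λ b → proj₂ s v b)) (nbrs-unique {v} {E N} (no-loops {N} (proj₁ s')) (λ b → proj₂ s' v b))
    (λ m → ∈-nbrs (no-loops {N} (proj₁ s')) (toAd N (h (fromAd S (nbrs-∈ {v} {E S} m)))))))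

emb-displays : ∀ {X N F w} → PreNet X [] N w → IsF X F → Emb X [] (On X) N (Adj F) → Displays X N F
emb-displays {X} {N} {F} pn f e = S , suppress S , (proj₁ sS , (λ v m → V⊆ m) , mu) , forest→acyclic {S} foS , suppress-all pre , eqv-isofix (suppress-isF pre (suppress-all pre)) f
    (on-trans (on-flip (Suppressed.eqvX (suppress-star pre (proj₁ (suppress-all pre))))) (on-flip eqS))
  where
  open Emb e
  module PN = PreNet pn
  dg : ∀ v → deg S v ≤ deg N v
  dg = deg-⊑ {S} {N} sS PN.simple E⊆
  inn : ∀ {v} → v ∈ V S → v ∈ X ⊎ deg S v ≡ 2 ⊎ deg S v ≡ 3
  inn {v} m with low m
  ... | inj₁ i = inj₁ i
  ... | inj₂ (inj₁ (() , _))
  ... | inj₂ (inj₂ d) with PN.inner (V⊆ m)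
  ...   | inj₁ i = inj₁ i
  ...   | inj₂ (inj₂ (() , _))
  ...   | inj₂ (inj₁ d3) = inj₂ (two-three (deg S v) d (subst (deg S v ≤_) d3 (dg v)))
    where
    two-three : ∀ k → 2 ≤ k → k ≤ 3 → k ≡ 2 ⊎ k ≡ 3
    two-three (suc (suc zero)) _ _ = inj₁ refl
    two-three (suc (suc (suc zero))) _ _ = inj₂ refl
    two-three (suc zero) (s≤s ()) _
    two-three (suc (suc (suc (suc k)))) _ (s≤s (s≤s (s≤s ())))
  pre : PreF X S
  pre = pref sS foS (λ m → labS (on m)) (λ m → ≤-trans (dg _) (PN.labD m)) inn
  mu : ∀ a b → mult S a b ≤ mult N a b
  mu a b = decide (adj? S a b) (λ r → ≤-trans (proj₂ sS a b) (E⊆ r)) (λ n → subst (_≤ mult N a b) (sym (¬adj-mult {E S} (λ r → n (fromAd S r)))) z≤n)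

net-realizes : ∀ {Z X F F' w} → IsF X F → IsF X F' → Net Z X F F' w → Σ ℕ λ m → m ≤ w × Realizes X F F' m
net-realizes {X = X} {w = w} f f' net = ret N , m≤n+o⇒m∸n≤o (length (E N) + 1) (length (V N)) (subst (length (E N) + 1 ≤_) (+-comm w (length (V N))) PN.count) ,
  N , (PN.simple , PN.connected , ((λ { v (m , d) → leaf-X m d }) , (λ v m → PN.labV m , PN.labD m)) , (λ v m → n3 m)) , emb-displays pn f e , emb-displays pn f' e' , refl
  where
  open Net net
  module PN = PreNet pn
  leaf-X : ∀ {v} → v ∈ V N → deg N v ≤ 1 → v ∈ X
  leaf-X m d with PN.inner m
  ... | inj₁ i = i
  ... | inj₂ (inj₁ q) = case subst (_≤ 1) q d of λ { (s≤s ()) }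
  n3 : ∀ {v} → v ∈ V N → deg N v ≤ 1 ⊎ deg N v ≡ 3
  n3 m with PN.inner m
  ... | inj₁ i = inj₁ (PN.labD i)
  ... | inj₂ (inj₁ q) = inj₂ q

single-net : ∀ {Z X F F' x} → IsF X F → IsF X F' → IsSingleton x F → IsSingleton x F' → Net Z X F F' 0
single-net {Z} {X} {F} {F'} {x} f f' (vF , eF) (vF' , eF') = record
  { N = N₀ ; some = x , xX ; clean = λ { (here refl) → inj₁ xX }
  ; pn = record { simple = ([] ∷ [] , []) , (λ _ _ → z≤n) ; connected = λ { _ _ (here refl) (here refl) → ε } ; labV = λ m → here (all-x m) ; labD = λ _ → z≤n
                ; inner = λ { (here refl) → inj₁ xX } ; count = s≤s z≤n }
  ; e = emb F eF ; e' = emb F' eF' }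
  where
  N₀ : Graph
  N₀ = mkGraph (x ∷ []) []
  all-x : ∀ {y} → y ∈ X → y ≡ x
  all-x m with subst (_ ∈_) vF (IsF.lab f m)
  ... | here q = q
  xX : x ∈ X
  xX with IsF.inner f (subst (x ∈_) (sym vF) (here refl))
  ... | inj₁ i = i
  ... | inj₂ d = case trans (sym d) (cong (λ es → degE es x) eF) of λ ()
  emb : ∀ F → E F ≡ [] → Emb X [] (On X) N₀ (Adj F)
  emb F q = record { S = N₀ ; sS = ([] ∷ [] , []) , (λ _ _ → z≤n) ; foS = λ () ; V⊆ = λ m → m ; E⊆ = λ r → r ; labS = λ { (on m) → here (all-x m) }
    ; low = λ { (here refl) → inj₁ xX } ; eqS = eqv-cong (λ ()) (λ {a} {b} r → subst (λ es → 0 < multE es a b) q r) (λ r → r) (λ r → r) (on-refl {F = Adj N₀}) }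

c2-cut : ∀ {x F F' G G'} → C2 x F F' G G' → (Σ ℕ λ a → Σ ℕ λ b → DelEdge F a b G × G' ≡ F') ⊎ (Σ ℕ λ a → Σ ℕ λ b → DelEdge F' a b G' × G ≡ F)
c2-cut {x} {F} {F'} {G} {G'} (y , _ , inj₁ (_ , _ , _ , q , c)) = inj₁ (go c)
  where
  pend : ∀ {x} → DelPendant F x G → Σ ℕ λ a → Σ ℕ λ b → DelEdge F a b G × G' ≡ F'
  pend {x} (z , d) = x , z , d , q
  go : _ → Σ ℕ λ a → Σ ℕ λ b → DelEdge F a b G × G' ≡ F'
  go (inj₁ (inj₁ d)) = pend d
  go (inj₁ (inj₂ d)) = pend d
  go (inj₂ (inj₁ (p , a , b , _ , _ , _ , _ , _ , _ , inj₁ d))) = pend d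
  go (inj₂ (inj₁ (p , a , b , _ , _ , _ , _ , _ , _ , inj₂ d))) = a , b , d , q
  go (inj₂ (inj₂ (p , r , a , b , _ , _ , _ , _ , _ , _ , _ , _ , _ , _ , inj₁ d))) = pend d
  go (inj₂ (inj₂ (p , r , a , b , _ , _ , _ , _ , _ , _ , _ , _ , _ , _ , inj₂ (inj₁ d)))) = pend d
  go (inj₂ (inj₂ (p , r , a , b , _ , _ , _ , _ , _ , _ , _ , _ , _ , _ , inj₂ (inj₂ (c , e , _ , _ , _ , d))))) = c , e , d , q
c2-cut (y , _ , inj₂ (inj₁ (_ , _ , _ , _ , _ , inj₁ (q , inj₁ (z , d))))) = inj₁ (_ , z , d , q)
c2-cut (y , _ , inj₂ (inj₁ (_ , _ , _ , _ , _ , inj₁ (q , inj₂ (z , d))))) = inj₁ (_ , z , d , q)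
c2-cut (y , _ , inj₂ (inj₁ (_ , _ , _ , _ , _ , inj₂ (v , z , _ , _ , _ , _ , d , q)))) = inj₂ (v , z , d , q)
c2-cut (y , _ , inj₂ (inj₂ (_ , _ , _ , _ , _ , q , inj₁ (z , d)))) = inj₁ (_ , z , d , q)
c2-cut (y , _ , inj₂ (inj₂ (_ , _ , _ , _ , _ , q , inj₂ (z , d)))) = inj₁ (_ , z , d , q)

cutting-net : ∀ {Z X F F' G G' w} → IsF X F → IsF X F' →
  (Σ ℕ λ a → Σ ℕ λ b → DelEdge F a b G × G' ≡ F') ⊎ (Σ ℕ λ a → Σ ℕ λ b → DelEdge F' a b G' × G ≡ F) →
  (IsF X G → IsF X G' → Net Z X G G' w) → Net Z X F F' (suc w)
cutting-net f f' (inj₁ (a , b , d , refl)) h = NetCut.net-cut f d (h (del-isF {a = a} {b} f d) f')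
cutting-net f f' (inj₂ (a , b , d , refl)) h = net-swap (NetCut.net-cut f' d (net-swap (h f (del-isF {a = a} {b} f' d))))

cps→net : ∀ {Z X F F' σ w} → (∀ {x} → x ∈ X → x ∈ Z) → IsF X F → IsF X F' → CPS F F' σ w → Net Z X F F' w
cps→net s f f' (final p q) = single-net f f' p q
cps→net {X = X} s f f' (free {x = x} (inj₁ (y , c , c' , d , d')) r) = net-free f f' m (s m) d d' (common y c c') (cps→net (λ i → s (proj₁ (∈-delV⁻ {V = X} i))) (delLeaf-isF f m d) (delLeaf-isF f' m d') r)
  where
  m : x ∈ X
  m = CherryF.leaf→X f (proj₁ (proj₂ c))
cps→net {X = X} s f f' (free {x = x} (inj₂ (inj₁ (i , z) , d , d')) r) = net-free f f' m (s m) d d' (isolatedL z) (cps→net (λ i → s (proj₁ (∈-delV⁻ {V = X} i))) (delLeaf-isF f m d) (delLeaf-isF f' m d') r)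
  where
  m : x ∈ X
  m = CherryF.leaf→X f (i , ≤1-of-0 z)
cps→net {X = X} s f f' (free {x = x} (inj₂ (inj₂ (i , z) , d , d')) r) = net-free f f' m (s m) d d' (isolatedR z) (cps→net (λ i → s (proj₁ (∈-delV⁻ {V = X} i))) (delLeaf-isF f m d) (delLeaf-isF f' m d') r)
  where
  m : x ∈ X
  m = CherryF.leaf→X f' (i , ≤1-of-0 z)
cps→net s f f' (paid (inj₁ c) r) = cutting-net f f' (c2-cut c) (λ g g' → cps→net s g g' r)
cps→net s f f' (paid (inj₂ c) r) = cutting-net f f' (swap (c2-cut c)) (λ g g' → cps→net s g g' r)

cg→net : ∀ t w {Z X F F'} → (∀ {x} → x ∈ X → x ∈ Z) → IsF X F → IsF X F' → CG t w F F' → Net Z X F F' w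
cg→net zero w s f f' (refl , p) = let (x , _ , q , q') = find p in single-net f f' q q'
cg→net (suc t) w {Z} {X} {F} {F'} s f f' (inj₁ p) = let (x , m , ok , r) = find p in go x m ok r
  where
  remove : ∀ x → x ∈ X → FreeCond F F' x → CG t w (delC F x) (delC F' x) → Net Z X F F' w
  remove x m c r = net-free f f' m (s m) (delC-del f m) (delC-del f' m) c
    (cg→net t w (λ i → s (proj₁ (∈-delV⁻ {V = X} i))) (delLeaf-isF f m (delC-del f m)) (delLeaf-isF f' m (delC-del f' m)) r)
  go : ∀ x → x ∈ V F → FreeOK F F' x → CG t w (delC F x) (delC F' x) → Net Z X F F' w
  go x m (inj₁ d) r = remove x (CherryF.leaf→X f (m , ≤1-of-0 d)) (isolatedL d) r
  go x m (inj₂ (inj₁ (i , d))) r = remove x (CherryF.leaf→X f' (i , ≤1-of-0 d)) (isolatedR d) r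
  go x m (inj₂ (inj₂ q)) r = let (y , _ , c , c') = find q in remove x (CherryF.leaf→X f (proj₁ (proj₂ c))) (common y (D→cherry {F} c) (D→cherry {F'} c')) r
cg→net (suc t) (suc w) s f f' (inj₂ (inj₁ p)) = let (a , _ , q) = find p ; (b , _ , ab , r) = find q in
  cutting-net f f' (inj₁ (a , b , cutC-del f ab , refl)) (λ g g' → cg→net t w s g g' r)
cg→net (suc t) (suc w) s f f' (inj₂ (inj₂ p)) = let (a , _ , q) = find p ; (b , _ , ab , r) = find q in
  cutting-net f f' (inj₂ (a , b , cutC-del f' ab , refl)) (λ g g' → cg→net t w s g g' r)

suppress-edges : ∀ {G H} → Star Suppress1 G H → length (E H) ≤ length (E G)
suppress-edges ε = ≤-refl
suppress-edges {G} ((v , u , w , _ , _ , _ , uv , _ , refl) ◅ s) = ≤-trans (suppress-edges s)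
  (filter-notAll (λ e → ¬? (inc? v e)) (E G) ([ (λ m → lose m λ k → k (inj₂ refl)) , (λ m → lose m λ k → k (inj₁ refl)) ] (toAd G uv)))

suppress-verts : ∀ {G H} → Star Suppress1 G H → ∀ {x} → x ∈ V H → x ∈ V G
suppress-verts ε m = m
suppress-verts ((v , _ , _ , _ , _ , _ , _ , _ , refl) ◅ s) m = proj₁ (∈-delV⁻ (suppress-verts s m))

-- Cutting all edges of F leaves only isolated labels, which are removed for free.
some-cg : ∀ m k {X F F'} → length (E F) ≤ m → Unique X → length X ≡ suc k → IsF X F → IsF X F' → Σ ℕ λ w → CG (k + w) w F F'
some-cg m k {X} {F} {F'} le u l f f' = go (E F) refl
  where
  all-cut : ∀ k {X F F'} → E F ≡ [] → Unique X → length X ≡ suc k → IsF X F → IsF X F' → CG (k + 0) 0 F F'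
  all-cut zero {x ∷ []} _ _ _ f f' = refl , lose (IsF.lab f (here refl)) (single f , single f')
  all-cut (suc k) {x ∷ X} {F} q u l f f' = inj₁ (lose (IsF.lab f (here refl)) (inj₁ z ,
      all-cut k (eE (delC-del f (here refl))) (Uₚ.filter⁺ (λ v → ¬? (v ≟ x)) u) (suc-injective (trans (sym (length-delV (x ∷ X) u (here refl))) l)) (delLeaf-isF f (here refl) (delC-del f (here refl))) (delLeaf-isF f' (here refl) (delC-del f' (here refl)))))
    where
    z : deg F x ≡ 0
    z = cong (λ es → degE es x) q
    eE : ∀ {G} → DelLeaf F x G → E G ≡ []
    eE (inj₁ (_ , _ , refl)) = q
    eE (inj₂ (_ , d , _)) = case trans (sym d) z of λ ()
  go : ∀ es → E F ≡ es → Σ ℕ λ w → CG (k + w) w F F'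
  go [] q = 0 , all-cut k q u l f f'
  go ((a , b) ∷ es) q = cut m le
    where
    ab : Adj F a b
    ab = fromAd F (inj₁ (subst ((a , b) ∈_) (sym q) (here refl)))
    smaller : length (E (cutC F a b)) < length (E F)
    smaller = ≤-trans (s≤s (suppress-edges (proj₁ (proj₂ (cutC-del f ab)))))
      (subst (λ z → length z < length (E F)) (sym (removeEdge-delE a b (E F) (proj₂ (IsF.simple f) a b))) (filter-notAll (λ e → ¬? (joins? a b e)) (E F) (lose (subst ((a , b) ∈_) (sym q) (here refl)) (λ n → n joins-self))))
    cut : ∀ m → length (E F) ≤ m → Σ ℕ λ w → CG (k + w) w F F'
    cut zero le = case ≤-trans smaller le of λ ()
    cut (suc m) le with some-cg m k (s≤s⁻¹ (≤-trans smaller le)) u l (del-isF {a = a} {b} f (cutC-del f ab)) f'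
    ... | w , g = suc w , subst (λ t → CG t (suc w) F F') (sym (+-suc k w)) (inj₂ (inj₁ (let (p , r , _) = adj-∈ {F} (proj₁ (IsF.simple f)) ab in lose p (lose r (ab , g)))))

module FromDisplay {X N F} (sN : Simple N) (f : IsF X F) (dp : Displays X N F) where

  S : Graph
  S = proj₁ dp

  private
    sub : SubgraphOf S N
    sub = proj₁ (proj₂ (proj₂ dp))

  sS : Simple S
  sS = proj₁ sub , λ a b → ≤-trans (proj₂ (proj₂ sub) a b) (proj₂ sN a b)

  foS : Forest (Adj S)
  foS = acyclic→forest {S} (proj₁ sub) (proj₁ (proj₂ (proj₂ (proj₂ dp))))

  S⊆N : Adj S ⊑ Adj N
  S⊆N {a} {b} r = ≤-trans r (proj₂ (proj₂ sub) a b)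

  private
    chain : ∀ {G H} → Simple G → Forest (Adj G) → Star Suppress1 G H → (∀ {x} → x ∈ X → x ∈ V H) → Simple H × Eqv (On X) (Adj G) (Adj H)
    chain si fo ε h = si , on-refl
    chain {G} si fo ((v , u , w , vV , d , ne , uv , vw , refl) ◅ s) h =
      let (si' , q) = chain T.simpleH T.forestH s h in si' , on-trans (T.eqvH (λ m → proj₂ (∈-delV⁻ {V = V G} (suppress-verts s (h m))) refl)) q
      where module T = Suppress {G} si fo d ne uv vw

  S≈F : Eqv (On X) (Adj F) (Adj S)
  S≈F = on-flip (on-trans (proj₂ c) (isofix-eqv (proj₁ (proj₁ c)) (proj₁ (IsF.simple f)) iso))
    where
    iso : IsoFix X (proj₁ (proj₂ dp)) F
    iso = proj₂ (proj₂ (proj₂ (proj₂ (proj₂ dp))))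
    c : Simple (proj₁ (proj₂ dp)) × Eqv (On X) (Adj S) (Adj (proj₁ (proj₂ dp)))
    c = chain sS foS (proj₁ (proj₁ (proj₂ (proj₂ (proj₂ (proj₂ dp)))))) (λ {x} m → proj₁ (proj₂ (proj₂ (proj₂ (proj₂ (proj₂ (proj₂ (proj₂ iso)))))) x m))

realizes-st : ∀ {X F F' n} → IsF X F → IsF X F' → Realizes X F F' n → St X F F' n
realizes-st {X} {F} {F'} {n} f f' (N , (sN , cN , (_ , lX) , _) , dp , dp' , q) = record
  { EN = E N ; ES = E A.S ; ES' = E A'.S ; vs = V N ; vsU = proj₁ (proj₁ sN)
  ; ends = λ r → proj₁ (adj-∈ {N} (proj₁ sN) (fromAd N r)) ; con = λ {a} {b} m m' → mono (toAd N) (cN a b m m')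
  ; cnt = subst (length (E N) + 1 ≤_) (trans (+-comm (length (V N)) _) (cong (_+ length (V N)) q)) (m≤n+m∸n (length (E N) + 1) (length (V N)))
  ; S⊆ = λ r → toAd N (A.S⊆N (fromAd A.S r)) ; S'⊆ = λ r → toAd N (A'.S⊆N (fromAd A'.S r))
  ; foS = forest-⊑ (fromAd A.S) A.foS ; foS' = forest-⊑ (fromAd A'.S) A'.foS
  ; X⊆ = λ {x} m → proj₁ (lX x m)
  ; eS = eqv-cong (λ r → r) (λ r → r) (toAd A.S) (fromAd A.S) A.S≈F ; eS' = eqv-cong (λ r → r) (λ r → r) (toAd A'.S) (fromAd A'.S) A'.S≈F }
  where
  module A = FromDisplay sN f dp
  module A' = FromDisplay sN f' dp'

least : ∀ {P : ℕ → Set} → (∀ n → Dec (P n)) → ∀ n → P n → Σ ℕ λ k → P k × (∀ m → P m → k ≤ m)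
least {P} p? n pn with p? 0
... | yes p = 0 , p , λ _ _ → z≤n
... | no np = go n pn
  where
  go : ∀ n → P n → Σ ℕ λ k → P k × (∀ m → P m → k ≤ m)
  go zero p = ⊥-elim (np p)
  go (suc n) p with least {λ m → P (suc m)} (λ m → p? (suc m)) n p
  ... | k , q , h = suc k , q , λ { zero r → ⊥-elim (np r) ; (suc m) r → s≤s (h m r) }

theorem4p1 : (X : List ℕ) → Unique X → X ≢ [] → (F F' : Graph) →
    ForestOn X F → ForestOn X F' →
    Σ ℕ (λ k → HybridNumberIs X F F' k × MinCPSWeightIs X F F' k)
theorem4p1 [] u ne F F' fo fo' = ⊥-elim (ne refl)
theorem4p1 X@(x ∷ X') u ne F F' fo fo' = k , (hyb , λ n r → proj₁ (from-net r)) , (cps , λ { n (σ , _ , c) → from-cps c })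
  where
  f : IsF X F
  f = forest→isF fo
  f' : IsF X F'
  f' = forest→isF fo'
  l : ℕ
  l = length X'
  minimum : Σ ℕ λ k → CG (l + k) k F F' × (∀ m → CG (l + m) m F F' → k ≤ m)
  minimum = let (w , g) = some-cg (length (E F)) l ≤-refl u refl f f' in least (λ m → cg? (l + m) m F F') w g
  k : ℕ
  k = proj₁ minimum
  to-cps : ∀ {n} → Realizes X F F' n → Goal n l X F F'
  to-cps {n} r = net→cps n l X u refl f f' (realizes-st f f' r)
  from-net : ∀ {n} → Realizes X F F' n → k ≤ n × Σ ℕ λ w → w ≤ n × k ≤ w × (Σ (List ℕ) λ σ → CPS F F' σ w × length X ≤ length σ)
  from-net r = let (w , le , s , g) = to-cps r ; kw = proj₂ (proj₂ minimum) w g in ≤-trans kw le , w , le , kw , s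
  from-cps : ∀ {σ n} → CPS F F' σ n → k ≤ n
  from-cps c = let (m , le , r) = net-realizes f f' (cps→net {X} {X} (λ i → i) f f' c) in ≤-trans (proj₁ (from-net r)) le
  hyb : Realizes X F F' k
  hyb = let (m , le , r) = net-realizes f f' (cg→net (l + k) k {X} {X} (λ i → i) f f' (proj₁ (proj₂ minimum))) in subst (Realizes X F F') (≤-antisym le (proj₁ (from-net r))) r
  cps : Σ (List ℕ) λ σ → CherryPickingSeq X F F' σ k
  cps = let (_ , w , le , kw , (σ , c , s)) = from-net hyb in σ , s , subst (CPS F F' σ) (≤-antisym le kw) c
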